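{- Let $M$ be a matroid and $N$ a $3$-connected matroid with $|E(N)|\ge 4$ such that $M$ has an $N$-minor. Let $T$ be a triangle of $M$, and suppose that $M$ is minor-minimal with the property of being $3$-connected, having an $N$-minor and having $T$ contained in its ground set (that is, no proper minor $M_0$ of $M$ with $T\subseteq E(M_0)$ is $3$-connected with an $N$-minor). Then $r(M)-r(N)\le 2$, and for some $N$-minor $N'$ of $M$, $|E(M)-(E(N')\cup T)|\le 1$. Moreover, if $E(M)-E(N')\not\subseteq T$, then one of the following holds: (a) $r(M)-r(N)=1$, $r^*(M)-r^*(N)\in\{2,3\}$, and $M$ has an element $x$ such that $E(M)-E(N')\subseteq T\cup\{x\}$, $T\cup \{x\}$ is a $4$-point line of $M$, $M\backslash x$ has no $N$-minor, and $x$ is the unique element of $M$ such that ${\rm si}(M/x)$ is $3$-connected with an $N$-minor; or (b) $r^*(M)-r^*(N)=2$, $r(M)-r(N)\in\{1,2\}$, and $M$ has an element $y$ such that $E(M)-E(N')\subseteq T\cup \{y\}$, $T\cup \{y\}$ is a $4$-element cocircuit of $M$, $M/y$ has no $N$-minor, and $M\backslash A$ has no $N$-minor for each subset $A$ of $T$ with $|A|\ge 2$.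
   Context: An $N$-minor of a matroid is a minor isomorphic to $N$. A triangle is a $3$-element circuit. $r$ denotes rank and $r^*$ corank (rank of the dual). ${\rm si}(M/x)$ denotes the simplification of $M/x$. A $4$-point line of $M$ is a $4$-element set of rank $2$ in $M$. -}

module Defs where

open import Data.Nat using (ℕ; _+_; _∸_; _≤_; _<_)
open import Data.Fin using (Fin)
open import Data.Fin.Properties using (any?) renaming (_≟_ to _≟ᶠ_)
open import Data.Fin.Subset using (Subset; _∈_; _∉_; _⊆_; _∪_; _∩_; _─_; ∣_∣; ⊥; ⁅_⁆)
open import Data.Fin.Subset.Properties using (_∈?_)
open import Data.Vec using (tabulate)
open import Data.Product using (Σ; ∃; _×_; _,_)
open import Data.Sum using (_⊎_)
open import Relation.Nullary using (¬_; does)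
open import Relation.Nullary.Decidable using (_×-dec_)
open import Relation.Binary.PropositionalEquality using (_≡_; _≢_)

-- Matroids, via the rank axioms (R1)-(R3) of Oxley.
-- A matroid "on Fin n" has a ground set E ⊆ Fin n; the rank function is
-- only constrained (and only ever consulted) on subsets of E.  Keeping
-- the ambient type Fin n fixed lets minors of M live on subsets of the
-- same Fin n, so that E(M) - E(N') etc. make sense literally.

record Matroid (n : ℕ) : Set where
  field
    E      : Subset n
    r      : Subset n → ℕ
    r-card : ∀ X → X ⊆ E → r X ≤ ∣ X ∣
    r-mono : ∀ X Y → Y ⊆ E → X ⊆ Y → r X ≤ r Y
    r-sub  : ∀ X Y → X ⊆ E → Y ⊆ E → r (X ∪ Y) + r (X ∩ Y) ≤ r X + r Y

open Matroid public

rk : ∀ {n} → Matroid n → ℕ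
rk M = r M (E M)

corank : ∀ {n} → Matroid n → ℕ
corank M = ∣ E M ∣ ∸ rk M

r* : ∀ {n} → Matroid n → Subset n → ℕ
r* M X = (∣ X ∣ + r M (E M ─ X)) ∸ rk M

IsCircuitFor : ∀ {n} → Subset n → (Subset n → ℕ) → Subset n → Set
IsCircuitFor E ρ X =
  X ⊆ E × ρ X < ∣ X ∣ × (∀ Y → Y ⊆ X → Y ≢ X → ρ Y ≡ ∣ Y ∣)

IsCircuit : ∀ {n} → Matroid n → Subset n → Set
IsCircuit M X = IsCircuitFor (E M) (r M) X

IsCocircuit : ∀ {n} → Matroid n → Subset n → Set
IsCocircuit M X = IsCircuitFor (E M) (r* M) X

IsTriangle : ∀ {n} → Matroid n → Subset n → Set
IsTriangle M T = IsCircuit M T × ∣ T ∣ ≡ 3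

IsFourPointLine : ∀ {n} → Matroid n → Subset n → Set
IsFourPointLine M L = L ⊆ E M × ∣ L ∣ ≡ 4 × r M L ≡ 2

IsMinorVia : ∀ {n} → Matroid n → Subset n → Subset n → Matroid n → Set
IsMinorVia M C D M₀ =
  C ⊆ E M × D ⊆ E M × C ∩ D ≡ ⊥ ×
  E M₀ ≡ E M ─ (C ∪ D) ×
  (∀ X → X ⊆ E M₀ → r M₀ X ≡ r M (X ∪ C) ∸ r M C)

IsMinor : ∀ {n} → Matroid n → Matroid n → Set
IsMinor M M₀ = Σ (Subset _) λ C → Σ (Subset _) λ D → IsMinorVia M C D M₀

IsProperMinor : ∀ {n} → Matroid n → Matroid n → Set
IsProperMinor M M₀ = IsMinor M M₀ × E M₀ ≢ E M

IsDeletion : ∀ {n} → Matroid n → Subset n → Matroid n → Set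
IsDeletion M A M₁ = IsMinorVia M ⊥ A M₁

IsContraction : ∀ {n} → Matroid n → Subset n → Matroid n → Set
IsContraction M A M₁ = IsMinorVia M A ⊥ M₁

image : ∀ {n m} → (Fin n → Fin m) → Subset n → Subset m
image f X = tabulate λ j → does (any? λ i → (i ∈? X) ×-dec (f i ≟ᶠ j))

Isomorphic : ∀ {n m} → Matroid n → Matroid m → Set
Isomorphic {n} {m} M N = Σ (Fin n → Fin m) λ f →
  (∀ {i} → i ∈ E M → f i ∈ E N) ×
  (∀ {i j} → i ∈ E M → j ∈ E M → f i ≡ f j → i ≡ j) ×
  (∀ {j} → j ∈ E N → ∃ λ i → i ∈ E M × f i ≡ j) ×
  (∀ X → X ⊆ E M → r N (image f X) ≡ r M X)

HasMinor : ∀ {n m} → Matroid n → Matroid m → Set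
HasMinor {n} M N = Σ (Matroid n) λ M₀ → IsMinor M M₀ × Isomorphic M₀ N

-- Tutte connectivity: M is 3-connected iff it has no k-separation for
-- k ∈ {1,2}, where (X, E - X) is a k-separation if |X|, |E - X| ≥ k and
-- r(X) + r(E - X) - r(E) < k.

ThreeConnected : ∀ {n} → Matroid n → Set
ThreeConnected M = ∀ (k : ℕ) → 1 ≤ k → k ≤ 2 → ∀ X → X ⊆ E M →
  k ≤ ∣ X ∣ → k ≤ ∣ E M ─ X ∣ → rk M + k ≤ r M X + r M (E M ─ X)

Simple : ∀ {n} → Matroid n → Set
Simple M = ∀ X → IsCircuit M X → 3 ≤ ∣ X ∣

IsSimplification : ∀ {n} → Matroid n → Matroid n → Set
IsSimplification M S = Σ (Subset _) λ D → IsDeletion M D S × Simple S ×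
  (∀ {d} → d ∈ D →
     IsCircuit M ⁅ d ⁆ ⊎ (∃ λ e → e ∈ E S × IsCircuit M (⁅ d ⁆ ∪ ⁅ e ⁆)))

SiContract3ConnNMinor : ∀ {n m} → Matroid n → Fin n → Matroid m → Set
SiContract3ConnNMinor M x N = Σ (Matroid _) λ M₁ → Σ (Matroid _) λ S →
  IsContraction M ⁅ x ⁆ M₁ × IsSimplification M₁ S ×
  ThreeConnected S × HasMinor S N

-- Call an element e of M contractible (deletable) if M / e (M \ e) has an N-minor.
-- The key fact is that a contractible element e lies in cl T.  Otherwise
-- minimality prevents si(M / e) from being 3-connected, so that there is a
-- vertical 3-separation (X , e , Y) with N essentially contained in Y.  If T lies
-- in X, Tutte's linking theorem contracts X onto T ∪ e inside the guts line.  If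
-- T lies in Y, then X can be contracted onto a three-point line through e, or
-- else e is deletable and co(M \ e) is 3-connected by Bixby's lemma.  Each time a
-- smaller 3-connected minor keeps T and N.
-- It follows that, for a deletable d outside T, every 2-separation of M \ d has T
-- as one of its sides, and that there is at most one such d in the complement of
-- a spanning N-minor.  In the same way a point of cl T outside T is never
-- deletable.  Counting the elements contracted and deleted gives (a) and (b).

module Submission where

open import Defs
open import Data.Bool using (Bool; true; false; _∧_; _∨_; not; if_then_else_)
import Data.Bool.Properties
open import Data.Empty using () renaming (⊥ to Absurd; ⊥-elim to absurd)
open import Data.Fin using (Fin; zero; suc)
open import Data.Fin.Properties using (any?; _≟_)
open import Data.Fin.Subset using (Subset; _∈_; _∉_; _⊆_; _∪_; _∩_; _─_; ∣_∣; ⊥; ⁅_⁆)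
open import Data.Fin.Subset.Properties using (∣⁅x⁆∣≡1; ∣⊥∣≡0; _∈?_; x∈⁅x⁆; x∈⁅y⁆⇒x≡y; x∈p∪q⁻; x∈p∪q⁺; x∈p∩q⁺; x∈p∩q⁻; ⊆-antisym; p⊆p∪q; q⊆p∪q; Empty-unique; ∉⊥; nonempty?; anySubset?)
open import Data.List using (List; []; _∷_; _++_; map; length; filterᵇ)
open import Data.List.Properties using (length-map; ∷-injectiveˡ; ∷-injectiveʳ)
open import Data.List.Membership.Propositional using () renaming (_∈_ to _∈ˡ_)
open import Data.List.Membership.Propositional.Properties using (∈-++⁺ˡ; ∈-++⁺ʳ; ∈-map⁺)
open import Data.List.Relation.Unary.All using (All; []; _∷_)
open import Data.List.Relation.Unary.All.Properties using (++⁺)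
open import Data.List.Relation.Unary.Any using (here; there)
open import Data.Maybe using (Maybe; just; nothing)
open import Data.Nat using (ℕ; zero; suc; _+_; _∸_; _≤_; _<_; _<ᵇ_; _≡ᵇ_; z≤n; s≤s; _≤?_)
open import Data.Nat.Properties hiding (_≟_)
open import Data.Product using (Σ; ∃; _×_; _,_; proj₁; proj₂; ∃-syntax)
open import Data.Sum using (_⊎_; inj₁; inj₂)
open import Data.Vec using (tabulate; lookup; []; _∷_)
open import Data.Vec.Properties using (≡-dec; lookup∘tabulate; []=⇒lookup; lookup⇒[]=; lookup-zipWith; lookup-replicate)
open import Function using (_∘_)
open import Relation.Binary.PropositionalEquality
open import Relation.Nullary using (¬_; Dec; yes; no; does)
open import Relation.Nullary.Decidable using (_×-dec_; dec-true)

-- An `N`-minor is carried as a pair of sets: `I`, the image of E(N), and `W`, what is contracted;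
-- all else is deleted. The obstacle is that minimality speaks of 3-connected minors only, whereas
-- the minors met on the way are 3-connected up to parallel and series classes. Such a class is cut
-- down one element at a time, and N must outlive each cut although it may use the very element
-- removed. This rests on one exchange: across a 2-separation with at most one element of N on the
-- side X, X acts on the other side only through the basepoint of the 2-sum, so any element
-- representing that basepoint can take over. Pairs inside `T` cannot be cut, hence the care that no
-- two elements of `T` become parallel or in series. The bound 2 on the rank difference is the rank
-- of `T`: W can be taken independent with I ∪ W spanning, so |W| is the rank difference, and W lies
-- in the line cl T. The elements outside I ∪ W number the corank difference. Outcome (a) is a
-- contracted point outside `T`; outcome (b) has W inside `T` and a deleted element outside it.

-- Inclusion as an equation, and rank functions on all subsets.

infix 4 _⊑_
-- Inclusion is an equation here because the solver below takes its hypotheses on sets as equations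
-- between Boolean terms.
_⊑_ : ∀ {n} → Subset n → Subset n → Set
A ⊑ B = A ∪ B ≡ B

-- The axioms hold for all subsets of `Fin n`, so that no instance of submodularity carries a side
-- condition about the ground set.
record RankFn (n : ℕ) : Set where
  field
    ρ      : Subset n → ℕ
    ρ-card : ∀ X → ρ X ≤ ∣ X ∣
    ρ-mono : ∀ X Y → X ⊑ Y → ρ X ≤ ρ Y
    ρ-sub  : ∀ X Y → ρ (X ∪ Y) + ρ (X ∩ Y) ≤ ρ X + ρ Y

∣∪∣+∣∩∣ : ∀ {n} (X Y : Subset n) → ∣ X ∪ Y ∣ + ∣ X ∩ Y ∣ ≡ ∣ X ∣ + ∣ Y ∣
∣∪∣+∣∩∣ [] [] = refl
∣∪∣+∣∩∣ (false ∷ X) (false ∷ Y) = ∣∪∣+∣∩∣ X Y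
∣∪∣+∣∩∣ (false ∷ X) (true ∷ Y) =
  trans (cong suc (∣∪∣+∣∩∣ X Y)) (sym (+-suc ∣ X ∣ ∣ Y ∣))
∣∪∣+∣∩∣ (true ∷ X) (false ∷ Y) = cong suc (∣∪∣+∣∩∣ X Y)
∣∪∣+∣∩∣ (true ∷ X) (true ∷ Y) = cong suc
  (trans (+-suc ∣ X ∪ Y ∣ ∣ X ∩ Y ∣)
    (trans (cong suc (∣∪∣+∣∩∣ X Y)) (sym (+-suc ∣ X ∣ ∣ Y ∣))))

∣⁅_⁆∣≤1 : ∀ {n} (x : Fin n) → ∣ ⁅ x ⁆ ∣ ≤ 1
∣⁅ x ⁆∣≤1 = ≤-reflexive (∣⁅x⁆∣≡1 x)

1≤∣⁅_⁆∣ : ∀ {n} (x : Fin n) → 1 ≤ ∣ ⁅ x ⁆ ∣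
1≤∣⁅ x ⁆∣ = ≤-reflexive (sym (∣⁅x⁆∣≡1 x))

-- A reflective prover for linear inequalities between ranks and
-- cardinalities.  A certificate lists the hypotheses and the instances of
-- submodularity, monotonicity, etc. whose sum is a contradiction; terms are
-- compared up to the Boolean identities of subsets implied by the set
-- hypotheses, and these are decided on truth tables.

infixr 8 _||_
infixr 9 _&&_
infixl 8 _-_
data SetExp : Set where
  ♯              : ℕ → SetExp
  ∅              : SetExp
  _||_ _&&_ _-_ : SetExp → SetExp → SetExp

v0 v1 v2 v3 v4 v5 v6 v7 v8 v9 v10 v11 : SetExp
v0 = ♯ 0
v1 = ♯ 1
v2 = ♯ 2
v3 = ♯ 3
v4 = ♯ 4
v5 = ♯ 5
v6 = ♯ 6
v7 = ♯ 7
v8 = ♯ 8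
v9 = ♯ 9
v10 = ♯ 10
v11 = ♯ 11

infixr 7 _⊕_
data NumExp : Set where
  con       : ℕ → NumExp
  nv        : ℕ → NumExp
  rank card : SetExp → NumExp
  _⊕_       : NumExp → NumExp → NumExp

infix 6 _==_ _<=_ _<:_
record SetEq : Set where
  constructor _==_
  field left right : SetExp

_<:_ : SetExp → SetExp → SetEq
a <: b = a || b == b

record NumLe : Set where
  constructor _<=_
  field left right : NumExp

data Step : Set where
  hyp                   : ℕ → Step
  sub mono csub cmod cmono : SetExp → SetExp → Step
  rc                    : SetExp → Step
  c∅                    : Step

nth : ∀ {A : Set} → A → List A → ℕ → A
nth d []       _       = d
nth d (x ∷ xs) zero    = x
nth d (x ∷ xs) (suc k) = nth d xs k

nth-map : ∀ {A B : Set} (f : A → B) d xs k → nth (f d) (map f xs) k ≡ f (nth d xs k)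
nth-map f d []       k       = refl
nth-map f d (x ∷ xs) zero    = refl
nth-map f d (x ∷ xs) (suc k) = nth-map f d xs k

evalB : List Bool → SetExp → Bool
evalB b (♯ i)    = nth false b i
evalB b ∅        = false
evalB b (e || f) = evalB b e ∨ evalB b f
evalB b (e && f) = evalB b e ∧ evalB b f
evalB b (e - f) = if evalB b f then false else evalB b e

_≡ᴮ_ : Bool → Bool → Bool
true  ≡ᴮ b = b
false ≡ᴮ b = not b

≡ᴮ-sound : ∀ a b → (a ≡ᴮ b) ≡ true → a ≡ b
≡ᴮ-sound true  true  _ = refl
≡ᴮ-sound false false _ = refl

≡ᴮ-refl : ∀ a → (a ≡ᴮ a) ≡ true
≡ᴮ-refl true  = refl
≡ᴮ-refl false = refl

eqL : List Bool → List Bool → Bool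
eqL []       []       = true
eqL []       (_ ∷ _)  = false
eqL (_ ∷ _)  []       = false
eqL (x ∷ xs) (y ∷ ys) = if x ≡ᴮ y then eqL xs ys else false

eqL-sound : ∀ xs ys → eqL xs ys ≡ true → xs ≡ ys
eqL-sound []       []       _ = refl
eqL-sound (x ∷ xs) (y ∷ ys) p with x ≡ᴮ y in q
... | true = cong₂ _∷_ (≡ᴮ-sound x y q) (eqL-sound xs ys p)

assignments : ℕ → List (List Bool)
assignments zero    = [] ∷ []
assignments (suc k) = map (true ∷_) (assignments k) ++ map (false ∷_) (assignments k)

assignments-complete : ∀ b → b ∈ˡ assignments (length b)
assignments-complete []          = here refl
assignments-complete (true ∷ b)  = ∈-++⁺ˡ (∈-map⁺ (true ∷_) (assignments-complete b))
assignments-complete (false ∷ b) = ∈-++⁺ʳ _ (∈-map⁺ (false ∷_) (assignments-complete b))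

satisfies : List SetEq → List Bool → Bool
satisfies []             b = true
satisfies ((e == f) ∷ hs) b = if evalB b e ≡ᴮ evalB b f then satisfies hs b else false

-- The regions of the Venn diagram of `k` sets that the hypotheses do not force to be empty. Terms
-- that agree on these regions denote equal sets.
cells : ℕ → List SetEq → List (List Bool)
cells k hs = filterᵇ (satisfies hs) (assignments k)

table : List (List Bool) → SetExp → List Bool
table cs e = map (λ b → evalB b e) cs

∈-filterᵇ : ∀ {A : Set} (p : A → Bool) {x xs} → x ∈ˡ xs → p x ≡ true → x ∈ˡ filterᵇ p xs
∈-filterᵇ p {x} (here refl) q with p x
∈-filterᵇ p (here refl) refl | true = here refl
∈-filterᵇ p {xs = y ∷ _} (there i) q with p y
... | true  = there (∈-filterᵇ p i q)
... | false = ∈-filterᵇ p i q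

map-≡-∈ : ∀ {A B : Set} (f g : A → B) {x xs} → map f xs ≡ map g xs → x ∈ˡ xs → f x ≡ g x
map-≡-∈ f g p (here refl) = ∷-injectiveˡ p
map-≡-∈ f g p (there i)   = map-≡-∈ f g (∷-injectiveʳ p) i

lookup-ext : ∀ {n} (A B : Subset n) → (∀ i → lookup A i ≡ lookup B i) → A ≡ B
lookup-ext []      []      h = refl
lookup-ext (a ∷ A) (b ∷ B) h = cong₂ _∷_ (h zero) (lookup-ext A B (h ∘ suc))

module Env {n : ℕ} (env : List (Subset n)) where

  evalS : SetExp → Subset n
  evalS (♯ i)    = nth ⊥ env i
  evalS ∅        = ⊥
  evalS (e || f) = evalS e ∪ evalS f
  evalS (e && f) = evalS e ∩ evalS f
  evalS (e - f) = evalS e ─ evalS f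

  HoldsS : SetEq → Set
  HoldsS (e == f) = evalS e ≡ evalS f

  at : Fin n → List Bool
  at i = map (λ A → lookup A i) env

  evalB-at : ∀ i e → evalB (at i) e ≡ lookup (evalS e) i
  evalB-at i (♯ k)    =
    trans (cong (λ d → nth d (at i) k) (sym (lookup-replicate i false)))
          (nth-map (λ A → lookup A i) ⊥ env k)
  evalB-at i ∅        = sym (lookup-replicate i false)
  evalB-at i (e || f) = trans (cong₂ _∨_ (evalB-at i e) (evalB-at i f))
    (sym (lookup-zipWith _∨_ i (evalS e) (evalS f)))
  evalB-at i (e && f) = trans (cong₂ _∧_ (evalB-at i e) (evalB-at i f))
    (sym (lookup-zipWith _∧_ i (evalS e) (evalS f)))
  evalB-at i (e - f)
    rewrite evalB-at i e | evalB-at i f = diff i (evalS e) (evalS f)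
    where
    diff : ∀ {n} (i : Fin n) A B →
      (if lookup B i then false else lookup A i) ≡ lookup (A ─ B) i
    diff zero    (a ∷ A) (true ∷ B)  = refl
    diff zero    (a ∷ A) (false ∷ B) = refl
    diff (suc i) (a ∷ A) (true ∷ B)  = diff i A B
    diff (suc i) (a ∷ A) (false ∷ B) = diff i A B

  satisfies-at : ∀ {hs} → All HoldsS hs → ∀ i → satisfies hs (at i) ≡ true
  satisfies-at []                        i = refl
  satisfies-at (_∷_ {e == f} {hs} p ps) i
    rewrite trans (evalB-at i e) (trans (cong (λ A → lookup A i) p) (sym (evalB-at i f)))
          | ≡ᴮ-refl (evalB (at i) f) = satisfies-at ps i

  -- The membership pattern of every point is a region allowed by the hypotheses, so agreement of
  -- the truth tables there is agreement at every point.
  table-sound : ∀ {hs} → All HoldsS hs → ∀ e f →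
    eqL (table (cells (length env) hs) e) (table (cells (length env) hs) f) ≡ true →
    evalS e ≡ evalS f
  table-sound {hs} ps e f q = lookup-ext _ _ λ i →
    trans (sym (evalB-at i e))
      (trans (map-≡-∈ (λ b → evalB b e) (λ b → evalB b f) (eqL-sound _ _ q) (at∈ i))
             (evalB-at i f))
    where
    at∈ : ∀ i → at i ∈ˡ cells (length env) hs
    at∈ i = ∈-filterᵇ (satisfies hs)
      (subst (λ k → at i ∈ˡ assignments k) (length-map _ env) (assignments-complete (at i)))
      (satisfies-at ps i)

abstract
  -- Opaque, so that a call costs the evaluation of the Boolean test behind `refl` and never an
  -- unfolding of the soundness proof.
  set= : ∀ {n} (env : List (Subset n)) hs e f →
    eqL (table (cells (length env) hs) e) (table (cells (length env) hs) f) ≡ true →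
    All (Env.HoldsS env) hs → Env.evalS env e ≡ Env.evalS env f
  set= env hs e f q ps = Env.table-sound env ps e f q

module RankSolver {n : ℕ} (R : RankFn n) where
  open RankFn R

  data Atom : Set where
    anv       : ℕ → Atom
    ark acd   : SetExp → Atom

  atoms : NumExp → List Atom
  atoms (con _)  = []
  atoms (nv i)   = anv i ∷ []
  atoms (rank e) = ark e ∷ []
  atoms (card e) = acd e ∷ []
  atoms (a ⊕ b)  = atoms a ++ atoms b

  const : NumExp → ℕ
  const (con k)  = k
  const (a ⊕ b)  = const a + const b
  const _        = 0

  eqA : List (List Bool) → Atom → Atom → Bool
  eqA cs (anv i) (anv j) = i ≡ᵇ j
  eqA cs (ark e) (ark f) = eqL (table cs e) (table cs f)
  eqA cs (acd e) (acd f) = eqL (table cs e) (table cs f)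
  eqA cs _       _       = false

  remove : List (List Bool) → Atom → List Atom → Maybe (List Atom)
  remove cs a []       = nothing
  remove cs a (b ∷ bs) with eqA cs a b
  ... | true  = just bs
  ... | false with remove cs a bs
  ...   | just bs′ = just (b ∷ bs′)
  ...   | nothing  = nothing

  contained : List (List Bool) → List Atom → List Atom → Bool
  contained cs []       bs = true
  contained cs (a ∷ as) bs with remove cs a bs
  ... | just bs′ = contained cs as bs′
  ... | nothing  = false

  stepLe : List NumLe → Step → NumLe
  -- Every hypothesis enters the sum once in any case; this step adds it again, which is how a
  -- multiplier above 1 is expressed. An index out of range yields the harmless 0 ≤ 0.
  stepLe ns (hyp k)     = nth (con 0 <= con 0) ns k
  stepLe ns (sub e f)   = rank (e || f) ⊕ rank (e && f) <= rank e ⊕ rank f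
  stepLe ns (mono e f)  = rank e <= rank (e || f)
  stepLe ns (csub e f)  = card (e || f) ⊕ card (e && f) <= card e ⊕ card f
  stepLe ns (cmod e f)  = card e ⊕ card f <= card (e || f) ⊕ card (e && f)
  stepLe ns (cmono e f) = card e <= card (e || f)
  stepLe ns (rc e)      = rank e <= card e
  stepLe ns c∅          = card ∅ <= con 0

  sumLe : List NumLe → NumLe
  sumLe []             = con 0 <= con 0
  sumLe ((a <= b) ∷ ns) with sumLe ns
  ... | c <= d = a ⊕ c <= b ⊕ d

  -- A certificate in the style of Farkas. The sum a ≤ b of all inequalities is absurd when the
  -- atoms of b occur, with multiplicity, among those of a and the constant of b is the smaller one;
  -- atoms of a left over are natural numbers and only enlarge that side.
  refutes : ℕ → List SetEq → List NumLe → List Step → Bool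
  refutes k hs ns ss with sumLe (ns ++ map (stepLe ns) ss)
  ... | a <= b = if const b <ᵇ const a then contained (cells k hs) (atoms b) (atoms a) else false

  module _ (env : List (Subset n)) (nenv : List ℕ) where
    open Env env

    evalN : NumExp → ℕ
    evalN (con k)  = k
    evalN (nv i)   = nth 0 nenv i
    evalN (rank e) = ρ (evalS e)
    evalN (card e) = ∣ evalS e ∣
    evalN (a ⊕ b)  = evalN a + evalN b

    HoldsN : NumLe → Set
    HoldsN (a <= b) = evalN a ≤ evalN b

    evalA : Atom → ℕ
    evalA (anv i) = nth 0 nenv i
    evalA (ark e) = ρ (evalS e)
    evalA (acd e) = ∣ evalS e ∣

    sumA : List Atom → ℕ
    sumA []       = 0
    sumA (a ∷ as) = evalA a + sumA as

    sumA-++ : ∀ as bs → sumA (as ++ bs) ≡ sumA as + sumA bs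
    sumA-++ []       bs = refl
    sumA-++ (a ∷ as) bs = trans (cong (evalA a +_) (sumA-++ as bs))
      (sym (+-assoc (evalA a) (sumA as) (sumA bs)))

    +-interchange : ∀ a b c d → (a + b) + (c + d) ≡ (a + c) + (b + d)
    +-interchange a b c d = trans (+-assoc a b (c + d)) (trans (cong (a +_)
      (trans (sym (+-assoc b c d)) (trans (cong (_+ d) (+-comm b c)) (+-assoc c b d))))
      (sym (+-assoc a c (b + d))))

    evalN-atoms : ∀ e → evalN e ≡ sumA (atoms e) + const e
    evalN-atoms (con k)  = refl
    evalN-atoms (nv i)   = sym (trans (+-identityʳ _) (+-identityʳ _))
    evalN-atoms (rank e) = sym (trans (+-identityʳ _) (+-identityʳ _))
    evalN-atoms (card e) = sym (trans (+-identityʳ _) (+-identityʳ _))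
    evalN-atoms (a ⊕ b)  = trans (cong₂ _+_ (evalN-atoms a) (evalN-atoms b))
      (trans (+-interchange (sumA (atoms a)) (const a) (sumA (atoms b)) (const b))
             (cong (_+ (const a + const b)) (sym (sumA-++ (atoms a) (atoms b)))))

    module _ {hs : List SetEq} (ps : All HoldsS hs) where
      cs : List (List Bool)
      cs = cells (length env) hs

      eqA-sound : ∀ a b → eqA cs a b ≡ true → evalA a ≡ evalA b
      eqA-sound (anv i) (anv j) q = cong (nth 0 nenv) (≡ᵇ⇒≡ i j (subst Data.Bool.T (sym q) _))
        where import Data.Bool
      eqA-sound (ark e) (ark f) q = cong ρ (table-sound ps e f q)
      eqA-sound (acd e) (acd f) q = cong ∣_∣ (table-sound ps e f q)

      remove-sound : ∀ a bs {bs′} → remove cs a bs ≡ just bs′ → sumA bs ≡ evalA a + sumA bs′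
      remove-sound a (b ∷ bs) q with eqA cs a b in r
      remove-sound a (b ∷ bs) refl | true = cong (_+ sumA bs) (sym (eqA-sound a b r))
      remove-sound a (b ∷ bs) q | false with remove cs a bs in r′
      remove-sound a (b ∷ bs) refl | false | just bs′ =
        trans (cong (evalA b +_) (remove-sound a bs r′))
          (trans (sym (+-assoc (evalA b) (evalA a) (sumA bs′)))
            (trans (cong (_+ sumA bs′) (+-comm (evalA b) (evalA a)))
                   (+-assoc (evalA a) (evalA b) (sumA bs′))))

      contained-sound : ∀ as bs → contained cs as bs ≡ true → sumA as ≤ sumA bs
      contained-sound []       bs q = z≤n
      contained-sound (a ∷ as) bs q with remove cs a bs in r
      ... | just bs′ = ≤-trans (+-monoʳ-≤ (evalA a) (contained-sound as bs′ q))
                               (≤-reflexive (sym (remove-sound a bs r)))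

      nth-All : ∀ {ns} → All HoldsN ns → ∀ k → HoldsN (nth (con 0 <= con 0) ns k)
      nth-All []       k       = z≤n
      nth-All (p ∷ ps) zero    = p
      nth-All (p ∷ ps) (suc k) = nth-All ps k

      step-sound : ∀ {ns} → All HoldsN ns → ∀ s → HoldsN (stepLe ns s)
      step-sound qs (hyp k)     = nth-All qs k
      step-sound qs (sub e f)   = ρ-sub (evalS e) (evalS f)
      step-sound qs (mono e f)  = ρ-mono _ _ (set= (evalS e ∷ evalS f ∷ []) [] (v0 || v0 || v1) (v0 || v1) refl [])
      step-sound qs (csub e f)  = ≤-reflexive (∣∪∣+∣∩∣ (evalS e) (evalS f))
      step-sound qs (cmod e f)  = ≤-reflexive (sym (∣∪∣+∣∩∣ (evalS e) (evalS f)))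
      step-sound qs (cmono e f) = ∣p∣≤∣p∪q∣ (evalS e) (evalS f)
        where open import Data.Fin.Subset.Properties using (∣p∣≤∣p∪q∣)
      step-sound qs (rc e)      = ρ-card (evalS e)
      step-sound qs c∅          = ≤-reflexive (∣⊥∣≡0 n)
        where open import Data.Fin.Subset.Properties using (∣⊥∣≡0)

      steps-sound : ∀ {ns} → All HoldsN ns → ∀ ss → All HoldsN (map (stepLe ns) ss)
      steps-sound qs []       = []
      steps-sound qs (s ∷ ss) = step-sound qs s ∷ steps-sound qs ss

      sumLe-sound : ∀ {ns} → All HoldsN ns → HoldsN (sumLe ns)
      sumLe-sound []                       = z≤n
      sumLe-sound {(_ <= _) ∷ ns} (q ∷ qs) with sumLe ns | sumLe-sound qs
      ... | _ <= _ | p = +-mono-≤ q p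

      refute-sound : ∀ ns ss → All HoldsN ns → refutes (length env) hs ns ss ≡ true → Absurd
      refute-sound ns ss qs r with sumLe (ns ++ map (stepLe ns) ss) | sumLe-sound (++⁺ qs (steps-sound qs ss))
      ... | a <= b | p with const b <ᵇ const a in r′
      ...   | true = <-irrefl refl (begin-strict
        evalN b                    ≡⟨ evalN-atoms b ⟩
        sumA (atoms b) + const b   <⟨ +-mono-≤-< (contained-sound (atoms b) (atoms a) r)
                                                 (<ᵇ⇒< (const b) (const a) (subst T (sym r′) _)) ⟩
        sumA (atoms a) + const a   ≡⟨ evalN-atoms a ⟨
        evalN a                    ≤⟨ p ⟩
        evalN b                    ∎)
        where
        open ≤-Reasoning
        open import Data.Bool using (T)

  abstract
    refute : ∀ env nenv hs ns ss → refutes (length env) hs ns ss ≡ true →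
      All (Env.HoldsS env) hs → All (HoldsN env nenv) ns → Absurd
    refute env nenv hs ns ss r ps qs = refute-sound env nenv ps ns ss qs r

    -- The negated goal is hypothesis 0 of the certificate.
    prove≤ : ∀ env nenv hs ns ss a b → refutes (length env) hs ((con 1 ⊕ b <= a) ∷ ns) ss ≡ true →
      All (Env.HoldsS env) hs → All (HoldsN env nenv) ns → evalN env nenv a ≤ evalN env nenv b
    prove≤ env nenv hs ns ss a b r ps qs =
      ≮⇒≥ λ b<a → refute env nenv hs ((con 1 ⊕ b <= a) ∷ ns) ss r ps (b<a ∷ qs)

-- Elements, singletons and small sets.

⊆⇒⊑ : ∀ {n} {A B : Subset n} → A ⊆ B → A ⊑ B
⊆⇒⊑ {A = A} {B} h = ⊆-antisym (λ x∈ → from (x∈p∪q⁻ A B x∈)) (q⊆p∪q A B)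
  where
  from : ∀ {x} → x ∈ A ⊎ x ∈ B → x ∈ B
  from (inj₁ a) = h a
  from (inj₂ b) = b

⊑⇒⊆ : ∀ {n} {A B : Subset n} → A ⊑ B → A ⊆ B
⊑⇒⊆ {A = A} {B} h x∈ = subst (_ ∈_) h (p⊆p∪q B x∈)

∈⇒⊑ : ∀ {n} {x : Fin n} {A} → x ∈ A → ⁅ x ⁆ ⊑ A
∈⇒⊑ {x = x} {A} x∈ = ⊆⇒⊑ λ y∈ → subst (_∈ A) (sym (x∈⁅y⁆⇒x≡y x y∈)) x∈

⊑⇒∈ : ∀ {n} {x : Fin n} {A} → ⁅ x ⁆ ⊑ A → x ∈ A
⊑⇒∈ {x = x} h = ⊑⇒⊆ h (x∈⁅x⁆ x)

∉⇒disjoint : ∀ {n} {x : Fin n} {A} → x ∉ A → ⁅ x ⁆ ∩ A ≡ ⊥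
∉⇒disjoint {x = x} {A} x∉ = Empty-unique λ (y , y∈) →
  let (p , q) = x∈p∩q⁻ ⁅ x ⁆ A y∈ in x∉ (subst (_∈ A) (x∈⁅y⁆⇒x≡y x p) q)

inside? : ∀ {n} (x : Fin n) A → ⁅ x ⁆ ⊑ A ⊎ ⁅ x ⁆ ∩ A ≡ ⊥
inside? x A with x ∈? A
... | yes p = inj₁ (∈⇒⊑ p)
... | no p  = inj₂ (∉⇒disjoint p)

≢⇒disjoint : ∀ {n} {x y : Fin n} → x ≢ y → ⁅ x ⁆ ∩ ⁅ y ⁆ ≡ ⊥
≢⇒disjoint {y = y} x≢y = ∉⇒disjoint λ h → x≢y (x∈⁅y⁆⇒x≡y y h)

disjoint⇒≢ : ∀ {n} {x y : Fin n} → ⁅ x ⁆ ∩ ⁅ y ⁆ ≡ ⊥ → x ≢ y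
disjoint⇒≢ {x = x} h refl = ∉⊥ (subst (x ∈_) h (x∈p∩q⁺ (x∈⁅x⁆ x , x∈⁅x⁆ x)))

_≟ˢ_ : ∀ {n} (A B : Subset n) → Dec (A ≡ B)
_≟ˢ_ = ≡-dec Data.Bool.Properties._≟_

empty-or-element : ∀ {n} (A : Subset n) → A ≡ ⊥ ⊎ ∃[ x ] ⁅ x ⁆ ⊑ A
empty-or-element A with nonempty? A
... | yes (x , h) = inj₂ (x , ∈⇒⊑ h)
... | no h        = inj₁ (Empty-unique h)

-- The zero function turns the rank solver into one for cardinalities.
zeroRank : ∀ {n} → RankFn n
zeroRank = record
  { ρ = λ _ → 0 ; ρ-card = λ _ → z≤n ; ρ-mono = λ _ _ _ → z≤n ; ρ-sub = λ _ _ → z≤n }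

module _ {n : ℕ} where
  open RankFn (zeroRank {n})
  open RankSolver (zeroRank {n})

  ∣∣≤0⇒≡⊥ : ∀ {A : Subset n} → ∣ A ∣ ≤ 0 → A ≡ ⊥
  ∣∣≤0⇒≡⊥ {A} h with empty-or-element A
  ... | inj₁ p = p
  ... | inj₂ (x , p) = absurd (refute (A ∷ ⁅ x ⁆ ∷ []) [] (v1 <: v0 ∷ []) (card v0 <= con 0 ∷ con 1 <= card v1 ∷ []) (cmono v1 v0 ∷
    []) refl (p ∷ []) (h ∷ 1≤∣⁅ x ⁆∣ ∷ []))

  ⊥≡⁅⁆⇒absurd : ∀ {x : Fin n} → ⊥ ≡ ⁅ x ⁆ → Absurd
  ⊥≡⁅⁆⇒absurd {x} p = (refute (⁅ x ⁆ ∷ []) [] (∅ == v0 ∷ []) (con 1 <= card v0 ∷ []) (c∅ ∷ []) refl (p ∷ []) (1≤∣⁅ x ⁆∣ ∷ []))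

  element : ∀ {A : Subset n} → 1 ≤ ∣ A ∣ → ∃[ x ] ⁅ x ⁆ ⊑ A
  element {A} h with empty-or-element A
  ... | inj₁ p = absurd (refute (A ∷ []) [] (v0 == ∅ ∷ []) (con 1 <= card v0 ∷ []) (c∅ ∷ []) refl (p ∷ []) (h ∷ []))
  ... | inj₂ p = p

  two-elements : ∀ {A : Subset n} → 2 ≤ ∣ A ∣ →
    ∃[ x ] ∃[ y ] ⁅ x ⁆ ⊑ A × ⁅ y ⁆ ⊑ A × ⁅ x ⁆ ∩ ⁅ y ⁆ ≡ ⊥
  two-elements {A} h with element {A} (prove≤ (A ∷ []) [] [] (con 2 <= card v0 ∷ []) [] (con 1) (card v0) refl [] (h ∷ []))
  ... | x , p with element {A ─ ⁅ x ⁆} (prove≤ (A ∷ ⁅ x ⁆ ∷ []) [] (v1 <: v0 ∷ []) (con 2 <= card v0 ∷ card v1 <= con 1 ∷ [])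
    (csub (v0 - v1) v1 ∷ []) (con 1) (card (v0 - v1)) refl (p ∷ []) (h ∷ ∣⁅ x ⁆∣≤1 ∷ []))
  ...   | y , q = x , y , p , (set= (⁅ x ⁆ ∷ A ∷ ⁅ y ⁆ ∷ []) (v2 <: v1 - v0 ∷ []) (v2 || v1) v1 refl (q ∷ [])) , (set= (⁅ x ⁆ ∷ A ∷ ⁅ y ⁆ ∷ []) (v2 <: v1 - v0 ∷ []) (v0 && v2) ∅ refl (q ∷ []))

  ≤1⇒≡⊥⊎≡⁅⁆ : ∀ {A : Subset n} → ∣ A ∣ ≤ 1 → A ≡ ⊥ ⊎ ∃[ x ] A ≡ ⁅ x ⁆
  ≤1⇒≡⊥⊎≡⁅⁆ {A} h with empty-or-element A
  ... | inj₁ p = inj₁ p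
  ... | inj₂ (x , p) = inj₂ (x , (set= (⁅ x ⁆ ∷ A ∷ []) (v0 <: v1 ∷ v1 - v0 == ∅ ∷ []) v1 v0 refl (p ∷ q ∷ [])))
    where
    q : A ─ ⁅ x ⁆ ≡ ⊥
    q = ∣∣≤0⇒≡⊥ (prove≤ (A ∷ ⁅ x ⁆ ∷ []) [] (v1 <: v0 ∷ []) (card v0 <= con 1 ∷ con 1 <= card v1 ∷ [])
      (cmod (v0 - v1) v1 ∷ c∅ ∷ []) (card (v0 - v1)) (con 0) refl (p ∷ []) (h ∷ 1≤∣⁅ x ⁆∣ ∷ []))

-- Augmentation and bases.

module Rank {n : ℕ} (R : RankFn n) where
  open RankFn R
  open RankSolver R

  -- Induction on a bound for |U|: if an element x of U does not raise the rank of F, then by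
  -- submodularity U without x still does.
  augment-by : ∀ k {F U} → ∣ U ∣ ≤ k → ρ F < ρ (F ∪ U) → ∃[ x ] ⁅ x ⁆ ⊑ U × ρ F < ρ (F ∪ ⁅ x ⁆)
  augment-by k {F} {U} h lt with empty-or-element U
  ... | inj₁ p = absurd (refute (U ∷ F ∷ []) [] (v0 == ∅ ∷ []) (con 1 ⊕ rank v1 <= rank (v1 || v0) ∷ []) [] refl (p ∷ []) (lt ∷
    []))
  augment-by zero {F} {U} h lt | inj₂ (x , p) = absurd (refute (U ∷ ⁅ x ⁆ ∷ []) [] (v1 <: v0 ∷ []) (card v0 <= con 0 ∷ con 1 <= card v1 ∷ []) (cmono v1 v0 ∷
    []) refl (p ∷ []) (h ∷ 1≤∣⁅ x ⁆∣ ∷ []))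
  augment-by (suc k) {F} {U} h lt | inj₂ (x , p) with suc (ρ F) ≤? ρ (F ∪ ⁅ x ⁆)
  ... | yes q = x , p , q
  ... | no q with augment-by k {F} {U ─ ⁅ x ⁆} (prove≤ (U ∷ ⁅ x ⁆ ∷ []) (k ∷ []) (v1 <: v0 ∷ []) (card v0 <= con 1 ⊕ nv 0 ∷ con 1 <= card v1 ∷ [])
    (cmod (v0 - v1) v1 ∷ c∅ ∷ []) (card (v0 - v1)) (nv 0) refl (p ∷ []) (h ∷ 1≤∣⁅ x ⁆∣ ∷ [])) (prove≤ (F ∷ U ∷ ⁅ x ⁆ ∷ []) [] (v2 <: v1 ∷ []) (con 1 ⊕ rank v0 <= rank (v0 || v1) ∷
    con 1 ⊕ rank (v0 || v2) <= con 1 ⊕ rank v0 ∷ []) (sub (v0 || (v1 - v2)) (v0 || v2) ∷ [])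
    (con 1 ⊕ rank v0) (rank (v0 || (v1 - v2))) refl (p ∷ []) (lt ∷ ≰⇒> q ∷ []))
  ...   | y , r , s = y , (set= (⁅ y ⁆ ∷ U ∷ ⁅ x ⁆ ∷ []) (v0 <: v1 - v2 ∷ []) (v0 || v1) v1 refl (r ∷ [])) , s

  augment : ∀ F U → ρ F < ρ (F ∪ U) → ∃[ x ] ⁅ x ⁆ ⊑ U × ρ F < ρ (F ∪ ⁅ x ⁆)
  augment F U = augment-by _ ≤-refl

  -- B is a basis of U in the contraction by F: each chosen element raises the rank by one, whence
  -- the second equation. The number k bounds the rank still missing.
  basis-by : ∀ k F U → ρ (F ∪ U) ≤ k + ρ F →
    ∃[ B ] B ⊑ U × ρ (F ∪ B) ≡ ρ (F ∪ U) × ρ (F ∪ B) ≡ ρ F + ∣ B ∣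
  basis-by k F U h with ρ (F ∪ U) ≤? ρ F
  ... | yes q = ⊥ , (set= (U ∷ []) [] (∅ || v0) v0 refl []) , (≤-antisym (prove≤ (F ∷ U ∷ []) [] [] [] (mono (v0 || ∅) (v0 || v1) ∷ []) (rank (v0 || ∅)) (rank (v0 || v1)) refl
    [] [])
    (prove≤ (F ∷ U ∷ []) [] [] (rank (v0 || v1) <= rank v0 ∷ []) [] (rank (v0 || v1)) (rank (v0 || ∅)) refl
    [] (q ∷ []))) , (≤-antisym (prove≤ (F ∷ []) [] [] [] [] (rank (v0 || ∅)) (rank v0 ⊕ card ∅) refl [] [])
    (prove≤ (F ∷ []) [] [] [] (c∅ ∷ []) (rank v0 ⊕ card ∅) (rank (v0 || ∅)) refl [] []))
  basis-by zero F U h | no q = absurd (q h)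
  basis-by (suc k) F U h | no q with augment F U (≰⇒> q)
  ... | x , x∈ , lt with basis-by k (F ∪ ⁅ x ⁆) U (prove≤ (F ∷ U ∷ ⁅ x ⁆ ∷ []) (k ∷ []) (v2 <: v1 ∷ []) (rank (v0 || v1) <= con 1 ⊕ nv 0 ⊕ rank v0 ∷
    con 1 ⊕ rank v0 <= rank (v0 || v2) ∷ []) [] (rank ((v0 || v2) || v1)) (nv 0 ⊕ rank (v0 || v2)) refl
    (x∈ ∷ []) (h ∷ lt ∷ []))
  ...   | B , B⊑ , p , r = ⁅ x ⁆ ∪ B , (set= (⁅ x ⁆ ∷ U ∷ B ∷ []) (v0 <: v1 ∷ v2 <: v1 ∷ []) ((v0 || v2) || v1) v1 refl (x∈ ∷ B⊑ ∷ [])) , (≤-antisym (prove≤ (F ∷ ⁅ x ⁆ ∷ B ∷ U ∷ []) [] (v1 <: v3 ∷ [])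
    (rank ((v0 || v1) || v2) <= rank ((v0 || v1) || v3) ∷ []) [] (rank (v0 || (v1 || v2))) (rank (v0 || v3))
    refl (x∈ ∷ []) (≤-reflexive p ∷ []))
    (prove≤ (F ∷ ⁅ x ⁆ ∷ B ∷ U ∷ []) [] (v1 <: v3 ∷ [])
    (rank ((v0 || v1) || v3) <= rank ((v0 || v1) || v2) ∷ []) [] (rank (v0 || v3)) (rank (v0 || (v1 || v2)))
    refl (x∈ ∷ []) (≤-reflexive (sym p) ∷ []))) , (≤-antisym (prove≤ (F ∷ ⁅ x ⁆ ∷ B ∷ []) [] [] [] (sub v0 (v2 || v1) ∷ rc (v1 || v2) ∷ []) (rank (v0 || (v1 || v2)))
    (rank v0 ⊕ card (v1 || v2)) refl [] [])
    (prove≤ (F ∷ ⁅ x ⁆ ∷ B ∷ []) [] [] (rank (v0 || v1) ⊕ card v2 <= rank ((v0 || v1) || v2) ∷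
    con 1 ⊕ rank v0 <= rank (v0 || v1) ∷ card v1 <= con 1 ∷ []) (csub v2 v1 ∷ [])
    (rank v0 ⊕ card (v1 || v2)) (rank (v0 || (v1 || v2))) refl [] (≤-reflexive (sym r) ∷ lt ∷ ∣⁅ x ⁆∣≤1 ∷
    [])))

  basis : ∀ F U → ∃[ B ] B ⊑ U × ρ (F ∪ B) ≡ ρ (F ∪ U) × ρ (F ∪ B) ≡ ρ F + ∣ B ∣
  basis F U = basis-by (ρ (F ∪ U)) F U (m≤m+n _ _)

-- Images and preimages of sets under a map.

tabulate∈⁺ : ∀ {n} {f : Fin n → Bool} {j} → f j ≡ true → j ∈ tabulate f
tabulate∈⁺ {f = f} {j} p = lookup⇒[]= j _ (trans (lookup∘tabulate f j) p)

tabulate∈⁻ : ∀ {n} {f : Fin n → Bool} {j} → j ∈ tabulate f → f j ≡ true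
tabulate∈⁻ {f = f} {j} p = trans (sym (lookup∘tabulate f j)) ([]=⇒lookup p)

does-true⁻ : ∀ {P : Set} (d : Dec P) → does d ≡ true → P
does-true⁻ (yes p) _ = p

module _ {m n : ℕ} (f : Fin m → Fin n) where

  ∈-image⁺ : ∀ {X i} → i ∈ X → f i ∈ image f X
  ∈-image⁺ {X} {i} i∈ = tabulate∈⁺ (dec-true (any? _) (i , i∈ , refl))

  ∈-image⁻ : ∀ {X j} → j ∈ image f X → ∃[ i ] i ∈ X × f i ≡ j
  ∈-image⁻ j∈ = does-true⁻ (any? _) (tabulate∈⁻ j∈)

  image-mono : ∀ {X Y} → X ⊑ Y → image f X ⊑ image f Y
  image-mono h = ⊆⇒⊑ λ j∈ → let (i , i∈ , p) = ∈-image⁻ j∈ in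
    subst (_∈ _) p (∈-image⁺ (⊑⇒⊆ h i∈))

  image-∪ : ∀ X Y → image f (X ∪ Y) ≡ image f X ∪ image f Y
  image-∪ X Y = ⊆-antisym to from
    where
    to : image f (X ∪ Y) ⊆ image f X ∪ image f Y
    to j∈ with ∈-image⁻ j∈
    ... | i , i∈ , refl with x∈p∪q⁻ X Y i∈
    ...   | inj₁ p = x∈p∪q⁺ (inj₁ (∈-image⁺ p))
    ...   | inj₂ p = x∈p∪q⁺ (inj₂ (∈-image⁺ p))
    from : image f X ∪ image f Y ⊆ image f (X ∪ Y)
    from j∈ with x∈p∪q⁻ (image f X) (image f Y) j∈
    ... | inj₁ p with ∈-image⁻ p
    ...   | i , i∈ , refl = ∈-image⁺ (x∈p∪q⁺ (inj₁ i∈))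
    from j∈ | inj₂ p with ∈-image⁻ p
    ...   | i , i∈ , refl = ∈-image⁺ (x∈p∪q⁺ (inj₂ i∈))

  image-⁅⁆ : ∀ i → image f ⁅ i ⁆ ≡ ⁅ f i ⁆
  image-⁅⁆ i = ⊆-antisym to from
    where
    to : image f ⁅ i ⁆ ⊆ ⁅ f i ⁆
    to j∈ with ∈-image⁻ j∈
    ... | k , k∈ , refl rewrite x∈⁅y⁆⇒x≡y i k∈ = x∈⁅x⁆ (f i)
    from : ⁅ f i ⁆ ⊆ image f ⁅ i ⁆
    from j∈ rewrite x∈⁅y⁆⇒x≡y (f i) j∈ = ∈-image⁺ (x∈⁅x⁆ i)

  image-∩-disjoint : ∀ {G X Y} → (∀ {i j} → i ∈ G → j ∈ G → f i ≡ f j → i ≡ j) →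
    X ⊑ G → Y ⊑ G → X ∩ Y ≡ ⊥ → image f X ∩ image f Y ≡ ⊥
  image-∩-disjoint {G} {X} {Y} inj X⊑ Y⊑ d = Empty-unique λ (j , j∈) →
    let (p , q) = x∈p∩q⁻ (image f X) (image f Y) j∈
        (i , i∈ , u) = ∈-image⁻ p
        (k , k∈ , w) = ∈-image⁻ q
        i≡k = inj (⊑⇒⊆ X⊑ i∈) (⊑⇒⊆ Y⊑ k∈) (trans u (sym w))
    in ∉⊥ (subst (i ∈_) d (x∈p∩q⁺ (i∈ , subst (_∈ Y) (sym i≡k) k∈)))

  preimage : Subset m → Subset n → Subset m
  preimage G Z = tabulate λ i → does ((i ∈? G) ×-dec (f i ∈? Z))

  preimage⁺ : ∀ {G Z i} → i ∈ G → f i ∈ Z → i ∈ preimage G Z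
  preimage⁺ {G} {Z} {i} p q = tabulate∈⁺ (dec-true ((i ∈? G) ×-dec (f i ∈? Z)) (p , q))

  preimage⁻ : ∀ {G Z i} → i ∈ preimage G Z → i ∈ G × f i ∈ Z
  preimage⁻ {G} {Z} {i} p = does-true⁻ ((i ∈? G) ×-dec (f i ∈? Z)) (tabulate∈⁻ p)

  image-preimage : ∀ {G Z} → Z ⊑ image f G → image f (preimage G Z) ≡ Z
  image-preimage {G} {Z} h = ⊆-antisym to from
    where
    to : image f (preimage G Z) ⊆ Z
    to j∈ with ∈-image⁻ j∈
    ... | i , i∈ , refl = proj₂ (preimage⁻ {G} i∈)
    from : Z ⊆ image f (preimage G Z)
    from j∈ with ∈-image⁻ (⊑⇒⊆ h j∈)
    ... | i , i∈ , refl = ∈-image⁺ (preimage⁺ i∈ j∈)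

module _ {m n : ℕ} (f : Fin m → Fin n) (G : Subset m)
         (inj : ∀ {i j} → i ∈ G → j ∈ G → f i ≡ f j → i ≡ j) where

  ∣image∣-by : ∀ k {X} → ∣ X ∣ ≤ k → X ⊑ G → ∣ image f X ∣ ≡ ∣ X ∣
  ∣image∣-by k {X} h X⊑ with empty-or-element X
  ... | inj₁ refl = trans (cong ∣_∣ (Empty-unique λ (j , j∈) →
    let (_ , i∈ , _) = ∈-image⁻ f j∈ in ∉⊥ i∈)) (trans (∣⊥∣≡0 n) (sym (∣⊥∣≡0 m)))
  ∣image∣-by zero {X} h X⊑ | inj₂ (x , x∈) = absurd (nonempty X h x∈)
    where
    open RankSolver (zeroRank {m})
    nonempty : ∀ Y → ∣ Y ∣ ≤ 0 → ⁅ x ⁆ ⊑ Y → Absurd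
    nonempty Y h x∈ = (refute (Y ∷ ⁅ x ⁆ ∷ []) [] (v1 <: v0 ∷ []) (card v0 <= con 0 ∷ con 1 <= card v1 ∷ []) (cmono v1 v0 ∷
      []) refl (x∈ ∷ []) (h ∷ 1≤∣⁅ x ⁆∣ ∷ []))
  ∣image∣-by (suc k) {X} h X⊑ | inj₂ (x , x∈) = step
    (∣image∣-by k (smaller h x∈) (set= (X ∷ G ∷ ⁅ x ⁆ ∷ []) (v0 <: v1 ∷ []) ((v0 - v2) || v1) v1 refl (X⊑ ∷ [])))
    (trans (cong (image f) X≡) (trans (image-∪ f ⁅ x ⁆ (X ─ ⁅ x ⁆)) (cong (_∪ image f (X ─ ⁅ x ⁆)) (image-⁅⁆ f x))))
    (subst (λ Z → Z ∩ image f (X ─ ⁅ x ⁆) ≡ ⊥) (image-⁅⁆ f x)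
      (image-∩-disjoint f {G} inj (set= (⁅ x ⁆ ∷ X ∷ G ∷ []) (v0 <: v1 ∷ v1 <: v2 ∷ []) (v0 || v2) v2 refl (x∈ ∷ X⊑ ∷ [])) (set= (X ∷ G ∷ ⁅ x ⁆ ∷ []) (v0 <: v1 ∷ []) ((v0 - v2) || v1) v1 refl (X⊑ ∷ [])) (set= (⁅ x ⁆ ∷ X ∷ []) [] (v0 && (v1 - v0)) ∅ refl [])))
    x∈
    where
    X≡ : X ≡ ⁅ x ⁆ ∪ (X ─ ⁅ x ⁆)
    X≡ = set= (⁅ x ⁆ ∷ X ∷ []) (v0 <: v1 ∷ []) v1 (v0 || (v1 - v0)) refl (x∈ ∷ [])
    smaller : ∣ X ∣ ≤ suc k → ⁅ x ⁆ ⊑ X → ∣ X ─ ⁅ x ⁆ ∣ ≤ k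
    smaller h x∈ = prove≤ (X ∷ ⁅ x ⁆ ∷ []) (k ∷ []) (v1 <: v0 ∷ []) (card v0 <= con 1 ⊕ nv 0 ∷ con 1 <= card v1 ∷ [])
      (cmod (v0 - v1) v1 ∷ c∅ ∷ []) (card (v0 - v1)) (nv 0) refl (x∈ ∷ []) (h ∷ 1≤∣⁅ x ⁆∣ ∷ [])
      where open RankSolver (zeroRank {m})
    step : ∀ {A B y} → ∣ B ∣ ≡ ∣ X ─ ⁅ x ⁆ ∣ → A ≡ ⁅ y ⁆ ∪ B → ⁅ y ⁆ ∩ B ≡ ⊥ → ⁅ x ⁆ ⊑ X → ∣ A ∣ ≡ ∣ X ∣
    step {A} {B} {y} p q d x∈ = trans one (trans (cong (_+ 1) p) two)
      where
      one : ∣ A ∣ ≡ ∣ B ∣ + 1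
      one = ≤-antisym (prove≤ (A ∷ ⁅ y ⁆ ∷ B ∷ []) [] (v0 == v1 || v2 ∷ []) (card v1 <= con 1 ∷ []) (csub v2 v1 ∷ [])
        (card v0) (card v2 ⊕ con 1) refl (q ∷ []) (∣⁅ y ⁆∣≤1 ∷ []))
        (prove≤ (A ∷ ⁅ y ⁆ ∷ B ∷ []) [] (v0 == v1 || v2 ∷ v1 && v2 == ∅ ∷ []) (con 1 <= card v1 ∷ [])
        (cmod v2 v1 ∷ c∅ ∷ []) (card v2 ⊕ con 1) (card v0) refl (q ∷ d ∷ []) (1≤∣⁅ y ⁆∣ ∷ []))
        where open RankSolver (zeroRank {n})
      two : ∣ X ─ ⁅ x ⁆ ∣ + 1 ≡ ∣ X ∣
      two = ≤-antisym (prove≤ (⁅ x ⁆ ∷ X ∷ []) [] (v0 <: v1 ∷ []) (con 1 <= card v0 ∷ []) (cmod (v1 - v0) v0 ∷ c∅ ∷ [])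
        (card (v1 - v0) ⊕ con 1) (card v1) refl (x∈ ∷ []) (1≤∣⁅ x ⁆∣ ∷ []))
        (prove≤ (⁅ x ⁆ ∷ X ∷ []) [] (v0 <: v1 ∷ []) (card v0 <= con 1 ∷ []) (csub (v1 - v0) v0 ∷ [])
        (card v1) (card (v1 - v0) ⊕ con 1) refl (x∈ ∷ []) (∣⁅ x ⁆∣≤1 ∷ []))
        where open RankSolver (zeroRank {m})

  ∣image∣ : ∀ {X} → X ⊑ G → ∣ image f X ∣ ≡ ∣ X ∣
  ∣image∣ = ∣image∣-by _ ≤-refl

-- `N`-minors as pairs of sets, and changes of such a pair.

module Models {n m : ℕ} (R : RankFn n) (N : Matroid m) where
  open RankFn R
  open RankSolver R
  open Rank R

  -- An embedding of N as the minor of ρ on I obtained by contracting W.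
  record Model (I W : Subset n) : Set where
    field
      φ         : Fin m → Fin n
      injective : ∀ {i j} → i ∈ E N → j ∈ E N → φ i ≡ φ j → i ≡ j
      onto      : image φ (E N) ≡ I
      disjoint  : I ∩ W ≡ ⊥
      -- A sum in place of a difference of ranks, so that linear arithmetic applies without
      -- truncated subtraction.
      rank-φ    : ∀ Z → Z ⊆ E N → r N Z + ρ W ≡ ρ (image φ Z ∪ W)

  open Model public

  ∣model∣ : ∀ {I W} → Model I W → ∣ I ∣ ≡ ∣ E N ∣
  ∣model∣ μ = trans (cong ∣_∣ (sym (onto μ))) (∣image∣ (φ μ) (E N) (injective μ) (set= (E N ∷ []) [] (v0 || v0) v0 refl []))

  rank-preimage : ∀ {I W} (μ : Model I W) {A} → A ⊑ I →
    r N (preimage (φ μ) (E N) A) + ρ W ≡ ρ (A ∪ W)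
  rank-preimage {W = W} μ {A} A⊑ = trans
    (rank-φ μ (preimage (φ μ) (E N) A) (λ i∈ → proj₁ (preimage⁻ (φ μ) i∈)))
    (cong (λ Z → ρ (Z ∪ W)) (image-preimage (φ μ) (subst (A ⊑_) (sym (onto μ)) A⊑)))

  -- The element g hands its role in N to f while the contracted set changes from W to W′. The last
  -- two hypotheses say, with subtractions cleared, that contracting W′ gives sets without g the
  -- rank they had, and sets with f the rank they had with g.
  relabel : ∀ {I W W′} g f → Model I W → ⁅ f ⁆ ∩ (I ─ ⁅ g ⁆) ≡ ⊥ → ⁅ g ⁆ ⊑ I →
    ((I ─ ⁅ g ⁆) ∪ ⁅ f ⁆) ∩ W′ ≡ ⊥ →
    (∀ Z → Z ⊑ I → ⁅ g ⁆ ∩ Z ≡ ⊥ → ρ (Z ∪ W′) + ρ W ≡ ρ (Z ∪ W) + ρ W′) →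
    (∀ Z → Z ⊑ I → ⁅ g ⁆ ∩ Z ≡ ⊥ → ρ ((Z ∪ ⁅ f ⁆) ∪ W′) + ρ W ≡ ρ ((Z ∪ ⁅ g ⁆) ∪ W) + ρ W′) →
    Model ((I ─ ⁅ g ⁆) ∪ ⁅ f ⁆) W′
  relabel {I} {W} {W′} g f μ f∉ g∈ dis without with-g = record
    { φ = ψ ; injective = inj ; onto = onto-ψ ; disjoint = dis ; rank-φ = rank-ψ }
    where
    move : Fin n → Fin n
    move j with j ≟ g
    ... | yes _ = f
    ... | no _  = j
    move-g : move g ≡ f
    move-g with g ≟ g
    ... | yes _ = refl
    ... | no p  = absurd (p refl)
    move-≢ : ∀ {j} → j ≢ g → move j ≡ j
    move-≢ {j} p with j ≟ g
    ... | yes q = absurd (p q)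
    ... | no _  = refl
    ψ : Fin m → Fin n
    ψ i = move (φ μ i)
    φ∈ : ∀ {i} → i ∈ E N → φ μ i ∈ I
    φ∈ i∈ = subst (_ ∈_) (onto μ) (∈-image⁺ (φ μ) i∈)
    f≢ : ∀ {j} → j ∈ I → j ≢ g → j ≢ f
    f≢ {j} j∈ j≢g refl = disjoint⇒≢ {x = f} {y = f} (set= (⁅ j ⁆ ∷ I ∷ ⁅ g ⁆ ∷ []) (v0 && (v1 - v2) == ∅ ∷ v0 <: v1 ∷ v0 && v2 == ∅ ∷ []) (v0 && v0) ∅
      refl (f∉ ∷ (∈⇒⊑ j∈) ∷ (≢⇒disjoint j≢g) ∷ [])) refl
    inj : ∀ {i j} → i ∈ E N → j ∈ E N → ψ i ≡ ψ j → i ≡ j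
    inj {i} {j} i∈ j∈ p with φ μ i ≟ g | φ μ j ≟ g
    ... | yes a | yes b = injective μ i∈ j∈ (trans a (sym b))
    ... | yes a | no b  = absurd (f≢ (φ∈ j∈) b (sym p))
    ... | no a  | yes b = absurd (f≢ (φ∈ i∈) a p)
    ... | no a  | no b  = injective μ i∈ j∈ p
    image-without : ∀ Z → ⁅ g ⁆ ∩ image (φ μ) Z ≡ ⊥ → image ψ Z ≡ image (φ μ) Z
    image-without Z g∉ = ⊆-antisym to from
      where
      ≢g : ∀ {i} → i ∈ Z → φ μ i ≢ g
      ≢g {i} i∈ p = ∉⊥ (subst (g ∈_) g∉ (x∈p∩q⁺ (x∈⁅x⁆ g , subst (_∈ _) p (∈-image⁺ (φ μ) i∈))))
      to : image ψ Z ⊆ image (φ μ) Z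
      to j∈ with ∈-image⁻ ψ j∈
      ... | i , i∈ , refl = subst (_∈ image (φ μ) Z) (sym (move-≢ (≢g i∈))) (∈-image⁺ (φ μ) i∈)
      from : image (φ μ) Z ⊆ image ψ Z
      from j∈ with ∈-image⁻ (φ μ) j∈
      ... | i , i∈ , refl = subst (_∈ image ψ Z) (move-≢ (≢g i∈)) (∈-image⁺ ψ i∈)
    image-with : ∀ Z → Z ⊆ E N → ⁅ g ⁆ ⊑ image (φ μ) Z → image ψ Z ≡ (image (φ μ) Z ─ ⁅ g ⁆) ∪ ⁅ f ⁆
    image-with Z Z⊆ g∈Z with ∈-image⁻ (φ μ) (⊑⇒∈ g∈Z)
    ... | k , k∈ , φk = trans (cong (image ψ) Z≡)
        (trans (image-∪ ψ (Z ─ ⁅ k ⁆) ⁅ k ⁆)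
          (cong₂ _∪_ (trans (image-without (Z ─ ⁅ k ⁆) g∉)
                       (disjoint-∪ (trans (cong (image (φ μ)) Z≡) (trans (image-∪ (φ μ) _ _)
                         (cong (image (φ μ) (Z ─ ⁅ k ⁆) ∪_) (trans (image-⁅⁆ (φ μ) k) (cong ⁅_⁆ φk))))) g∉))
                     (trans (image-⁅⁆ ψ k) (cong ⁅_⁆ (trans (cong move φk) move-g)))))
      where
      Z≡ : Z ≡ (Z ─ ⁅ k ⁆) ∪ ⁅ k ⁆
      Z≡ = set= (⁅ k ⁆ ∷ Z ∷ []) (v0 <: v1 ∷ []) v1 ((v1 - v0) || v0) refl ((∈⇒⊑ k∈) ∷ [])
      g∉ : ⁅ g ⁆ ∩ image (φ μ) (Z ─ ⁅ k ⁆) ≡ ⊥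
      g∉ = subst (λ A → A ∩ image (φ μ) (Z ─ ⁅ k ⁆) ≡ ⊥) (trans (image-⁅⁆ (φ μ) k) (cong ⁅_⁆ φk))
        (image-∩-disjoint (φ μ) {E N} (injective μ) (set= (⁅ k ⁆ ∷ E N ∷ []) (v0 <: v1 ∷ []) (v0 || v1) v1 refl ((∈⇒⊑ (Z⊆ k∈)) ∷ [])) (set= (Z ∷ E N ∷ ⁅ k ⁆ ∷ []) (v0 <: v1 ∷ []) ((v0 - v2) || v1) v1 refl ((⊆⇒⊑ Z⊆) ∷ [])) (set= (⁅ k ⁆ ∷ Z ∷ []) [] (v0 && (v1 - v0)) ∅ refl []))
      disjoint-∪ : ∀ {A B C : Subset n} → A ≡ B ∪ C → C ∩ B ≡ ⊥ → B ≡ A ─ C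
      disjoint-∪ {A} {B} {C} p d = set= (A ∷ B ∷ C ∷ []) (v0 == v1 || v2 ∷ v2 && v1 == ∅ ∷ []) v1 (v0 - v2) refl (p ∷ d ∷ [])
    onto-ψ : image ψ (E N) ≡ (I ─ ⁅ g ⁆) ∪ ⁅ f ⁆
    onto-ψ = trans (image-with (E N) (λ i∈ → i∈) (subst (⁅ g ⁆ ⊑_) (sym (onto μ)) g∈))
      (cong (λ Z → (Z ─ ⁅ g ⁆) ∪ ⁅ f ⁆) (onto μ))
    rank-ψ : ∀ Z → Z ⊆ E N → r N Z + ρ W′ ≡ ρ (image ψ Z ∪ W′)
    rank-ψ Z Z⊆ with inside? g (image (φ μ) Z)
    ... | inj₂ p = combine (rank-φ μ Z Z⊆) (without (image (φ μ) Z) (img⊑ Z⊆) p) (cong (λ A → ρ (A ∪ W′)) (image-without Z p))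
      where
      img⊑ : Z ⊆ E N → image (φ μ) Z ⊑ I
      img⊑ h = subst (image (φ μ) Z ⊑_) (onto μ) (image-mono (φ μ) (⊆⇒⊑ h))
      combine : ∀ {a b c d e f} → a + b ≡ c → d + b ≡ c + e → f ≡ d → a + e ≡ f
      combine {a} {b} {c} {d} {e} {f} p q r = ≤-antisym (prove≤ [] (a ∷ b ∷ c ∷ d ∷ e ∷ f ∷ []) [] (nv 0 ⊕ nv 1 <= nv 2 ∷ nv 2 ⊕ nv 4 <= nv 3 ⊕ nv 1 ∷
        nv 3 <= nv 5 ∷ []) [] (nv 0 ⊕ nv 4) (nv 5) refl [] (≤-reflexive p ∷ ≤-reflexive (sym q) ∷
        ≤-reflexive (sym r) ∷ []))
        (prove≤ [] (a ∷ b ∷ c ∷ d ∷ e ∷ f ∷ []) [] (nv 2 <= nv 0 ⊕ nv 1 ∷ nv 3 ⊕ nv 1 <= nv 2 ⊕ nv 4 ∷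
        nv 5 <= nv 3 ∷ []) [] (nv 5) (nv 0 ⊕ nv 4) refl [] (≤-reflexive (sym p) ∷ ≤-reflexive q ∷
        ≤-reflexive r ∷ []))
    ... | inj₁ p = combine (rank-φ μ Z Z⊆) (with-g (image (φ μ) Z ─ ⁅ g ⁆) (set= (image (φ μ) Z ∷ I ∷ ⁅ g ⁆ ∷ []) (v0 <: v1 ∷ []) ((v0 - v2) || v1) v1 refl ((img⊑ Z⊆) ∷ [])) (set= (⁅ g ⁆ ∷ image (φ μ) Z ∷ []) [] (v0 && (v1 - v0)) ∅ refl []))
        (cong (λ A → ρ (A ∪ W)) {x = (image (φ μ) Z ─ ⁅ g ⁆) ∪ ⁅ g ⁆} {y = image (φ μ) Z} (restore p))
        (cong (λ A → ρ (A ∪ W′)) (image-with Z Z⊆ p))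
      where
      img⊑ : Z ⊆ E N → image (φ μ) Z ⊑ I
      img⊑ h = subst (image (φ μ) Z ⊑_) (onto μ) (image-mono (φ μ) (⊆⇒⊑ h))
      restore : ∀ {A B : Subset n} → B ⊑ A → (A ─ B) ∪ B ≡ A
      restore {A} {B} p = set= (B ∷ A ∷ []) (v0 <: v1 ∷ []) ((v1 - v0) || v0) v1 refl (p ∷ [])
      combine : ∀ {a b c d e f c′} → a + b ≡ c → d + b ≡ c′ + e → c′ ≡ c → f ≡ d → a + e ≡ f
      combine {a} {b} {c} {d} {e} {f} {c′} p q s r = ≤-antisym (prove≤ [] (a ∷ b ∷ c ∷ d ∷ c′ ∷ e ∷ f ∷ []) [] (nv 0 ⊕ nv 1 <= nv 2 ∷ nv 4 ⊕ nv 5 <= nv 3 ⊕ nv 1 ∷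
        nv 3 <= nv 6 ∷ nv 2 <= nv 4 ∷ []) [] (nv 0 ⊕ nv 5) (nv 6) refl [] (≤-reflexive p ∷
        ≤-reflexive (sym q) ∷ ≤-reflexive (sym r) ∷ ≤-reflexive (sym s) ∷ []))
        (prove≤ [] (a ∷ b ∷ c ∷ d ∷ c′ ∷ e ∷ f ∷ []) [] (nv 2 <= nv 0 ⊕ nv 1 ∷ nv 3 ⊕ nv 1 <= nv 4 ⊕ nv 5 ∷
        nv 6 <= nv 3 ∷ nv 4 <= nv 2 ∷ []) [] (nv 6) (nv 0 ⊕ nv 5) refl [] (≤-reflexive (sym p) ∷
        ≤-reflexive q ∷ ≤-reflexive r ∷ ≤-reflexive s ∷ []))

  -- The hypothesis says that W and W′ give the same contracted rank to every subset of I, so the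
  -- embedding itself can be kept.
  recontract : ∀ {I W} W′ → Model I W → I ∩ W′ ≡ ⊥ →
    (∀ Z → Z ⊑ I → ρ (Z ∪ W′) + ρ W ≡ ρ (Z ∪ W) + ρ W′) → Model I W′
  recontract {I} {W} W′ μ dis h = record
    { φ = φ μ ; injective = injective μ ; onto = onto μ ; disjoint = dis
    ; rank-φ = λ Z Z⊆ → combine (rank-φ μ Z Z⊆)
        (h _ (subst (image (φ μ) Z ⊑_) (onto μ) (image-mono (φ μ) (⊆⇒⊑ Z⊆)))) }
    where
    combine : ∀ {a b c d e} → a + b ≡ c → d + b ≡ c + e → a + e ≡ d
    combine {a} {b} {c} {d} {e} p q = ≤-antisym (prove≤ [] (a ∷ b ∷ c ∷ d ∷ e ∷ []) [] (nv 0 ⊕ nv 1 <= nv 2 ∷ nv 2 ⊕ nv 4 <= nv 3 ⊕ nv 1 ∷ []) []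
      (nv 0 ⊕ nv 4) (nv 3) refl [] (≤-reflexive p ∷ ≤-reflexive (sym q) ∷ []))
      (prove≤ [] (a ∷ b ∷ c ∷ d ∷ e ∷ []) [] (nv 2 <= nv 0 ⊕ nv 1 ∷ nv 3 ⊕ nv 1 <= nv 2 ⊕ nv 4 ∷ []) []
      (nv 3) (nv 0 ⊕ nv 4) refl [] (≤-reflexive (sym p) ∷ ≤-reflexive q ∷ []))

-- 2-separations of a contraction, and how N survives them.

module Survival {n m : ℕ} (R : RankFn n) (N : Matroid m)
                (N-conn : ThreeConnected N) (N-size : 4 ≤ ∣ E N ∣) where
  open RankFn R
  open RankSolver R
  open Rank R
  open Models R N

  preimage-─ : ∀ {I W} (μ : Model I W) {A B} → A ∪ B ≡ I → A ∩ B ≡ ⊥ →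
    E N ─ preimage (φ μ) (E N) A ≡ preimage (φ μ) (E N) B
  preimage-─ {I} μ {A} {B} p d = ⊆-antisym to from
    where
    open import Data.Fin.Subset.Properties using (p─q⊆p; x∈p∧x∉q⇒x∈p─q)
    to : E N ─ preimage (φ μ) (E N) A ⊆ preimage (φ μ) (E N) B
    to {i} i∈ with x∈p∪q⁻ A B (subst (φ μ i ∈_) (trans (onto μ) (sym p)) (∈-image⁺ (φ μ) (p─q⊆p (E N) _ i∈)))
    ... | inj₂ q = preimage⁺ (φ μ) (p─q⊆p (E N) _ i∈) q
    ... | inj₁ q = absurd (disjoint⇒≢ {x = i} {y = i} (contra {A = E N} (∈⇒⊑ i∈)
      (∈⇒⊑ (preimage⁺ (φ μ) {G = E N} {Z = A} (p─q⊆p (E N) _ i∈) q))) refl)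
      where
      contra : ∀ {x} {A B : Subset m} → ⁅ x ⁆ ⊑ A ─ B → ⁅ x ⁆ ⊑ B → ⁅ x ⁆ ∩ ⁅ x ⁆ ≡ ⊥
      contra {x} {A} {B} p q = set= (⁅ x ⁆ ∷ A ∷ B ∷ []) (v0 <: v1 - v2 ∷ v0 <: v2 ∷ []) (v0 && v0) ∅ refl (p ∷ q ∷ [])
    from : preimage (φ μ) (E N) B ⊆ E N ─ preimage (φ μ) (E N) A
    from i∈ = let (a , b) = preimage⁻ (φ μ) i∈ in
      x∈p∧x∉q⇒x∈p─q a (λ q → ∉⊥ (subst (_ ∈_) d (x∈p∩q⁺ (proj₂ (preimage⁻ (φ μ) {G = E N} q) , b))))

  ∣preimage∣ : ∀ {I W} (μ : Model I W) {A} → A ⊑ I → ∣ preimage (φ μ) (E N) A ∣ ≡ ∣ A ∣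
  ∣preimage∣ {I} μ {A} A⊑ = trans
    (sym (∣image∣ (φ μ) (E N) (injective μ) (⊆⇒⊑ (λ i∈ → proj₁ (preimage⁻ (φ μ) i∈)))))
    (cong ∣_∣ (image-preimage (φ μ) (subst (A ⊑_) (sym (onto μ)) A⊑)))

  rank-model : ∀ {I W} → Model I W → rk N + ρ W ≡ ρ (I ∪ W)
  rank-model {I} {W} μ = trans (rank-φ μ (E N) (λ i∈ → i∈)) (cong (λ Z → ρ (Z ∪ W)) (onto μ))

  -- The 3-connectivity of N, transported to M. Each of the three ranks in N is a rank over W minus
  -- `ρ W`, which leaves a single `ρ W` on the smaller side.
  connected : ∀ {I W} → Model I W → ∀ {A B} → A ∪ B ≡ I → A ∩ B ≡ ⊥ →
    ∀ k → 1 ≤ k → k ≤ 2 → k ≤ ∣ A ∣ → k ≤ ∣ B ∣ → ρ (I ∪ W) + ρ W + k ≤ ρ (A ∪ W) + ρ (B ∪ W)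
  connected {I} {W} μ {A} {B} p d k 1≤k k≤2 kA kB =
    combine (N-conn k 1≤k k≤2 A′ (λ i∈ → proj₁ (preimage⁻ (φ μ) i∈))
        (subst (k ≤_) (sym (∣preimage∣ μ A⊑)) kA)
        (subst (λ Z → k ≤ ∣ Z ∣) (sym (preimage-─ μ p d)) (subst (k ≤_) (sym (∣preimage∣ μ B⊑)) kB)))
      (rank-model μ) (rank-preimage μ A⊑)
      (trans (cong (λ Z → r N Z + ρ W) (preimage-─ μ p d)) (rank-preimage μ B⊑))
    where
    A′ = preimage (φ μ) (E N) A
    A⊑ : A ⊑ I
    A⊑ = set= (A ∷ B ∷ I ∷ []) (v0 || v1 == v2 ∷ []) (v0 || v2) v2 refl (p ∷ [])
    B⊑ : B ⊑ I
    B⊑ = set= (A ∷ B ∷ I ∷ []) (v0 || v1 == v2 ∷ []) (v1 || v2) v2 refl (p ∷ [])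
    combine : ∀ {a b c w i x y} → a + k ≤ b + c → a + w ≡ i → b + w ≡ x → c + w ≡ y → i + w + k ≤ x + y
    combine {a} {b} {c} {w} {i} {x} {y} p q s t = prove≤ [] (a ∷ k ∷ b ∷ c ∷ w ∷ i ∷ x ∷ y ∷ []) [] (nv 0 ⊕ nv 1 <= nv 2 ⊕ nv 3 ∷ nv 5 <= nv 0 ⊕ nv 4 ∷
      nv 2 ⊕ nv 4 <= nv 6 ∷ nv 3 ⊕ nv 4 <= nv 7 ∷ []) [] ((nv 5 ⊕ nv 4) ⊕ nv 1) (nv 6 ⊕ nv 7) refl [] (p ∷
      ≤-reflexive (sym q) ∷ ≤-reflexive s ∷ ≤-reflexive t ∷ [])

  model-size : ∀ {I W} → Model I W → 4 ≤ ∣ I ∣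
  model-size μ = subst (4 ≤_) (sym (∣model∣ μ)) N-size

  -- Passing to a minor cannot raise connectivity, so (X , Y) induces a partition of N of
  -- connectivity at most one. As N is 3-connected, one of its sides has at most one element.
  one-side : ∀ {I W X Y C₀} → Model I W → X ∩ Y ≡ ⊥ → I ⊑ X ∪ Y → W ⊑ (X ∪ Y) ∪ C₀ → C₀ ⊑ W →
    ρ (X ∪ C₀) + ρ (Y ∪ C₀) ≤ ρ ((X ∪ Y) ∪ C₀) + ρ C₀ + 1 → ∣ X ∩ I ∣ ≤ 1 ⊎ ∣ Y ∩ I ∣ ≤ 1
  one-side {I} {W} {X} {Y} {C₀} μ XY I⊑ W⊑ C₀⊑ sep with 2 ≤? ∣ X ∩ I ∣ | 2 ≤? ∣ Y ∩ I ∣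
  ... | no p  | _     = inj₁ (≤-pred (≰⇒> p))
  ... | yes _ | no p  = inj₂ (≤-pred (≰⇒> p))
  ... | yes p | yes q = contradiction
      (connected μ {X ∩ I} {Y ∩ I} (set= (I ∷ X ∷ Y ∷ []) (v0 <: v1 || v2 ∷ []) ((v1 && v0) || (v2 && v0)) v0 refl (I⊑ ∷ [])) (set= (X ∷ Y ∷ I ∷ []) (v0 && v1 == ∅ ∷ []) ((v0 && v2) && (v1 && v2)) ∅ refl (XY ∷ [])) 2 (s≤s z≤n) ≤-refl p q)
    where
    contradiction : ρ (I ∪ W) + ρ W + 2 ≤ ρ ((X ∩ I) ∪ W) + ρ ((Y ∩ I) ∪ W) → _
    contradiction c = absurd (refute (I ∷ W ∷ X ∷ Y ∷ C₀ ∷ []) [] (v4 <: v1 ∷ v1 <: (v2 || v3) || v4 ∷ v0 <: v2 || v3 ∷ [])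
      ((rank (v0 || v1) ⊕ rank v1) ⊕ con 2 <= rank ((v2 && v0) || v1) ⊕ rank ((v3 && v0) || v1) ∷
      rank (v2 || v4) ⊕ rank (v3 || v4) <= (rank ((v2 || v3) || v4) ⊕ rank v4) ⊕ con 1 ∷ [])
      (sub (v0 || v1) (v2 || v4) ∷ sub v1 ((v0 || v1) && (v2 || v4)) ∷ sub (v3 || v4) (v1 && (v2 || v4)) ∷
      sub (v2 || ((v3 && v0) || v1)) (v1 || (v3 || v4)) ∷ mono v4 ((v2 || v4) && ((v1 && v3) || v4)) ∷
      mono ((v3 && v0) || v1) (v1 || ((v3 || v4) && (v2 || ((v3 && v0) || v1)))) ∷ []) refl (C₀⊑ ∷ W⊑ ∷ I⊑ ∷
      []) (c ∷ sep ∷ []))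

  module TwoSeparation {X Y C₀ : Subset n} (XY : X ∩ Y ≡ ⊥)
      (sep : ρ (X ∪ C₀) + ρ (Y ∪ C₀) ≤ ρ ((X ∪ Y) ∪ C₀) + ρ C₀ + 1) where

    -- The local connectivity of P and Y in the contraction by C₀ is zero, respectively at least
    -- one. For P inside X the separation bounds it by one, so these are the only two ways in which
    -- P can act on Y.
    Neutral Full : Subset n → Set
    Neutral P = ρ (P ∪ C₀) + ρ (Y ∪ C₀) ≤ ρ ((P ∪ Y) ∪ C₀) + ρ C₀
    Full P    = ρ ((P ∪ Y) ∪ C₀) + ρ C₀ + 1 ≤ ρ (P ∪ C₀) + ρ (Y ∪ C₀)

    -- A full P acts on Y as all of X does. Hence contracting P gives a subset Q of Y the least rank
    -- that contracting any P′ inside X can give it.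
    exchange-full : ∀ {P P′ Q} → P ⊑ X → P′ ⊑ X → Q ⊑ Y →
      ρ ((P ∪ Y) ∪ C₀) + ρ C₀ + 1 ≤ ρ (P ∪ C₀) + ρ (Y ∪ C₀) →
      ρ ((P ∪ Q) ∪ C₀) + ρ (P′ ∪ C₀) ≤ ρ ((P′ ∪ Q) ∪ C₀) + ρ (P ∪ C₀)
    exchange-full {P} {P′} {Q} P⊑ P′⊑ Q⊑ f = prove≤ (P ∷ Q ∷ C₀ ∷ X ∷ P′ ∷ []) [] []
      (rank ((v0 || v1) || v2) ⊕ rank (v3 || v2) <= rank ((v3 || v1) || v2) ⊕ rank (v0 || v2) ∷
      rank ((v3 || v1) || v2) ⊕ rank (v4 || v2) <= rank ((v4 || v1) || v2) ⊕ rank (v3 || v2) ∷ []) []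
      (rank ((v0 || v1) || v2) ⊕ rank (v4 || v2)) (rank ((v4 || v1) || v2) ⊕ rank (v0 || v2)) refl []
      (through-X ∷ back ∷ [])
      where
      through-X : ρ ((P ∪ Q) ∪ C₀) + ρ (X ∪ C₀) ≤ ρ ((X ∪ Q) ∪ C₀) + ρ (P ∪ C₀)
      through-X = prove≤ (X ∷ C₀ ∷ Y ∷ P ∷ Q ∷ []) [] (v0 && v2 == ∅ ∷ v3 <: v0 ∷ v4 <: v2 ∷ [])
        (rank (v0 || v1) ⊕ rank (v2 || v1) <= (rank ((v0 || v2) || v1) ⊕ rank v1) ⊕ con 1 ∷
        (rank ((v3 || v2) || v1) ⊕ rank v1) ⊕ con 1 <= rank (v3 || v1) ⊕ rank (v2 || v1) ∷ [])
        (sub ((v0 || v4) || v1) ((v3 || v2) || v1) ∷ []) (rank ((v3 || v4) || v1) ⊕ rank (v0 || v1))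
        (rank ((v0 || v4) || v1) ⊕ rank (v3 || v1)) refl (XY ∷ P⊑ ∷ Q⊑ ∷ []) (sep ∷ f ∷ [])
      back : ρ ((X ∪ Q) ∪ C₀) + ρ (P′ ∪ C₀) ≤ ρ ((P′ ∪ Q) ∪ C₀) + ρ (X ∪ C₀)
      back = prove≤ (X ∷ Y ∷ P′ ∷ Q ∷ C₀ ∷ []) [] (v0 && v1 == ∅ ∷ v2 <: v0 ∷ v3 <: v1 ∷ []) []
        (sub ((v2 || v3) || v4) (v0 || v4) ∷ []) (rank ((v0 || v3) || v4) ⊕ rank (v2 || v4))
        (rank ((v2 || v3) || v4) ⊕ rank (v0 || v4)) refl (XY ∷ P′⊑ ∷ Q⊑ ∷ []) []

    -- Contracting a neutral P′ leaves the rank of every Q inside Y unchanged, and that is the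
    -- largest value that contracting any P can give.
    exchange-neutral : ∀ {P P′ Q} → P ⊑ X → P′ ⊑ X → Q ⊑ Y →
      ρ (P′ ∪ C₀) + ρ (Y ∪ C₀) ≤ ρ ((P′ ∪ Y) ∪ C₀) + ρ C₀ →
      ρ ((P ∪ Q) ∪ C₀) + ρ (P′ ∪ C₀) ≤ ρ ((P′ ∪ Q) ∪ C₀) + ρ (P ∪ C₀)
    exchange-neutral {P} {P′} {Q} P⊑ P′⊑ Q⊑ f = prove≤ (P ∷ Q ∷ C₀ ∷ P′ ∷ []) [] []
      (rank ((v0 || v1) || v2) ⊕ rank v2 <= rank (v0 || v2) ⊕ rank (v1 || v2) ∷
      rank (v3 || v2) ⊕ rank (v1 || v2) <= rank ((v3 || v1) || v2) ⊕ rank v2 ∷ []) []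
      (rank ((v0 || v1) || v2) ⊕ rank (v3 || v2)) (rank ((v3 || v1) || v2) ⊕ rank (v0 || v2)) refl []
      (upper ∷ lower ∷ [])
      where
      upper : ρ ((P ∪ Q) ∪ C₀) + ρ C₀ ≤ ρ (P ∪ C₀) + ρ (Q ∪ C₀)
      upper = prove≤ (P ∷ Q ∷ C₀ ∷ []) [] [] [] (sub (v0 || v2) (v1 || v2) ∷ mono v2 ((v0 || v2) && (v1 || v2)) ∷
        []) (rank ((v0 || v1) || v2) ⊕ rank v2) (rank (v0 || v2) ⊕ rank (v1 || v2)) refl [] []
      lower : ρ (P′ ∪ C₀) + ρ (Q ∪ C₀) ≤ ρ ((P′ ∪ Q) ∪ C₀) + ρ C₀
      lower = prove≤ (X ∷ Y ∷ P′ ∷ Q ∷ C₀ ∷ []) [] (v0 && v1 == ∅ ∷ v2 <: v0 ∷ v3 <: v1 ∷ [])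
        (rank (v2 || v4) ⊕ rank (v1 || v4) <= rank ((v2 || v1) || v4) ⊕ rank v4 ∷ [])
        (sub ((v2 || v3) || v4) (v1 || v4) ∷ []) (rank (v2 || v4) ⊕ rank (v3 || v4))
        (rank ((v2 || v3) || v4) ⊕ rank v4) refl (XY ∷ P′⊑ ∷ Q⊑ ∷ []) (f ∷ [])

    neutral-or-full : ∀ P → Neutral P ⊎ Full P
    neutral-or-full P with ρ (P ∪ C₀) + ρ (Y ∪ C₀) ≤? ρ ((P ∪ Y) ∪ C₀) + ρ C₀
    ... | yes p = inj₁ p
    ... | no p  = inj₂ (prove≤ (P ∷ Y ∷ C₀ ∷ []) [] []
      (con 1 ⊕ rank ((v0 || v1) || v2) ⊕ rank v2 <= rank (v0 || v2) ⊕ rank (v1 || v2) ∷ []) []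
      ((rank ((v0 || v1) || v2) ⊕ rank v2) ⊕ con 1) (rank (v0 || v2) ⊕ rank (v1 || v2)) refl [] (≰⇒> p ∷
      []))

    -- If N lies on the side of Y up to one element, X can be replaced by any
    -- element f that represents the basepoint of the 2-separation.
    survives : ∀ {I W C f} → Model I W → I ⊑ X ∪ Y → W ⊑ (X ∪ Y) ∪ C₀ → C₀ ⊑ W → ∣ X ∩ I ∣ ≤ 1 →
      C ⊑ X → ⁅ f ⁆ ⊑ X → Neutral C → ρ (C ∪ C₀) + 1 ≤ ρ ((⁅ f ⁆ ∪ C) ∪ C₀) →
      ρ (((⁅ f ⁆ ∪ C) ∪ Y) ∪ C₀) ≤ ρ ((C ∪ Y) ∪ C₀) →
      ∃[ I′ ] ∃[ W′ ] Model I′ W′ × C₀ ∪ C ⊑ W′ × I′ ∪ W′ ⊑ ((C₀ ∪ C) ∪ ⁅ f ⁆) ∪ Y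
    survives {I} {W} {C} {f} μ I⊑ W⊑ C₀⊑ one C⊑ f⊑ C-neutral f-new f-spanned =
      go (≤1⇒≡⊥⊎≡⁅⁆ one) (neutral-or-full (W ∩ X))
      where
      dis : I ∩ W ≡ ⊥
      dis = disjoint μ
      U⊑ : W ∩ X ⊑ X
      U⊑ = set= (W ∷ X ∷ []) [] ((v0 && v1) || v1) v1 refl []
      fC⊑ : ⁅ f ⁆ ∪ C ⊑ X
      fC⊑ = set= (C ∷ X ∷ ⁅ f ⁆ ∷ []) (v0 <: v1 ∷ v2 <: v1 ∷ []) ((v2 || v0) || v1) v1 refl (C⊑ ∷ f⊑ ∷ [])
      -- C has no connectivity with Y but f ∪ C has: once C is contracted, f represents the
      -- basepoint of the 2-sum.
      fC-full : Full (⁅ f ⁆ ∪ C)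
      fC-full = prove≤ (C ∷ C₀ ∷ Y ∷ ⁅ f ⁆ ∷ []) [] [] (rank (v0 || v1) ⊕ con 1 <= rank ((v3 || v0) || v1) ∷
        rank (((v3 || v0) || v2) || v1) <= rank ((v0 || v2) || v1) ∷ []) (sub (v2 || v1) (v0 || v1) ∷
        mono v1 ((v2 || v1) && (v0 || v1)) ∷ []) ((rank (((v3 || v0) || v2) || v1) ⊕ rank v1) ⊕ con 1)
        (rank ((v3 || v0) || v1) ⊕ rank (v2 || v1)) refl [] (f-new ∷ f-spanned ∷ [])
      f∉C₀C : ⁅ f ⁆ ∩ (C₀ ∪ C) ≡ ⊥
      f∉C₀C with inside? f (C₀ ∪ C)
      ... | inj₂ p = p
      ... | inj₁ p = absurd (refute (⁅ f ⁆ ∷ C₀ ∷ C ∷ []) [] (v0 <: v1 || v2 ∷ [])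
        (rank (v2 || v1) ⊕ con 1 <= rank ((v0 || v2) || v1) ∷ []) [] refl (p ∷ []) (f-new ∷ []))
      Result : Set
      Result = ∃[ I′ ] ∃[ W′ ] Model I′ W′ × C₀ ∪ C ⊑ W′ × I′ ∪ W′ ⊑ ((C₀ ∪ C) ∪ ⁅ f ⁆) ∪ Y
      -- Two neutral sets act on Y in the same way, namely not at all, so the exchange holds in both
      -- directions and inequalities become an equality. The same scheme serves for two full sets.
      neutral-swap : Neutral (W ∩ X) → ∀ Z → Z ⊑ Y →
        ρ (Z ∪ (C₀ ∪ C) ∪ (W ∩ Y)) + ρ W ≡ ρ (Z ∪ W) + ρ ((C₀ ∪ C) ∪ (W ∩ Y))
      neutral-swap u Z Z⊑ = ≤-antisym (prove≤ (C ∷ Z ∷ W ∷ Y ∷ C₀ ∷ X ∷ []) [] (v2 <: (v5 || v3) || v4 ∷ v4 <: v2 ∷ [])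
        (rank ((v0 || (v1 || (v2 && v3))) || v4) ⊕ rank ((v2 && v5) || v4) <= rank (((v2 && v5) || (v1 || (v2 && v3))) || v4) ⊕ rank (v0 || v4) ∷
        rank (((v2 && v5) || (v2 && v3)) || v4) ⊕ rank (v0 || v4) <= rank ((v0 || (v2 && v3)) || v4) ⊕ rank ((v2 && v5) || v4) ∷
        []) [] (rank (v1 || ((v4 || v0) || (v2 && v3))) ⊕ rank v2)
        (rank (v1 || v2) ⊕ rank ((v4 || v0) || (v2 && v3))) refl (W⊑ ∷ C₀⊑ ∷ []) (a ∷ b₀ ∷ []))
        (prove≤ (C ∷ Z ∷ W ∷ Y ∷ C₀ ∷ X ∷ []) [] (v2 <: (v5 || v3) || v4 ∷ v4 <: v2 ∷ [])
        (rank (((v2 && v5) || (v1 || (v2 && v3))) || v4) ⊕ rank (v0 || v4) <= rank ((v0 || (v1 || (v2 && v3))) || v4) ⊕ rank ((v2 && v5) || v4) ∷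
        rank ((v0 || (v2 && v3)) || v4) ⊕ rank ((v2 && v5) || v4) <= rank (((v2 && v5) || (v2 && v3)) || v4) ⊕ rank (v0 || v4) ∷
        []) [] (rank (v1 || v2) ⊕ rank ((v4 || v0) || (v2 && v3)))
        (rank (v1 || ((v4 || v0) || (v2 && v3))) ⊕ rank v2) refl (W⊑ ∷ C₀⊑ ∷ []) (b ∷ a₀ ∷ []))
        where
        ZV⊑ : Z ∪ (W ∩ Y) ⊑ Y
        ZV⊑ = set= (Z ∷ Y ∷ W ∷ []) (v0 <: v1 ∷ []) ((v0 || (v2 && v1)) || v1) v1 refl (Z⊑ ∷ [])
        V⊑ : W ∩ Y ⊑ Y
        V⊑ = set= (W ∷ Y ∷ []) [] ((v0 && v1) || v1) v1 refl []
        a = exchange-neutral C⊑ U⊑ ZV⊑ u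
        b = exchange-neutral U⊑ C⊑ ZV⊑ C-neutral
        a₀ = exchange-neutral C⊑ U⊑ V⊑ u
        b₀ = exchange-neutral U⊑ C⊑ V⊑ C-neutral
      full-swap : Full (W ∩ X) → ∀ Z → Z ⊑ Y →
        ρ (Z ∪ ((C₀ ∪ C) ∪ ⁅ f ⁆) ∪ (W ∩ Y)) + ρ W ≡ ρ (Z ∪ W) + ρ (((C₀ ∪ C) ∪ ⁅ f ⁆) ∪ (W ∩ Y))
      full-swap u Z Z⊑ = ≤-antisym (prove≤ (⁅ f ⁆ ∷ C ∷ Z ∷ W ∷ Y ∷ C₀ ∷ X ∷ []) [] (v3 <: (v6 || v4) || v5 ∷ v5 <: v3 ∷ [])
        (rank (((v0 || v1) || (v2 || (v3 && v4))) || v5) ⊕ rank ((v3 && v6) || v5) <= rank (((v3 && v6) || (v2 || (v3 && v4))) || v5) ⊕ rank ((v0 || v1) || v5) ∷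
        rank (((v3 && v6) || (v3 && v4)) || v5) ⊕ rank ((v0 || v1) || v5) <= rank (((v0 || v1) || (v3 && v4)) || v5) ⊕ rank ((v3 && v6) || v5) ∷
        []) [] (rank (v2 || (((v5 || v1) || v0) || (v3 && v4))) ⊕ rank v3)
        (rank (v2 || v3) ⊕ rank (((v5 || v1) || v0) || (v3 && v4))) refl (W⊑ ∷ C₀⊑ ∷ []) (a ∷ b₀ ∷ []))
        (prove≤ (⁅ f ⁆ ∷ C ∷ Z ∷ W ∷ Y ∷ C₀ ∷ X ∷ []) [] (v3 <: (v6 || v4) || v5 ∷ v5 <: v3 ∷ [])
        (rank (((v3 && v6) || (v2 || (v3 && v4))) || v5) ⊕ rank ((v0 || v1) || v5) <= rank (((v0 || v1) || (v2 || (v3 && v4))) || v5) ⊕ rank ((v3 && v6) || v5) ∷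
        rank (((v0 || v1) || (v3 && v4)) || v5) ⊕ rank ((v3 && v6) || v5) <= rank (((v3 && v6) || (v3 && v4)) || v5) ⊕ rank ((v0 || v1) || v5) ∷
        []) [] (rank (v2 || v3) ⊕ rank (((v5 || v1) || v0) || (v3 && v4)))
        (rank (v2 || (((v5 || v1) || v0) || (v3 && v4))) ⊕ rank v3) refl (W⊑ ∷ C₀⊑ ∷ []) (b ∷ a₀ ∷ []))
        where
        ZV⊑ : Z ∪ (W ∩ Y) ⊑ Y
        ZV⊑ = set= (Z ∷ Y ∷ W ∷ []) (v0 <: v1 ∷ []) ((v0 || (v2 && v1)) || v1) v1 refl (Z⊑ ∷ [])
        V⊑ : W ∩ Y ⊑ Y
        V⊑ = set= (W ∷ Y ∷ []) [] ((v0 && v1) || v1) v1 refl []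
        a = exchange-full fC⊑ U⊑ ZV⊑ fC-full
        b = exchange-full U⊑ fC⊑ ZV⊑ u
        a₀ = exchange-full fC⊑ U⊑ V⊑ fC-full
        b₀ = exchange-full U⊑ fC⊑ V⊑ u
      -- An element of N lying in X as a loop or coloop would be a separator of N.
      no-separator : ∀ {g} → X ∩ I ≡ ⁅ g ⁆ → ρ (I ∪ W) + ρ W + 1 ≤ ρ (⁅ g ⁆ ∪ W) + ρ ((I ─ ⁅ g ⁆) ∪ W)
      no-separator {g} p = connected μ {⁅ g ⁆} {I ─ ⁅ g ⁆} (set= (X ∷ I ∷ ⁅ g ⁆ ∷ []) (v0 && v1 == v2 ∷ []) (v2 || (v1 - v2)) v1 refl (p ∷ [])) (set= (⁅ g ⁆ ∷ I ∷ []) [] (v0 && (v1 - v0)) ∅ refl []) 1 ≤-refl (s≤s z≤n)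
        (prove≤ (⁅ g ⁆ ∷ []) [] [] (con 1 <= card v0 ∷ []) [] (con 1) (card v0) refl [] (1≤∣⁅ g ⁆∣ ∷ [])) (big p (model-size μ))
        where
        big : X ∩ I ≡ ⁅ g ⁆ → 4 ≤ ∣ I ∣ → 1 ≤ ∣ I ─ ⁅ g ⁆ ∣
        big p q = prove≤ (I ∷ ⁅ g ⁆ ∷ []) [] [] (con 4 <= card v0 ∷ card v1 <= con 1 ∷ []) (csub (v0 - v1) v1 ∷
          cmono v0 ((v0 - v1) || v1) ∷ []) (con 1) (card (v0 - v1)) refl [] (q ∷ ∣⁅ g ⁆∣≤1 ∷ [])
      go : X ∩ I ≡ ⊥ ⊎ ∃[ g ] X ∩ I ≡ ⁅ g ⁆ → Neutral (W ∩ X) ⊎ Full (W ∩ X) → Result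
      -- N avoids X. If the part of W in X is neutral, contracting C has the same effect on Y, and f
      -- is deleted.
      go (inj₁ p) (inj₁ u) = I , (C₀ ∪ C) ∪ (W ∩ Y) ,
        recontract _ μ (set= (X ∷ I ∷ W ∷ C ∷ C₀ ∷ Y ∷ []) (v0 && v1 == ∅ ∷ v1 && v2 == ∅ ∷ v3 <: v0 ∷ v4 <: v2 ∷ [])
          (v1 && ((v4 || v3) || (v2 && v5))) ∅ refl (p ∷ dis ∷ C⊑ ∷ C₀⊑ ∷ [])) (λ Z Z⊑ → neutral-swap u Z (set= (X ∷ I ∷ Z ∷ Y ∷ []) (v0 && v1 == ∅ ∷ v2 <: v1 ∷ v1 <: v0 || v3 ∷ []) (v2 || v3) v3 refl
          (p ∷ Z⊑ ∷ I⊑ ∷ []))) ,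
        (set= (C₀ ∷ C ∷ W ∷ Y ∷ []) [] ((v0 || v1) || ((v0 || v1) || (v2 && v3)))
          ((v0 || v1) || (v2 && v3)) refl []) , (set= (X ∷ I ∷ Y ∷ C₀ ∷ C ∷ W ∷ ⁅ f ⁆ ∷ []) (v0 && v1 == ∅ ∷ v1 <: v0 || v2 ∷ [])
          ((v1 || ((v3 || v4) || (v5 && v2))) || (((v3 || v4) || v6) || v2)) (((v3 || v4) || v6) || v2) refl
          (p ∷ I⊑ ∷ []))
      -- Here the part of W in X contracts the basepoint, so f has to be contracted along with C.
      go (inj₁ p) (inj₂ u) = I , ((C₀ ∪ C) ∪ ⁅ f ⁆) ∪ (W ∩ Y) ,
        recontract _ μ (set= (X ∷ I ∷ W ∷ C ∷ ⁅ f ⁆ ∷ C₀ ∷ Y ∷ []) (v0 && v1 == ∅ ∷ v1 && v2 == ∅ ∷ v3 <: v0 ∷ v4 <: v0 ∷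
          v5 <: v2 ∷ []) (v1 && (((v5 || v3) || v4) || (v2 && v6))) ∅ refl (p ∷ dis ∷ C⊑ ∷ f⊑ ∷ C₀⊑ ∷ [])) (λ Z Z⊑ → full-swap u Z (set= (X ∷ I ∷ Z ∷ Y ∷ []) (v0 && v1 == ∅ ∷ v2 <: v1 ∷ v1 <: v0 || v3 ∷ []) (v2 || v3) v3 refl
          (p ∷ Z⊑ ∷ I⊑ ∷ []))) ,
        (set= (C₀ ∷ C ∷ ⁅ f ⁆ ∷ W ∷ Y ∷ []) [] ((v0 || v1) || (((v0 || v1) || v2) || (v3 && v4)))
          (((v0 || v1) || v2) || (v3 && v4)) refl []) , (set= (X ∷ I ∷ Y ∷ C₀ ∷ C ∷ ⁅ f ⁆ ∷ W ∷ []) (v0 && v1 == ∅ ∷ v1 <: v0 || v2 ∷ [])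
          ((v1 || (((v3 || v4) || v5) || (v6 && v2))) || (((v3 || v4) || v5) || v2))
          (((v3 || v4) || v5) || v2) refl (p ∷ I⊑ ∷ []))
      -- The basepoint is already contracted by W, so g no longer interacts with Y and would be
      -- separated from the rest of N.
      go (inj₂ (g , p)) (inj₂ u) = absurd (sep-g (no-separator p))
        where
        gU⊑ : ⁅ g ⁆ ∪ (W ∩ X) ⊑ X
        gU⊑ = set= (X ∷ I ∷ ⁅ g ⁆ ∷ W ∷ []) (v0 && v1 == v2 ∷ []) ((v2 || (v3 && v0)) || v0) v0 refl (p ∷ [])
        Q⊑ : (I ─ ⁅ g ⁆) ∪ (W ∩ Y) ⊑ Y
        Q⊑ = set= (X ∷ I ∷ ⁅ g ⁆ ∷ Y ∷ W ∷ []) (v0 && v1 == v2 ∷ v1 <: v0 || v3 ∷ [])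
          (((v1 - v2) || (v4 && v3)) || v3) v3 refl (p ∷ I⊑ ∷ [])
        b = exchange-full U⊑ gU⊑ Q⊑ u
        sep-g : ρ (I ∪ W) + ρ W + 1 ≤ ρ (⁅ g ⁆ ∪ W) + ρ ((I ─ ⁅ g ⁆) ∪ W) → Absurd
        sep-g c = (refute (I ∷ W ∷ ⁅ g ⁆ ∷ X ∷ Y ∷ C₀ ∷ []) [] (v3 && v0 == v2 ∷ v1 <: (v3 || v4) || v5 ∷ v5 <: v1 ∷
          []) ((rank (v0 || v1) ⊕ rank v1) ⊕ con 1 <= rank (v2 || v1) ⊕ rank ((v0 - v2) || v1) ∷
          rank (((v1 && v3) || ((v0 - v2) || (v1 && v4))) || v5) ⊕ rank ((v2 || (v1 && v3)) || v5) <= rank (((v2 || (v1 && v3)) || ((v0 - v2) || (v1 && v4))) || v5) ⊕ rank ((v1 && v3) || v5) ∷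
          []) (sub v1 ((v2 || (v1 && v3)) || v5) ∷ []) refl (p ∷ W⊑ ∷ C₀⊑ ∷ []) (c ∷ b ∷ []))
      go (inj₂ (g , p)) (inj₁ u) with neutral-or-full (⁅ g ⁆ ∪ (W ∩ X))
      -- If W ∩ X stays neutral after g is added, then g does not interact with Y either.
      ... | inj₁ w = absurd (sep-g (no-separator p))
        where
        gU⊑ : ⁅ g ⁆ ∪ (W ∩ X) ⊑ X
        gU⊑ = set= (X ∷ I ∷ ⁅ g ⁆ ∷ W ∷ []) (v0 && v1 == v2 ∷ []) ((v2 || (v3 && v0)) || v0) v0 refl (p ∷ [])
        Q⊑ : (I ─ ⁅ g ⁆) ∪ (W ∩ Y) ⊑ Y
        Q⊑ = set= (X ∷ I ∷ ⁅ g ⁆ ∷ Y ∷ W ∷ []) (v0 && v1 == v2 ∷ v1 <: v0 || v3 ∷ [])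
          (((v1 - v2) || (v4 && v3)) || v3) v3 refl (p ∷ I⊑ ∷ [])
        b = exchange-neutral U⊑ gU⊑ Q⊑ w
        sep-g : ρ (I ∪ W) + ρ W + 1 ≤ ρ (⁅ g ⁆ ∪ W) + ρ ((I ─ ⁅ g ⁆) ∪ W) → Absurd
        sep-g c = (refute (I ∷ W ∷ ⁅ g ⁆ ∷ X ∷ Y ∷ C₀ ∷ []) [] (v3 && v0 == v2 ∷ v1 <: (v3 || v4) || v5 ∷ v5 <: v1 ∷
          []) ((rank (v0 || v1) ⊕ rank v1) ⊕ con 1 <= rank (v2 || v1) ⊕ rank ((v0 - v2) || v1) ∷
          rank (((v1 && v3) || ((v0 - v2) || (v1 && v4))) || v5) ⊕ rank ((v2 || (v1 && v3)) || v5) <= rank (((v2 || (v1 && v3)) || ((v0 - v2) || (v1 && v4))) || v5) ⊕ rank ((v1 && v3) || v5) ∷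
          []) (sub v1 ((v2 || (v1 && v3)) || v5) ∷ []) refl (p ∷ W⊑ ∷ C₀⊑ ∷ []) (c ∷ b ∷ []))
      -- In N the element g represents the basepoint, and f does so once C is contracted: f takes
      -- the place of g.
      ... | inj₂ w = (I ─ ⁅ g ⁆) ∪ ⁅ f ⁆ , (C₀ ∪ C) ∪ (W ∩ Y) ,
        relabel g f μ (set= (X ∷ I ∷ ⁅ g ⁆ ∷ ⁅ f ⁆ ∷ []) (v0 && v1 == v2 ∷ v3 <: v0 ∷ []) (v3 && (v1 - v2)) ∅ refl (p ∷
          f⊑ ∷ [])) (set= (X ∷ I ∷ ⁅ g ⁆ ∷ []) (v0 && v1 == v2 ∷ []) (v2 || v1) v1 refl (p ∷ [])) (set= (X ∷ I ∷ ⁅ g ⁆ ∷ W ∷ C ∷ C₀ ∷ ⁅ f ⁆ ∷ Y ∷ []) (v0 && v1 == v2 ∷ v1 && v3 == ∅ ∷ v4 <: v0 ∷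
          v5 <: v3 ∷ v6 <: v0 ∷ v6 && (v5 || v4) == ∅ ∷ v0 && v7 == ∅ ∷ [])
          (((v1 - v2) || v6) && ((v5 || v4) || (v3 && v7))) ∅ refl (p ∷ dis ∷ C⊑ ∷ C₀⊑ ∷ f⊑ ∷ f∉C₀C ∷ XY ∷
          []))
          (λ Z Z⊑ g∉ → neutral-swap u Z (set= (X ∷ I ∷ ⁅ g ⁆ ∷ Z ∷ Y ∷ []) (v0 && v1 == v2 ∷ v3 <: v1 ∷ v2 && v3 == ∅ ∷ v1 <: v0 || v4 ∷
            []) (v3 || v4) v4 refl (p ∷ Z⊑ ∷ g∉ ∷ I⊑ ∷ [])))
          (λ Z Z⊑ g∉ → moved Z (set= (X ∷ I ∷ ⁅ g ⁆ ∷ Z ∷ Y ∷ []) (v0 && v1 == v2 ∷ v3 <: v1 ∷ v2 && v3 == ∅ ∷ v1 <: v0 || v4 ∷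
            []) (v3 || v4) v4 refl (p ∷ Z⊑ ∷ g∉ ∷ I⊑ ∷ []))) ,
        (set= (C₀ ∷ C ∷ W ∷ Y ∷ []) [] ((v0 || v1) || ((v0 || v1) || (v2 && v3)))
          ((v0 || v1) || (v2 && v3)) refl []) , (set= (X ∷ I ∷ ⁅ g ⁆ ∷ Y ∷ ⁅ f ⁆ ∷ C₀ ∷ C ∷ W ∷ []) (v0 && v1 == v2 ∷ v1 <: v0 || v3 ∷ [])
          ((((v1 - v2) || v4) || ((v5 || v6) || (v7 && v3))) || (((v5 || v6) || v4) || v3))
          (((v5 || v6) || v4) || v3) refl (p ∷ I⊑ ∷ []))
        where
        gU⊑ : ⁅ g ⁆ ∪ (W ∩ X) ⊑ X
        gU⊑ = set= (X ∷ I ∷ ⁅ g ⁆ ∷ W ∷ []) (v0 && v1 == v2 ∷ []) ((v2 || (v3 && v0)) || v0) v0 refl (p ∷ [])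
        -- The full sets g ∪ (W ∩ X) and f ∪ C are exchanged on one side, the neutral sets W ∩ X and
        -- C on the other; g and f each raise the rank of their neutral set by exactly one, so the
        -- two shifts agree.
        moved : ∀ Z → Z ⊑ Y → ρ ((Z ∪ ⁅ f ⁆) ∪ (C₀ ∪ C) ∪ (W ∩ Y)) + ρ W ≡ ρ ((Z ∪ ⁅ g ⁆) ∪ W) + ρ ((C₀ ∪ C) ∪ (W ∩ Y))
        moved Z Z⊑ = ≤-antisym (prove≤ (⁅ f ⁆ ∷ C ∷ Z ∷ W ∷ Y ∷ C₀ ∷ ⁅ g ⁆ ∷ X ∷ []) [] (v3 <: (v7 || v4) || v5 ∷ v5 <: v3 ∷ [])
          (rank (((v0 || v1) || (v2 || (v3 && v4))) || v5) ⊕ rank ((v6 || (v3 && v7)) || v5) <= rank (((v6 || (v3 && v7)) || (v2 || (v3 && v4))) || v5) ⊕ rank ((v0 || v1) || v5) ∷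
          rank (((v3 && v7) || (v3 && v4)) || v5) ⊕ rank (v1 || v5) <= rank ((v1 || (v3 && v4)) || v5) ⊕ rank ((v3 && v7) || v5) ∷
          rank ((v0 || v1) || v5) <= rank (v1 || v5) ⊕ con 1 ∷
          rank ((v3 && v7) || v5) ⊕ con 1 <= rank ((v6 || (v3 && v7)) || v5) ∷ []) []
          (rank ((v2 || v0) || ((v5 || v1) || (v3 && v4))) ⊕ rank v3)
          (rank ((v2 || v6) || v3) ⊕ rank ((v5 || v1) || (v3 && v4))) refl (W⊑ ∷ C₀⊑ ∷ []) (a ∷ b₀ ∷ f≤ ∷
          g-new ∷ []))
          (prove≤ (⁅ f ⁆ ∷ C ∷ Z ∷ W ∷ Y ∷ C₀ ∷ ⁅ g ⁆ ∷ X ∷ []) [] (v3 <: (v7 || v4) || v5 ∷ v5 <: v3 ∷ [])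
          (rank (((v6 || (v3 && v7)) || (v2 || (v3 && v4))) || v5) ⊕ rank ((v0 || v1) || v5) <= rank (((v0 || v1) || (v2 || (v3 && v4))) || v5) ⊕ rank ((v6 || (v3 && v7)) || v5) ∷
          rank ((v1 || (v3 && v4)) || v5) ⊕ rank ((v3 && v7) || v5) <= rank (((v3 && v7) || (v3 && v4)) || v5) ⊕ rank (v1 || v5) ∷
          rank (v1 || v5) ⊕ con 1 <= rank ((v0 || v1) || v5) ∷
          rank ((v6 || (v3 && v7)) || v5) <= rank ((v3 && v7) || v5) ⊕ con 1 ∷ []) []
          (rank ((v2 || v6) || v3) ⊕ rank ((v5 || v1) || (v3 && v4)))
          (rank ((v2 || v0) || ((v5 || v1) || (v3 && v4))) ⊕ rank v3) refl (W⊑ ∷ C₀⊑ ∷ []) (b ∷ a₀ ∷ f-new ∷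
          g≤ ∷ []))
          where
          ZV⊑ : Z ∪ (W ∩ Y) ⊑ Y
          ZV⊑ = set= (Z ∷ Y ∷ W ∷ []) (v0 <: v1 ∷ []) ((v0 || (v2 && v1)) || v1) v1 refl (Z⊑ ∷ [])
          V⊑ : W ∩ Y ⊑ Y
          V⊑ = set= (W ∷ Y ∷ []) [] ((v0 && v1) || v1) v1 refl []
          a = exchange-full fC⊑ gU⊑ ZV⊑ fC-full
          b = exchange-full gU⊑ fC⊑ ZV⊑ w
          a₀ = exchange-neutral C⊑ U⊑ V⊑ u
          b₀ = exchange-neutral U⊑ C⊑ V⊑ C-neutral
          f≤ : ρ ((⁅ f ⁆ ∪ C) ∪ C₀) ≤ ρ (C ∪ C₀) + 1
          f≤ = prove≤ (⁅ f ⁆ ∷ C ∷ C₀ ∷ []) [] [] (card v0 <= con 1 ∷ []) (sub (v1 || v2) v0 ∷ rc v0 ∷ [])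
            (rank ((v0 || v1) || v2)) (rank (v1 || v2) ⊕ con 1) refl [] (∣⁅ f ⁆∣≤1 ∷ [])
          g≤ : ρ ((⁅ g ⁆ ∪ (W ∩ X)) ∪ C₀) ≤ ρ ((W ∩ X) ∪ C₀) + 1
          g≤ = prove≤ (⁅ g ⁆ ∷ W ∷ X ∷ C₀ ∷ []) [] [] (card v0 <= con 1 ∷ []) (sub ((v1 && v2) || v3) v0 ∷
            rc v0 ∷ []) (rank ((v0 || (v1 && v2)) || v3)) (rank ((v1 && v2) || v3) ⊕ con 1) refl []
            (∣⁅ g ⁆∣≤1 ∷ [])
          g-new : ρ ((W ∩ X) ∪ C₀) + 1 ≤ ρ ((⁅ g ⁆ ∪ (W ∩ X)) ∪ C₀)
          g-new = prove≤ (W ∷ X ∷ C₀ ∷ Y ∷ ⁅ g ⁆ ∷ []) [] []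
            (rank ((v0 && v1) || v2) ⊕ rank (v3 || v2) <= rank (((v0 && v1) || v3) || v2) ⊕ rank v2 ∷
            (rank (((v4 || (v0 && v1)) || v3) || v2) ⊕ rank v2) ⊕ con 1 <= rank ((v4 || (v0 && v1)) || v2) ⊕ rank (v3 || v2) ∷
            []) (mono (((v0 && v1) || v3) || v2) (((v4 || (v0 && v1)) || v3) || v2) ∷ [])
            (rank ((v0 && v1) || v2) ⊕ con 1) (rank ((v4 || (v0 && v1)) || v2)) refl [] (u ∷ w ∷ [])

    -- Here f and most of the contracted set are found instead of given. B is a basis of S over P ∪
    -- Y, so P ∪ B is still neutral, while S is spanned once Y is added. Since X has connectivity
    -- one with Y and S spans X, some dimension of S is missing from P ∪ B, and f supplies it.
    survives-in : ∀ {I W P S} → Model I W → I ⊑ X ∪ Y → W ⊑ (X ∪ Y) ∪ C₀ → C₀ ⊑ W → ∣ X ∩ I ∣ ≤ 1 →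
      ρ ((X ∪ Y) ∪ C₀) + ρ C₀ + 1 ≤ ρ (X ∪ C₀) + ρ (Y ∪ C₀) →
      P ⊑ S → S ⊑ X → ρ (X ∪ C₀) ≤ ρ (S ∪ C₀) → ρ ((X ∪ Y) ∪ C₀) ≤ ρ ((S ∪ Y) ∪ C₀) → Neutral P →
      ∃[ I′ ] ∃[ W′ ] Model I′ W′ × C₀ ∪ P ⊑ W′ × I′ ∪ W′ ⊑ (C₀ ∪ S) ∪ Y
    survives-in {I} {W} {P} {S} μ I⊑ W⊑ C₀⊑ one X-full P⊑ S⊑ XS XYS P-neutral
      with basis ((P ∪ Y) ∪ C₀) S
    ... | B , B⊑ , b₁ , b₂ = finish (augment ((P ∪ B) ∪ C₀) S rank-C)
      where
      rank-C : ρ ((P ∪ B) ∪ C₀) < ρ (((P ∪ B) ∪ C₀) ∪ S)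
      rank-C = prove≤ (P ∷ Y ∷ C₀ ∷ B ∷ S ∷ X ∷ []) [] (v3 <: v4 ∷ v0 <: v4 ∷ v4 <: v5 ∷ [])
        (rank (((v0 || v1) || v2) || v3) <= rank (((v0 || v1) || v2) || v4) ∷
        rank ((v0 || v1) || v2) ⊕ card v3 <= rank (((v0 || v1) || v2) || v3) ∷
        (rank ((v5 || v1) || v2) ⊕ rank v2) ⊕ con 1 <= rank (v5 || v2) ⊕ rank (v1 || v2) ∷
        rank (v5 || v2) <= rank (v4 || v2) ∷
        rank (v0 || v2) ⊕ rank (v1 || v2) <= rank ((v0 || v1) || v2) ⊕ rank v2 ∷ []) (sub (v0 || v2) v3 ∷
        mono (((v0 || v1) || v2) || v4) ((v5 || v1) || v2) ∷ rc v3 ∷ []) (con 1 ⊕ rank ((v0 || v3) || v2))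
        (rank (((v0 || v3) || v2) || v4)) refl (B⊑ ∷ P⊑ ∷ S⊑ ∷ []) (≤-reflexive b₁ ∷ ≤-reflexive (sym b₂) ∷
        X-full ∷ XS ∷ P-neutral ∷ [])
      C-neutral : Neutral (P ∪ B)
      C-neutral = prove≤ (P ∷ Y ∷ C₀ ∷ B ∷ []) [] []
        (rank ((v0 || v1) || v2) ⊕ card v3 <= rank (((v0 || v1) || v2) || v3) ∷
        rank (v0 || v2) ⊕ rank (v1 || v2) <= rank ((v0 || v1) || v2) ⊕ rank v2 ∷ []) (sub (v0 || v2) v3 ∷
        rc v3 ∷ []) (rank ((v0 || v3) || v2) ⊕ rank (v1 || v2)) (rank (((v0 || v3) || v1) || v2) ⊕ rank v2)
        refl [] (≤-reflexive (sym b₂) ∷ P-neutral ∷ [])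
      finish : ∃[ f ] ⁅ f ⁆ ⊑ S × ρ ((P ∪ B) ∪ C₀) < ρ (((P ∪ B) ∪ C₀) ∪ ⁅ f ⁆) →
        ∃[ I′ ] ∃[ W′ ] Model I′ W′ × C₀ ∪ P ⊑ W′ × I′ ∪ W′ ⊑ (C₀ ∪ S) ∪ Y
      finish (f , f⊑ , f-new) with survives {C = P ∪ B} {f = f} μ I⊑ W⊑ C₀⊑ one (set= (P ∷ S ∷ B ∷ X ∷ []) (v0 <: v1 ∷ v2 <: v1 ∷ v1 <: v3 ∷ []) ((v0 || v2) || v3) v3 refl (P⊑ ∷
        B⊑ ∷ S⊑ ∷ [])) (set= (⁅ f ⁆ ∷ S ∷ X ∷ []) (v0 <: v1 ∷ v1 <: v2 ∷ []) (v0 || v2) v2 refl (f⊑ ∷ S⊑ ∷ []))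
        C-neutral (prove≤ (P ∷ B ∷ C₀ ∷ ⁅ f ⁆ ∷ []) [] []
          (con 1 ⊕ rank ((v0 || v1) || v2) <= rank (((v0 || v1) || v2) || v3) ∷ []) []
          (rank ((v0 || v1) || v2) ⊕ con 1) (rank ((v3 || (v0 || v1)) || v2)) refl [] (f-new ∷ [])) (prove≤ (P ∷ Y ∷ C₀ ∷ B ∷ S ∷ ⁅ f ⁆ ∷ []) [] (v5 <: v4 ∷ v3 <: v4 ∷ [])
          (rank (((v0 || v1) || v2) || v4) <= rank (((v0 || v1) || v2) || v3) ∷ [])
          (mono (((v5 || (v0 || v3)) || v1) || v2) (((v0 || v1) || v2) || v4) ∷ [])
          (rank (((v5 || (v0 || v3)) || v1) || v2)) (rank (((v0 || v3) || v1) || v2)) refl (f⊑ ∷ B⊑ ∷ [])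
          (≤-reflexive (sym b₁) ∷ []))
      ... | I′ , W′ , μ′ , p , q = I′ , W′ , μ′ , (set= (C₀ ∷ P ∷ B ∷ W′ ∷ []) (v0 || (v1 || v2) <: v3 ∷ []) ((v0 || v1) || v3) v3 refl (p ∷ [])) , (set= (I′ ∷ W′ ∷ C₀ ∷ P ∷ B ∷ ⁅ f ⁆ ∷ Y ∷ S ∷ []) (v0 || v1 <: ((v2 || (v3 || v4)) || v5) || v6 ∷
        v3 <: v7 ∷ v4 <: v7 ∷ v5 <: v7 ∷ []) ((v0 || v1) || ((v2 || v7) || v6)) ((v2 || v7) || v6) refl (q ∷
        P⊑ ∷ B⊑ ∷ f⊑ ∷ []))

-- A pair (S , C) stands for the minor with ground set S obtained by contracting C.
Connected₃ : ∀ {n} → RankFn n → Subset n → Subset n → Set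
Connected₃ R S C = ∀ k → 1 ≤ k → k ≤ 2 → ∀ A B → A ∪ B ≡ S → A ∩ B ≡ ⊥ →
  k ≤ ∣ A ∣ → k ≤ ∣ B ∣ → ρ (S ∪ C) + ρ C + k ≤ ρ (A ∪ C) + ρ (B ∪ C)
  where open RankFn R

module HasN {n m : ℕ} (R : RankFn n) (N : Matroid m) where
  open Models R N

  Has : Subset n → Subset n → Set
  Has S C = ∃[ I ] ∃[ W ] Model I W × C ⊑ W × I ⊑ S × W ⊑ S ∪ C

-- Reducing parallel and series pairs in minors that are nearly 3-connected.

module Minimal {n m : ℕ} (R : RankFn n) (N : Matroid m)
    (N-conn : ThreeConnected N) (N-size : 4 ≤ ∣ E N ∣)
    (G T : Subset n) (T⊑G : T ⊑ G)
    (minimal : ∀ S C → S ∩ C ≡ ⊥ → S ∪ C ⊑ G → T ⊑ S → S ≢ G →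
      Connected₃ R S C → HasN.Has R N S C → Absurd) where
  open RankFn R
  open RankSolver R
  open Rank R
  open Models R N
  open Survival R N N-conn N-size
  open HasN R N public

  -- The connectivity of {u , v} with the rest of the minor is at most one. In the absence of
  -- 1-separations this is a parallel or a series pair.
  Pair : Subset n → Subset n → Fin n → Fin n → Set
  Pair S C u v = ρ ((⁅ u ⁆ ∪ ⁅ v ⁆) ∪ C) + ρ ((S ─ (⁅ u ⁆ ∪ ⁅ v ⁆)) ∪ C) ≤ ρ (S ∪ C) + ρ C + 1

  -- What is needed of a parallel or series class. The clause about `T` ensures that a class with
  -- two elements has one that may be removed.
  Clique : Subset n → Subset n → Subset n → Set
  Clique S C A = ∀ u v → ⁅ u ⁆ ⊑ A → ⁅ v ⁆ ⊑ A → ⁅ u ⁆ ∩ ⁅ v ⁆ ≡ ⊥ →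
    Pair S C u v × ¬ (⁅ u ⁆ ⊑ T × ⁅ v ⁆ ⊑ T)

  -- 3-connected up to parallel and series pairs, none of them inside T.
  record NearlyConnected (S C : Subset n) : Set where
    field
      no-1-sep : ∀ A B → A ∪ B ≡ S → A ∩ B ≡ ⊥ →
        ρ (A ∪ C) + ρ (B ∪ C) ≤ ρ (S ∪ C) + ρ C → A ≡ ⊥ ⊎ B ≡ ⊥
      2-seps   : ∀ A B → A ∪ B ≡ S → A ∩ B ≡ ⊥ →
        ρ (A ∪ C) + ρ (B ∪ C) ≤ ρ (S ∪ C) + ρ C + 1 → Clique S C A ⊎ Clique S C B
  open NearlyConnected

  -- The element u is the one to be removed, hence outside `T`; v stays and inherits its role.
  Found : Subset n → Subset n → Set
  Found S C = ∃[ u ] ∃[ v ] ⁅ u ⁆ ⊑ S × ⁅ v ⁆ ⊑ S × ⁅ u ⁆ ∩ ⁅ v ⁆ ≡ ⊥ × ⁅ u ⁆ ∩ T ≡ ⊥ × Pair S C u v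

  found? : ∀ S C → Dec (Found S C)
  found? S C = any? λ u → any? λ v → ((⁅ u ⁆ ∪ S) ≟ˢ S) ×-dec ((⁅ v ⁆ ∪ S) ≟ˢ S) ×-dec
    ((⁅ u ⁆ ∩ ⁅ v ⁆) ≟ˢ ⊥) ×-dec ((⁅ u ⁆ ∩ T) ≟ˢ ⊥) ×-dec (_ ≤? _)

  clique-found : ∀ {S C A} → A ⊑ S → 2 ≤ ∣ A ∣ → Clique S C A → Found S C
  clique-found {S} {C} {A} A⊑ h cl with two-elements h
  ... | u , v , u∈ , v∈ , d with cl u v u∈ v∈ d | inside? u T | inside? v T
  ...   | p , q | inj₂ u∉ | _       = u , v , (set= (⁅ u ⁆ ∷ A ∷ S ∷ []) (v0 <: v1 ∷ v1 <: v2 ∷ []) (v0 || v2) v2 refl (u∈ ∷ A⊑ ∷ [])) , (set= (⁅ v ⁆ ∷ A ∷ S ∷ []) (v0 <: v1 ∷ v1 <: v2 ∷ []) (v0 || v2) v2 refl (v∈ ∷ A⊑ ∷ [])) , d , u∉ , p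
  ...   | p , q | inj₁ u∈T | inj₁ v∈T = absurd (q (u∈T , v∈T))
  ...   | p , q | inj₁ _ | inj₂ v∉  = v , u , (set= (⁅ v ⁆ ∷ A ∷ S ∷ []) (v0 <: v1 ∷ v1 <: v2 ∷ []) (v0 || v2) v2 refl (v∈ ∷ A⊑ ∷ [])) , (set= (⁅ u ⁆ ∷ A ∷ S ∷ []) (v0 <: v1 ∷ v1 <: v2 ∷ []) (v0 || v2) v2 refl (u∈ ∷ A⊑ ∷ [])) , (set= (⁅ u ⁆ ∷ ⁅ v ⁆ ∷ []) (v0 && v1 == ∅ ∷ []) (v1 && v0) ∅ refl (d ∷ [])) , v∉ , (prove≤ (⁅ u ⁆ ∷ ⁅ v ⁆ ∷ C ∷ S ∷ []) [] []
    (rank ((v0 || v1) || v2) ⊕ rank ((v3 - (v0 || v1)) || v2) <= (rank (v3 || v2) ⊕ rank v2) ⊕ con 1 ∷ [])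
    [] (rank ((v1 || v0) || v2) ⊕ rank ((v3 - (v1 || v0)) || v2)) ((rank (v3 || v2) ⊕ rank v2) ⊕ con 1) refl
    [] (p ∷ []))

  -- Without a removable pair a clique has at most one element, too few for the side of a
  -- 2-separation.
  nothing-found : ∀ {S C} → NearlyConnected S C → ¬ Found S C → Connected₃ R S C
  nothing-found {S} {C} near none 1 _ _ A B AB d kA kB
    with ρ (S ∪ C) + ρ C + 1 ≤? ρ (A ∪ C) + ρ (B ∪ C)
  ... | yes p = p
  ... | no p with no-1-sep near A B AB d (prove≤ (A ∷ C ∷ B ∷ S ∷ []) [] []
    (con 1 ⊕ rank (v0 || v1) ⊕ rank (v2 || v1) <= (rank (v3 || v1) ⊕ rank v1) ⊕ con 1 ∷ []) []
    (rank (v0 || v1) ⊕ rank (v2 || v1)) (rank (v3 || v1) ⊕ rank v1) refl [] (≰⇒> p ∷ []))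
  ...   | inj₁ q = absurd (refute (A ∷ []) [] (v0 == ∅ ∷ []) (con 1 <= card v0 ∷ []) (c∅ ∷ []) refl (q ∷ []) (kA ∷ []))
  ...   | inj₂ q = absurd (refute (B ∷ []) [] (v0 == ∅ ∷ []) (con 1 <= card v0 ∷ []) (c∅ ∷ []) refl (q ∷ []) (kB ∷ []))
  nothing-found {S} {C} near none 2 _ _ A B AB d kA kB
    with ρ (S ∪ C) + ρ C + 2 ≤? ρ (A ∪ C) + ρ (B ∪ C)
  ... | yes p = p
  ... | no p with 2-seps near A B AB d (prove≤ (A ∷ C ∷ B ∷ S ∷ []) [] []
    (con 1 ⊕ rank (v0 || v1) ⊕ rank (v2 || v1) <= (rank (v3 || v1) ⊕ rank v1) ⊕ con 2 ∷ []) []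
    (rank (v0 || v1) ⊕ rank (v2 || v1)) ((rank (v3 || v1) ⊕ rank v1) ⊕ con 1) refl [] (≰⇒> p ∷ []))
  ...   | inj₁ q = absurd (none (clique-found (set= (A ∷ B ∷ S ∷ []) (v0 || v1 == v2 ∷ []) (v0 || v2) v2 refl (AB ∷ [])) kA q))
  ...   | inj₂ q = absurd (none (clique-found (set= (A ∷ B ∷ S ∷ []) (v0 || v1 == v2 ∷ []) (v1 || v2) v2 refl (AB ∷ [])) kB q))
  nothing-found near none (suc (suc (suc k))) _ (s≤s (s≤s ()))

  -- Removing u from a parallel or series pair {u , v} gives the minor on S ─ u
  -- with contracted set C′, whose separations are those of (S , C) with u
  -- put next to v.
  module Shrink {S C C′ : Subset n} {u v : Fin n} (near : NearlyConnected S C)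
      (u∈ : ⁅ u ⁆ ⊑ S) (v∈ : ⁅ v ⁆ ⊑ S) (uv : ⁅ u ⁆ ∩ ⁅ v ⁆ ≡ ⊥)
      (pull : ∀ A B → A ∪ B ≡ S ─ ⁅ u ⁆ → A ∩ B ≡ ⊥ → ⁅ v ⁆ ⊑ A →
        ρ ((A ∪ ⁅ u ⁆) ∪ C) + ρ (B ∪ C) + ρ ((S ─ ⁅ u ⁆) ∪ C′) + ρ C′
          ≤ ρ (A ∪ C′) + ρ (B ∪ C′) + ρ (S ∪ C) + ρ C)
      (pair : ∀ x y → ⁅ x ⁆ ⊑ S ─ ⁅ u ⁆ → ⁅ y ⁆ ⊑ S ─ ⁅ u ⁆ → Pair S C x y → Pair (S ─ ⁅ u ⁆) C′ x y)
      where

    clique : ∀ {A A′} → A ⊑ S ─ ⁅ u ⁆ → A ⊑ A′ → Clique S C A′ → Clique (S ─ ⁅ u ⁆) C′ A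
    clique {A} {A′} A⊑ A⊑A′ cl x y x∈ y∈ d =
      let (p , q) = cl x y (set= (⁅ x ⁆ ∷ A ∷ A′ ∷ []) (v0 <: v1 ∷ v1 <: v2 ∷ []) (v0 || v2) v2 refl (x∈ ∷ A⊑A′ ∷ [])) (set= (⁅ y ⁆ ∷ A ∷ A′ ∷ []) (v0 <: v1 ∷ v1 <: v2 ∷ []) (v0 || v2) v2 refl (y∈ ∷ A⊑A′ ∷ [])) d in
      pair x y (set= (⁅ x ⁆ ∷ A ∷ S ∷ ⁅ u ⁆ ∷ []) (v0 <: v1 ∷ v1 <: v2 - v3 ∷ []) (v0 || (v2 - v3)) (v2 - v3) refl
        (x∈ ∷ A⊑ ∷ [])) (set= (⁅ y ⁆ ∷ A ∷ S ∷ ⁅ u ⁆ ∷ []) (v0 <: v1 ∷ v1 <: v2 - v3 ∷ []) (v0 || (v2 - v3)) (v2 - v3) refl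
        (y∈ ∷ A⊑ ∷ [])) p , q

    no-1 : ∀ A B → A ∪ B ≡ S ─ ⁅ u ⁆ → A ∩ B ≡ ⊥ → ⁅ v ⁆ ⊑ A →
      ρ (A ∪ C′) + ρ (B ∪ C′) ≤ ρ ((S ─ ⁅ u ⁆) ∪ C′) + ρ C′ → B ≡ ⊥
    no-1 A B AB d v∈A sep with pull A B AB d v∈A
    ... | p with no-1-sep near (A ∪ ⁅ u ⁆) B (set= (A ∷ B ∷ S ∷ ⁅ u ⁆ ∷ []) (v0 || v1 == v2 - v3 ∷ v3 <: v2 ∷ []) ((v0 || v3) || v1) v2 refl (AB ∷
      u∈ ∷ [])) (set= (A ∷ B ∷ S ∷ ⁅ u ⁆ ∷ []) (v0 || v1 == v2 - v3 ∷ v0 && v1 == ∅ ∷ []) ((v0 || v3) && v1) ∅ refl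
      (AB ∷ d ∷ [])) (prove≤ (A ∷ ⁅ u ⁆ ∷ C ∷ B ∷ S ∷ C′ ∷ []) [] []
      (((rank ((v0 || v1) || v2) ⊕ rank (v3 || v2)) ⊕ rank ((v4 - v1) || v5)) ⊕ rank v5 <= ((rank (v0 || v5) ⊕ rank (v3 || v5)) ⊕ rank (v4 || v2)) ⊕ rank v2 ∷
      rank (v0 || v5) ⊕ rank (v3 || v5) <= rank ((v4 - v1) || v5) ⊕ rank v5 ∷ []) []
      (rank ((v0 || v1) || v2) ⊕ rank (v3 || v2)) (rank (v4 || v2) ⊕ rank v2) refl [] (p ∷ sep ∷ []))
    ...   | inj₁ q = absurd (⊥≡⁅⁆⇒absurd {x = u} (set= (A ∷ ⁅ u ⁆ ∷ []) (v0 || v1 == ∅ ∷ []) ∅ v1 refl (q ∷ [])))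
    ...   | inj₂ q = q

    two-1 : ∀ A B → A ∪ B ≡ S ─ ⁅ u ⁆ → A ∩ B ≡ ⊥ → ⁅ v ⁆ ⊑ A →
      ρ (A ∪ C′) + ρ (B ∪ C′) ≤ ρ ((S ─ ⁅ u ⁆) ∪ C′) + ρ C′ + 1 →
      Clique (S ─ ⁅ u ⁆) C′ A ⊎ Clique (S ─ ⁅ u ⁆) C′ B
    two-1 A B AB d v∈A sep with pull A B AB d v∈A
    ... | p with 2-seps near (A ∪ ⁅ u ⁆) B (set= (A ∷ B ∷ S ∷ ⁅ u ⁆ ∷ []) (v0 || v1 == v2 - v3 ∷ v3 <: v2 ∷ []) ((v0 || v3) || v1) v2 refl (AB ∷
      u∈ ∷ [])) (set= (A ∷ B ∷ S ∷ ⁅ u ⁆ ∷ []) (v0 || v1 == v2 - v3 ∷ v0 && v1 == ∅ ∷ []) ((v0 || v3) && v1) ∅ refl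
      (AB ∷ d ∷ [])) (prove≤ (A ∷ ⁅ u ⁆ ∷ C ∷ B ∷ S ∷ C′ ∷ []) [] []
      (((rank ((v0 || v1) || v2) ⊕ rank (v3 || v2)) ⊕ rank ((v4 - v1) || v5)) ⊕ rank v5 <= ((rank (v0 || v5) ⊕ rank (v3 || v5)) ⊕ rank (v4 || v2)) ⊕ rank v2 ∷
      rank (v0 || v5) ⊕ rank (v3 || v5) <= (rank ((v4 - v1) || v5) ⊕ rank v5) ⊕ con 1 ∷ []) []
      (rank ((v0 || v1) || v2) ⊕ rank (v3 || v2)) ((rank (v4 || v2) ⊕ rank v2) ⊕ con 1) refl [] (p ∷ sep ∷
      []))
    ...   | inj₁ q = inj₁ (clique (set= (A ∷ B ∷ S ∷ ⁅ u ⁆ ∷ []) (v0 || v1 == v2 - v3 ∷ []) (v0 || (v2 - v3)) (v2 - v3) refl (AB ∷ [])) (set= (A ∷ ⁅ u ⁆ ∷ []) [] (v0 || (v0 || v1)) (v0 || v1) refl []) q)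
    ...   | inj₂ q = inj₂ (clique (set= (A ∷ B ∷ S ∷ ⁅ u ⁆ ∷ []) (v0 || v1 == v2 - v3 ∷ []) (v1 || (v2 - v3)) (v2 - v3) refl (AB ∷ [])) (set= (B ∷ []) [] (v0 || v0) v0 refl []) q)

    v-side : ∀ A B → A ∪ B ≡ S ─ ⁅ u ⁆ → ⁅ v ⁆ ⊑ A ⊎ ⁅ v ⁆ ⊑ B
    v-side A B AB with inside? v A
    ... | inj₁ p = inj₁ p
    ... | inj₂ p = inj₂ (set= (A ∷ B ∷ S ∷ ⁅ u ⁆ ∷ ⁅ v ⁆ ∷ []) (v0 || v1 == v2 - v3 ∷ v4 && v0 == ∅ ∷ v3 && v4 == ∅ ∷
      v4 <: v2 ∷ []) (v4 || v1) v1 refl (AB ∷ p ∷ uv ∷ v∈ ∷ []))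

    shrunk : NearlyConnected (S ─ ⁅ u ⁆) C′
    shrunk = record { no-1-sep = one ; 2-seps = two }
      where
      one : ∀ A B → A ∪ B ≡ S ─ ⁅ u ⁆ → A ∩ B ≡ ⊥ →
        ρ (A ∪ C′) + ρ (B ∪ C′) ≤ ρ ((S ─ ⁅ u ⁆) ∪ C′) + ρ C′ → A ≡ ⊥ ⊎ B ≡ ⊥
      one A B AB d sep with v-side A B AB
      ... | inj₁ p = inj₂ (no-1 A B AB d p sep)
      ... | inj₂ p = inj₁ (no-1 B A (set= (A ∷ B ∷ S ∷ ⁅ u ⁆ ∷ []) (v0 || v1 == v2 - v3 ∷ []) (v1 || v0) (v2 - v3) refl (AB ∷ [])) (set= (A ∷ B ∷ []) (v0 && v1 == ∅ ∷ []) (v1 && v0) ∅ refl (d ∷ [])) p (prove≤ (A ∷ C′ ∷ B ∷ S ∷ ⁅ u ⁆ ∷ []) [] []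
        (rank (v0 || v1) ⊕ rank (v2 || v1) <= rank ((v3 - v4) || v1) ⊕ rank v1 ∷ []) []
        (rank (v2 || v1) ⊕ rank (v0 || v1)) (rank ((v3 - v4) || v1) ⊕ rank v1) refl [] (sep ∷ [])))
      two : ∀ A B → A ∪ B ≡ S ─ ⁅ u ⁆ → A ∩ B ≡ ⊥ →
        ρ (A ∪ C′) + ρ (B ∪ C′) ≤ ρ ((S ─ ⁅ u ⁆) ∪ C′) + ρ C′ + 1 →
        Clique (S ─ ⁅ u ⁆) C′ A ⊎ Clique (S ─ ⁅ u ⁆) C′ B
      two A B AB d sep with v-side A B AB
      ... | inj₁ p = two-1 A B AB d p sep
      ... | inj₂ p with two-1 B A (set= (A ∷ B ∷ S ∷ ⁅ u ⁆ ∷ []) (v0 || v1 == v2 - v3 ∷ []) (v1 || v0) (v2 - v3) refl (AB ∷ [])) (set= (A ∷ B ∷ []) (v0 && v1 == ∅ ∷ []) (v1 && v0) ∅ refl (d ∷ [])) p (prove≤ (A ∷ C′ ∷ B ∷ S ∷ ⁅ u ⁆ ∷ []) [] []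
        (rank (v0 || v1) ⊕ rank (v2 || v1) <= (rank ((v3 - v4) || v1) ⊕ rank v1) ⊕ con 1 ∷ []) []
        (rank (v2 || v1) ⊕ rank (v0 || v1)) ((rank ((v3 - v4) || v1) ⊕ rank v1) ⊕ con 1) refl [] (sep ∷ []))
      ...   | inj₁ q = inj₂ q
      ...   | inj₂ q = inj₁ q

  -- While some pair {u , v} is left, u is removed, and N survives by the exchange across the
  -- 2-separation that the pair forms with the rest. The process ends in a 3-connected proper minor
  -- that contains `T` and has N, against minimality.
  reduce : ∀ k S C → ∣ S ∣ ≤ k → S ∩ C ≡ ⊥ → S ∪ C ⊑ G → T ⊑ S → S ≢ G →
    NearlyConnected S C → Has S C → Absurd
  reduce k S C h SC SCG TS S≢G near has with found? S C
  ... | no none = minimal S C SC SCG TS S≢G (nothing-found near none) has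
  reduce zero S C h SC SCG TS S≢G near has | yes (u , v , u∈ , _) = (refute (S ∷ ⁅ u ⁆ ∷ []) [] (v1 <: v0 ∷ []) (card v0 <= con 0 ∷ con 1 <= card v1 ∷ []) (cmono v1 v0 ∷
    []) refl (u∈ ∷ []) (h ∷ 1≤∣⁅ u ⁆∣ ∷ []))
  reduce (suc k) S C h SC SCG TS S≢G near (I , W , μ , C⊑ , I⊑ , W⊑) | yes (u , v , u∈ , v∈ , uv , u∉T , pr) =
    cases (suc (ρ C) + 1 ≤? ρ ((⁅ u ⁆ ∪ ⁅ v ⁆) ∪ C))
    where
    XY : (⁅ u ⁆ ∪ ⁅ v ⁆) ∩ (S ─ (⁅ u ⁆ ∪ ⁅ v ⁆)) ≡ ⊥
    XY = set= (⁅ u ⁆ ∷ ⁅ v ⁆ ∷ S ∷ []) [] ((v0 || v1) && (v2 - (v0 || v1))) ∅ refl []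
    I⊑′ : I ⊑ (⁅ u ⁆ ∪ ⁅ v ⁆) ∪ (S ─ (⁅ u ⁆ ∪ ⁅ v ⁆))
    I⊑′ = set= (I ∷ S ∷ ⁅ u ⁆ ∷ ⁅ v ⁆ ∷ []) (v0 <: v1 ∷ []) (v0 || ((v2 || v3) || (v1 - (v2 || v3))))
      ((v2 || v3) || (v1 - (v2 || v3))) refl (I⊑ ∷ [])
    W⊑′ : W ⊑ ((⁅ u ⁆ ∪ ⁅ v ⁆) ∪ (S ─ (⁅ u ⁆ ∪ ⁅ v ⁆))) ∪ C
    W⊑′ = set= (W ∷ S ∷ C ∷ ⁅ u ⁆ ∷ ⁅ v ⁆ ∷ []) (v0 <: v1 || v2 ∷ [])
      (v0 || (((v3 || v4) || (v1 - (v3 || v4))) || v2)) (((v3 || v4) || (v1 - (v3 || v4))) || v2) refl (W⊑ ∷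
      [])
    size : 4 ≤ ∣ I ∣
    size = model-size μ
    sep : ρ ((⁅ u ⁆ ∪ ⁅ v ⁆) ∪ C) + ρ ((S ─ (⁅ u ⁆ ∪ ⁅ v ⁆)) ∪ C)
      ≤ ρ (((⁅ u ⁆ ∪ ⁅ v ⁆) ∪ (S ─ (⁅ u ⁆ ∪ ⁅ v ⁆))) ∪ C) + ρ C + 1
    sep = prove≤ (⁅ u ⁆ ∷ ⁅ v ⁆ ∷ C ∷ S ∷ []) [] (v0 <: v3 ∷ v1 <: v3 ∷ [])
      (rank ((v0 || v1) || v2) ⊕ rank ((v3 - (v0 || v1)) || v2) <= (rank (v3 || v2) ⊕ rank v2) ⊕ con 1 ∷ [])
      [] (rank ((v0 || v1) || v2) ⊕ rank ((v3 - (v0 || v1)) || v2))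
      ((rank (((v0 || v1) || (v3 - (v0 || v1))) || v2) ⊕ rank v2) ⊕ con 1) refl (u∈ ∷ v∈ ∷ []) (pr ∷ [])
    open TwoSeparation {X = ⁅ u ⁆ ∪ ⁅ v ⁆} {Y = S ─ (⁅ u ⁆ ∪ ⁅ v ⁆)} {C₀ = C} XY sep
    one : ∣ (⁅ u ⁆ ∪ ⁅ v ⁆) ∩ I ∣ ≤ 1
    one with one-side μ XY I⊑′ W⊑′ C⊑ sep
    ... | inj₁ p = p
    ... | inj₂ p = absurd (refute (S ∷ ⁅ u ⁆ ∷ ⁅ v ⁆ ∷ I ∷ []) [] (v3 <: v0 ∷ []) (card ((v0 - (v1 || v2)) && v3) <= con 1 ∷
      con 4 <= card v3 ∷ card v1 <= con 1 ∷ card v2 <= con 1 ∷ [])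
      (csub ((v1 || v2) && v3) ((v0 - (v1 || v2)) && v3) ∷ csub v1 v2 ∷
      cmono ((v1 || v2) && v3) (v1 || v2) ∷ []) refl (I⊑ ∷ []) (p ∷ size ∷ ∣⁅ u ⁆∣≤1 ∷ ∣⁅ v ⁆∣≤1 ∷ []))
    not-separated : ∀ A B → A ∪ B ≡ S → A ∩ B ≡ ⊥ → 1 ≤ ∣ A ∣ → 1 ≤ ∣ B ∣ →
      ρ (S ∪ C) + ρ C + 1 ≤ ρ (A ∪ C) + ρ (B ∪ C)
    not-separated A B AB d kA kB with ρ (S ∪ C) + ρ C + 1 ≤? ρ (A ∪ C) + ρ (B ∪ C)
    ... | yes p = p
    ... | no p with no-1-sep near A B AB d (prove≤ (A ∷ C ∷ B ∷ S ∷ []) [] []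
      (con 1 ⊕ rank (v0 || v1) ⊕ rank (v2 || v1) <= (rank (v3 || v1) ⊕ rank v1) ⊕ con 1 ∷ []) []
      (rank (v0 || v1) ⊕ rank (v2 || v1)) (rank (v3 || v1) ⊕ rank v1) refl [] (≰⇒> p ∷ []))
    ...   | inj₁ q = absurd (refute (A ∷ []) [] (v0 == ∅ ∷ []) (con 1 <= card v0 ∷ []) (c∅ ∷ []) refl (q ∷ []) (kA ∷ []))
    ...   | inj₂ q = absurd (refute (B ∷ []) [] (v0 == ∅ ∷ []) (con 1 <= card v0 ∷ []) (c∅ ∷ []) refl (q ∷ []) (kB ∷ []))
    Y-size : 1 ≤ ∣ S ─ (⁅ u ⁆ ∪ ⁅ v ⁆) ∣
    Y-size = prove≤ (⁅ u ⁆ ∷ ⁅ v ⁆ ∷ I ∷ S ∷ []) [] (v2 <: v3 ∷ []) (card ((v0 || v1) && v2) <= con 1 ∷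
      con 4 <= card v2 ∷ []) (csub (v3 - (v0 || v1)) ((v0 || v1) && v2) ∷
      cmono v2 ((v3 - (v0 || v1)) || ((v0 || v1) && v2)) ∷ []) (con 1) (card (v3 - (v0 || v1))) refl (I⊑ ∷
      []) (one ∷ size ∷ [])
    sep-uv : ρ (S ∪ C) + ρ C + 1 ≤ ρ ((⁅ u ⁆ ∪ ⁅ v ⁆) ∪ C) + ρ ((S ─ (⁅ u ⁆ ∪ ⁅ v ⁆)) ∪ C)
    sep-uv = not-separated (⁅ u ⁆ ∪ ⁅ v ⁆) (S ─ (⁅ u ⁆ ∪ ⁅ v ⁆)) (set= (⁅ u ⁆ ∷ S ∷ ⁅ v ⁆ ∷ []) (v0 <: v1 ∷ v2 <: v1 ∷ []) ((v0 || v2) || (v1 - (v0 || v2))) v1 refl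
      (u∈ ∷ v∈ ∷ [])) (set= (⁅ u ⁆ ∷ ⁅ v ⁆ ∷ S ∷ []) [] ((v0 || v1) && (v2 - (v0 || v1))) ∅ refl []) (prove≤ (⁅ u ⁆ ∷ ⁅ v ⁆ ∷ []) [] [] (con 1 <= card v0 ∷ []) (cmono v0 (v0 || v1) ∷ []) (con 1)
      (card (v0 || v1)) refl [] (1≤∣⁅ u ⁆∣ ∷ [])) Y-size
    -- So v is neither a loop nor a coloop of the minor, and both facts are needed for v to
    -- represent the basepoint.
    sep-v : ρ (S ∪ C) + ρ C + 1 ≤ ρ (⁅ v ⁆ ∪ C) + ρ ((S ─ ⁅ v ⁆) ∪ C)
    sep-v = not-separated ⁅ v ⁆ (S ─ ⁅ v ⁆) (set= (⁅ v ⁆ ∷ S ∷ []) (v0 <: v1 ∷ []) (v0 || (v1 - v0)) v1 refl (v∈ ∷ [])) (set= (⁅ v ⁆ ∷ S ∷ []) [] (v0 && (v1 - v0)) ∅ refl []) (prove≤ (⁅ v ⁆ ∷ []) [] [] (con 1 <= card v0 ∷ []) [] (con 1) (card v0) refl [] (1≤∣⁅ v ⁆∣ ∷ [])) (prove≤ (S ∷ ⁅ u ⁆ ∷ ⁅ v ⁆ ∷ []) [] [] (con 1 <= card (v0 - (v1 || v2)) ∷ [])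
      (cmono (v0 - (v1 || v2)) (v0 - v2) ∷ []) (con 1) (card (v0 - v2)) refl [] (Y-size ∷ []))
    smaller : ∣ S ─ ⁅ u ⁆ ∣ ≤ k
    smaller = prove≤ (S ∷ ⁅ u ⁆ ∷ []) (k ∷ []) (v1 <: v0 ∷ []) (card v0 <= con 1 ⊕ nv 0 ∷ con 1 <= card v1 ∷ [])
      (cmod (v0 - v1) v1 ∷ c∅ ∷ []) (card (v0 - v1)) (nv 0) refl (u∈ ∷ []) (h ∷ 1≤∣⁅ u ⁆∣ ∷ [])
    proper : S ─ ⁅ u ⁆ ≢ G
    proper p = ⊥≡⁅⁆⇒absurd {x = u} (set= (S ∷ ⁅ u ⁆ ∷ G ∷ C ∷ []) (v0 - v1 == v2 ∷ v0 || v3 <: v2 ∷ v1 <: v0 ∷ []) ∅ v1 refl (p ∷ SCG ∷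
      u∈ ∷ []))
    next : ∀ C′ → C ⊑ C′ → C′ ⊑ C ∪ ⁅ u ⁆ → NearlyConnected (S ─ ⁅ u ⁆) C′ →
      ∃[ I′ ] ∃[ W′ ] Model I′ W′ × C′ ⊑ W′ × I′ ∪ W′ ⊑ (C′ ∪ ⁅ v ⁆) ∪ (S ─ (⁅ u ⁆ ∪ ⁅ v ⁆)) → Absurd
    next C′ CC′ C′⊑ near′ (I′ , W′ , μ′ , p , q) = reduce k (S ─ ⁅ u ⁆) C′ smaller (set= (S ∷ C ∷ C′ ∷ ⁅ u ⁆ ∷ []) (v0 && v1 == ∅ ∷ v2 <: v1 || v3 ∷ []) ((v0 - v3) && v2) ∅ refl (SC ∷
      C′⊑ ∷ []))
      (set= (S ∷ C ∷ G ∷ C′ ∷ ⁅ u ⁆ ∷ []) (v0 || v1 <: v2 ∷ v3 <: v1 || v4 ∷ v4 <: v0 ∷ [])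
        (((v0 - v4) || v3) || v2) v2 refl (SCG ∷ C′⊑ ∷ u∈ ∷ [])) (set= (T ∷ S ∷ ⁅ u ⁆ ∷ []) (v0 <: v1 ∷ v2 && v0 == ∅ ∷ []) (v0 || (v1 - v2)) (v1 - v2) refl (TS ∷
        u∉T ∷ [])) proper near′
      (I′ , W′ , μ′ , p , (set= (C′ ∷ W′ ∷ I′ ∷ ⁅ v ⁆ ∷ S ∷ ⁅ u ⁆ ∷ []) (v0 <: v1 ∷
        v2 || v1 <: (v0 || v3) || (v4 - (v5 || v3)) ∷ v2 && v1 == ∅ ∷ v3 <: v4 ∷ v5 && v3 == ∅ ∷ [])
        (v2 || (v4 - v5)) (v4 - v5) refl (p ∷ q ∷ dis ∷ v∈ ∷ uv ∷ [])) , (set= (I′ ∷ W′ ∷ C′ ∷ ⁅ v ⁆ ∷ S ∷ ⁅ u ⁆ ∷ []) (v0 || v1 <: (v2 || v3) || (v4 - (v5 || v3)) ∷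
        v3 <: v4 ∷ v5 && v3 == ∅ ∷ []) (v1 || ((v4 - v5) || v2)) ((v4 - v5) || v2) refl (q ∷ v∈ ∷ uv ∷ [])))
      where
      dis : I′ ∩ W′ ≡ ⊥
      dis = disjoint μ′
    cases : Dec (suc (ρ C) + 1 ≤ ρ ((⁅ u ⁆ ∪ ⁅ v ⁆) ∪ C)) → Absurd
    -- Rank at most one: u and v are parallel. Here u is deleted and v represents the basepoint with
    -- nothing further contracted.
    cases (no p) = next C (set= (C ∷ []) [] (v0 || v0) v0 refl []) (set= (C ∷ ⁅ u ⁆ ∷ []) [] (v0 || (v0 || v1)) (v0 || v1) refl [])
      (Shrink.shrunk {C′ = C} near u∈ v∈ uv
        (λ A B AB d v∈A → (prove≤ (⁅ u ⁆ ∷ ⁅ v ⁆ ∷ C ∷ S ∷ A ∷ B ∷ []) [] (v4 || v5 == v3 - v0 ∷ v1 <: v4 ∷ [])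
          (rank ((v0 || v1) || v2) <= rank v2 ⊕ con 1 ∷
          (rank (v3 || v2) ⊕ rank v2) ⊕ con 1 <= rank (v1 || v2) ⊕ rank ((v3 - v1) || v2) ∷ [])
          (sub (v4 || v2) ((v0 || v1) || v2) ∷ mono ((v3 - v0) || v2) (v3 || v2) ∷
          mono ((v3 - v1) || v2) (v3 || v2) ∷ [])
          (((rank ((v4 || v0) || v2) ⊕ rank (v5 || v2)) ⊕ rank ((v3 - v0) || v2)) ⊕ rank v2)
          (((rank (v4 || v2) ⊕ rank (v5 || v2)) ⊕ rank (v3 || v2)) ⊕ rank v2) refl (AB ∷ v∈A ∷ []) (par ∷
          sep-v ∷ []))) (λ x y x∈ y∈ q → (prove≤ (⁅ x ⁆ ∷ ⁅ y ⁆ ∷ C ∷ S ∷ ⁅ u ⁆ ∷ []) [] (v0 <: v3 - v4 ∷ v1 <: v3 - v4 ∷ [])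
          (rank ((v0 || v1) || v2) ⊕ rank ((v3 - (v0 || v1)) || v2) <= (rank (v3 || v2) ⊕ rank v2) ⊕ con 1 ∷
          []) (sub ((v3 - v4) || v2) ((v3 - (v0 || v1)) || v2) ∷ [])
          (rank ((v0 || v1) || v2) ⊕ rank (((v3 - v4) - (v0 || v1)) || v2))
          ((rank ((v3 - v4) || v2) ⊕ rank v2) ⊕ con 1) refl (x∈ ∷ y∈ ∷ []) (q ∷ []))))
      (model (survives {C = ⊥} {f = v} μ I⊑′ W⊑′ C⊑ one (set= (⁅ u ⁆ ∷ ⁅ v ⁆ ∷ []) [] (∅ || (v0 || v1)) (v0 || v1) refl []) (set= (⁅ v ⁆ ∷ ⁅ u ⁆ ∷ []) [] (v0 || (v1 || v0)) (v1 || v0) refl []) (prove≤ (C ∷ S ∷ ⁅ u ⁆ ∷ ⁅ v ⁆ ∷ []) [] [] [] [] (rank (∅ || v0) ⊕ rank ((v1 - (v2 || v3)) || v0))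
        (rank ((∅ || (v1 - (v2 || v3))) || v0) ⊕ rank v0) refl [] []) (prove≤ (S ∷ C ∷ ⁅ v ⁆ ∷ []) [] []
        ((rank (v0 || v1) ⊕ rank v1) ⊕ con 1 <= rank (v2 || v1) ⊕ rank ((v0 - v2) || v1) ∷ [])
        (mono ((v0 - v2) || v1) (v0 || v1) ∷ []) (rank (∅ || v1) ⊕ con 1) (rank ((v2 || ∅) || v1)) refl []
        (sep-v ∷ [])) (prove≤ (⁅ u ⁆ ∷ ⁅ v ⁆ ∷ C ∷ S ∷ []) [] (v1 <: v3 ∷ [])
        (rank ((v0 || v1) || v2) <= rank v2 ⊕ con 1 ∷
        (rank (v3 || v2) ⊕ rank v2) ⊕ con 1 <= rank ((v0 || v1) || v2) ⊕ rank ((v3 - (v0 || v1)) || v2) ∷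
        []) (mono (((v1 || ∅) || (v3 - (v0 || v1))) || v2) (v3 || v2) ∷ [])
        (rank (((v1 || ∅) || (v3 - (v0 || v1))) || v2)) (rank ((∅ || (v3 - (v0 || v1))) || v2)) refl (v∈ ∷
        []) (par ∷ sep-uv ∷ []))))
      where
      par : ρ ((⁅ u ⁆ ∪ ⁅ v ⁆) ∪ C) ≤ ρ C + 1
      par = prove≤ (⁅ u ⁆ ∷ ⁅ v ⁆ ∷ C ∷ []) [] []
        (con 1 ⊕ rank ((v0 || v1) || v2) <= (con 1 ⊕ rank v2) ⊕ con 1 ∷ []) [] (rank ((v0 || v1) || v2))
        (rank v2 ⊕ con 1) refl [] (≰⇒> p ∷ [])
      model : ∃[ I′ ] ∃[ W′ ] Model I′ W′ × C ∪ ⊥ ⊑ W′ × I′ ∪ W′ ⊑ ((C ∪ ⊥) ∪ ⁅ v ⁆) ∪ (S ─ (⁅ u ⁆ ∪ ⁅ v ⁆)) →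
        ∃[ I′ ] ∃[ W′ ] Model I′ W′ × C ⊑ W′ × I′ ∪ W′ ⊑ (C ∪ ⁅ v ⁆) ∪ (S ─ (⁅ u ⁆ ∪ ⁅ v ⁆))
      model (I′ , W′ , μ′ , p , q) = I′ , W′ , μ′ , (set= (C ∷ W′ ∷ []) (v0 || ∅ <: v1 ∷ []) (v0 || v1) v1 refl (p ∷ [])) , (set= (I′ ∷ W′ ∷ C ∷ ⁅ v ⁆ ∷ S ∷ ⁅ u ⁆ ∷ []) (v0 || v1 <: ((v2 || ∅) || v3) || (v4 - (v5 || v3)) ∷
        []) ((v0 || v1) || ((v2 || v3) || (v4 - (v5 || v3)))) ((v2 || v3) || (v4 - (v5 || v3))) refl (q ∷
        []))
    -- Rank two: u and v are in series. Here u is contracted, after which v represents the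
    -- basepoint.
    cases (yes p) = next (C ∪ ⁅ u ⁆) (set= (C ∷ ⁅ u ⁆ ∷ []) [] (v0 || (v0 || v1)) (v0 || v1) refl []) (set= (C ∷ ⁅ u ⁆ ∷ []) [] ((v0 || v1) || (v0 || v1)) (v0 || v1) refl [])
      (Shrink.shrunk {C′ = C ∪ ⁅ u ⁆} near u∈ v∈ uv
        (λ A B AB d v∈A → (prove≤ (C ∷ ⁅ u ⁆ ∷ ⁅ v ⁆ ∷ S ∷ A ∷ B ∷ []) [] (v4 || v5 == v3 - v1 ∷ v4 && v5 == ∅ ∷ v2 <: v4 ∷
          v1 <: v3 ∷ []) ((con 1 ⊕ rank v0) ⊕ con 1 <= rank ((v1 || v2) || v0) ∷
          rank ((v1 || v2) || v0) ⊕ rank ((v3 - (v1 || v2)) || v0) <= (rank (v3 || v0) ⊕ rank v0) ⊕ con 1 ∷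
          (rank (v3 || v0) ⊕ rank v0) ⊕ con 1 <= rank (v2 || v0) ⊕ rank ((v3 - v2) || v0) ∷
          card v1 <= con 1 ∷ card v2 <= con 1 ∷ []) (sub (v5 || (v0 || v1)) ((v3 - (v1 || v2)) || v0) ∷
          sub v0 v1 ∷ sub v0 v2 ∷ rc v1 ∷ rc v2 ∷ [])
          (((rank ((v4 || v1) || v0) ⊕ rank (v5 || v0)) ⊕ rank ((v3 - v1) || (v0 || v1))) ⊕ rank (v0 || v1))
          (((rank (v4 || (v0 || v1)) ⊕ rank (v5 || (v0 || v1))) ⊕ rank (v3 || v0)) ⊕ rank v0) refl (AB ∷ d ∷
          v∈A ∷ u∈ ∷ []) (p ∷ pr ∷ sep-v ∷ ∣⁅ u ⁆∣≤1 ∷ ∣⁅ v ⁆∣≤1 ∷ []))) (λ x y x∈ y∈ q → (prove≤ (⁅ x ⁆ ∷ ⁅ y ⁆ ∷ C ∷ S ∷ ⁅ u ⁆ ∷ []) [] (v0 <: v3 - v4 ∷ v1 <: v3 - v4 ∷ v4 <: v3 ∷ [])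
          (rank ((v0 || v1) || v2) ⊕ rank ((v3 - (v0 || v1)) || v2) <= (rank (v3 || v2) ⊕ rank v2) ⊕ con 1 ∷
          []) (sub (v2 || v4) ((v0 || v1) || v2) ∷ [])
          (rank ((v0 || v1) || (v2 || v4)) ⊕ rank (((v3 - v4) - (v0 || v1)) || (v2 || v4)))
          ((rank ((v3 - v4) || (v2 || v4)) ⊕ rank (v2 || v4)) ⊕ con 1) refl (x∈ ∷ y∈ ∷ u∈ ∷ []) (q ∷ []))))
      (survives {C = ⁅ u ⁆} {f = v} μ I⊑′ W⊑′ C⊑ one (set= (⁅ u ⁆ ∷ ⁅ v ⁆ ∷ []) [] (v0 || (v0 || v1)) (v0 || v1) refl []) (set= (⁅ v ⁆ ∷ ⁅ u ⁆ ∷ []) [] (v0 || (v1 || v0)) (v1 || v0) refl []) (prove≤ (C ∷ ⁅ u ⁆ ∷ ⁅ v ⁆ ∷ S ∷ []) [] [] ((con 1 ⊕ rank v0) ⊕ con 1 <= rank ((v1 || v2) || v0) ∷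
        rank ((v1 || v2) || v0) ⊕ rank ((v3 - (v1 || v2)) || v0) <= (rank (v3 || v0) ⊕ rank v0) ⊕ con 1 ∷
        (rank (v3 || v0) ⊕ rank v0) ⊕ con 1 <= rank (v2 || v0) ⊕ rank ((v3 - v2) || v0) ∷ card v1 <= con 1 ∷
        card v2 <= con 1 ∷ []) (sub v0 v1 ∷ sub v0 v2 ∷
        mono ((v3 - v2) || v0) ((v1 || (v3 - (v1 || v2))) || v0) ∷ rc v1 ∷ rc v2 ∷ [])
        (rank (v1 || v0) ⊕ rank ((v3 - (v1 || v2)) || v0))
        (rank ((v1 || (v3 - (v1 || v2))) || v0) ⊕ rank v0) refl [] (p ∷ pr ∷ sep-v ∷ ∣⁅ u ⁆∣≤1 ∷ ∣⁅ v ⁆∣≤1 ∷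
        []))
        (prove≤ (C ∷ ⁅ u ⁆ ∷ ⁅ v ⁆ ∷ []) [] [] ((con 1 ⊕ rank v0) ⊕ con 1 <= rank ((v1 || v2) || v0) ∷
          card v1 <= con 1 ∷ []) (sub v0 v1 ∷ rc v1 ∷ []) (rank (v1 || v0) ⊕ con 1)
          (rank ((v2 || v1) || v0)) refl [] (p ∷ ∣⁅ u ⁆∣≤1 ∷ [])) (prove≤ (C ∷ ⁅ u ⁆ ∷ ⁅ v ⁆ ∷ S ∷ []) [] (v1 <: v3 ∷ v2 <: v3 ∷ [])
          ((rank (v3 || v0) ⊕ rank v0) ⊕ con 1 <= rank (v2 || v0) ⊕ rank ((v3 - v2) || v0) ∷
          card v2 <= con 1 ∷ []) (sub v0 v2 ∷ mono ((v3 - v2) || v0) ((v1 || (v3 - (v1 || v2))) || v0) ∷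
          rc v2 ∷ []) (rank (((v2 || v1) || (v3 - (v1 || v2))) || v0))
          (rank ((v1 || (v3 - (v1 || v2))) || v0)) refl (u∈ ∷ v∈ ∷ []) (sep-v ∷ ∣⁅ v ⁆∣≤1 ∷ [])))

-- Tutte's linking theorem: a minor on P ∪ Q keeping the connectivity between P and Q.
module Linking {n : ℕ} (R : RankFn n) (P Q : Subset n) where
  open RankFn R
  open RankSolver R

  -- Tutte's connectivity κ between P and Q in the minor (S , C) is at least 2.
  Linked : Subset n → Subset n → Set
  Linked S C = ∀ A B → A ∪ B ≡ S → A ∩ B ≡ ⊥ → P ⊑ A → Q ⊑ B →
    ρ (S ∪ C) + ρ C + 2 ≤ ρ (A ∪ C) + ρ (B ∪ C)

  Bad : Subset n → Subset n → Subset n → Set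
  Bad S C A = A ⊑ S × P ⊑ A × Q ⊑ S ─ A × ρ (A ∪ C) + ρ ((S ─ A) ∪ C) ≤ ρ (S ∪ C) + ρ C + 1

  linked? : ∀ S C → Linked S C ⊎ ∃[ A ] Bad S C A
  linked? S C with anySubset? (λ A → ((A ∪ S) ≟ˢ S) ×-dec ((P ∪ A) ≟ˢ A) ×-dec ((Q ∪ (S ─ A)) ≟ˢ (S ─ A))
                        ×-dec (ρ (A ∪ C) + ρ ((S ─ A) ∪ C) ≤? ρ (S ∪ C) + ρ C + 1))
  ... | yes bad = inj₂ bad
  ... | no none = inj₁ linked
    where
    linked : Linked S C
    linked A B AB d PA QB with ρ (S ∪ C) + ρ C + 2 ≤? ρ (A ∪ C) + ρ (B ∪ C)
    ... | yes p = p
    ... | no p  = absurd (none (A , (set= (A ∷ B ∷ S ∷ []) (v0 || v1 == v2 ∷ []) (v0 || v2) v2 refl (AB ∷ [])) , PA , (set= (A ∷ B ∷ S ∷ Q ∷ []) (v0 || v1 == v2 ∷ v0 && v1 == ∅ ∷ v3 <: v1 ∷ []) (v3 || (v2 - v0))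
      (v2 - v0) refl (AB ∷ d ∷ QB ∷ [])) , (prove≤ (A ∷ B ∷ S ∷ C ∷ []) [] (v0 || v1 == v2 ∷ v0 && v1 == ∅ ∷ [])
      (con 1 ⊕ rank (v0 || v3) ⊕ rank (v1 || v3) <= (rank (v2 || v3) ⊕ rank v3) ⊕ con 2 ∷ []) []
      (rank (v0 || v3) ⊕ rank ((v2 - v0) || v3)) ((rank (v2 || v3) ⊕ rank v3) ⊕ con 1) refl (AB ∷ d ∷ [])
      (≰⇒> p ∷ []))))

  -- Each element x outside P ∪ Q is deleted if that keeps the linkage and contracted otherwise. If
  -- both destroyed it, the two separations that witness this would uncross to a separation of the
  -- minor that x still belongs to.
  link : ∀ k S C → P ∩ Q ≡ ⊥ → ∣ S ─ (P ∪ Q) ∣ ≤ k → P ∪ Q ⊑ S → Linked S C →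
    ∃[ Z ] Z ⊑ C ∪ (S ─ (P ∪ Q)) × ρ ((P ∪ Q) ∪ Z) + ρ Z + 2 ≤ ρ (P ∪ Z) + ρ (Q ∪ Z)
  link k S C PQ0 h PQ linked with empty-or-element (S ─ (P ∪ Q))
  ... | inj₁ p = C , (set= (C ∷ S ∷ P ∷ Q ∷ []) [] (v0 || (v0 || (v1 - (v2 || v3)))) (v0 || (v1 - (v2 || v3))) refl []) , (prove≤ (S ∷ C ∷ P ∷ Q ∷ []) [] (v0 - (v2 || v3) == ∅ ∷ v2 || v3 <: v0 ∷ [])
    ((rank (v0 || v1) ⊕ rank v1) ⊕ con 2 <= rank (v2 || v1) ⊕ rank (v3 || v1) ∷ []) []
    ((rank ((v2 || v3) || v1) ⊕ rank v1) ⊕ con 2) (rank (v2 || v1) ⊕ rank (v3 || v1)) refl (p ∷ PQ ∷ [])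
    (final p ∷ []))
    where
    final : S ─ (P ∪ Q) ≡ ⊥ → ρ (S ∪ C) + ρ C + 2 ≤ ρ (P ∪ C) + ρ (Q ∪ C)
    final p = linked P Q (set= (S ∷ P ∷ Q ∷ []) (v0 - (v1 || v2) == ∅ ∷ v1 || v2 <: v0 ∷ []) (v1 || v2) v0 refl (p ∷ PQ ∷ [])) PQ0 (set= (P ∷ []) [] (v0 || v0) v0 refl []) (set= (Q ∷ []) [] (v0 || v0) v0 refl [])
  link zero S C PQ0 h PQ linked | inj₂ (x , x∈) = absurd (refute (S ∷ P ∷ Q ∷ ⁅ x ⁆ ∷ []) [] (v3 <: v0 - (v1 || v2) ∷ []) (card (v0 - (v1 || v2)) <= con 0 ∷
    con 1 <= card v3 ∷ []) (cmono v3 (v0 - (v1 || v2)) ∷ []) refl (x∈ ∷ []) (h ∷ 1≤∣⁅ x ⁆∣ ∷ []))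
  link (suc k) S C PQ0 h PQ linked | inj₂ (x , x∈) with linked? (S ─ ⁅ x ⁆) C
  ... | inj₁ l with link k (S ─ ⁅ x ⁆) C PQ0 (prove≤ (S ∷ P ∷ Q ∷ ⁅ x ⁆ ∷ []) (k ∷ []) (v3 <: v0 - (v1 || v2) ∷ [])
    (card (v0 - (v1 || v2)) <= con 1 ⊕ nv 0 ∷ con 1 <= card v3 ∷ []) (cmod ((v0 - v3) - (v1 || v2)) v3 ∷
    c∅ ∷ []) (card ((v0 - v3) - (v1 || v2))) (nv 0) refl (x∈ ∷ []) (h ∷ 1≤∣⁅ x ⁆∣ ∷ [])) (set= (P ∷ Q ∷ S ∷ ⁅ x ⁆ ∷ []) (v0 || v1 <: v2 ∷ v3 <: v2 - (v0 || v1) ∷ []) ((v0 || v1) || (v2 - v3))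
    (v2 - v3) refl (PQ ∷ x∈ ∷ [])) l
  ...   | Z , p , q = Z , (set= (Z ∷ C ∷ S ∷ ⁅ x ⁆ ∷ P ∷ Q ∷ []) (v0 <: v1 || ((v2 - v3) - (v4 || v5)) ∷ [])
    (v0 || (v1 || (v2 - (v4 || v5)))) (v1 || (v2 - (v4 || v5))) refl (p ∷ [])) , q
  link (suc k) S C PQ0 h PQ linked | inj₂ (x , x∈) | inj₂ (A₁ , A₁⊑ , PA₁ , QB₁ , s₁) with linked? (S ─ ⁅ x ⁆) (C ∪ ⁅ x ⁆)
  ... | inj₁ l with link k (S ─ ⁅ x ⁆) (C ∪ ⁅ x ⁆) PQ0 (prove≤ (S ∷ P ∷ Q ∷ ⁅ x ⁆ ∷ []) (k ∷ []) (v3 <: v0 - (v1 || v2) ∷ [])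
    (card (v0 - (v1 || v2)) <= con 1 ⊕ nv 0 ∷ con 1 <= card v3 ∷ []) (cmod ((v0 - v3) - (v1 || v2)) v3 ∷
    c∅ ∷ []) (card ((v0 - v3) - (v1 || v2))) (nv 0) refl (x∈ ∷ []) (h ∷ 1≤∣⁅ x ⁆∣ ∷ [])) (set= (P ∷ Q ∷ S ∷ ⁅ x ⁆ ∷ []) (v0 || v1 <: v2 ∷ v3 <: v2 - (v0 || v1) ∷ []) ((v0 || v1) || (v2 - v3))
    (v2 - v3) refl (PQ ∷ x∈ ∷ [])) l
  ...   | Z , p , q = Z , (set= (Z ∷ C ∷ ⁅ x ⁆ ∷ S ∷ P ∷ Q ∷ []) (v0 <: (v1 || v2) || ((v3 - v2) - (v4 || v5)) ∷
    v2 <: v3 - (v4 || v5) ∷ []) (v0 || (v1 || (v3 - (v4 || v5)))) (v1 || (v3 - (v4 || v5))) refl (p ∷ x∈ ∷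
    [])) , q
  -- A₁ is bad after deleting x and A₂ after contracting it. Submodularity trades them for A₁ ∩ A₂
  -- and A₁ ∪ A₂ ∪ x at the cost of the rank of x, so a total connectivity of 1 + 1 would have to
  -- reach 2 + 2 - 1.
  link (suc k) S C PQ0 h PQ linked | inj₂ (x , x∈) | inj₂ (A₁ , A₁⊑ , PA₁ , QB₁ , s₁) | inj₂ (A₂ , A₂⊑ , PA₂ , QB₂ , s₂) =
    (absurd (refute (A₁ ∷ C ∷ S ∷ ⁅ x ⁆ ∷ A₂ ∷ P ∷ Q ∷ []) [] (v3 <: v2 - (v5 || v6) ∷ v0 <: v2 - v3 ∷ [])
      (rank (v0 || v1) ⊕ rank (((v2 - v3) - v0) || v1) <= (rank ((v2 - v3) || v1) ⊕ rank v1) ⊕ con 1 ∷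
      rank (v4 || (v1 || v3)) ⊕ rank (((v2 - v3) - v4) || (v1 || v3)) <= (rank ((v2 - v3) || (v1 || v3)) ⊕ rank (v1 || v3)) ⊕ con 1 ∷
      (rank (v2 || v1) ⊕ rank v1) ⊕ con 2 <= rank ((v0 && v4) || v1) ⊕ rank ((v2 - (v0 && v4)) || v1) ∷
      (rank (v2 || v1) ⊕ rank v1) ⊕ con 2 <= rank (((v0 || v4) || v3) || v1) ⊕ rank ((v2 - ((v0 || v4) || v3)) || v1) ∷
      card v3 <= con 1 ∷ []) (sub (v0 || v1) (v4 || (v1 || v3)) ∷
      sub (((v2 - v3) - v0) || v1) (((v2 - v3) - v4) || (v1 || v3)) ∷ sub v1 v3 ∷
      mono ((v2 - v3) || v1) ((v2 - v3) || (v1 || v3)) ∷ rc v3 ∷ []) refl (x∈ ∷ A₁⊑ ∷ []) (s₁ ∷ s₂ ∷ small ∷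
      large ∷ ∣⁅ x ⁆∣≤1 ∷ [])))
    where
    small = linked (A₁ ∩ A₂) (S ─ (A₁ ∩ A₂)) (set= (A₁ ∷ S ∷ ⁅ x ⁆ ∷ A₂ ∷ []) (v0 <: v1 - v2 ∷ []) ((v0 && v3) || (v1 - (v0 && v3))) v1 refl (A₁⊑ ∷
      [])) (set= (A₁ ∷ A₂ ∷ S ∷ []) [] ((v0 && v1) && (v2 - (v0 && v1))) ∅ refl []) (set= (P ∷ A₁ ∷ A₂ ∷ []) (v0 <: v1 ∷ v0 <: v2 ∷ []) (v0 || (v1 && v2)) (v1 && v2) refl (PA₁ ∷ PA₂ ∷
      [])) (set= (Q ∷ S ∷ ⁅ x ⁆ ∷ A₁ ∷ A₂ ∷ []) (v0 <: (v1 - v2) - v3 ∷ []) (v0 || (v1 - (v3 && v4)))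
      (v1 - (v3 && v4)) refl (QB₁ ∷ []))
    large = linked ((A₁ ∪ A₂) ∪ ⁅ x ⁆) (S ─ ((A₁ ∪ A₂) ∪ ⁅ x ⁆)) (set= (A₁ ∷ S ∷ ⁅ x ⁆ ∷ A₂ ∷ P ∷ Q ∷ []) (v0 <: v1 - v2 ∷ v3 <: v1 - v2 ∷ v2 <: v1 - (v4 || v5) ∷ [])
      (((v0 || v3) || v2) || (v1 - ((v0 || v3) || v2))) v1 refl (A₁⊑ ∷ A₂⊑ ∷ x∈ ∷ [])) (set= (A₁ ∷ A₂ ∷ ⁅ x ⁆ ∷ S ∷ []) [] (((v0 || v1) || v2) && (v3 - ((v0 || v1) || v2))) ∅ refl []) (set= (P ∷ A₁ ∷ A₂ ∷ ⁅ x ⁆ ∷ []) (v0 <: v1 ∷ []) (v0 || ((v1 || v2) || v3)) ((v1 || v2) || v3) refl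
      (PA₁ ∷ [])) (set= (Q ∷ S ∷ ⁅ x ⁆ ∷ A₁ ∷ A₂ ∷ []) (v0 <: (v1 - v2) - v3 ∷ v0 <: (v1 - v2) - v4 ∷ [])
      (v0 || (v1 - ((v3 || v4) || v2))) (v1 - ((v3 || v4) || v2)) refl (QB₁ ∷ QB₂ ∷ []))

-- A minimal matroid and its triangle `T`.

module Triangle {n m : ℕ} (R : RankFn n) (N : Matroid m)
    (N-conn : ThreeConnected N) (N-size : 4 ≤ ∣ E N ∣)
    (G T : Subset n) (T⊑G : T ⊑ G) (T-size : ∣ T ∣ ≡ 3) (T-line : RankFn.ρ R T ≤ 2)
    (T-pair : ∀ u v → ⁅ u ⁆ ⊑ T → ⁅ v ⁆ ⊑ T → ⁅ u ⁆ ∩ ⁅ v ⁆ ≡ ⊥ → 2 ≤ RankFn.ρ R (⁅ u ⁆ ∪ ⁅ v ⁆))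
    (G-size : 4 ≤ ∣ G ∣)
    (conn : ∀ k → 1 ≤ k → k ≤ 2 → ∀ A B → A ∪ B ≡ G → A ∩ B ≡ ⊥ → k ≤ ∣ A ∣ → k ≤ ∣ B ∣ →
      RankFn.ρ R G + k ≤ RankFn.ρ R A + RankFn.ρ R B)
    (minimal : ∀ S C → S ∩ C ≡ ⊥ → S ∪ C ⊑ G → T ⊑ S → S ≢ G →
      Connected₃ R S C → HasN.Has R N S C → Absurd) where
  open RankFn R
  open RankSolver R
  open Rank R
  open Models R N
  open Survival R N N-conn N-size
  open Minimal R N N-conn N-size G T T⊑G minimal

  conn₁ : ∀ {A B} → A ∪ B ≡ G → A ∩ B ≡ ⊥ → 1 ≤ ∣ A ∣ → 1 ≤ ∣ B ∣ → ρ G + 1 ≤ ρ A + ρ B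
  conn₁ = conn 1 ≤-refl (s≤s z≤n) _ _

  conn₂ : ∀ {A B} → A ∪ B ≡ G → A ∩ B ≡ ⊥ → 2 ≤ ∣ A ∣ → 2 ≤ ∣ B ∣ → ρ G + 2 ≤ ρ A + ρ B
  conn₂ = conn 2 (s≤s z≤n) ≤-refl _ _

  -- Pigeonhole on three elements. A side with two elements of `T` spans all of `T`, and this is how
  -- the triangle enters the separation arguments.
  T-sides : ∀ A B → T ⊑ A ∪ B → 2 ≤ ∣ T ∩ A ∣ ⊎ 2 ≤ ∣ T ∩ B ∣
  T-sides A B h with 2 ≤? ∣ T ∩ A ∣ | 2 ≤? ∣ T ∩ B ∣
  ... | yes p | _     = inj₁ p
  ... | no _  | yes q = inj₂ q
  ... | no p  | no q  = absurd (refute (T ∷ A ∷ B ∷ []) [] (v0 <: v1 || v2 ∷ []) (con 3 <= card v0 ∷ con 1 ⊕ card (v0 && v1) <= con 2 ∷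
    con 1 ⊕ card (v0 && v2) <= con 2 ∷ []) (csub (v0 && v1) (v0 && v2) ∷ []) refl (h ∷ [])
    (≤-reflexive (sym T-size) ∷ ≰⇒> p ∷ ≰⇒> q ∷ []))

  T-spanned : ∀ {A} → 2 ≤ ∣ T ∩ A ∣ → 2 ≤ ρ (T ∩ A)
  T-spanned {A} h with two-elements {A = T ∩ A} h
  ... | u , v , p , q , d with T-pair u v (set= (⁅ u ⁆ ∷ T ∷ A ∷ []) (v0 <: v1 && v2 ∷ []) (v0 || v1) v1 refl (p ∷ [])) (set= (⁅ v ⁆ ∷ T ∷ A ∷ []) (v0 <: v1 && v2 ∷ []) (v0 || v1) v1 refl (q ∷ [])) d
  ...   | r = prove≤ (⁅ u ⁆ ∷ ⁅ v ⁆ ∷ T ∷ A ∷ []) [] (v0 <: v2 && v3 ∷ v1 <: v2 && v3 ∷ [])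
    (con 2 <= rank (v0 || v1) ∷ []) (mono (v0 || v1) (v2 && v3) ∷ []) (con 2) (rank (v2 && v3)) refl (p ∷
    q ∷ []) (r ∷ [])

  nonloop : ∀ {x} → ⁅ x ⁆ ⊑ G → 1 ≤ ρ ⁅ x ⁆
  nonloop {x} x∈ = prove≤ (G ∷ ⁅ x ⁆ ∷ []) [] [] (rank v0 ⊕ con 1 <= rank v1 ⊕ rank (v0 - v1) ∷ []) (mono (v0 - v1) v0 ∷
    []) (con 1) (rank v1) refl [] (c ∷ [])
    where
    c = conn₁ {⁅ x ⁆} {G ─ ⁅ x ⁆} (set= (⁅ x ⁆ ∷ G ∷ []) (v0 <: v1 ∷ []) (v0 || (v1 - v0)) v1 refl (x∈ ∷ [])) (set= (⁅ x ⁆ ∷ G ∷ []) [] (v0 && (v1 - v0)) ∅ refl []) (prove≤ (⁅ x ⁆ ∷ []) [] [] (con 1 <= card v0 ∷ []) [] (con 1) (card v0) refl [] (1≤∣⁅ x ⁆∣ ∷ [])) (prove≤ (⁅ x ⁆ ∷ G ∷ []) [] (v0 <: v1 ∷ []) (con 4 <= card v1 ∷ card v0 <= con 1 ∷ [])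
      (csub (v1 - v0) v0 ∷ []) (con 1) (card (v1 - v0)) refl (x∈ ∷ []) (G-size ∷ ∣⁅ x ⁆∣≤1 ∷ []))

  -- Without 1-separations there are no coloops.
  spans : ∀ {B} → B ⊑ G → ∣ B ∣ ≤ 1 → ρ G ≤ ρ (G ─ B)
  spans {B} B⊑ h with ≤1⇒≡⊥⊎≡⁅⁆ {A = B} h
  ... | inj₁ p = prove≤ (B ∷ G ∷ []) [] (v0 == ∅ ∷ []) [] [] (rank v1) (rank (v1 - v0)) refl (p ∷ []) []
  ... | inj₂ (x , p) = prove≤ (B ∷ ⁅ x ⁆ ∷ G ∷ []) [] (v0 == v1 ∷ []) (rank v2 ⊕ con 1 <= rank v1 ⊕ rank (v2 - v1) ∷
    card v1 <= con 1 ∷ []) (rc v1 ∷ []) (rank v2) (rank (v2 - v0)) refl (p ∷ []) (c ∷ ∣⁅ x ⁆∣≤1 ∷ [])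
    where
    c = conn₁ {⁅ x ⁆} {G ─ ⁅ x ⁆} (set= (B ∷ G ∷ ⁅ x ⁆ ∷ []) (v0 <: v1 ∷ v0 == v2 ∷ []) (v2 || (v1 - v2)) v1 refl (B⊑ ∷ p ∷ [])) (set= (⁅ x ⁆ ∷ G ∷ []) [] (v0 && (v1 - v0)) ∅ refl []) (prove≤ (⁅ x ⁆ ∷ []) [] [] (con 1 <= card v0 ∷ []) [] (con 1) (card v0) refl [] (1≤∣⁅ x ⁆∣ ∷ [])) (prove≤ (B ∷ G ∷ ⁅ x ⁆ ∷ []) [] (v0 <: v1 ∷ v0 == v2 ∷ []) (con 4 <= card v1 ∷ card v2 <= con 1 ∷ [])
      (csub (v1 - v2) v2 ∷ []) (con 1) (card (v1 - v2)) refl (B⊑ ∷ p ∷ []) (G-size ∷ ∣⁅ x ⁆∣≤1 ∷ []))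

  pair-rank : ∀ {x y} → ⁅ x ⁆ ⊑ G → ⁅ y ⁆ ⊑ G → ⁅ x ⁆ ∩ ⁅ y ⁆ ≡ ⊥ → 2 ≤ ρ (⁅ x ⁆ ∪ ⁅ y ⁆)
  pair-rank {x} {y} x∈ y∈ d = prove≤ (G ∷ ⁅ x ⁆ ∷ ⁅ y ⁆ ∷ []) [] [] (rank v0 ⊕ con 2 <= rank (v1 || v2) ⊕ rank (v0 - (v1 || v2)) ∷
    []) (mono (v0 - (v1 || v2)) v0 ∷ []) (con 2) (rank (v1 || v2)) refl [] (c ∷ [])
    where
    c = conn₂ {⁅ x ⁆ ∪ ⁅ y ⁆} {G ─ (⁅ x ⁆ ∪ ⁅ y ⁆)} (set= (⁅ x ⁆ ∷ G ∷ ⁅ y ⁆ ∷ []) (v0 <: v1 ∷ v2 <: v1 ∷ []) ((v0 || v2) || (v1 - (v0 || v2))) v1 refl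
      (x∈ ∷ y∈ ∷ [])) (set= (⁅ x ⁆ ∷ ⁅ y ⁆ ∷ G ∷ []) [] ((v0 || v1) && (v2 - (v0 || v1))) ∅ refl []) (prove≤ (⁅ x ⁆ ∷ ⁅ y ⁆ ∷ []) [] (v0 && v1 == ∅ ∷ []) (con 1 <= card v0 ∷ con 1 <= card v1 ∷ [])
      (cmod v0 v1 ∷ c∅ ∷ []) (con 2) (card (v0 || v1)) refl (d ∷ []) (1≤∣⁅ x ⁆∣ ∷ 1≤∣⁅ y ⁆∣ ∷ [])) (prove≤ (⁅ x ⁆ ∷ ⁅ y ⁆ ∷ G ∷ []) [] (v0 <: v2 ∷ v1 <: v2 ∷ []) (con 4 <= card v2 ∷ card v0 <= con 1 ∷
      card v1 <= con 1 ∷ []) (csub (v2 - (v0 || v1)) (v0 || v1) ∷ csub v0 v1 ∷ []) (con 2)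
      (card (v2 - (v0 || v1))) refl (x∈ ∷ y∈ ∷ []) (G-size ∷ ∣⁅ x ⁆∣≤1 ∷ ∣⁅ y ⁆∣≤1 ∷ []))

  -- X is replaced by the points L of its guts line, X being contracted onto that
  -- line along Z.
  line : ∀ X Y Z L → X ∪ Y ≡ G → X ∩ Y ≡ ⊥ → ρ X + ρ Y ≤ ρ G + 2 → Z ⊑ X → L ⊑ X → L ∩ Z ≡ ⊥ →
    ρ G ≤ ρ (Y ∪ Z) → ρ Y + ρ Z ≤ ρ (Y ∪ Z) → 1 ≤ ρ Z → 2 ≤ ∣ X ∣ →
    (∀ A B → L ⊑ A ∪ B → ρ Z + 2 ≤ ρ ((A ∩ L) ∪ Z) ⊎ ρ Z + 2 ≤ ρ ((B ∩ L) ∪ Z)) →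
    (∀ l → ⁅ l ⁆ ⊑ L → ρ Z + 1 ≤ ρ (⁅ l ⁆ ∪ Z)) → T ⊑ Y ∪ L →
    (∀ u v → ⁅ u ⁆ ⊑ T → ⁅ v ⁆ ⊑ T → ⁅ u ⁆ ∩ ⁅ v ⁆ ≡ ⊥ → ρ Z + 2 ≤ ρ ((⁅ u ⁆ ∪ ⁅ v ⁆) ∪ Z)) →
    Has (Y ∪ L) Z → Absurd
  line X Y Z L XY XY0 sep Z⊑ L⊑ LZ G≤ skew Z≠ X-size L-split L-nonloop T⊑ T-pairs has =
    reduce ∣ Y ∪ L ∣ (Y ∪ L) Z ≤-refl (set= (X ∷ Y ∷ Z ∷ L ∷ []) (v0 && v1 == ∅ ∷ v2 <: v0 ∷ v3 && v2 == ∅ ∷ []) ((v1 || v3) && v2) ∅ refl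
      (XY0 ∷ Z⊑ ∷ LZ ∷ [])) (set= (X ∷ Y ∷ G ∷ L ∷ Z ∷ []) (v0 || v1 == v2 ∷ v3 <: v0 ∷ v4 <: v0 ∷ []) (((v1 || v3) || v4) || v2)
      v2 refl (XY ∷ L⊑ ∷ Z⊑ ∷ [])) T⊑ proper
      (record { no-1-sep = no-1 ; 2-seps = two }) has
    where
    proper : Y ∪ L ≢ G
    proper p = (refute (Z ∷ Y ∷ L ∷ G ∷ X ∷ []) [] (v1 || v2 == v3 ∷ v0 <: v4 ∷ v2 && v0 == ∅ ∷ v4 && v1 == ∅ ∷
      v4 || v1 == v3 ∷ []) (con 1 <= rank v0 ∷ []) (c∅ ∷ rc v0 ∷ []) refl (p ∷ Z⊑ ∷ LZ ∷ XY0 ∷ XY ∷ [])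
      (Z≠ ∷ []))
    -- When A ∩ L spans the line, A ∪ X has no more rank than A ∪ Z, so a low separation (A , B) of
    -- the new minor becomes (A ∪ X , B ∩ Y) in M. Two elements in B ∩ Y would contradict the
    -- 3-connectivity of M; with fewer, A ∪ X is spanning and only the slack j is left for B over Z.
    -- Thus B is empty for j = 0 and a parallel class for j = 1.
    sep-B : ∀ {A B j} → A ∪ B ≡ Y ∪ L → A ∩ B ≡ ⊥ → ρ Z + 2 ≤ ρ ((A ∩ L) ∪ Z) → j ≤ 1 →
      ρ (A ∪ Z) + ρ (B ∪ Z) ≤ ρ ((Y ∪ L) ∪ Z) + ρ Z + j → ρ (B ∪ Z) ≤ ρ Z + j
    sep-B {A} {B} {j} AB d AL j≤1 s with 2 ≤? ∣ B ∩ Y ∣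
    ... | yes p = absurd (refute (A ∷ X ∷ Z ∷ B ∷ Y ∷ L ∷ G ∷ []) (j ∷ []) (v1 || v4 == v6 ∷ v5 <: v1 ∷ v2 <: v1 ∷ [])
      (rank (v0 || v1) <= rank (v0 || v2) ∷ rank (v3 && v4) ⊕ rank v2 <= rank ((v3 && v4) || v2) ∷
      rank (v0 || v2) ⊕ rank (v3 || v2) <= (rank ((v4 || v5) || v2) ⊕ rank v2) ⊕ nv 0 ∷ nv 0 <= con 1 ∷
      rank v6 ⊕ con 2 <= rank (v0 || v1) ⊕ rank (v3 && v4) ∷ []) (mono ((v3 && v4) || v2) (v3 || v2) ∷
      mono ((v4 || v5) || v2) v6 ∷ []) refl (XY ∷ L⊑ ∷ Z⊑ ∷ []) (AX ∷ BZ ∷ s ∷ j≤1 ∷ c ∷ []))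
      where
      AX : ρ (A ∪ X) ≤ ρ (A ∪ Z)
      AX = prove≤ (Z ∷ A ∷ L ∷ X ∷ Y ∷ G ∷ []) [] (v2 <: v3 ∷ v0 <: v3 ∷ [])
        (rank v0 ⊕ con 2 <= rank ((v1 && v2) || v0) ∷ rank v3 ⊕ rank v4 <= rank v5 ⊕ con 2 ∷
        rank v5 <= rank (v4 || v0) ∷ []) (sub (v1 || v0) v3 ∷ sub v0 v4 ∷
        mono ((v1 && v2) || v0) ((v1 || v0) && v3) ∷ []) (rank (v1 || v3)) (rank (v1 || v0)) refl (L⊑ ∷ Z⊑ ∷
        []) (AL ∷ sep ∷ G≤ ∷ [])
      BZ : ρ (B ∩ Y) + ρ Z ≤ ρ ((B ∩ Y) ∪ Z)
      BZ = prove≤ (Y ∷ Z ∷ B ∷ []) [] [] (rank v0 ⊕ rank v1 <= rank (v0 || v1) ∷ [])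
        (sub ((v2 && v0) || v1) v0 ∷ mono (v2 && v0) (((v2 && v0) || v1) && v0) ∷ [])
        (rank (v2 && v0) ⊕ rank v1) (rank ((v2 && v0) || v1)) refl [] (skew ∷ [])
      c = conn₂ {A ∪ X} {B ∩ Y} (set= (A ∷ B ∷ Y ∷ L ∷ X ∷ G ∷ []) (v0 || v1 == v2 || v3 ∷ v4 || v2 == v5 ∷ v3 <: v4 ∷ [])
        ((v0 || v4) || (v1 && v2)) v5 refl (AB ∷ XY ∷ L⊑ ∷ [])) (set= (X ∷ Y ∷ A ∷ B ∷ []) (v0 && v1 == ∅ ∷ v2 && v3 == ∅ ∷ []) ((v2 || v0) && (v3 && v1)) ∅ refl
        (XY0 ∷ d ∷ [])) (prove≤ (X ∷ A ∷ []) [] [] (con 2 <= card v0 ∷ []) (cmono v0 (v1 || v0) ∷ []) (con 2)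
        (card (v1 || v0)) refl [] (X-size ∷ [])) p
    ... | no p = prove≤ (A ∷ X ∷ Z ∷ G ∷ B ∷ Y ∷ L ∷ []) (j ∷ []) (v0 || v4 == v5 || v6 ∷ v1 || v5 == v3 ∷
      v1 && v5 == ∅ ∷ v0 && v4 == ∅ ∷ v6 <: v1 ∷ v2 <: v1 ∷ []) (rank (v0 || v1) <= rank (v0 || v2) ∷
      rank v3 <= rank (v3 - (v4 && v5)) ∷
      rank (v0 || v2) ⊕ rank (v4 || v2) <= (rank ((v5 || v6) || v2) ⊕ rank v2) ⊕ nv 0 ∷ [])
      (mono ((v5 || v6) || v2) v3 ∷ []) (rank (v4 || v2)) (rank v2 ⊕ nv 0) refl (AB ∷ XY ∷ XY0 ∷ d ∷ L⊑ ∷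
      Z⊑ ∷ []) (AX ∷ c ∷ s ∷ [])
      where
      AX : ρ (A ∪ X) ≤ ρ (A ∪ Z)
      AX = prove≤ (Z ∷ A ∷ L ∷ X ∷ Y ∷ G ∷ []) [] (v2 <: v3 ∷ v0 <: v3 ∷ [])
        (rank v0 ⊕ con 2 <= rank ((v1 && v2) || v0) ∷ rank v3 ⊕ rank v4 <= rank v5 ⊕ con 2 ∷
        rank v5 <= rank (v4 || v0) ∷ []) (sub (v1 || v0) v3 ∷ sub v0 v4 ∷
        mono ((v1 && v2) || v0) ((v1 || v0) && v3) ∷ []) (rank (v1 || v3)) (rank (v1 || v0)) refl (L⊑ ∷ Z⊑ ∷
        []) (AL ∷ sep ∷ G≤ ∷ [])
      c = spans {B ∩ Y} (set= (X ∷ Y ∷ G ∷ B ∷ []) (v0 || v1 == v2 ∷ []) ((v3 && v1) || v2) v2 refl (XY ∷ [])) (≤-pred (≰⇒> p))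
    nonloop-Z : ∀ {x} → ⁅ x ⁆ ⊑ Y ∪ L → ρ Z + 1 ≤ ρ (⁅ x ⁆ ∪ Z)
    nonloop-Z {x} x∈ with inside? x L
    ... | inj₁ p = L-nonloop x p
    ... | inj₂ p = prove≤ (⁅ x ⁆ ∷ Y ∷ Z ∷ L ∷ []) [] (v0 && v3 == ∅ ∷ v0 <: v1 || v3 ∷ []) (con 1 <= rank v0 ∷
      rank v1 ⊕ rank v2 <= rank (v1 || v2) ∷ []) (sub (v0 || v2) v1 ∷ mono v0 ((v0 || v2) && v1) ∷ [])
      (rank v2 ⊕ con 1) (rank (v0 || v2)) refl (p ∷ x∈ ∷ []) (q ∷ skew ∷ [])
      where
      q : 1 ≤ ρ ⁅ x ⁆
      q = nonloop (set= (⁅ x ⁆ ∷ Y ∷ L ∷ X ∷ G ∷ []) (v0 <: v1 || v2 ∷ v2 <: v3 ∷ v3 || v1 == v4 ∷ []) (v0 || v4) v4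
        refl (x∈ ∷ L⊑ ∷ XY ∷ []))
    empty : ∀ {B} → B ⊑ Y ∪ L → ρ (B ∪ Z) ≤ ρ Z + 0 → B ≡ ⊥
    empty {B} B⊑ h with empty-or-element B
    ... | inj₁ p = p
    ... | inj₂ (x , p) with nonloop-Z {x} (set= (⁅ x ⁆ ∷ B ∷ Y ∷ L ∷ []) (v0 <: v1 ∷ v1 <: v2 || v3 ∷ []) (v0 || (v2 || v3)) (v2 || v3) refl
      (p ∷ B⊑ ∷ []))
    ...   | q = absurd (refute (Z ∷ ⁅ x ⁆ ∷ B ∷ []) [] (v1 <: v2 ∷ []) (rank v0 ⊕ con 1 <= rank (v1 || v0) ∷
      rank (v2 || v0) <= rank v0 ⊕ con 0 ∷ []) (mono (v1 || v0) (v2 || v0) ∷ []) refl (p ∷ []) (q ∷ h ∷ []))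
    clique : ∀ {B} → B ⊑ Y ∪ L → ρ (B ∪ Z) ≤ ρ Z + 1 → Clique (Y ∪ L) Z B
    clique {B} B⊑ h u v u∈ v∈ d = (prove≤ (B ∷ Z ∷ ⁅ u ⁆ ∷ ⁅ v ⁆ ∷ Y ∷ L ∷ []) [] (v2 <: v0 ∷ v3 <: v0 ∷ [])
      (rank (v0 || v1) <= rank v1 ⊕ con 1 ∷ []) (mono (((v4 || v5) - (v2 || v3)) || v1) ((v4 || v5) || v1) ∷
      mono ((v2 || v3) || v1) (v0 || v1) ∷ [])
      (rank ((v2 || v3) || v1) ⊕ rank (((v4 || v5) - (v2 || v3)) || v1))
      ((rank ((v4 || v5) || v1) ⊕ rank v1) ⊕ con 1) refl (u∈ ∷ v∈ ∷ []) (h ∷ [])) , λ (p , q) → T-absurd p q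
      where
      T-absurd : ⁅ u ⁆ ⊑ T → ⁅ v ⁆ ⊑ T → Absurd
      T-absurd p q with T-pairs u v p q d
      ... | s = (refute (Z ∷ ⁅ u ⁆ ∷ ⁅ v ⁆ ∷ B ∷ []) [] (v1 <: v3 ∷ v2 <: v3 ∷ [])
        (rank v0 ⊕ con 2 <= rank ((v1 || v2) || v0) ∷ rank (v3 || v0) <= rank v0 ⊕ con 1 ∷ [])
        (mono ((v1 || v2) || v0) (v3 || v0) ∷ []) refl (u∈ ∷ v∈ ∷ []) (s ∷ h ∷ []))
    no-1 : ∀ A B → A ∪ B ≡ Y ∪ L → A ∩ B ≡ ⊥ →
      ρ (A ∪ Z) + ρ (B ∪ Z) ≤ ρ ((Y ∪ L) ∪ Z) + ρ Z → A ≡ ⊥ ⊎ B ≡ ⊥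
    no-1 A B AB d s with L-split A B (set= (A ∷ B ∷ Y ∷ L ∷ []) (v0 || v1 == v2 || v3 ∷ []) (v3 || (v0 || v1)) (v0 || v1) refl (AB ∷ []))
    ... | inj₁ p = inj₂ (empty (set= (A ∷ B ∷ Y ∷ L ∷ []) (v0 || v1 == v2 || v3 ∷ []) (v1 || (v2 || v3)) (v2 || v3) refl (AB ∷ [])) (sep-B {A} {B} {0} AB d p z≤n (prove≤ (A ∷ Z ∷ B ∷ Y ∷ L ∷ []) [] []
      (rank (v0 || v1) ⊕ rank (v2 || v1) <= rank ((v3 || v4) || v1) ⊕ rank v1 ∷ []) []
      (rank (v0 || v1) ⊕ rank (v2 || v1)) ((rank ((v3 || v4) || v1) ⊕ rank v1) ⊕ con 0) refl [] (s ∷ []))))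
    ... | inj₂ p = inj₁ (empty (set= (A ∷ B ∷ Y ∷ L ∷ []) (v0 || v1 == v2 || v3 ∷ []) (v0 || (v2 || v3)) (v2 || v3) refl (AB ∷ [])) (sep-B {B} {A} {0} (set= (A ∷ B ∷ Y ∷ L ∷ []) (v0 || v1 == v2 || v3 ∷ []) (v1 || v0) (v2 || v3) refl (AB ∷ [])) (set= (A ∷ B ∷ []) (v0 && v1 == ∅ ∷ []) (v1 && v0) ∅ refl (d ∷ [])) p z≤n (prove≤ (A ∷ Z ∷ B ∷ Y ∷ L ∷ []) [] []
      (rank (v0 || v1) ⊕ rank (v2 || v1) <= rank ((v3 || v4) || v1) ⊕ rank v1 ∷ []) []
      (rank (v2 || v1) ⊕ rank (v0 || v1)) ((rank ((v3 || v4) || v1) ⊕ rank v1) ⊕ con 0) refl [] (s ∷ []))))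
    two : ∀ A B → A ∪ B ≡ Y ∪ L → A ∩ B ≡ ⊥ →
      ρ (A ∪ Z) + ρ (B ∪ Z) ≤ ρ ((Y ∪ L) ∪ Z) + ρ Z + 1 → Clique (Y ∪ L) Z A ⊎ Clique (Y ∪ L) Z B
    two A B AB d s with L-split A B (set= (A ∷ B ∷ Y ∷ L ∷ []) (v0 || v1 == v2 || v3 ∷ []) (v3 || (v0 || v1)) (v0 || v1) refl (AB ∷ []))
    ... | inj₁ p = inj₂ (clique (set= (A ∷ B ∷ Y ∷ L ∷ []) (v0 || v1 == v2 || v3 ∷ []) (v1 || (v2 || v3)) (v2 || v3) refl (AB ∷ [])) (sep-B {A} {B} {1} AB d p ≤-refl s))
    ... | inj₂ p = inj₁ (clique (set= (A ∷ B ∷ Y ∷ L ∷ []) (v0 || v1 == v2 || v3 ∷ []) (v0 || (v2 || v3)) (v2 || v3) refl (AB ∷ [])) (sep-B {B} {A} {1} (set= (A ∷ B ∷ Y ∷ L ∷ []) (v0 || v1 == v2 || v3 ∷ []) (v1 || v0) (v2 || v3) refl (AB ∷ [])) (set= (A ∷ B ∷ []) (v0 && v1 == ∅ ∷ []) (v1 && v0) ∅ refl (d ∷ [])) p ≤-refl (prove≤ (A ∷ Z ∷ B ∷ Y ∷ L ∷ []) [] []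
      (rank (v0 || v1) ⊕ rank (v2 || v1) <= (rank ((v3 || v4) || v1) ⊕ rank v1) ⊕ con 1 ∷ []) []
      (rank (v2 || v1) ⊕ rank (v0 || v1)) ((rank ((v3 || v4) || v1) ⊕ rank v1) ⊕ con 1) refl [] (s ∷ []))))

  ⊑⁅⁆⇒≡ : ∀ {x y : Fin n} → ⁅ x ⁆ ⊑ ⁅ y ⁆ → x ≡ y
  ⊑⁅⁆⇒≡ {y = y} h = x∈⁅y⁆⇒x≡y y (⊑⇒∈ h)

  -- A vertical 3-separation (X , e , Y) with at most one element of N in X.

  module _ {e X Y I W} (e∈ : ⁅ e ⁆ ⊑ G) (XY : X ∪ Y ≡ G ─ ⁅ e ⁆) (XY0 : X ∩ Y ≡ ⊥)
      (eX : ρ (X ∪ ⁅ e ⁆) ≤ ρ X) (eY : ρ (Y ∪ ⁅ e ⁆) ≤ ρ Y) (sep : ρ X + ρ Y ≤ ρ G + 2)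
      (rX : 3 ≤ ρ X) (rY : 3 ≤ ρ Y) (μ : Model I W) (IW⊑ : I ∪ W ⊑ G) (e∈W : ⁅ e ⁆ ⊑ W) (one : ∣ X ∩ I ∣ ≤ 1)
      where

    I∩W : I ∩ W ≡ ⊥
    I∩W = disjoint μ

    e-rank : 1 ≤ ρ ⁅ e ⁆
    e-rank = nonloop e∈

    -- Both sides span e, so contracting e brings their connectivity down from 2 to 1 and the
    -- exchange across 2-separations becomes available.
    sep-e : ρ (X ∪ ⁅ e ⁆) + ρ (Y ∪ ⁅ e ⁆) ≤ ρ ((X ∪ Y) ∪ ⁅ e ⁆) + ρ ⁅ e ⁆ + 1
    sep-e = prove≤ (X ∷ ⁅ e ⁆ ∷ Y ∷ G ∷ []) [] (v0 || v2 == v3 - v1 ∷ v1 <: v3 ∷ [])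
      (rank (v0 || v1) <= rank v0 ∷ rank (v2 || v1) <= rank v2 ∷ rank v0 ⊕ rank v2 <= rank v3 ⊕ con 2 ∷
      con 1 <= rank v1 ∷ []) [] (rank (v0 || v1) ⊕ rank (v2 || v1))
      ((rank ((v0 || v2) || v1) ⊕ rank v1) ⊕ con 1) refl (XY ∷ e∈ ∷ []) (eX ∷ eY ∷ sep ∷ e-rank ∷ [])

    open TwoSeparation {X = X} {Y = Y} {C₀ = ⁅ e ⁆} XY0 sep-e

    exact : ρ G + 2 ≤ ρ X + ρ Y
    exact = prove≤ (G ∷ X ∷ ⁅ e ⁆ ∷ Y ∷ []) [] [] (rank v0 ⊕ con 2 <= rank (v1 || v2) ⊕ rank v3 ∷
      rank (v1 || v2) <= rank v1 ∷ []) [] (rank v0 ⊕ con 2) (rank v1 ⊕ rank v3) refl [] (c ∷ eX ∷ [])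
      where
      c = conn₂ {X ∪ ⁅ e ⁆} {Y} (set= (X ∷ Y ∷ G ∷ ⁅ e ⁆ ∷ []) (v0 || v1 == v2 - v3 ∷ v3 <: v2 ∷ []) ((v0 || v3) || v1) v2 refl
        (XY ∷ e∈ ∷ [])) (set= (X ∷ Y ∷ G ∷ ⁅ e ⁆ ∷ []) (v0 || v1 == v2 - v3 ∷ v0 && v1 == ∅ ∷ []) ((v0 || v3) && v1) ∅ refl
        (XY ∷ XY0 ∷ [])) (prove≤ (X ∷ ⁅ e ⁆ ∷ []) [] [] (con 3 <= rank v0 ∷ []) (cmono v0 (v0 || v1) ∷ rc v0 ∷ []) (con 2)
        (card (v0 || v1)) refl [] (rX ∷ [])) (prove≤ (Y ∷ []) [] [] (con 3 <= rank v0 ∷ []) (rc v0 ∷ []) (con 2) (card v0) refl [] (rY ∷ []))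

    -- Y spans e, and a set skew to Y meets the closure of Y in loops only.
    avoids-e : ∀ {Z} → ρ Y + ρ Z ≤ ρ (Y ∪ Z) → ⁅ e ⁆ ∩ Z ≡ ⊥
    avoids-e {Z} skew with inside? e Z
    ... | inj₂ p = p
    ... | inj₁ p = absurd (refute (⁅ e ⁆ ∷ Z ∷ Y ∷ []) [] (v0 <: v1 ∷ []) (rank v2 ⊕ rank v1 <= rank (v2 || v1) ∷
      rank (v2 || v0) <= rank v2 ∷ con 1 <= rank v0 ∷ []) (sub v1 (v2 || v0) ∷ mono v0 (v1 && (v2 || v0)) ∷
      []) refl (p ∷ []) (skew ∷ eY ∷ e-rank ∷ []))

    -- A set Z skew to Y remains neutral after e is contracted, as Y spans e. It can therefore be
    -- contracted as well, with X shrinking to the single element f.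
    contracted : ∀ {Z f} → Z ⊑ X → ⁅ f ⁆ ⊑ X → ρ G ≤ ρ (Y ∪ Z) → ρ Y + ρ Z ≤ ρ (Y ∪ Z) →
      ρ (Z ∪ ⁅ e ⁆) + 1 ≤ ρ ((⁅ f ⁆ ∪ Z) ∪ ⁅ e ⁆) →
      ∃[ I′ ] ∃[ W′ ] Model I′ W′ × ⁅ e ⁆ ∪ Z ⊑ W′ × I′ ∪ W′ ⊑ ((⁅ e ⁆ ∪ Z) ∪ ⁅ f ⁆) ∪ Y
    contracted {Z} {f} Z⊑ f∈ G≤ skew f-new =
      survives {C = Z} {f = f} μ (set= (I ∷ W ∷ G ∷ ⁅ e ⁆ ∷ X ∷ Y ∷ []) (v0 || v1 <: v2 ∷ v0 && v1 == ∅ ∷ v3 <: v1 ∷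
        v4 || v5 == v2 - v3 ∷ []) (v0 || (v4 || v5)) (v4 || v5) refl (IW⊑ ∷ I∩W ∷ e∈W ∷ XY ∷ [])) (set= (I ∷ W ∷ G ∷ X ∷ Y ∷ ⁅ e ⁆ ∷ []) (v0 || v1 <: v2 ∷ v3 || v4 == v2 - v5 ∷ [])
        (v1 || ((v3 || v4) || v5)) ((v3 || v4) || v5) refl (IW⊑ ∷ XY ∷ [])) e∈W one Z⊑ f∈
        (prove≤ (Y ∷ Z ∷ ⁅ e ⁆ ∷ []) [] [] (rank v0 ⊕ rank v1 <= rank (v0 || v1) ∷
          rank (v0 || v2) <= rank v0 ∷ []) (sub v2 v1 ∷ mono (v0 || v1) ((v1 || v0) || v2) ∷ [])
          (rank (v1 || v2) ⊕ rank (v0 || v2)) (rank ((v1 || v0) || v2) ⊕ rank v2) refl [] (skew ∷ eY ∷ [])) f-new (prove≤ (G ∷ Y ∷ Z ∷ X ∷ ⁅ f ⁆ ∷ ⁅ e ⁆ ∷ []) [] (v2 <: v3 ∷ v4 <: v3 ∷ v3 || v1 == v0 - v5 ∷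
          v5 <: v0 ∷ []) (rank v0 <= rank (v1 || v2) ∷ []) (mono (v1 || v2) ((v2 || v1) || v5) ∷
          mono (((v4 || v2) || v1) || v5) v0 ∷ []) (rank (((v4 || v2) || v1) || v5))
          (rank ((v2 || v1) || v5)) refl (Z⊑ ∷ f∈ ∷ XY ∷ e∈ ∷ []) (G≤ ∷ []))

    -- Linking provides Z₀ over which `T` and Y have connectivity 2, so over Z₀ the triangle spans
    -- the guts of the separation. Enlarged to a spanning complement of Y, this set contracts X onto
    -- the guts line, where T ∪ e is kept.
    triangle-opposite : T ⊑ X → Absurd
    triangle-opposite T⊑X with Linking.link R T Y ∣ G ─ (T ∪ Y) ∣ G ⊥ (set= (T ∷ X ∷ Y ∷ []) (v0 <: v1 ∷ v1 && v2 == ∅ ∷ []) (v0 && v2) ∅ refl (T⊑X ∷ XY0 ∷ [])) ≤-refl (set= (X ∷ Y ∷ G ∷ ⁅ e ⁆ ∷ T ∷ []) (v0 || v1 == v2 - v3 ∷ v4 <: v2 ∷ []) ((v4 || v1) || v2) v2 refl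
      (XY ∷ T⊑G ∷ [])) linked
      where
      linked : Linking.Linked R T Y G ⊥
      linked A B AB d TA YB with conn₂ {A} {B} AB d (prove≤ (T ∷ A ∷ []) [] (v0 <: v1 ∷ []) (con 3 <= card v0 ∷ []) (cmono v0 v1 ∷ []) (con 2) (card v1)
        refl (TA ∷ []) (≤-reflexive (sym T-size) ∷ [])) (prove≤ (Y ∷ B ∷ []) [] (v0 <: v1 ∷ []) (con 3 <= rank v0 ∷ []) (cmono v0 v1 ∷ rc v0 ∷ []) (con 2)
        (card v1) refl (YB ∷ []) (rY ∷ []))
      ... | c = prove≤ (G ∷ A ∷ B ∷ []) [] [] (rank v0 ⊕ con 2 <= rank v1 ⊕ rank v2 ∷ []) (c∅ ∷ rc ∅ ∷ [])
        ((rank (v0 || ∅) ⊕ rank ∅) ⊕ con 2) (rank (v1 || ∅) ⊕ rank (v2 || ∅)) refl [] (c ∷ [])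
    -- B makes Y ∪ Z₀ ∪ B spanning. Being independent over T ∪ Y ∪ Z₀, it leaves the connectivity of
    -- `T` and Y untouched.
    ... | Z₀ , Z₀⊑ , z with basis ((T ∪ Y) ∪ Z₀) (G ─ ((T ∪ Y) ∪ Z₀))
    -- Over Z₀ ∪ B the triangle has rank 2 and e accounts for at most one, so some f of `T` remains
    -- unspanned.
    ...   | B , B⊑ , b₁ , b₂ = extended (augment ((Z₀ ∪ B) ∪ ⁅ e ⁆) T (prove≤ (Z₀ ∷ B ∷ T ∷ ⁅ e ⁆ ∷ []) [] [] (rank (v0 || v1) ⊕ con 2 <= rank (v2 || (v0 || v1)) ∷
      card v3 <= con 1 ∷ []) (sub (v0 || v1) v3 ∷ mono (v2 || (v0 || v1)) (((v0 || v1) || v3) || v2) ∷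
      rc v3 ∷ []) (con 1 ⊕ rank ((v0 || v1) || v3)) (rank (((v0 || v1) || v3) || v2)) refl [] (TZ ∷
      ∣⁅ e ⁆∣≤1 ∷ [])))
      where
      Z₀⊑′ : Z₀ ⊑ X ∪ ⁅ e ⁆
      Z₀⊑′ = set= (Z₀ ∷ G ∷ T ∷ Y ∷ X ∷ ⁅ e ⁆ ∷ []) (v0 <: ∅ || (v1 - (v2 || v3)) ∷ v4 || v3 == v1 - v5 ∷ [])
        (v0 || (v4 || v5)) (v4 || v5) refl (Z₀⊑ ∷ XY ∷ [])
      TZ₀ : ρ Z₀ + 2 ≤ ρ (T ∪ Z₀)
      TZ₀ = prove≤ (T ∷ Y ∷ Z₀ ∷ []) [] []
        ((rank ((v0 || v1) || v2) ⊕ rank v2) ⊕ con 2 <= rank (v0 || v2) ⊕ rank (v1 || v2) ∷ [])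
        (mono (v1 || v2) ((v0 || v1) || v2) ∷ []) (rank v2 ⊕ con 2) (rank (v0 || v2)) refl [] (z ∷ [])
      -- Connectivity 2 with Y exhausts the rank of `T`, so Y spans `T` over Z₀.
      YZ₀ : ρ ((T ∪ Y) ∪ Z₀) ≤ ρ (Y ∪ Z₀)
      YZ₀ = prove≤ (T ∷ Y ∷ Z₀ ∷ []) [] []
        ((rank ((v0 || v1) || v2) ⊕ rank v2) ⊕ con 2 <= rank (v0 || v2) ⊕ rank (v1 || v2) ∷
        rank v0 <= con 2 ∷ []) (sub v2 v0 ∷ []) (rank ((v0 || v1) || v2)) (rank (v1 || v2)) refl [] (z ∷
        T-line ∷ [])
      Y-TZ₀ : ρ Y + ρ (T ∪ Z₀) ≤ ρ ((T ∪ Y) ∪ Z₀) + 2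
      Y-TZ₀ = prove≤ (X ∷ Y ∷ G ∷ ⁅ e ⁆ ∷ T ∷ Z₀ ∷ []) [] (v4 <: v0 ∷ v5 <: v0 || v3 ∷ v0 || v1 == v2 - v3 ∷
        v3 <: v2 ∷ []) (rank v0 ⊕ rank v1 <= rank v2 ⊕ con 2 ∷ rank (v0 || v3) <= rank v0 ∷ [])
        (sub ((v4 || v1) || v5) (v0 || v3) ∷ mono (v4 || v5) (((v4 || v1) || v5) && (v0 || v3)) ∷ [])
        (rank v1 ⊕ rank (v4 || v5)) (rank ((v4 || v1) || v5) ⊕ con 2) refl (T⊑X ∷ Z₀⊑′ ∷ XY ∷ e∈ ∷ [])
        (sep ∷ eX ∷ [])
      BG : ρ G ≤ ρ ((T ∪ Y) ∪ Z₀ ∪ B)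
      BG = prove≤ (T ∷ Y ∷ Z₀ ∷ B ∷ G ∷ X ∷ ⁅ e ⁆ ∷ []) [] (v5 || v1 == v4 - v6 ∷ v0 <: v4 ∷
        v2 <: ∅ || (v4 - (v0 || v1)) ∷ [])
        (rank (((v0 || v1) || v2) || (v4 - ((v0 || v1) || v2))) <= rank (((v0 || v1) || v2) || v3) ∷ []) []
        (rank v4) (rank ((v0 || v1) || (v2 || v3))) refl (XY ∷ T⊑G ∷ Z₀⊑ ∷ []) (≤-reflexive (sym b₁) ∷ [])
      G≤ : ρ G ≤ ρ (Y ∪ (Z₀ ∪ B))
      G≤ = prove≤ (G ∷ T ∷ Y ∷ Z₀ ∷ B ∷ []) [] [] (rank v0 <= rank ((v1 || v2) || (v3 || v4)) ∷
        rank ((v1 || v2) || v3) <= rank (v2 || v3) ∷ []) (sub (v2 || (v3 || v4)) ((v1 || v2) || v3) ∷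
        mono (v2 || v3) ((v2 || (v3 || v4)) && ((v1 || v2) || v3)) ∷ []) (rank v0) (rank (v2 || (v3 || v4)))
        refl [] (BG ∷ YZ₀ ∷ [])
      skew : ρ Y + ρ (Z₀ ∪ B) ≤ ρ (Y ∪ (Z₀ ∪ B))
      skew = prove≤ (Y ∷ Z₀ ∷ B ∷ T ∷ []) [] [] (rank ((v3 || v0) || v1) <= rank (v0 || v1) ∷
        rank v0 ⊕ rank (v3 || v1) <= rank ((v3 || v0) || v1) ⊕ con 2 ∷ rank v1 ⊕ con 2 <= rank (v3 || v1) ∷
        rank ((v3 || v0) || v1) ⊕ card v2 <= rank (((v3 || v0) || v1) || v2) ∷ [])
        (sub (v0 || (v1 || v2)) ((v3 || v0) || v1) ∷ sub v1 v2 ∷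
        mono (v0 || v1) ((v0 || (v1 || v2)) && ((v3 || v0) || v1)) ∷ rc v2 ∷ []) (rank v0 ⊕ rank (v1 || v2))
        (rank (v0 || (v1 || v2))) refl [] (YZ₀ ∷ Y-TZ₀ ∷ TZ₀ ∷ ≤-reflexive (sym b₂) ∷ [])
      TZ : ρ (Z₀ ∪ B) + 2 ≤ ρ (T ∪ (Z₀ ∪ B))
      TZ = prove≤ (Z₀ ∷ T ∷ Y ∷ B ∷ []) [] [] (rank v0 ⊕ con 2 <= rank (v1 || v0) ∷
        rank ((v1 || v2) || v0) ⊕ card v3 <= rank (((v1 || v2) || v0) || v3) ∷ [])
        (sub (v1 || (v0 || v3)) ((v1 || v2) || v0) ∷ sub v0 v3 ∷
        mono (v1 || v0) ((v1 || (v0 || v3)) && ((v1 || v2) || v0)) ∷ rc v3 ∷ []) (rank (v0 || v3) ⊕ con 2)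
        (rank (v1 || (v0 || v3))) refl [] (TZ₀ ∷ ≤-reflexive (sym b₂) ∷ [])
      e∉Z : ⁅ e ⁆ ∩ (Z₀ ∪ B) ≡ ⊥
      e∉Z = avoids-e skew
      Z⊑ : Z₀ ∪ B ⊑ X
      Z⊑ = set= (⁅ e ⁆ ∷ Z₀ ∷ B ∷ G ∷ T ∷ Y ∷ X ∷ []) (v0 && (v1 || v2) == ∅ ∷ v1 <: ∅ || (v3 - (v4 || v5)) ∷
        v2 <: v3 - ((v4 || v5) || v1) ∷ v6 || v5 == v3 - v0 ∷ []) ((v1 || v2) || v6) v6 refl (e∉Z ∷ Z₀⊑ ∷
        B⊑ ∷ XY ∷ [])
      Z-disjoint : (T ∪ ⁅ e ⁆) ∩ (Z₀ ∪ B) ≡ ⊥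
      Z-disjoint = set= (⁅ e ⁆ ∷ Z₀ ∷ B ∷ G ∷ T ∷ Y ∷ []) (v0 && (v1 || v2) == ∅ ∷ v1 <: ∅ || (v3 - (v4 || v5)) ∷
        v2 <: v3 - ((v4 || v5) || v1) ∷ []) ((v4 || v0) && (v1 || v2)) ∅ refl (e∉Z ∷ Z₀⊑ ∷ B⊑ ∷ [])
      split : ∀ A B′ → T ∪ ⁅ e ⁆ ⊑ A ∪ B′ →
        ρ (Z₀ ∪ B) + 2 ≤ ρ ((A ∩ (T ∪ ⁅ e ⁆)) ∪ (Z₀ ∪ B)) ⊎ ρ (Z₀ ∪ B) + 2 ≤ ρ ((B′ ∩ (T ∪ ⁅ e ⁆)) ∪ (Z₀ ∪ B))
      split A B′ h with T-sides A B′ (set= (T ∷ ⁅ e ⁆ ∷ A ∷ B′ ∷ []) (v0 || v1 <: v2 || v3 ∷ []) (v0 || (v2 || v3)) (v2 || v3) refl (h ∷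
        []))
      ... | inj₁ p = inj₁ (prove≤ (T ∷ A ∷ Z₀ ∷ B ∷ ⁅ e ⁆ ∷ []) [] [] (con 2 <= rank (v0 && v1) ∷ rank v0 <= con 2 ∷
        rank (v2 || v3) ⊕ con 2 <= rank (v0 || (v2 || v3)) ∷ [])
        (sub ((v1 && (v0 || v4)) || (v2 || v3)) v0 ∷
        mono (v0 && v1) (((v1 && (v0 || v4)) || (v2 || v3)) && v0) ∷
        mono (v0 || (v2 || v3)) (((v1 && (v0 || v4)) || (v2 || v3)) || v0) ∷ []) (rank (v2 || v3) ⊕ con 2)
        (rank ((v1 && (v0 || v4)) || (v2 || v3))) refl [] (T-spanned {A} p ∷ T-line ∷ TZ ∷ []))
      ... | inj₂ p = inj₂ (prove≤ (T ∷ B′ ∷ Z₀ ∷ B ∷ ⁅ e ⁆ ∷ []) [] [] (con 2 <= rank (v0 && v1) ∷ rank v0 <= con 2 ∷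
        rank (v2 || v3) ⊕ con 2 <= rank (v0 || (v2 || v3)) ∷ [])
        (sub ((v1 && (v0 || v4)) || (v2 || v3)) v0 ∷
        mono (v0 && v1) (((v1 && (v0 || v4)) || (v2 || v3)) && v0) ∷
        mono (v0 || (v2 || v3)) (((v1 && (v0 || v4)) || (v2 || v3)) || v0) ∷ []) (rank (v2 || v3) ⊕ con 2)
        (rank ((v1 && (v0 || v4)) || (v2 || v3))) refl [] (T-spanned {B′} p ∷ T-line ∷ TZ ∷ []))
      nonloops : ∀ l → ⁅ l ⁆ ⊑ T ∪ ⁅ e ⁆ → ρ (Z₀ ∪ B) + 1 ≤ ρ (⁅ l ⁆ ∪ (Z₀ ∪ B))
      nonloops l l∈ with inside? l T
      ... | inj₁ p = prove≤ (Z₀ ∷ B ∷ T ∷ ⁅ l ⁆ ∷ []) [] (v3 <: v2 ∷ [])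
        (rank (v0 || v1) ⊕ con 2 <= rank (v2 || (v0 || v1)) ∷ rank v2 <= con 2 ∷ con 1 <= rank v3 ∷ [])
        (sub (v3 || (v0 || v1)) v2 ∷ mono v3 ((v3 || (v0 || v1)) && v2) ∷ []) (rank (v0 || v1) ⊕ con 1)
        (rank (v3 || (v0 || v1))) refl (p ∷ []) (TZ ∷ T-line ∷ l-rank ∷ [])
        where
        l-rank : 1 ≤ ρ ⁅ l ⁆
        l-rank = nonloop (set= (⁅ l ⁆ ∷ T ∷ G ∷ []) (v0 <: v1 ∷ v1 <: v2 ∷ []) (v0 || v2) v2 refl (p ∷ T⊑G ∷ []))
      ... | inj₂ p with ⊑⁅⁆⇒≡ {l} {e} (set= (⁅ l ⁆ ∷ T ∷ ⁅ e ⁆ ∷ []) (v0 <: v1 || v2 ∷ v0 && v1 == ∅ ∷ []) (v0 || v2) v2 refl (l∈ ∷ p ∷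
        []))
      ...   | refl = prove≤ (Y ∷ Z₀ ∷ B ∷ ⁅ l ⁆ ∷ []) [] [] (rank v0 ⊕ rank (v1 || v2) <= rank (v0 || (v1 || v2)) ∷
        rank (v0 || v3) <= rank v0 ∷ con 1 <= rank v3 ∷ []) (sub (v3 || (v1 || v2)) (v0 || v3) ∷
        mono v3 ((v3 || (v1 || v2)) && (v0 || v3)) ∷ mono (v0 || (v1 || v2)) ((v3 || (v1 || v2)) || v0) ∷
        []) (rank (v1 || v2) ⊕ con 1) (rank (v3 || (v1 || v2))) refl [] (skew ∷ eY ∷ e-rank ∷ [])
      extended : ∃[ f ] ⁅ f ⁆ ⊑ T × ρ ((Z₀ ∪ B) ∪ ⁅ e ⁆) < ρ (((Z₀ ∪ B) ∪ ⁅ e ⁆) ∪ ⁅ f ⁆) → Absurd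
      extended (f , f∈ , f-new) with contracted {Z₀ ∪ B} {f} Z⊑ (set= (⁅ f ⁆ ∷ T ∷ X ∷ []) (v0 <: v1 ∷ v1 <: v2 ∷ []) (v0 || v2) v2 refl (f∈ ∷ T⊑X ∷ [])) G≤ skew (prove≤ (Z₀ ∷ B ∷ ⁅ e ⁆ ∷ ⁅ f ⁆ ∷ []) [] []
        (con 1 ⊕ rank ((v0 || v1) || v2) <= rank (((v0 || v1) || v2) || v3) ∷ []) []
        (rank ((v0 || v1) || v2) ⊕ con 1) (rank ((v3 || (v0 || v1)) || v2)) refl [] (f-new ∷ []))
      ... | I′ , W′ , μ′ , p , q = line (X ∪ ⁅ e ⁆) Y (Z₀ ∪ B) (T ∪ ⁅ e ⁆) (set= (X ∷ Y ∷ G ∷ ⁅ e ⁆ ∷ []) (v0 || v1 == v2 - v3 ∷ v3 <: v2 ∷ []) ((v0 || v3) || v1) v2 refl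
        (XY ∷ e∈ ∷ [])) (set= (X ∷ Y ∷ G ∷ ⁅ e ⁆ ∷ []) (v0 || v1 == v2 - v3 ∷ v0 && v1 == ∅ ∷ []) ((v0 || v3) && v1) ∅ refl
        (XY ∷ XY0 ∷ []))
        (prove≤ (X ∷ ⁅ e ⁆ ∷ Y ∷ G ∷ []) [] [] (rank (v0 || v1) <= rank v0 ∷
          rank v0 ⊕ rank v2 <= rank v3 ⊕ con 2 ∷ []) [] (rank (v0 || v1) ⊕ rank v2) (rank v3 ⊕ con 2) refl
          [] (eX ∷ sep ∷ [])) (set= (Z₀ ∷ B ∷ X ∷ ⁅ e ⁆ ∷ []) (v0 || v1 <: v2 ∷ []) ((v0 || v1) || (v2 || v3)) (v2 || v3) refl
          (Z⊑ ∷ [])) (set= (T ∷ X ∷ ⁅ e ⁆ ∷ []) (v0 <: v1 ∷ []) ((v0 || v2) || (v1 || v2)) (v1 || v2) refl (T⊑X ∷ [])) Z-disjoint G≤ skew (prove≤ (G ∷ Y ∷ Z₀ ∷ B ∷ X ∷ []) [] [] (rank v0 <= rank (v1 || (v2 || v3)) ∷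
          rank v4 ⊕ rank v1 <= rank v0 ⊕ con 2 ∷ con 3 <= rank v4 ∷ []) (sub (v2 || v3) v1 ∷ []) (con 1)
          (rank (v2 || v3)) refl [] (G≤ ∷ sep ∷ rX ∷ [])) (prove≤ (X ∷ ⁅ e ⁆ ∷ []) [] [] (con 3 <= rank v0 ∷ []) (cmono v0 (v0 || v1) ∷ rc v0 ∷ []) (con 2)
          (card (v0 || v1)) refl [] (rX ∷ []))
        split nonloops (set= (T ∷ Y ∷ ⁅ e ⁆ ∷ []) [] (v0 || (v1 || (v0 || v2))) (v1 || (v0 || v2)) refl [])
        (λ u v u∈ v∈ d → (prove≤ (⁅ u ⁆ ∷ ⁅ v ⁆ ∷ Z₀ ∷ B ∷ T ∷ []) [] (v0 <: v4 ∷ v1 <: v4 ∷ [])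
          (con 2 <= rank (v0 || v1) ∷ rank (v2 || v3) ⊕ con 2 <= rank (v4 || (v2 || v3)) ∷
          rank v4 <= con 2 ∷ []) (sub ((v0 || v1) || (v2 || v3)) v4 ∷
          mono (v0 || v1) (((v0 || v1) || (v2 || v3)) && v4) ∷ []) (rank (v2 || v3) ⊕ con 2)
          (rank ((v0 || v1) || (v2 || v3))) refl (u∈ ∷ v∈ ∷ []) (T-pair u v u∈ v∈ d ∷ TZ ∷ T-line ∷ [])))
        (I′ , W′ , μ′ , (set= (⁅ e ⁆ ∷ Z₀ ∷ B ∷ W′ ∷ []) (v0 || (v1 || v2) <: v3 ∷ []) ((v1 || v2) || v3) v3 refl (p ∷
          [])) , (set= (⁅ e ⁆ ∷ Z₀ ∷ B ∷ W′ ∷ I′ ∷ ⁅ f ⁆ ∷ Y ∷ T ∷ []) (v0 || (v1 || v2) <: v3 ∷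
          v4 || v3 <: ((v0 || (v1 || v2)) || v5) || v6 ∷ v4 && v3 == ∅ ∷ v5 <: v7 ∷ [])
          (v4 || (v6 || (v7 || v0))) (v6 || (v7 || v0)) refl (p ∷ q ∷ dis ∷ f∈ ∷ [])) , (set= (I′ ∷ W′ ∷ ⁅ e ⁆ ∷ Z₀ ∷ B ∷ ⁅ f ⁆ ∷ Y ∷ T ∷ [])
          (v0 || v1 <: ((v2 || (v3 || v4)) || v5) || v6 ∷ v5 <: v7 ∷ [])
          (v1 || ((v6 || (v7 || v2)) || (v3 || v4))) ((v6 || (v7 || v2)) || (v3 || v4)) refl (q ∷ f∈ ∷ [])))
        where
        dis : I′ ∩ W′ ≡ ⊥
        dis = disjoint μ′

    -- Uncrossing with (X , Y) shows that two opposite quadrants cannot both have two elements.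
    -- Since X and Y have at least three elements each, the two small quadrants found in this way
    -- make up A or B.
    bixby : ∀ {A B} → A ∪ B ≡ G ─ ⁅ e ⁆ → A ∩ B ≡ ⊥ → ρ A + ρ B ≤ ρ G + 1 → ∣ A ∣ ≤ 2 ⊎ ∣ B ∣ ≤ 2
    bixby {A} {B} AB d s
      with 2 ≤? ∣ A ∩ X ∣ | 2 ≤? ∣ B ∩ Y ∣ | 2 ≤? ∣ A ∩ Y ∣ | 2 ≤? ∣ B ∩ X ∣
    -- As X and Y both span e, it joins either union at no cost. The two opposite quadrants have
    -- connectivity at least 2 each in M, against a total of 1 + 2 for the two given separations.
    ... | yes p | yes q | _ | _ = absurd (refute (G ∷ A ∷ X ∷ B ∷ Y ∷ ⁅ e ⁆ ∷ []) [] (v1 || v3 == v0 - v5 ∷ [])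
      (rank v0 ⊕ con 2 <= rank (v1 && v2) ⊕ rank (v3 || (v4 || v5)) ∷
      rank v0 ⊕ con 2 <= rank (v3 && v4) ⊕ rank (v1 || (v2 || v5)) ∷ rank v1 ⊕ rank v3 <= rank v0 ⊕ con 1 ∷
      rank v2 ⊕ rank v4 <= rank v0 ⊕ con 2 ∷ rank (v2 || v5) <= rank v2 ∷ rank (v4 || v5) <= rank v4 ∷ [])
      (sub v1 (v2 || v5) ∷ sub v3 (v4 || v5) ∷ []) refl (AB ∷ []) (c₁ ∷ c₂ ∷ s ∷ sep ∷ eX ∷ eY ∷ []))
      where
      c₁ = conn₂ {A ∩ X} {B ∪ Y ∪ ⁅ e ⁆} (set= (A ∷ B ∷ G ∷ ⁅ e ⁆ ∷ X ∷ Y ∷ []) (v0 || v1 == v2 - v3 ∷ v4 || v5 == v2 - v3 ∷ v3 <: v2 ∷ [])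
        ((v0 && v4) || (v1 || (v5 || v3))) v2 refl (AB ∷ XY ∷ e∈ ∷ [])) (set= (A ∷ B ∷ G ∷ ⁅ e ⁆ ∷ X ∷ Y ∷ []) (v4 || v5 == v2 - v3 ∷ v0 && v1 == ∅ ∷ v4 && v5 == ∅ ∷ [])
        ((v0 && v4) && (v1 || (v5 || v3))) ∅ refl (XY ∷ d ∷ XY0 ∷ [])) p (prove≤ (B ∷ Y ∷ ⁅ e ⁆ ∷ []) [] [] (con 2 <= card (v0 && v1) ∷ [])
        (cmono (v0 && v1) (v0 || (v1 || v2)) ∷ []) (con 2) (card (v0 || (v1 || v2))) refl [] (q ∷ []))
      c₂ = conn₂ {B ∩ Y} {A ∪ X ∪ ⁅ e ⁆} (set= (A ∷ B ∷ G ∷ ⁅ e ⁆ ∷ X ∷ Y ∷ []) (v0 || v1 == v2 - v3 ∷ v4 || v5 == v2 - v3 ∷ v3 <: v2 ∷ [])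
        ((v1 && v5) || (v0 || (v4 || v3))) v2 refl (AB ∷ XY ∷ e∈ ∷ [])) (set= (A ∷ B ∷ G ∷ ⁅ e ⁆ ∷ X ∷ Y ∷ []) (v4 || v5 == v2 - v3 ∷ v0 && v1 == ∅ ∷ v4 && v5 == ∅ ∷ [])
        ((v1 && v5) && (v0 || (v4 || v3))) ∅ refl (XY ∷ d ∷ XY0 ∷ [])) q (prove≤ (A ∷ X ∷ ⁅ e ⁆ ∷ []) [] [] (con 2 <= card (v0 && v1) ∷ [])
        (cmono (v0 && v1) (v0 || (v1 || v2)) ∷ []) (con 2) (card (v0 || (v1 || v2))) refl [] (p ∷ []))
    ... | _ | _ | yes p | yes q = absurd (refute (G ∷ A ∷ Y ∷ B ∷ X ∷ ⁅ e ⁆ ∷ []) [] (v1 || v3 == v0 - v5 ∷ [])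
      (rank v0 ⊕ con 2 <= rank (v1 && v2) ⊕ rank (v3 || (v4 || v5)) ∷
      rank v0 ⊕ con 2 <= rank (v3 && v4) ⊕ rank (v1 || (v2 || v5)) ∷ rank v1 ⊕ rank v3 <= rank v0 ⊕ con 1 ∷
      rank v4 ⊕ rank v2 <= rank v0 ⊕ con 2 ∷ rank (v4 || v5) <= rank v4 ∷ rank (v2 || v5) <= rank v2 ∷ [])
      (sub v1 (v2 || v5) ∷ sub v3 (v4 || v5) ∷ []) refl (AB ∷ []) (c₁ ∷ c₂ ∷ s ∷ sep ∷ eX ∷ eY ∷ []))
      where
      c₁ = conn₂ {A ∩ Y} {B ∪ X ∪ ⁅ e ⁆} (set= (A ∷ B ∷ G ∷ ⁅ e ⁆ ∷ X ∷ Y ∷ []) (v0 || v1 == v2 - v3 ∷ v4 || v5 == v2 - v3 ∷ v3 <: v2 ∷ [])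
        ((v0 && v5) || (v1 || (v4 || v3))) v2 refl (AB ∷ XY ∷ e∈ ∷ [])) (set= (A ∷ B ∷ G ∷ ⁅ e ⁆ ∷ X ∷ Y ∷ []) (v4 || v5 == v2 - v3 ∷ v0 && v1 == ∅ ∷ v4 && v5 == ∅ ∷ [])
        ((v0 && v5) && (v1 || (v4 || v3))) ∅ refl (XY ∷ d ∷ XY0 ∷ [])) p (prove≤ (B ∷ X ∷ ⁅ e ⁆ ∷ []) [] [] (con 2 <= card (v0 && v1) ∷ [])
        (cmono (v0 && v1) (v0 || (v1 || v2)) ∷ []) (con 2) (card (v0 || (v1 || v2))) refl [] (q ∷ []))
      c₂ = conn₂ {B ∩ X} {A ∪ Y ∪ ⁅ e ⁆} (set= (A ∷ B ∷ G ∷ ⁅ e ⁆ ∷ X ∷ Y ∷ []) (v0 || v1 == v2 - v3 ∷ v4 || v5 == v2 - v3 ∷ v3 <: v2 ∷ [])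
        ((v1 && v4) || (v0 || (v5 || v3))) v2 refl (AB ∷ XY ∷ e∈ ∷ [])) (set= (A ∷ B ∷ G ∷ ⁅ e ⁆ ∷ X ∷ Y ∷ []) (v4 || v5 == v2 - v3 ∷ v0 && v1 == ∅ ∷ v4 && v5 == ∅ ∷ [])
        ((v1 && v4) && (v0 || (v5 || v3))) ∅ refl (XY ∷ d ∷ XY0 ∷ [])) q (prove≤ (A ∷ Y ∷ ⁅ e ⁆ ∷ []) [] [] (con 2 <= card (v0 && v1) ∷ [])
        (cmono (v0 && v1) (v0 || (v1 || v2)) ∷ []) (con 2) (card (v0 || (v1 || v2))) refl [] (p ∷ []))
    ... | no p | _ | no q | _ = inj₁ (prove≤ (A ∷ X ∷ Y ∷ B ∷ G ∷ ⁅ e ⁆ ∷ []) [] (v0 || v3 == v4 - v5 ∷ v1 || v2 == v4 - v5 ∷ [])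
      (con 1 ⊕ card (v0 && v1) <= con 2 ∷ con 1 ⊕ card (v0 && v2) <= con 2 ∷ [])
      (csub (v0 && v1) (v0 && v2) ∷ []) (card v0) (con 2) refl (AB ∷ XY ∷ []) (≰⇒> p ∷ ≰⇒> q ∷ []))
    ... | _ | no p | _ | no q = inj₂ (prove≤ (B ∷ Y ∷ X ∷ A ∷ G ∷ ⁅ e ⁆ ∷ []) [] (v3 || v0 == v4 - v5 ∷ v2 || v1 == v4 - v5 ∷ [])
      (con 1 ⊕ card (v0 && v1) <= con 2 ∷ con 1 ⊕ card (v0 && v2) <= con 2 ∷ [])
      (csub (v0 && v1) (v0 && v2) ∷ []) (card v0) (con 2) refl (AB ∷ XY ∷ []) (≰⇒> p ∷ ≰⇒> q ∷ []))
    ... | no p | _ | _ | no q = absurd (refute (A ∷ X ∷ B ∷ G ∷ ⁅ e ⁆ ∷ Y ∷ []) [] (v0 || v2 == v3 - v4 ∷ v1 || v5 == v3 - v4 ∷ [])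
      (con 1 ⊕ card (v0 && v1) <= con 2 ∷ con 1 ⊕ card (v2 && v1) <= con 2 ∷ con 3 <= rank v1 ∷ [])
      (csub (v0 && v1) (v2 && v1) ∷ rc v1 ∷ []) refl (AB ∷ XY ∷ []) (≰⇒> p ∷ ≰⇒> q ∷ rX ∷ []))
    ... | _ | no p | no q | _ = absurd (refute (B ∷ Y ∷ A ∷ G ∷ ⁅ e ⁆ ∷ X ∷ []) [] (v2 || v0 == v3 - v4 ∷ v5 || v1 == v3 - v4 ∷ [])
      (con 1 ⊕ card (v0 && v1) <= con 2 ∷ con 1 ⊕ card (v2 && v1) <= con 2 ∷ con 3 <= rank v1 ∷ [])
      (csub (v0 && v1) (v2 && v1) ∷ rc v1 ∷ []) refl (AB ∷ XY ∷ []) (≰⇒> p ∷ ≰⇒> q ∷ rY ∷ []))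

    -- A 2-separation of the deletion of e has a side of at most two elements, so only series pairs
    -- stand in the way of 3-connectivity. Such a pair is not inside `T`: the other side would then
    -- contain X, hence span e, and M itself would have a 2-separation.
    not-deletable : T ⊑ Y → Has (G ─ ⁅ e ⁆) ⊥ → Absurd
    not-deletable T⊑Y has = reduce _ (G ─ ⁅ e ⁆) ⊥ ≤-refl (set= (G ∷ ⁅ e ⁆ ∷ []) [] ((v0 - v1) && ∅) ∅ refl []) (set= (G ∷ ⁅ e ⁆ ∷ []) [] (((v0 - v1) || ∅) || v0) v0 refl []) (set= (T ∷ Y ∷ X ∷ G ∷ ⁅ e ⁆ ∷ []) (v0 <: v1 ∷ v2 || v1 == v3 - v4 ∷ []) (v0 || (v3 - v4)) (v3 - v4)
      refl (T⊑Y ∷ XY ∷ [])) proper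
      (record { no-1-sep = no-1 ; 2-seps = two }) has
      where
      proper : G ─ ⁅ e ⁆ ≢ G
      proper p = ⊥≡⁅⁆⇒absurd {x = e} (set= (G ∷ ⁅ e ⁆ ∷ []) (v0 - v1 == v0 ∷ v1 <: v0 ∷ []) ∅ v1 refl (p ∷ e∈ ∷ []))
      no-1 : ∀ A B → A ∪ B ≡ G ─ ⁅ e ⁆ → A ∩ B ≡ ⊥ →
        ρ (A ∪ ⊥) + ρ (B ∪ ⊥) ≤ ρ ((G ─ ⁅ e ⁆) ∪ ⊥) + ρ ⊥ → A ≡ ⊥ ⊎ B ≡ ⊥
      no-1 A B AB d s with 1 ≤? ∣ A ∣ | 1 ≤? ∣ B ∣
      ... | no p  | _     = inj₁ (∣∣≤0⇒≡⊥ (prove≤ (A ∷ []) [] [] (con 1 ⊕ card v0 <= con 1 ∷ []) [] (card v0) (con 0) refl [] (≰⇒> p ∷ [])))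
      ... | _     | no q  = inj₂ (∣∣≤0⇒≡⊥ (prove≤ (B ∷ []) [] [] (con 1 ⊕ card v0 <= con 1 ∷ []) [] (card v0) (con 0) refl [] (≰⇒> q ∷ [])))
      ... | yes p | yes q with 2 ≤? ∣ A ∣
      ...   | yes p₂ = absurd (refute (G ∷ A ∷ B ∷ ⁅ e ⁆ ∷ []) [] [] (rank v0 ⊕ con 2 <= rank v1 ⊕ rank (v2 || v3) ∷
        rank (v1 || ∅) ⊕ rank (v2 || ∅) <= rank ((v0 - v3) || ∅) ⊕ rank ∅ ∷ card v3 <= con 1 ∷ [])
        (sub (v2 || ∅) v3 ∷ mono ((v0 - v3) || ∅) (v0 && (v1 || ((v0 - v3) || ∅))) ∷
        mono (v0 && (v1 || ((v0 - v3) || ∅))) v0 ∷ c∅ ∷ rc v3 ∷ rc ∅ ∷ []) refl [] (c ∷ s ∷ ∣⁅ e ⁆∣≤1 ∷ []))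
        where
        c = conn₂ {A} {B ∪ ⁅ e ⁆} (set= (A ∷ B ∷ G ∷ ⁅ e ⁆ ∷ []) (v0 || v1 == v2 - v3 ∷ v3 <: v2 ∷ []) (v0 || (v1 || v3)) v2 refl
          (AB ∷ e∈ ∷ [])) (set= (A ∷ B ∷ G ∷ ⁅ e ⁆ ∷ []) (v0 || v1 == v2 - v3 ∷ v0 && v1 == ∅ ∷ []) (v0 && (v1 || v3)) ∅
          refl (AB ∷ d ∷ [])) p₂ (prove≤ (B ∷ A ∷ G ∷ ⁅ e ⁆ ∷ []) [] (v1 || v0 == v2 - v3 ∷ []) (con 1 <= card v0 ∷
          con 1 <= card v3 ∷ []) (cmod v0 v3 ∷ c∅ ∷ []) (con 2) (card (v0 || v3)) refl (AB ∷ []) (q ∷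
          1≤∣⁅ e ⁆∣ ∷ []))
      ...   | no p₂ = absurd (refute (G ∷ A ∷ ⁅ e ⁆ ∷ B ∷ []) [] [] (rank v0 ⊕ con 2 <= rank (v1 || v2) ⊕ rank v3 ∷
        rank (v1 || ∅) ⊕ rank (v3 || ∅) <= rank ((v0 - v2) || ∅) ⊕ rank ∅ ∷ card v2 <= con 1 ∷ [])
        (sub (v1 || ∅) v2 ∷ mono ((v0 - v2) || ∅) (v0 && (v3 || ((v0 - v2) || ∅))) ∷
        mono (v0 && (v3 || ((v0 - v2) || ∅))) v0 ∷ c∅ ∷ rc v2 ∷ rc ∅ ∷ []) refl [] (c ∷ s ∷ ∣⁅ e ⁆∣≤1 ∷ []))
        where
        c = conn₂ {A ∪ ⁅ e ⁆} {B} (set= (A ∷ B ∷ G ∷ ⁅ e ⁆ ∷ []) (v0 || v1 == v2 - v3 ∷ v3 <: v2 ∷ []) ((v0 || v3) || v1) v2 refl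
          (AB ∷ e∈ ∷ [])) (set= (A ∷ B ∷ G ∷ ⁅ e ⁆ ∷ []) (v0 || v1 == v2 - v3 ∷ v0 && v1 == ∅ ∷ []) ((v0 || v3) && v1) ∅
          refl (AB ∷ d ∷ [])) (prove≤ (A ∷ B ∷ G ∷ ⁅ e ⁆ ∷ []) [] (v0 || v1 == v2 - v3 ∷ []) (con 1 <= card v0 ∷
          con 1 <= card v3 ∷ []) (cmod v0 v3 ∷ c∅ ∷ []) (con 2) (card (v0 || v3)) refl (AB ∷ []) (p ∷
          1≤∣⁅ e ⁆∣ ∷ [])) (prove≤ (A ∷ B ∷ G ∷ ⁅ e ⁆ ∷ []) [] (v0 || v1 == v2 - v3 ∷ v3 <: v2 ∷ []) (con 4 <= card v2 ∷
          con 1 ⊕ card v0 <= con 2 ∷ card v3 <= con 1 ∷ []) (csub v1 (v0 || v3) ∷ csub v0 v3 ∷ []) (con 2)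
          (card v1) refl (AB ∷ e∈ ∷ []) (G-size ∷ ≰⇒> p₂ ∷ ∣⁅ e ⁆∣≤1 ∷ []))
      small-clique : ∀ {A B} → A ∪ B ≡ G ─ ⁅ e ⁆ → A ∩ B ≡ ⊥ → ρ A + ρ B ≤ ρ G + 1 → ∣ A ∣ ≤ 2 →
        Clique (G ─ ⁅ e ⁆) ⊥ A
      small-clique {A} {B} AB d s small u v u∈ v∈ uv = (prove≤ (A ∷ ⁅ u ⁆ ∷ ⁅ v ⁆ ∷ B ∷ G ∷ ⁅ e ⁆ ∷ []) [] (v0 == v1 || v2 ∷ v0 || v3 == v4 - v5 ∷
        v0 && v3 == ∅ ∷ []) (rank v0 ⊕ rank v3 <= rank v4 ⊕ con 1 ∷ rank v4 <= rank (v4 - v5) ∷ []) []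
        (rank ((v1 || v2) || ∅) ⊕ rank (((v4 - v5) - (v1 || v2)) || ∅))
        ((rank ((v4 - v5) || ∅) ⊕ rank ∅) ⊕ con 1) refl (A≡ ∷ AB ∷ d ∷ []) (s ∷ full ∷ [])) , λ (p , q) → T-absurd p q
        where
        full : ρ G ≤ ρ (G ─ ⁅ e ⁆)
        full = spans {⁅ e ⁆} e∈ (prove≤ (⁅ e ⁆ ∷ []) [] [] (card v0 <= con 1 ∷ []) [] (card v0) (con 1) refl [] (∣⁅ e ⁆∣≤1 ∷ []))
        A≡ : A ≡ ⁅ u ⁆ ∪ ⁅ v ⁆
        A≡ = set= (A ∷ ⁅ u ⁆ ∷ ⁅ v ⁆ ∷ []) (v0 - (v1 || v2) == ∅ ∷ v1 <: v0 ∷ v2 <: v0 ∷ []) v0 (v1 || v2)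
          refl ((∣∣≤0⇒≡⊥ {A = A ─ (⁅ u ⁆ ∪ ⁅ v ⁆)} rest) ∷ u∈ ∷ v∈ ∷ [])
          where
          rest : ∣ A ─ (⁅ u ⁆ ∪ ⁅ v ⁆) ∣ ≤ 0
          rest = prove≤ (A ∷ ⁅ u ⁆ ∷ ⁅ v ⁆ ∷ []) [] (v1 <: v0 ∷ v2 <: v0 ∷ v1 && v2 == ∅ ∷ [])
            (card v0 <= con 2 ∷ con 1 <= card v1 ∷ con 1 <= card v2 ∷ []) (cmod (v0 - (v1 || v2)) v1 ∷
            cmod v2 ((v0 - (v1 || v2)) || v1) ∷ c∅ ∷ c∅ ∷ []) (card (v0 - (v1 || v2))) (con 0) refl (u∈ ∷
            v∈ ∷ uv ∷ []) (small ∷ 1≤∣⁅ u ⁆∣ ∷ 1≤∣⁅ v ⁆∣ ∷ [])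
        T-absurd : ⁅ u ⁆ ⊑ T → ⁅ v ⁆ ⊑ T → Absurd
        T-absurd p q = (refute (G ∷ A ∷ B ∷ ⁅ e ⁆ ∷ X ∷ []) [] (v4 <: v2 ∷ [])
          (rank v0 ⊕ con 2 <= rank v1 ⊕ rank (v2 || v3) ∷ rank v1 ⊕ rank v2 <= rank v0 ⊕ con 1 ∷
          rank (v4 || v3) <= rank v4 ∷ []) (sub v2 (v4 || v3) ∷ mono v4 (v2 && (v4 || v3)) ∷ []) refl (X⊑B ∷
          []) (c ∷ s ∷ eX ∷ []))
          where
          X⊑B : X ⊑ B
          X⊑B = set= (A ∷ ⁅ u ⁆ ∷ ⁅ v ⁆ ∷ B ∷ G ∷ ⁅ e ⁆ ∷ X ∷ Y ∷ T ∷ []) (v0 == v1 || v2 ∷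
            v0 || v3 == v4 - v5 ∷ v6 || v7 == v4 - v5 ∷ v6 && v7 == ∅ ∷ v1 <: v8 ∷ v2 <: v8 ∷ v8 <: v7 ∷ [])
            (v6 || v3) v3 refl (A≡ ∷ AB ∷ XY ∷ XY0 ∷ p ∷ q ∷ T⊑Y ∷ [])
          c = conn₂ {A} {B ∪ ⁅ e ⁆} (set= (A ∷ B ∷ G ∷ ⁅ e ⁆ ∷ []) (v0 || v1 == v2 - v3 ∷ v3 <: v2 ∷ []) (v0 || (v1 || v3)) v2 refl
            (AB ∷ e∈ ∷ [])) (set= (A ∷ B ∷ G ∷ ⁅ e ⁆ ∷ []) (v0 || v1 == v2 - v3 ∷ v0 && v1 == ∅ ∷ []) (v0 && (v1 || v3)) ∅
            refl (AB ∷ d ∷ [])) (prove≤ (A ∷ ⁅ u ⁆ ∷ ⁅ v ⁆ ∷ []) [] (v0 == v1 || v2 ∷ v1 && v2 == ∅ ∷ []) (con 1 <= card v1 ∷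
            con 1 <= card v2 ∷ []) (cmod v1 v2 ∷ c∅ ∷ []) (con 2) (card v0) refl (A≡ ∷ uv ∷ []) (1≤∣⁅ u ⁆∣ ∷
            1≤∣⁅ v ⁆∣ ∷ [])) (prove≤ (X ∷ B ∷ ⁅ e ⁆ ∷ []) [] (v0 <: v1 ∷ []) (con 3 <= rank v0 ∷ []) (cmono v0 (v1 || v2) ∷
            rc v0 ∷ []) (con 2) (card (v1 || v2)) refl (X⊑B ∷ []) (rX ∷ []))
      two : ∀ A B → A ∪ B ≡ G ─ ⁅ e ⁆ → A ∩ B ≡ ⊥ →
        ρ (A ∪ ⊥) + ρ (B ∪ ⊥) ≤ ρ ((G ─ ⁅ e ⁆) ∪ ⊥) + ρ ⊥ + 1 →
        Clique (G ─ ⁅ e ⁆) ⊥ A ⊎ Clique (G ─ ⁅ e ⁆) ⊥ B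
      two A B AB d s with bixby {A} {B} AB d (prove≤ (A ∷ B ∷ G ∷ ⁅ e ⁆ ∷ []) [] []
        (rank (v0 || ∅) ⊕ rank (v1 || ∅) <= (rank ((v2 - v3) || ∅) ⊕ rank ∅) ⊕ con 1 ∷ [])
        (mono ((v2 - v3) || ∅) v2 ∷ c∅ ∷ rc ∅ ∷ []) (rank v0 ⊕ rank v1) (rank v2 ⊕ con 1) refl [] (s ∷ []))
      ... | inj₁ p = inj₁ (small-clique {A} {B} AB d (prove≤ (A ∷ B ∷ G ∷ ⁅ e ⁆ ∷ []) [] []
        (rank (v0 || ∅) ⊕ rank (v1 || ∅) <= (rank ((v2 - v3) || ∅) ⊕ rank ∅) ⊕ con 1 ∷ [])
        (mono ((v2 - v3) || ∅) v2 ∷ c∅ ∷ rc ∅ ∷ []) (rank v0 ⊕ rank v1) (rank v2 ⊕ con 1) refl [] (s ∷ [])) p)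
      ... | inj₂ p = inj₂ (small-clique {B} {A} (set= (A ∷ B ∷ G ∷ ⁅ e ⁆ ∷ []) (v0 || v1 == v2 - v3 ∷ []) (v1 || v0) (v2 - v3) refl (AB ∷ [])) (set= (A ∷ B ∷ []) (v0 && v1 == ∅ ∷ []) (v1 && v0) ∅ refl (d ∷ [])) (prove≤ (A ∷ B ∷ G ∷ ⁅ e ⁆ ∷ []) [] []
        (rank (v0 || ∅) ⊕ rank (v1 || ∅) <= (rank ((v2 - v3) || ∅) ⊕ rank ∅) ⊕ con 1 ∷ [])
        (mono ((v2 - v3) || ∅) v2 ∷ c∅ ∷ rc ∅ ∷ []) (rank v1 ⊕ rank v0) (rank v2 ⊕ con 1) refl [] (s ∷ [])) p)

    -- Z is a complement of Y inside X. Contracting it projects X onto the guts line, on which e and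
    -- f are distinct points. A third point g is wanted because among three points every partition
    -- leaves two on one side, which then span the line. If there is none, e turns out to be
    -- deletable.
    triangle-same : T ⊑ Y → Absurd
    triangle-same T⊑Y with basis Y X
    ... | Z , Z⊑ , b₁ , b₂ = extended (augment (Z ∪ ⁅ e ⁆) X Ze)
      where
      G≤ : ρ G ≤ ρ (Y ∪ Z)
      G≤ = prove≤ (Y ∷ Z ∷ X ∷ G ∷ ⁅ e ⁆ ∷ []) [] (v2 || v0 == v3 - v4 ∷ v4 <: v3 ∷ [])
        (rank (v0 || v2) <= rank (v0 || v1) ∷ rank (v0 || v4) <= rank v0 ∷ []) (sub (v0 || v2) (v0 || v4) ∷
        []) (rank v3) (rank (v0 || v1)) refl (XY ∷ e∈ ∷ []) (≤-reflexive (sym b₁) ∷ eY ∷ [])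
      skew : ρ Y + ρ Z ≤ ρ (Y ∪ Z)
      skew = prove≤ (Y ∷ Z ∷ []) [] [] (rank v0 ⊕ card v1 <= rank (v0 || v1) ∷ []) (rc v1 ∷ [])
        (rank v0 ⊕ rank v1) (rank (v0 || v1)) refl [] (≤-reflexive (sym b₂) ∷ [])
      Ze : ρ (Z ∪ ⁅ e ⁆) < ρ ((Z ∪ ⁅ e ⁆) ∪ X)
      Ze = prove≤ (G ∷ X ∷ Y ∷ Z ∷ ⁅ e ⁆ ∷ []) [] (v1 || v2 == v0 - v4 ∷ v3 <: v1 ∷ [])
        (rank v0 ⊕ con 2 <= rank v1 ⊕ rank v2 ∷ rank v2 ⊕ card v3 <= rank (v2 || v3) ∷ card v4 <= con 1 ∷
        []) (csub v3 v4 ∷ mono v1 ((v3 || v4) || v1) ∷ mono (v2 || v3) v0 ∷ rc (v3 || v4) ∷ [])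
        (con 1 ⊕ rank (v3 || v4)) (rank ((v3 || v4) || v1)) refl (XY ∷ Z⊑ ∷ []) (exact ∷
        ≤-reflexive (sym b₂) ∷ ∣⁅ e ⁆∣≤1 ∷ [])
      e∉Z : ⁅ e ⁆ ∩ Z ≡ ⊥
      e∉Z = avoids-e skew
      eZ : ρ Z + 1 ≤ ρ (⁅ e ⁆ ∪ Z)
      eZ = prove≤ (Y ∷ Z ∷ ⁅ e ⁆ ∷ []) [] [] (rank v0 ⊕ rank v1 <= rank (v0 || v1) ∷
        rank (v0 || v2) <= rank v0 ∷ con 1 <= rank v2 ∷ []) (sub (v2 || v1) (v0 || v2) ∷
        mono v2 ((v2 || v1) && (v0 || v2)) ∷ mono (v0 || v1) ((v2 || v1) || v0) ∷ []) (rank v1 ⊕ con 1)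
        (rank (v2 || v1)) refl [] (skew ∷ eY ∷ e-rank ∷ [])
      extended : ∃[ f ] ⁅ f ⁆ ⊑ X × ρ (Z ∪ ⁅ e ⁆) < ρ ((Z ∪ ⁅ e ⁆) ∪ ⁅ f ⁆) → Absurd
      extended (f , f∈ , f-new) with contracted {Z} {f} Z⊑ f∈ G≤ skew (prove≤ (Z ∷ ⁅ e ⁆ ∷ ⁅ f ⁆ ∷ []) [] [] (con 1 ⊕ rank (v0 || v1) <= rank ((v0 || v1) || v2) ∷ []) []
        (rank (v0 || v1) ⊕ con 1) (rank ((v2 || v0) || v1)) refl [] (f-new ∷ []))
      ... | I′ , W′ , μ′ , p , q = decide (any? λ g →
          ((⁅ g ⁆ ∪ X) ≟ˢ X) ×-dec (ρ Z + 2 ≤? ρ ((⁅ g ⁆ ∪ ⁅ e ⁆) ∪ Z)) ×-dec (ρ Z + 2 ≤? ρ ((⁅ g ⁆ ∪ ⁅ f ⁆) ∪ Z)))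
        where
        dis : I′ ∩ W′ ≡ ⊥
        dis = disjoint μ′
        ef : ρ Z + 2 ≤ ρ ((⁅ e ⁆ ∪ ⁅ f ⁆) ∪ Z)
        ef = prove≤ (Z ∷ ⁅ e ⁆ ∷ ⁅ f ⁆ ∷ []) [] [] (con 1 ⊕ rank (v0 || v1) <= rank ((v0 || v1) || v2) ∷
          rank v0 ⊕ con 1 <= rank (v1 || v0) ∷ []) [] (rank v0 ⊕ con 2) (rank ((v1 || v2) || v0)) refl []
          (f-new ∷ eZ ∷ [])
        decide : Dec (∃[ g ] ⁅ g ⁆ ⊑ X × ρ Z + 2 ≤ ρ ((⁅ g ⁆ ∪ ⁅ e ⁆) ∪ Z) × ρ Z + 2 ≤ ρ ((⁅ g ⁆ ∪ ⁅ f ⁆) ∪ Z)) → Absurd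
        decide (yes (g , g∈ , ge , gf)) = line (X ∪ ⁅ e ⁆) Y Z (⁅ e ⁆ ∪ ⁅ f ⁆ ∪ ⁅ g ⁆)
          (set= (X ∷ Y ∷ G ∷ ⁅ e ⁆ ∷ []) (v0 || v1 == v2 - v3 ∷ v3 <: v2 ∷ []) ((v0 || v3) || v1) v2 refl
            (XY ∷ e∈ ∷ [])) (set= (X ∷ Y ∷ G ∷ ⁅ e ⁆ ∷ []) (v0 || v1 == v2 - v3 ∷ v0 && v1 == ∅ ∷ []) ((v0 || v3) && v1) ∅
            refl (XY ∷ XY0 ∷ [])) (prove≤ (X ∷ ⁅ e ⁆ ∷ Y ∷ G ∷ []) [] [] (rank (v0 || v1) <= rank v0 ∷
            rank v0 ⊕ rank v2 <= rank v3 ⊕ con 2 ∷ []) [] (rank (v0 || v1) ⊕ rank v2) (rank v3 ⊕ con 2) refl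
            [] (eX ∷ sep ∷ [])) (set= (Z ∷ X ∷ ⁅ e ⁆ ∷ []) (v0 <: v1 ∷ []) (v0 || (v1 || v2)) (v1 || v2) refl (Z⊑ ∷ [])) (set= (⁅ f ⁆ ∷ X ∷ ⁅ g ⁆ ∷ ⁅ e ⁆ ∷ []) (v0 <: v1 ∷ v2 <: v1 ∷ [])
            ((v3 || (v0 || v2)) || (v1 || v3)) (v1 || v3) refl (f∈ ∷ g∈ ∷ [])) disjoint-Z
          G≤ skew (prove≤ (G ∷ Y ∷ Z ∷ X ∷ []) [] [] (rank v0 <= rank (v1 || v2) ∷
            rank v3 ⊕ rank v1 <= rank v0 ⊕ con 2 ∷ con 3 <= rank v3 ∷ []) (sub v2 v1 ∷ []) (con 1) (rank v2)
            refl [] (G≤ ∷ sep ∷ rX ∷ [])) (prove≤ (X ∷ ⁅ e ⁆ ∷ []) [] [] (con 3 <= rank v0 ∷ []) (cmono v0 (v0 || v1) ∷ rc v0 ∷ [])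
            (con 2) (card (v0 || v1)) refl [] (rX ∷ [])) split nonloops (set= (T ∷ Y ∷ ⁅ e ⁆ ∷ ⁅ f ⁆ ∷ ⁅ g ⁆ ∷ []) (v0 <: v1 ∷ []) (v0 || (v1 || (v2 || (v3 || v4))))
            (v1 || (v2 || (v3 || v4))) refl (T⊑Y ∷ []))
          (λ u v u∈ v∈ d → (prove≤ (⁅ u ⁆ ∷ ⁅ v ⁆ ∷ Y ∷ Z ∷ T ∷ []) [] (v0 <: v4 ∷ v1 <: v4 ∷ v4 <: v2 ∷ [])
            (con 2 <= rank (v0 || v1) ∷ rank v2 ⊕ rank v3 <= rank (v2 || v3) ∷ [])
            (sub ((v0 || v1) || v3) v2 ∷ mono (v0 || v1) (((v0 || v1) || v3) && v2) ∷ []) (rank v3 ⊕ con 2)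
            (rank ((v0 || v1) || v3)) refl (u∈ ∷ v∈ ∷ T⊑Y ∷ []) (T-pair u v u∈ v∈ d ∷ skew ∷ [])))
          (I′ , W′ , μ′ , (set= (⁅ e ⁆ ∷ Z ∷ W′ ∷ []) (v0 || v1 <: v2 ∷ []) (v1 || v2) v2 refl (p ∷ [])) , (set= (⁅ e ⁆ ∷ Z ∷ W′ ∷ I′ ∷ ⁅ f ⁆ ∷ Y ∷ ⁅ g ⁆ ∷ []) (v0 || v1 <: v2 ∷
            v3 || v2 <: ((v0 || v1) || v4) || v5 ∷ v3 && v2 == ∅ ∷ []) (v3 || (v5 || (v0 || (v4 || v6))))
            (v5 || (v0 || (v4 || v6))) refl (p ∷ q ∷ dis ∷ [])) , (set= (I′ ∷ W′ ∷ ⁅ e ⁆ ∷ Z ∷ ⁅ f ⁆ ∷ Y ∷ ⁅ g ⁆ ∷ []) (v0 || v1 <: ((v2 || v3) || v4) || v5 ∷ [])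
            (v1 || ((v5 || (v2 || (v4 || v6))) || v3)) ((v5 || (v2 || (v4 || v6))) || v3) refl (q ∷ [])))
          where
          fZ : ρ Z + 1 ≤ ρ (⁅ f ⁆ ∪ Z)
          fZ = prove≤ (Z ∷ ⁅ e ⁆ ∷ ⁅ f ⁆ ∷ []) [] [] (rank v0 ⊕ con 2 <= rank ((v1 || v2) || v0) ∷
            card v1 <= con 1 ∷ []) (sub (v2 || v0) v1 ∷ rc v1 ∷ []) (rank v0 ⊕ con 1) (rank (v2 || v0)) refl
            [] (ef ∷ ∣⁅ e ⁆∣≤1 ∷ [])
          gZ : ρ Z + 1 ≤ ρ (⁅ g ⁆ ∪ Z)
          gZ = prove≤ (Z ∷ ⁅ g ⁆ ∷ ⁅ e ⁆ ∷ []) [] [] (rank v0 ⊕ con 2 <= rank ((v1 || v2) || v0) ∷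
            card v2 <= con 1 ∷ []) (sub (v1 || v0) v2 ∷ rc v2 ∷ []) (rank v0 ⊕ con 1) (rank (v1 || v0)) refl
            [] (ge ∷ ∣⁅ e ⁆∣≤1 ∷ [])
          avoid : ∀ {h} → ρ Z + 1 ≤ ρ (⁅ h ⁆ ∪ Z) → ⁅ h ⁆ ∩ Z ≡ ⊥
          avoid {h} r with inside? h Z
          ... | inj₂ s = s
          ... | inj₁ s = absurd (refute (⁅ h ⁆ ∷ Z ∷ []) [] (v0 <: v1 ∷ []) (rank v1 ⊕ con 1 <= rank (v0 || v1) ∷ []) [] refl
            (s ∷ []) (r ∷ []))
          disjoint-Z : (⁅ e ⁆ ∪ ⁅ f ⁆ ∪ ⁅ g ⁆) ∩ Z ≡ ⊥
          disjoint-Z = set= (⁅ e ⁆ ∷ Z ∷ ⁅ f ⁆ ∷ ⁅ g ⁆ ∷ []) (v0 && v1 == ∅ ∷ v2 && v1 == ∅ ∷ v3 && v1 == ∅ ∷ [])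
            ((v0 || (v2 || v3)) && v1) ∅ refl ((avoid eZ) ∷ (avoid fZ) ∷ (avoid gZ) ∷ [])
          nonloops : ∀ l → ⁅ l ⁆ ⊑ ⁅ e ⁆ ∪ ⁅ f ⁆ ∪ ⁅ g ⁆ → ρ Z + 1 ≤ ρ (⁅ l ⁆ ∪ Z)
          nonloops l l∈ with inside? l ⁅ e ⁆ | inside? l ⁅ f ⁆
          ... | inj₁ s | _      rewrite ⊑⁅⁆⇒≡ {l} {e} s = eZ
          ... | inj₂ _ | inj₁ s rewrite ⊑⁅⁆⇒≡ {l} {f} s = fZ
          ... | inj₂ s | inj₂ t rewrite ⊑⁅⁆⇒≡ {l} {g} (set= (⁅ l ⁆ ∷ ⁅ e ⁆ ∷ ⁅ f ⁆ ∷ ⁅ g ⁆ ∷ []) (v0 <: v1 || (v2 || v3) ∷ v0 && v1 == ∅ ∷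
            v0 && v2 == ∅ ∷ []) (v0 || v3) v3 refl (l∈ ∷ s ∷ t ∷ [])) = gZ
          split : ∀ A B → ⁅ e ⁆ ∪ ⁅ f ⁆ ∪ ⁅ g ⁆ ⊑ A ∪ B →
            ρ Z + 2 ≤ ρ ((A ∩ (⁅ e ⁆ ∪ ⁅ f ⁆ ∪ ⁅ g ⁆)) ∪ Z) ⊎ ρ Z + 2 ≤ ρ ((B ∩ (⁅ e ⁆ ∪ ⁅ f ⁆ ∪ ⁅ g ⁆)) ∪ Z)
          split A B h with inside? e A | inside? f A | inside? g A
          ... | inj₁ a | inj₁ b | _      = inj₁ (prove≤ (⁅ e ⁆ ∷ A ∷ ⁅ f ⁆ ∷ Z ∷ ⁅ g ⁆ ∷ []) [] (v0 <: v1 ∷ v2 <: v1 ∷ [])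
            (rank v3 ⊕ con 2 <= rank ((v0 || v2) || v3) ∷ [])
            (mono ((v0 || v2) || v3) ((v1 && (v0 || (v2 || v4))) || v3) ∷ []) (rank v3 ⊕ con 2)
            (rank ((v1 && (v0 || (v2 || v4))) || v3)) refl (a ∷ b ∷ []) (ef ∷ []))
          ... | inj₁ a | inj₂ _ | inj₁ c = inj₁ (prove≤ (⁅ e ⁆ ∷ A ∷ ⁅ g ⁆ ∷ Z ∷ ⁅ f ⁆ ∷ []) [] (v0 <: v1 ∷ v2 <: v1 ∷ [])
            (rank v3 ⊕ con 2 <= rank ((v2 || v0) || v3) ∷ [])
            (mono ((v2 || v0) || v3) ((v1 && (v0 || (v4 || v2))) || v3) ∷ []) (rank v3 ⊕ con 2)
            (rank ((v1 && (v0 || (v4 || v2))) || v3)) refl (a ∷ c ∷ []) (ge ∷ []))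
          ... | inj₁ _ | inj₂ b | inj₂ c = inj₂ (prove≤ (⁅ f ⁆ ∷ A ∷ ⁅ g ⁆ ∷ ⁅ e ⁆ ∷ B ∷ Z ∷ []) [] (v0 && v1 == ∅ ∷ v2 && v1 == ∅ ∷
            v3 || (v0 || v2) <: v1 || v4 ∷ []) (rank v5 ⊕ con 2 <= rank ((v2 || v0) || v5) ∷ [])
            (mono ((v2 || v0) || v5) ((v4 && (v3 || (v0 || v2))) || v5) ∷ []) (rank v5 ⊕ con 2)
            (rank ((v4 && (v3 || (v0 || v2))) || v5)) refl (b ∷ c ∷ h ∷ []) (gf ∷ []))
          ... | inj₂ _ | inj₁ b | inj₁ c = inj₁ (prove≤ (⁅ f ⁆ ∷ A ∷ ⁅ g ⁆ ∷ Z ∷ ⁅ e ⁆ ∷ []) [] (v0 <: v1 ∷ v2 <: v1 ∷ [])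
            (rank v3 ⊕ con 2 <= rank ((v2 || v0) || v3) ∷ [])
            (mono ((v2 || v0) || v3) ((v1 && (v4 || (v0 || v2))) || v3) ∷ []) (rank v3 ⊕ con 2)
            (rank ((v1 && (v4 || (v0 || v2))) || v3)) refl (b ∷ c ∷ []) (gf ∷ []))
          ... | inj₂ a | inj₂ b | _      = inj₂ (prove≤ (⁅ e ⁆ ∷ A ∷ ⁅ f ⁆ ∷ ⁅ g ⁆ ∷ B ∷ Z ∷ []) [] (v0 && v1 == ∅ ∷ v2 && v1 == ∅ ∷
            v0 || (v2 || v3) <: v1 || v4 ∷ []) (rank v5 ⊕ con 2 <= rank ((v0 || v2) || v5) ∷ [])
            (mono ((v0 || v2) || v5) ((v4 && (v0 || (v2 || v3))) || v5) ∷ []) (rank v5 ⊕ con 2)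
            (rank ((v4 && (v0 || (v2 || v3))) || v5)) refl (a ∷ b ∷ h ∷ []) (ef ∷ []))
          ... | inj₂ a | inj₁ _ | inj₂ c = inj₂ (prove≤ (⁅ e ⁆ ∷ A ∷ ⁅ g ⁆ ∷ ⁅ f ⁆ ∷ B ∷ Z ∷ []) [] (v0 && v1 == ∅ ∷ v2 && v1 == ∅ ∷
            v0 || (v3 || v2) <: v1 || v4 ∷ []) (rank v5 ⊕ con 2 <= rank ((v2 || v0) || v5) ∷ [])
            (mono ((v2 || v0) || v5) ((v4 && (v0 || (v3 || v2))) || v5) ∷ []) (rank v5 ⊕ con 2)
            (rank ((v4 && (v0 || (v3 || v2))) || v5)) refl (a ∷ c ∷ h ∷ []) (ge ∷ []))
        -- A point g of X that is not spanned by f over Z must be parallel to e over Z, not being a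
        -- third point. So W′ may contract g in place of e, and e is free to be deleted.
        decide (no none) with augment (Z ∪ ⁅ f ⁆) X (prove≤ (G ∷ X ∷ Y ∷ Z ∷ ⁅ e ⁆ ∷ ⁅ f ⁆ ∷ []) [] (v3 <: v1 ∷ v1 || v2 == v0 - v4 ∷ [])
          (rank v0 ⊕ con 2 <= rank v1 ⊕ rank v2 ∷ rank v2 ⊕ card v3 <= rank (v2 || v3) ∷ card v5 <= con 1 ∷
          []) (csub v3 v5 ∷ mono v1 ((v3 || v5) || v1) ∷ mono (v2 || v3) v0 ∷ rc (v3 || v5) ∷ [])
          (con 1 ⊕ rank (v3 || v5)) (rank ((v3 || v5) || v1)) refl (Z⊑ ∷ XY ∷ []) (exact ∷
          ≤-reflexive (sym b₂) ∷ ∣⁅ f ⁆∣≤1 ∷ []))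
        ... | g , g∈ , g-new = not-deletable T⊑Y
          (I′ , (W′ ─ ⁅ e ⁆) ∪ ⁅ g ⁆ , recontract _ μ′ (set= (I′ ∷ W′ ∷ ⁅ g ⁆ ∷ ⁅ e ⁆ ∷ []) (v0 && v1 == ∅ ∷ v0 && v2 == ∅ ∷ [])
            (v0 && ((v1 - v3) || v2)) ∅ refl (dis ∷ g∉I ∷ [])) same , (set= (W′ ∷ ⁅ e ⁆ ∷ ⁅ g ⁆ ∷ []) [] (∅ || ((v0 - v1) || v2)) ((v0 - v1) || v2) refl []) , (set= (I′ ∷ W′ ∷ ⁅ e ⁆ ∷ Z ∷ ⁅ f ⁆ ∷ Y ∷ X ∷ G ∷ []) (v0 || v1 <: ((v2 || v3) || v4) || v5 ∷
            v4 <: v6 ∷ v6 || v5 == v7 - v2 ∷ v2 || v3 <: v1 ∷ v0 && v1 == ∅ ∷ []) (v0 || (v7 - v2))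
            (v7 - v2) refl (q ∷ f∈ ∷ XY ∷ p ∷ dis ∷ [])) ,
           (set= (I′ ∷ W′ ∷ ⁅ e ⁆ ∷ Z ∷ ⁅ f ⁆ ∷ Y ∷ X ∷ G ∷ ⁅ g ⁆ ∷ [])
             (v0 || v1 <: ((v2 || v3) || v4) || v5 ∷ v4 <: v6 ∷ v3 <: v6 ∷ v6 || v5 == v7 - v2 ∷ v8 <: v6 ∷
             []) (((v1 - v2) || v8) || ((v7 - v2) || ∅)) ((v7 - v2) || ∅) refl (q ∷ f∈ ∷ Z⊑ ∷ XY ∷ g∈ ∷ [])))
          where
          gf : ρ Z + 2 ≤ ρ ((⁅ g ⁆ ∪ ⁅ f ⁆) ∪ Z)
          gf = prove≤ (Z ∷ ⁅ f ⁆ ∷ ⁅ g ⁆ ∷ ⁅ e ⁆ ∷ []) [] []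
            (con 1 ⊕ rank (v0 || v1) <= rank ((v0 || v1) || v2) ∷
            con 1 ⊕ rank (v0 || v3) <= rank ((v0 || v3) || v1) ∷ []) (sub (v0 || v1) (v0 || v3) ∷
            mono v0 ((v0 || v1) && (v0 || v3)) ∷ []) (rank v0 ⊕ con 2) (rank ((v2 || v1) || v0)) refl []
            (g-new ∷ f-new ∷ [])
          ge : ρ ((⁅ g ⁆ ∪ ⁅ e ⁆) ∪ Z) ≤ ρ Z + 1
          ge with ρ Z + 2 ≤? ρ ((⁅ g ⁆ ∪ ⁅ e ⁆) ∪ Z)
          ... | yes r = absurd (none (g , g∈ , r , gf))
          ... | no r  = prove≤ (⁅ g ⁆ ∷ ⁅ e ⁆ ∷ Z ∷ []) [] [] (con 1 ⊕ rank ((v0 || v1) || v2) <= rank v2 ⊕ con 2 ∷ [])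
            [] (rank ((v0 || v1) || v2)) (rank v2 ⊕ con 1) refl [] (≰⇒> r ∷ [])
          gZ : ρ Z + 1 ≤ ρ (⁅ g ⁆ ∪ Z)
          gZ = prove≤ (Z ∷ ⁅ g ⁆ ∷ ⁅ f ⁆ ∷ []) [] [] (rank v0 ⊕ con 2 <= rank ((v1 || v2) || v0) ∷
            card v2 <= con 1 ∷ []) (sub (v1 || v0) v2 ∷ rc v2 ∷ []) (rank v0 ⊕ con 1) (rank (v1 || v0)) refl
            [] (gf ∷ ∣⁅ f ⁆∣≤1 ∷ [])
          g∉f : ⁅ g ⁆ ∩ ⁅ f ⁆ ≡ ⊥
          g∉f with inside? g ⁅ f ⁆
          ... | inj₂ s = s
          ... | inj₁ s = absurd (refute (⁅ g ⁆ ∷ ⁅ f ⁆ ∷ Z ∷ []) [] (v0 <: v1 ∷ [])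
            (con 1 ⊕ rank (v2 || v1) <= rank ((v2 || v1) || v0) ∷ []) [] refl (s ∷ []) (g-new ∷ []))
          e∉g : ⁅ e ⁆ ∩ ⁅ g ⁆ ≡ ⊥
          e∉g with inside? e ⁅ g ⁆
          ... | inj₂ s = s
          ... | inj₁ s = set= (⁅ e ⁆ ∷ ⁅ g ⁆ ∷ X ∷ Y ∷ G ∷ []) (v1 <: v2 ∷ v2 || v3 == v4 - v0 ∷ []) (v0 && v1) ∅ refl
            (g∈ ∷ XY ∷ [])
          g∉I : I′ ∩ ⁅ g ⁆ ≡ ⊥
          g∉I = set= (I′ ∷ W′ ∷ ⁅ e ⁆ ∷ Z ∷ ⁅ f ⁆ ∷ Y ∷ ⁅ g ⁆ ∷ X ∷ []) (v0 || v1 <: ((v2 || v3) || v4) || v5 ∷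
            v0 && v1 == ∅ ∷ v2 || v3 <: v1 ∷ v6 && v4 == ∅ ∷ v6 <: v7 ∷ v7 && v5 == ∅ ∷ []) (v0 && v6) ∅
            refl (q ∷ dis ∷ p ∷ g∉f ∷ g∈ ∷ XY0 ∷ [])
          same : ∀ A → A ⊑ I′ → ρ (A ∪ (W′ ─ ⁅ e ⁆) ∪ ⁅ g ⁆) + ρ W′ ≡ ρ (A ∪ W′) + ρ ((W′ ─ ⁅ e ⁆) ∪ ⁅ g ⁆)
          same A _ = ≤-antisym (prove≤ (A ∷ W′ ∷ ⁅ e ⁆ ∷ ⁅ g ⁆ ∷ []) [] [] (rank (v0 || ((v1 - v2) || v3)) <= rank (v0 || v1) ∷
            rank (∅ || v1) <= rank (∅ || ((v1 - v2) || v3)) ∷ []) []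
            (rank (v0 || ((v1 - v2) || v3)) ⊕ rank v1) (rank (v0 || v1) ⊕ rank ((v1 - v2) || v3)) refl []
            (≤-reflexive (close A) ∷ ≤-reflexive (sym (close ⊥)) ∷ []))
            (prove≤ (A ∷ W′ ∷ ⁅ e ⁆ ∷ ⁅ g ⁆ ∷ []) [] [] (rank (v0 || v1) <= rank (v0 || ((v1 - v2) || v3)) ∷
            rank (∅ || ((v1 - v2) || v3)) <= rank (∅ || v1) ∷ []) []
            (rank (v0 || v1) ⊕ rank ((v1 - v2) || v3)) (rank (v0 || ((v1 - v2) || v3)) ⊕ rank v1) refl []
            (≤-reflexive (sym (close A)) ∷ ≤-reflexive (close ⊥) ∷ []))
            where
            close : ∀ A → ρ (A ∪ (W′ ─ ⁅ e ⁆) ∪ ⁅ g ⁆) ≡ ρ (A ∪ W′)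
            close A = ≤-antisym (prove≤ (⁅ g ⁆ ∷ ⁅ e ⁆ ∷ Z ∷ W′ ∷ A ∷ []) [] (v1 || v2 <: v3 ∷ [])
              (rank ((v0 || v1) || v2) <= rank v2 ⊕ con 1 ∷ rank v2 ⊕ con 1 <= rank (v1 || v2) ∷ [])
              (sub (v4 || v3) ((v0 || v1) || v2) ∷ mono (v1 || v2) ((v4 || v3) && ((v0 || v1) || v2)) ∷
              mono (v4 || ((v3 - v1) || v0)) (v4 || (v3 || v0)) ∷ []) (rank (v4 || ((v3 - v1) || v0)))
              (rank (v4 || v3)) refl (p ∷ []) (ge ∷ eZ ∷ []))
              (prove≤ (⁅ g ⁆ ∷ ⁅ e ⁆ ∷ Z ∷ W′ ∷ A ∷ []) [] (v1 || v2 <: v3 ∷ v1 && v2 == ∅ ∷ [])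
              (rank ((v0 || v1) || v2) <= rank v2 ⊕ con 1 ∷ rank v2 ⊕ con 1 <= rank (v0 || v2) ∷ [])
              (sub (v4 || ((v3 - v1) || v0)) ((v0 || v1) || v2) ∷
              mono (v0 || v2) ((v4 || ((v3 - v1) || v0)) && ((v0 || v1) || v2)) ∷
              mono (v4 || v3) (v4 || (v3 || v0)) ∷ []) (rank (v4 || v3)) (rank (v4 || ((v3 - v1) || v0)))
              refl (p ∷ e∉Z ∷ []) (ge ∷ gZ ∷ []))

  -- Contractible elements lie on the line of `T`.

  module _ {e I W} (e∈ : ⁅ e ⁆ ⊑ G) (μ : Model I W) (IW⊑ : I ∪ W ⊑ G) (e∈W : ⁅ e ⁆ ⊑ W) where

    private
      IW-disjoint : I ∩ W ≡ ⊥
      IW-disjoint = disjoint μ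

      e-nonloop : 1 ≤ ρ ⁅ e ⁆
      e-nonloop = nonloop e∈

    -- Two elements of `T` in A span the triangle, so all of `T` moves to that side without raising
    -- its rank over e. Afterwards both sides still span e, and N has at most one element on one of
    -- them: either the side with `T` or the other.
    vertical-absurd : ∀ {A B} → 3 ≤ ρ (T ∪ ⁅ e ⁆) → A ∪ B ≡ G ─ ⁅ e ⁆ → A ∩ B ≡ ⊥ →
      3 ≤ ρ (A ∪ ⁅ e ⁆) → 3 ≤ ρ (B ∪ ⁅ e ⁆) → ρ (A ∪ ⁅ e ⁆) + ρ (B ∪ ⁅ e ⁆) ≤ ρ G + 2 →
      2 ≤ ∣ T ∩ A ∣ → Absurd
    vertical-absurd {A} {B} Te AB d rA rB s TA = cases (one-side {X = A ∪ T} {Y = B ─ T} {C₀ = ⁅ e ⁆} μ XY0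
        (set= (I ∷ W ∷ G ∷ ⁅ e ⁆ ∷ A ∷ T ∷ B ∷ []) (v0 || v1 <: v2 ∷ v0 && v1 == ∅ ∷ v3 <: v1 ∷
          (v4 || v5) || (v6 - v5) == v2 - v3 ∷ []) (v0 || ((v4 || v5) || (v6 - v5)))
          ((v4 || v5) || (v6 - v5)) refl (IW⊑ ∷ IW-disjoint ∷ e∈W ∷ XY ∷ [])) (set= (I ∷ W ∷ G ∷ A ∷ T ∷ B ∷ ⁅ e ⁆ ∷ []) (v0 || v1 <: v2 ∷ (v3 || v4) || (v5 - v4) == v2 - v6 ∷
          []) (v1 || (((v3 || v4) || (v5 - v4)) || v6)) (((v3 || v4) || (v5 - v4)) || v6) refl (IW⊑ ∷ XY ∷
          [])) e∈W sep-e′)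
      where
      e∉T : ⁅ e ⁆ ∩ T ≡ ⊥
      e∉T with inside? e T
      ... | inj₂ p = p
      ... | inj₁ p = absurd (refute (⁅ e ⁆ ∷ T ∷ []) [] (v0 <: v1 ∷ []) (con 3 <= rank (v1 || v0) ∷ rank v1 <= con 2 ∷ []) []
        refl (p ∷ []) (Te ∷ T-line ∷ []))
      XY : (A ∪ T) ∪ (B ─ T) ≡ G ─ ⁅ e ⁆
      XY = set= (A ∷ B ∷ G ∷ ⁅ e ⁆ ∷ T ∷ []) (v0 || v1 == v2 - v3 ∷ v4 <: v2 ∷ v3 && v4 == ∅ ∷ [])
        ((v0 || v4) || (v1 - v4)) (v2 - v3) refl (AB ∷ T⊑G ∷ e∉T ∷ [])
      XY0 : (A ∪ T) ∩ (B ─ T) ≡ ⊥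
      XY0 = set= (A ∷ B ∷ T ∷ []) (v0 && v1 == ∅ ∷ []) ((v0 || v2) && (v1 - v2)) ∅ refl (d ∷ [])
      XA : ρ ((A ∪ T) ∪ ⁅ e ⁆) ≤ ρ (A ∪ ⁅ e ⁆)
      XA = prove≤ (T ∷ A ∷ ⁅ e ⁆ ∷ []) [] [] (con 2 <= rank (v0 && v1) ∷ rank v0 <= con 2 ∷ [])
        (sub (v1 || v2) v0 ∷ mono (v0 && v1) ((v1 || v2) && v0) ∷ []) (rank ((v1 || v0) || v2))
        (rank (v1 || v2)) refl [] (T-spanned {A} TA ∷ T-line ∷ [])
      c-A : ρ G + 2 ≤ ρ A + ρ (B ∪ ⁅ e ⁆)
      c-A = conn₂ {A} {B ∪ ⁅ e ⁆} (set= (A ∷ B ∷ G ∷ ⁅ e ⁆ ∷ []) (v0 || v1 == v2 - v3 ∷ v3 <: v2 ∷ []) (v0 || (v1 || v3)) v2 refl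
        (AB ∷ e∈ ∷ [])) (set= (A ∷ B ∷ G ∷ ⁅ e ⁆ ∷ []) (v0 || v1 == v2 - v3 ∷ v0 && v1 == ∅ ∷ []) (v0 && (v1 || v3)) ∅ refl
        (AB ∷ d ∷ [])) (prove≤ (T ∷ A ∷ []) [] [] (con 2 <= card (v0 && v1) ∷ []) (cmono (v0 && v1) v1 ∷ []) (con 2)
        (card v1) refl [] (TA ∷ [])) (prove≤ (B ∷ ⁅ e ⁆ ∷ []) [] [] (con 2 <= card (v0 || v1) ∷ []) [] (con 2) (card (v0 || v1)) refl []
        (B-size ∷ []))
        where
        B-size : 2 ≤ ∣ B ∪ ⁅ e ⁆ ∣
        B-size = prove≤ (B ∷ ⁅ e ⁆ ∷ []) [] [] (con 3 <= rank (v0 || v1) ∷ []) (rc (v0 || v1) ∷ []) (con 2)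
          (card (v0 || v1)) refl [] (rB ∷ [])
      rB′ : 3 ≤ ρ B
      rB′ = prove≤ (G ∷ B ∷ A ∷ ⁅ e ⁆ ∷ []) [] [] (rank v0 ⊕ con 2 <= rank v1 ⊕ rank (v2 || v3) ∷
        rank (v2 || v3) ⊕ rank (v1 || v3) <= rank v0 ⊕ con 2 ∷ con 3 <= rank (v1 || v3) ∷ []) [] (con 3)
        (rank v1) refl [] (c ∷ s ∷ rB ∷ [])
        where
        c = conn₂ {B} {A ∪ ⁅ e ⁆} (set= (A ∷ B ∷ G ∷ ⁅ e ⁆ ∷ []) (v0 || v1 == v2 - v3 ∷ v3 <: v2 ∷ []) (v1 || (v0 || v3)) v2 refl
          (AB ∷ e∈ ∷ [])) (set= (A ∷ B ∷ G ∷ ⁅ e ⁆ ∷ []) (v0 || v1 == v2 - v3 ∷ v0 && v1 == ∅ ∷ []) (v1 && (v0 || v3)) ∅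
          refl (AB ∷ d ∷ [])) (prove≤ (B ∷ ⁅ e ⁆ ∷ []) [] [] (con 3 <= rank (v0 || v1) ∷ card v1 <= con 1 ∷ []) (csub v0 v1 ∷
          rc (v0 || v1) ∷ []) (con 2) (card v0) refl [] (rB ∷ ∣⁅ e ⁆∣≤1 ∷ [])) (prove≤ (T ∷ A ∷ ⁅ e ⁆ ∷ []) [] [] (con 2 <= card (v0 && v1) ∷ []) (cmono (v0 && v1) (v1 || v2) ∷
          []) (con 2) (card (v1 || v2)) refl [] (TA ∷ []))
      B-T-size : 2 ≤ ∣ B ─ T ∣
      B-T-size = prove≤ (T ∷ A ∷ B ∷ []) [] (v1 && v2 == ∅ ∷ []) (con 2 <= card (v0 && v1) ∷ con 3 <= rank v2 ∷
        card v0 <= con 3 ∷ []) (csub (v2 - v0) v0 ∷ cmod (v0 && v1) v2 ∷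
        cmono ((v0 && v1) || v2) ((v2 - v0) || v0) ∷ rc v2 ∷ []) (con 2) (card (v2 - v0)) refl (d ∷ [])
        (TA ∷ rB′ ∷ ≤-reflexive T-size ∷ [])
      c-B : ρ G + 2 ≤ ρ (B ─ T) + ρ ((A ∪ T) ∪ ⁅ e ⁆)
      c-B = conn₂ {B ─ T} {(A ∪ T) ∪ ⁅ e ⁆} (set= (A ∷ B ∷ G ∷ ⁅ e ⁆ ∷ T ∷ []) (v0 || v1 == v2 - v3 ∷ v3 <: v2 ∷ v4 <: v2 ∷ [])
        ((v1 - v4) || ((v0 || v4) || v3)) v2 refl (AB ∷ e∈ ∷ T⊑G ∷ [])) (set= (A ∷ B ∷ G ∷ ⁅ e ⁆ ∷ T ∷ []) (v0 || v1 == v2 - v3 ∷ v0 && v1 == ∅ ∷ [])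
        ((v1 - v4) && ((v0 || v4) || v3)) ∅ refl (AB ∷ d ∷ [])) B-T-size (prove≤ (T ∷ A ∷ ⁅ e ⁆ ∷ []) [] [] (con 2 <= card (v0 && v1) ∷ [])
        (cmono (v0 && v1) ((v1 || v0) || v2) ∷ []) (con 2) (card ((v1 || v0) || v2)) refl [] (TA ∷ []))
      eX : ρ ((A ∪ T) ∪ ⁅ e ⁆) ≤ ρ (A ∪ T)
      eX = prove≤ (A ∷ T ∷ ⁅ e ⁆ ∷ G ∷ B ∷ []) [] [] (rank ((v0 || v1) || v2) <= rank (v0 || v2) ∷
        rank v3 ⊕ con 2 <= rank v0 ⊕ rank (v4 || v2) ∷
        rank (v0 || v2) ⊕ rank (v4 || v2) <= rank v3 ⊕ con 2 ∷ []) (mono v0 (v0 || v1) ∷ [])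
        (rank ((v0 || v1) || v2)) (rank (v0 || v1)) refl [] (XA ∷ c-A ∷ s ∷ [])
      eY : ρ ((B ─ T) ∪ ⁅ e ⁆) ≤ ρ (B ─ T)
      eY = prove≤ (A ∷ T ∷ ⁅ e ⁆ ∷ G ∷ B ∷ []) [] [] (rank ((v0 || v1) || v2) <= rank (v0 || v2) ∷
        rank v3 ⊕ con 2 <= rank (v4 - v1) ⊕ rank ((v0 || v1) || v2) ∷
        rank (v0 || v2) ⊕ rank (v4 || v2) <= rank v3 ⊕ con 2 ∷ []) (mono ((v4 - v1) || v2) (v4 || v2) ∷ [])
        (rank ((v4 - v1) || v2)) (rank (v4 - v1)) refl [] (XA ∷ c-B ∷ s ∷ [])
      sep : ρ (A ∪ T) + ρ (B ─ T) ≤ ρ G + 2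
      sep = prove≤ (A ∷ T ∷ ⁅ e ⁆ ∷ B ∷ G ∷ []) [] [] (rank ((v0 || v1) || v2) <= rank (v0 || v2) ∷
        rank (v0 || v2) ⊕ rank (v3 || v2) <= rank v4 ⊕ con 2 ∷ []) (mono (v3 - v1) (v3 || v2) ∷
        mono (v0 || v1) ((v0 || v1) || v2) ∷ []) (rank (v0 || v1) ⊕ rank (v3 - v1)) (rank v4 ⊕ con 2) refl
        [] (XA ∷ s ∷ [])
      sep-e′ : ρ ((A ∪ T) ∪ ⁅ e ⁆) + ρ ((B ─ T) ∪ ⁅ e ⁆) ≤ ρ (((A ∪ T) ∪ (B ─ T)) ∪ ⁅ e ⁆) + ρ ⁅ e ⁆ + 1
      sep-e′ = prove≤ (A ∷ T ∷ ⁅ e ⁆ ∷ B ∷ G ∷ []) [] ((v0 || v1) || (v3 - v1) == v4 - v2 ∷ v2 <: v4 ∷ [])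
        (rank ((v0 || v1) || v2) <= rank (v0 || v2) ∷ rank (v0 || v2) ⊕ rank (v3 || v2) <= rank v4 ⊕ con 2 ∷
        con 1 <= rank v2 ∷ []) (mono ((v3 - v1) || v2) (v3 || v2) ∷ [])
        (rank ((v0 || v1) || v2) ⊕ rank ((v3 - v1) || v2))
        ((rank (((v0 || v1) || (v3 - v1)) || v2) ⊕ rank v2) ⊕ con 1) refl (XY ∷ e∈ ∷ []) (XA ∷ s ∷
        e-nonloop ∷ [])
      rX : 3 ≤ ρ (A ∪ T)
      rX = prove≤ (A ∷ ⁅ e ⁆ ∷ T ∷ []) [] [] (con 3 <= rank (v0 || v1) ∷
        rank ((v0 || v2) || v1) <= rank (v0 || v2) ∷ []) (mono (v0 || v1) ((v0 || v2) || v1) ∷ []) (con 3)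
        (rank (v0 || v2)) refl [] (rA ∷ eX ∷ [])
      rY : 3 ≤ ρ (B ─ T)
      rY = prove≤ (G ∷ B ∷ T ∷ A ∷ ⁅ e ⁆ ∷ []) [] []
        (rank v0 ⊕ con 2 <= rank (v1 - v2) ⊕ rank ((v3 || v2) || v4) ∷
        rank ((v3 || v2) || v4) <= rank (v3 || v4) ∷ rank (v3 || v4) ⊕ rank (v1 || v4) <= rank v0 ⊕ con 2 ∷
        con 3 <= rank (v1 || v4) ∷ []) [] (con 3) (rank (v1 - v2)) refl [] (c-B ∷ XA ∷ s ∷ rB ∷ [])
      cases : ∣ (A ∪ T) ∩ I ∣ ≤ 1 ⊎ ∣ (B ─ T) ∩ I ∣ ≤ 1 → Absurd
      cases (inj₁ one) = triangle-opposite e∈ XY XY0 eX eY sep rX rY μ IW⊑ e∈W one (set= (T ∷ A ∷ []) [] (v0 || (v1 || v0)) (v1 || v0) refl [])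
      cases (inj₂ one) = triangle-same {X = B ─ T} {Y = A ∪ T} e∈ (set= (A ∷ T ∷ B ∷ G ∷ ⁅ e ⁆ ∷ []) ((v0 || v1) || (v2 - v1) == v3 - v4 ∷ [])
        ((v2 - v1) || (v0 || v1)) (v3 - v4) refl (XY ∷ [])) (set= (A ∷ T ∷ B ∷ []) ((v0 || v1) && (v2 - v1) == ∅ ∷ []) ((v2 - v1) && (v0 || v1)) ∅ refl (XY0 ∷
        [])) eY eX (prove≤ (A ∷ T ∷ B ∷ G ∷ []) [] [] (rank (v0 || v1) ⊕ rank (v2 - v1) <= rank v3 ⊕ con 2 ∷ []) []
        (rank (v2 - v1) ⊕ rank (v0 || v1)) (rank v3 ⊕ con 2) refl [] (sep ∷ []))
        rY rX μ IW⊑ e∈W one (set= (T ∷ A ∷ []) [] (v0 || (v1 || v0)) (v1 || v0) refl [])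

    -- Suppose e is off the line of `T`. Without a vertical 3-separation at e, each 2-separation of
    -- M/e has a side of rank at most one, a parallel class. It has no two elements of `T`, since
    -- `T` keeps rank 2 in M/e, so M/e can be reduced to a forbidden minor.
    contractible-spanned : ρ (T ∪ ⁅ e ⁆) ≤ 2
    contractible-spanned with ρ (T ∪ ⁅ e ⁆) ≤? 2
    ... | yes p = p
    -- A search over the finitely many subsets decides whether there is a vertical 3-separation at
    -- e.
    ... | no p with anySubset? (λ A → ((A ∪ (G ─ ⁅ e ⁆)) ≟ˢ (G ─ ⁅ e ⁆)) ×-dec (3 ≤? ρ (A ∪ ⁅ e ⁆))
          ×-dec (3 ≤? ρ ((G ─ ⁅ e ⁆ ─ A) ∪ ⁅ e ⁆))
          ×-dec (ρ (A ∪ ⁅ e ⁆) + ρ ((G ─ ⁅ e ⁆ ─ A) ∪ ⁅ e ⁆) ≤? ρ G + 2))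
    ...   | yes (A , A⊑ , rA , rB , s) with T-sides A (G ─ A) (set= (T ∷ G ∷ A ∷ []) (v0 <: v1 ∷ []) (v0 || (v2 || (v1 - v2))) (v2 || (v1 - v2)) refl (T⊑G ∷ []))
    ...     | inj₁ q = absurd (vertical-absurd {A} {G ─ ⁅ e ⁆ ─ A} (≰⇒> p) (set= (A ∷ G ∷ ⁅ e ⁆ ∷ []) (v0 <: v1 - v2 ∷ []) (v0 || ((v1 - v2) - v0)) (v1 - v2) refl (A⊑ ∷ [])) (set= (A ∷ G ∷ ⁅ e ⁆ ∷ []) [] (v0 && ((v1 - v2) - v0)) ∅ refl []) rA rB s q)
    ...     | inj₂ q = absurd (vertical-absurd {G ─ ⁅ e ⁆ ─ A} {A} (≰⇒> p) (set= (A ∷ G ∷ ⁅ e ⁆ ∷ []) (v0 <: v1 - v2 ∷ []) (((v1 - v2) - v0) || v0) (v1 - v2) refl (A⊑ ∷ [])) (set= (G ∷ ⁅ e ⁆ ∷ A ∷ []) [] (((v0 - v1) - v2) && v2) ∅ refl []) rB rA (prove≤ (A ∷ ⁅ e ⁆ ∷ G ∷ []) [] []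
      (rank (v0 || v1) ⊕ rank (((v2 - v1) - v0) || v1) <= rank v2 ⊕ con 2 ∷ []) []
      (rank (((v2 - v1) - v0) || v1) ⊕ rank (v0 || v1)) (rank v2 ⊕ con 2) refl [] (s ∷ [])) (prove≤ (T ∷ G ∷ A ∷ ⁅ e ⁆ ∷ []) [] (v3 && v0 == ∅ ∷ []) (con 2 <= card (v0 && (v1 - v2)) ∷ []) []
      (con 2) (card (v0 && ((v1 - v3) - v2))) refl (e∉T ∷ []) (q ∷ [])))
      where
      e∉T : ⁅ e ⁆ ∩ T ≡ ⊥
      e∉T with inside? e T
      ... | inj₂ r = r
      ... | inj₁ r = absurd (refute (⁅ e ⁆ ∷ T ∷ []) [] (v0 <: v1 ∷ []) (con 1 ⊕ con 2 <= rank (v1 || v0) ∷ rank v1 <= con 2 ∷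
        []) [] refl (r ∷ []) (≰⇒> p ∷ T-line ∷ []))
    contractible-spanned | no p | no none = absurd (reduce _ (G ─ ⁅ e ⁆) ⁅ e ⁆ ≤-refl (set= (G ∷ ⁅ e ⁆ ∷ []) [] ((v0 - v1) && v1) ∅ refl []) (set= (⁅ e ⁆ ∷ G ∷ []) (v0 <: v1 ∷ []) (((v1 - v0) || v0) || v1) v1 refl (e∈ ∷ []))
      (set= (T ∷ G ∷ ⁅ e ⁆ ∷ []) (v0 <: v1 ∷ v2 && v0 == ∅ ∷ []) (v0 || (v1 - v2)) (v1 - v2) refl (T⊑G ∷
        e∉T ∷ [])) proper (record { no-1-sep = no-1 ; 2-seps = two })
      (I , W , μ , e∈W , (set= (I ∷ W ∷ G ∷ ⁅ e ⁆ ∷ []) (v0 || v1 <: v2 ∷ v0 && v1 == ∅ ∷ v3 <: v1 ∷ []) (v0 || (v2 - v3))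
        (v2 - v3) refl (IW⊑ ∷ IW-disjoint ∷ e∈W ∷ [])) , (set= (I ∷ W ∷ G ∷ ⁅ e ⁆ ∷ []) (v0 || v1 <: v2 ∷ []) (v1 || ((v2 - v3) || v3)) ((v2 - v3) || v3)
        refl (IW⊑ ∷ []))))
      where
      e∉T : ⁅ e ⁆ ∩ T ≡ ⊥
      e∉T with inside? e T
      ... | inj₂ r = r
      ... | inj₁ r = absurd (refute (⁅ e ⁆ ∷ T ∷ []) [] (v0 <: v1 ∷ []) (con 1 ⊕ con 2 <= rank (v1 || v0) ∷ rank v1 <= con 2 ∷
        []) [] refl (r ∷ []) (≰⇒> p ∷ T-line ∷ []))
      proper : G ─ ⁅ e ⁆ ≢ G
      proper q = ⊥≡⁅⁆⇒absurd {x = e} (set= (G ∷ ⁅ e ⁆ ∷ []) (v0 - v1 == v0 ∷ v1 <: v0 ∷ []) ∅ v1 refl (q ∷ e∈ ∷ []))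
      no-1 : ∀ A B → A ∪ B ≡ G ─ ⁅ e ⁆ → A ∩ B ≡ ⊥ →
        ρ (A ∪ ⁅ e ⁆) + ρ (B ∪ ⁅ e ⁆) ≤ ρ ((G ─ ⁅ e ⁆) ∪ ⁅ e ⁆) + ρ ⁅ e ⁆ → A ≡ ⊥ ⊎ B ≡ ⊥
      no-1 A B AB d s with 1 ≤? ∣ A ∣ | 1 ≤? ∣ B ∣
      ... | no q  | _     = inj₁ (∣∣≤0⇒≡⊥ (prove≤ (A ∷ []) [] [] (con 1 ⊕ card v0 <= con 1 ∷ []) [] (card v0) (con 0) refl [] (≰⇒> q ∷ [])))
      ... | _     | no q  = inj₂ (∣∣≤0⇒≡⊥ (prove≤ (B ∷ []) [] [] (con 1 ⊕ card v0 <= con 1 ∷ []) [] (card v0) (con 0) refl [] (≰⇒> q ∷ [])))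
      ... | yes q | yes q′ with 2 ≤? ∣ A ∣
      ...   | yes q₂ = absurd (refute (G ∷ A ∷ B ∷ ⁅ e ⁆ ∷ []) [] (v3 <: v0 ∷ []) (rank v0 ⊕ con 2 <= rank v1 ⊕ rank (v2 || v3) ∷
        rank (v1 || v3) ⊕ rank (v2 || v3) <= rank ((v0 - v3) || v3) ⊕ rank v3 ∷ card v3 <= con 1 ∷ [])
        (mono v1 (v1 || v3) ∷ rc v3 ∷ []) refl (e∈ ∷ []) (c ∷ s ∷ ∣⁅ e ⁆∣≤1 ∷ []))
        where
        c = conn₂ {A} {B ∪ ⁅ e ⁆} (set= (A ∷ B ∷ G ∷ ⁅ e ⁆ ∷ []) (v0 || v1 == v2 - v3 ∷ v3 <: v2 ∷ []) (v0 || (v1 || v3)) v2 refl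
          (AB ∷ e∈ ∷ [])) (set= (A ∷ B ∷ G ∷ ⁅ e ⁆ ∷ []) (v0 || v1 == v2 - v3 ∷ v0 && v1 == ∅ ∷ []) (v0 && (v1 || v3)) ∅
          refl (AB ∷ d ∷ [])) q₂ (prove≤ (B ∷ A ∷ G ∷ ⁅ e ⁆ ∷ []) [] (v1 || v0 == v2 - v3 ∷ []) (con 1 <= card v0 ∷
          con 1 <= card v3 ∷ []) (cmod v0 v3 ∷ c∅ ∷ []) (con 2) (card (v0 || v3)) refl (AB ∷ []) (q′ ∷
          1≤∣⁅ e ⁆∣ ∷ []))
      ...   | no q₂ = absurd (refute (G ∷ A ∷ ⁅ e ⁆ ∷ B ∷ []) [] (v2 <: v0 ∷ []) (rank v0 ⊕ con 2 <= rank (v1 || v2) ⊕ rank v3 ∷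
        rank (v1 || v2) ⊕ rank (v3 || v2) <= rank ((v0 - v2) || v2) ⊕ rank v2 ∷ card v2 <= con 1 ∷ [])
        (mono v3 (v3 || v2) ∷ rc v2 ∷ []) refl (e∈ ∷ []) (c ∷ s ∷ ∣⁅ e ⁆∣≤1 ∷ []))
        where
        c = conn₂ {A ∪ ⁅ e ⁆} {B} (set= (A ∷ B ∷ G ∷ ⁅ e ⁆ ∷ []) (v0 || v1 == v2 - v3 ∷ v3 <: v2 ∷ []) ((v0 || v3) || v1) v2 refl
          (AB ∷ e∈ ∷ [])) (set= (A ∷ B ∷ G ∷ ⁅ e ⁆ ∷ []) (v0 || v1 == v2 - v3 ∷ v0 && v1 == ∅ ∷ []) ((v0 || v3) && v1) ∅
          refl (AB ∷ d ∷ [])) (prove≤ (A ∷ B ∷ G ∷ ⁅ e ⁆ ∷ []) [] (v0 || v1 == v2 - v3 ∷ []) (con 1 <= card v0 ∷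
          con 1 <= card v3 ∷ []) (cmod v0 v3 ∷ c∅ ∷ []) (con 2) (card (v0 || v3)) refl (AB ∷ []) (q ∷
          1≤∣⁅ e ⁆∣ ∷ [])) (prove≤ (A ∷ B ∷ G ∷ ⁅ e ⁆ ∷ []) [] (v0 || v1 == v2 - v3 ∷ v3 <: v2 ∷ []) (con 4 <= card v2 ∷
          con 1 ⊕ card v0 <= con 2 ∷ card v3 <= con 1 ∷ []) (csub v1 (v0 || v3) ∷ csub v0 v3 ∷ []) (con 2)
          (card v1) refl (AB ∷ e∈ ∷ []) (G-size ∷ ≰⇒> q₂ ∷ ∣⁅ e ⁆∣≤1 ∷ []))
      clique : ∀ {A} → A ⊑ G ─ ⁅ e ⁆ → ρ (A ∪ ⁅ e ⁆) ≤ 2 → Clique (G ─ ⁅ e ⁆) ⁅ e ⁆ A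
      clique {A} A⊑ rA u v u∈ v∈ uv = (prove≤ (A ∷ ⁅ e ⁆ ∷ ⁅ u ⁆ ∷ ⁅ v ⁆ ∷ G ∷ []) [] (v2 <: v0 ∷ v3 <: v0 ∷ [])
        (rank (v0 || v1) <= con 2 ∷ con 1 <= rank v1 ∷ [])
        (mono (((v4 - v1) - (v2 || v3)) || v1) ((v4 - v1) || v1) ∷ mono ((v2 || v3) || v1) (v0 || v1) ∷ [])
        (rank ((v2 || v3) || v1) ⊕ rank (((v4 - v1) - (v2 || v3)) || v1))
        ((rank ((v4 - v1) || v1) ⊕ rank v1) ⊕ con 1) refl (u∈ ∷ v∈ ∷ []) (rA ∷ e-nonloop ∷ [])) , λ (q , r) → T-absurd q r
        where
        T-absurd : ⁅ u ⁆ ⊑ T → ⁅ v ⁆ ⊑ T → Absurd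
        T-absurd q r = (refute (⁅ u ⁆ ∷ ⁅ v ⁆ ∷ T ∷ A ∷ ⁅ e ⁆ ∷ []) [] (v0 <: v3 ∷ v1 <: v3 ∷ v0 <: v2 ∷ v1 <: v2 ∷ [])
          (con 2 <= rank (v0 || v1) ∷ rank v2 <= con 2 ∷ rank (v3 || v4) <= con 2 ∷
          con 1 ⊕ con 2 <= rank (v2 || v4) ∷ []) (sub v2 (v3 || v4) ∷ mono (v0 || v1) (v2 && (v3 || v4)) ∷
          mono (v2 || v4) (v2 || (v3 || v4)) ∷ []) refl (u∈ ∷ v∈ ∷ q ∷ r ∷ []) (T-pair u v q r uv ∷ T-line ∷
          rA ∷ ≰⇒> p ∷ []))
      two : ∀ A B → A ∪ B ≡ G ─ ⁅ e ⁆ → A ∩ B ≡ ⊥ →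
        ρ (A ∪ ⁅ e ⁆) + ρ (B ∪ ⁅ e ⁆) ≤ ρ ((G ─ ⁅ e ⁆) ∪ ⁅ e ⁆) + ρ ⁅ e ⁆ + 1 →
        Clique (G ─ ⁅ e ⁆) ⁅ e ⁆ A ⊎ Clique (G ─ ⁅ e ⁆) ⁅ e ⁆ B
      two A B AB d s with 3 ≤? ρ (A ∪ ⁅ e ⁆) | 3 ≤? ρ (B ∪ ⁅ e ⁆)
      ... | no q  | _     = inj₁ (clique {A} (set= (A ∷ B ∷ G ∷ ⁅ e ⁆ ∷ []) (v0 || v1 == v2 - v3 ∷ []) (v0 || (v2 - v3)) (v2 - v3) refl (AB ∷
        [])) (≤-pred (≰⇒> q)))
      ... | _     | no q  = inj₂ (clique {B} (set= (A ∷ B ∷ G ∷ ⁅ e ⁆ ∷ []) (v0 || v1 == v2 - v3 ∷ []) (v1 || (v2 - v3)) (v2 - v3) refl (AB ∷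
        [])) (≤-pred (≰⇒> q)))
      ... | yes q | yes r = absurd (none (A , (set= (A ∷ B ∷ G ∷ ⁅ e ⁆ ∷ []) (v0 || v1 == v2 - v3 ∷ []) (v0 || (v2 - v3)) (v2 - v3) refl (AB ∷
        [])) , q , (prove≤ (B ∷ ⁅ e ⁆ ∷ A ∷ G ∷ []) [] (v2 || v0 == v3 - v1 ∷ v2 && v0 == ∅ ∷ [])
        (con 3 <= rank (v0 || v1) ∷ []) [] (con 3) (rank (((v3 - v1) - v2) || v1)) refl (AB ∷ d ∷ []) (r ∷
        [])) , (prove≤ (A ∷ ⁅ e ⁆ ∷ B ∷ G ∷ []) [] (v0 || v2 == v3 - v1 ∷ v0 && v2 == ∅ ∷ v1 <: v3 ∷ [])
        (rank (v0 || v1) ⊕ rank (v2 || v1) <= (rank ((v3 - v1) || v1) ⊕ rank v1) ⊕ con 1 ∷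
        card v1 <= con 1 ∷ []) (rc v1 ∷ []) (rank (v0 || v1) ⊕ rank (((v3 - v1) - v0) || v1))
        (rank v3 ⊕ con 2) refl (AB ∷ d ∷ e∈ ∷ []) (s ∷ ∣⁅ e ⁆∣≤1 ∷ []))))

  -- Deletable elements outside `T`.

  delete-minimal : ∀ {x} → ⁅ x ⁆ ⊑ G → ⁅ x ⁆ ∩ T ≡ ⊥ → Connected₃ R (G ─ ⁅ x ⁆) ⊥ →
    ∀ {I W} → Model I W → I ∪ W ⊑ G → ⁅ x ⁆ ∩ (I ∪ W) ≡ ⊥ → Absurd
  delete-minimal {x} x∈ x∉T c {I} {W} μ IW⊑ x∉ = minimal (G ─ ⁅ x ⁆) ⊥ (set= (G ∷ ⁅ x ⁆ ∷ []) [] ((v0 - v1) && ∅) ∅ refl []) (set= (G ∷ ⁅ x ⁆ ∷ []) [] (((v0 - v1) || ∅) || v0) v0 refl []) (set= (T ∷ G ∷ ⁅ x ⁆ ∷ []) (v0 <: v1 ∷ v2 && v0 == ∅ ∷ []) (v0 || (v1 - v2)) (v1 - v2) refl (T⊑G ∷ x∉T ∷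
    [])) proper c
    (I , W , μ , (set= (W ∷ []) [] (∅ || v0) v0 refl []) , (set= (I ∷ W ∷ G ∷ ⁅ x ⁆ ∷ []) (v0 || v1 <: v2 ∷ v3 && (v0 || v1) == ∅ ∷ []) (v0 || (v2 - v3))
      (v2 - v3) refl (IW⊑ ∷ x∉ ∷ [])) , (set= (I ∷ W ∷ G ∷ ⁅ x ⁆ ∷ []) (v0 || v1 <: v2 ∷ v3 && (v0 || v1) == ∅ ∷ []) (v1 || ((v2 - v3) || ∅))
      ((v2 - v3) || ∅) refl (IW⊑ ∷ x∉ ∷ [])))
    where
    proper : G ─ ⁅ x ⁆ ≢ G
    proper p = ⊥≡⁅⁆⇒absurd {x = x} (set= (G ∷ ⁅ x ⁆ ∷ []) (v0 - v1 == v0 ∷ v1 <: v0 ∷ []) ∅ v1 refl (p ∷ x∈ ∷ []))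

  -- In any partition of the deletion of x, a side with two elements of `T` spans `T` and hence x.
  -- Putting x back there costs no rank, so the deletion is 3-connected.
  spanned-undeletable : ∀ {x I W} → ⁅ x ⁆ ⊑ G → ⁅ x ⁆ ∩ T ≡ ⊥ → ρ (T ∪ ⁅ x ⁆) ≤ 2 →
    Model I W → I ∪ W ⊑ G → ⁅ x ⁆ ∩ (I ∪ W) ≡ ⊥ → Absurd
  spanned-undeletable {x} x∈ x∉T Tx μ IW⊑ x∉ = delete-minimal x∈ x∉T connected-x μ IW⊑ x∉
    where
    connected-x : Connected₃ R (G ─ ⁅ x ⁆) ⊥
    connected-x k 1≤k k≤2 A B AB d kA kB with T-sides A B (set= (A ∷ B ∷ G ∷ ⁅ x ⁆ ∷ T ∷ []) (v0 || v1 == v2 - v3 ∷ v4 <: v2 ∷ v3 && v4 == ∅ ∷ [])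
      (v4 || (v0 || v1)) (v0 || v1) refl (AB ∷ T⊑G ∷ x∉T ∷ []))
    ... | inj₁ p = prove≤ (G ∷ A ∷ ⁅ x ⁆ ∷ B ∷ T ∷ []) (k ∷ []) [] (rank v0 ⊕ nv 0 <= rank (v1 || v2) ⊕ rank v3 ∷
      con 2 <= rank (v4 && v1) ∷ rank (v4 || v2) <= con 2 ∷ []) (sub (v1 || ∅) (v4 || v2) ∷
      mono ((v0 - v2) || ∅) v0 ∷ mono (v4 && v1) ((v1 || ∅) && (v4 || v2)) ∷
      mono (v1 || v2) ((v1 || ∅) || (v4 || v2)) ∷ c∅ ∷ rc ∅ ∷ []) ((rank ((v0 - v2) || ∅) ⊕ rank ∅) ⊕ nv 0)
      (rank (v1 || ∅) ⊕ rank (v3 || ∅)) refl [] (c ∷ T-spanned {A} p ∷ Tx ∷ [])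
      where
      c = conn k 1≤k k≤2 (A ∪ ⁅ x ⁆) B (set= (A ∷ B ∷ G ∷ ⁅ x ⁆ ∷ []) (v0 || v1 == v2 - v3 ∷ v3 <: v2 ∷ []) ((v0 || v3) || v1) v2 refl
        (AB ∷ x∈ ∷ [])) (set= (A ∷ B ∷ G ∷ ⁅ x ⁆ ∷ []) (v0 || v1 == v2 - v3 ∷ v0 && v1 == ∅ ∷ []) ((v0 || v3) && v1) ∅ refl
        (AB ∷ d ∷ [])) (prove≤ (A ∷ ⁅ x ⁆ ∷ []) (k ∷ []) [] (nv 0 <= card v0 ∷ []) (cmono v0 (v0 || v1) ∷ []) (nv 0)
        (card (v0 || v1)) refl [] (kA ∷ [])) kB
    ... | inj₂ p = prove≤ (G ∷ A ∷ B ∷ ⁅ x ⁆ ∷ T ∷ []) (k ∷ []) [] (rank v0 ⊕ nv 0 <= rank v1 ⊕ rank (v2 || v3) ∷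
      con 2 <= rank (v4 && v2) ∷ rank (v4 || v3) <= con 2 ∷ []) (sub (v2 || ∅) (v4 || v3) ∷
      mono ((v0 - v3) || ∅) v0 ∷ mono (v4 && v2) ((v2 || ∅) && (v4 || v3)) ∷
      mono (v2 || v3) ((v2 || ∅) || (v4 || v3)) ∷ c∅ ∷ rc ∅ ∷ []) ((rank ((v0 - v3) || ∅) ⊕ rank ∅) ⊕ nv 0)
      (rank (v1 || ∅) ⊕ rank (v2 || ∅)) refl [] (c ∷ T-spanned {B} p ∷ Tx ∷ [])
      where
      c = conn k 1≤k k≤2 A (B ∪ ⁅ x ⁆) (set= (A ∷ B ∷ G ∷ ⁅ x ⁆ ∷ []) (v0 || v1 == v2 - v3 ∷ v3 <: v2 ∷ []) (v0 || (v1 || v3)) v2 refl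
        (AB ∷ x∈ ∷ [])) (set= (A ∷ B ∷ G ∷ ⁅ x ⁆ ∷ []) (v0 || v1 == v2 - v3 ∷ v0 && v1 == ∅ ∷ []) (v0 && (v1 || v3)) ∅ refl
        (AB ∷ d ∷ [])) kA (prove≤ (B ∷ ⁅ x ⁆ ∷ []) (k ∷ []) [] (nv 0 <= card v0 ∷ []) (cmono v0 (v0 || v1) ∷ []) (nv 0)
        (card (v0 || v1)) refl [] (kB ∷ []))

  module _ {d I W} (d∈ : ⁅ d ⁆ ⊑ G) (d∉T : ⁅ d ⁆ ∩ T ≡ ⊥) (μ : Model I W) (IW⊑ : I ∪ W ⊑ G)
      (d∉ : ⁅ d ⁆ ∩ (I ∪ W) ≡ ⊥) where

    d-full : ρ G ≤ ρ (G ─ ⁅ d ⁆)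
    d-full = spans {⁅ d ⁆} d∈ (prove≤ (⁅ d ⁆ ∷ []) [] [] (card v0 <= con 1 ∷ []) [] (card v0) (con 1) refl [] (∣⁅ d ⁆∣≤1 ∷ []))

    module _ {X Y} (XY : X ∪ Y ≡ G ─ ⁅ d ⁆) (XY0 : X ∩ Y ≡ ⊥) (s : ρ X + ρ Y ≤ ρ G + 1)
        (X-size : 2 ≤ ∣ X ∣) (Y-size : 2 ≤ ∣ Y ∣) (one : ∣ X ∩ I ∣ ≤ 1) where

      sep-d : ρ (X ∪ ⊥) + ρ (Y ∪ ⊥) ≤ ρ ((X ∪ Y) ∪ ⊥) + ρ ⊥ + 1
      sep-d = prove≤ (X ∷ Y ∷ G ∷ ⁅ d ⁆ ∷ []) [] (v0 || v1 == v2 - v3 ∷ [])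
        (rank v0 ⊕ rank v1 <= rank v2 ⊕ con 1 ∷ rank v2 <= rank (v2 - v3) ∷ []) []
        (rank (v0 || ∅) ⊕ rank (v1 || ∅)) ((rank ((v0 || v1) || ∅) ⊕ rank ∅) ⊕ con 1) refl (XY ∷ []) (s ∷
        d-full ∷ [])

      open TwoSeparation {X = X} {Y = Y} {C₀ = ⊥} XY0 sep-d

      exact-d : ρ ((X ∪ Y) ∪ ⊥) + ρ ⊥ + 1 ≤ ρ (X ∪ ⊥) + ρ (Y ∪ ⊥)
      exact-d = prove≤ (G ∷ X ∷ Y ∷ ⁅ d ⁆ ∷ []) [] (v1 || v2 == v0 - v3 ∷ [])
        (rank v0 ⊕ con 2 <= rank v1 ⊕ rank (v2 || v3) ∷ card v3 <= con 1 ∷ []) (sub (v2 || ∅) v3 ∷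
        mono ((v1 || v2) || ∅) v0 ∷ rc v3 ∷ []) ((rank ((v1 || v2) || ∅) ⊕ rank ∅) ⊕ con 1)
        (rank (v1 || ∅) ⊕ rank (v2 || ∅)) refl (XY ∷ []) (c ∷ ∣⁅ d ⁆∣≤1 ∷ [])
        where
        c = conn₂ {X} {Y ∪ ⁅ d ⁆} (set= (X ∷ Y ∷ G ∷ ⁅ d ⁆ ∷ []) (v0 || v1 == v2 - v3 ∷ v3 <: v2 ∷ []) (v0 || (v1 || v3)) v2 refl
          (XY ∷ d∈ ∷ [])) (set= (X ∷ Y ∷ G ∷ ⁅ d ⁆ ∷ []) (v0 || v1 == v2 - v3 ∷ v0 && v1 == ∅ ∷ []) (v0 && (v1 || v3)) ∅
          refl (XY ∷ XY0 ∷ [])) X-size (prove≤ (Y ∷ ⁅ d ⁆ ∷ []) [] [] (con 2 <= card v0 ∷ []) (cmono v0 (v0 || v1) ∷ []) (con 2)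
          (card (v0 || v1)) refl [] (Y-size ∷ []))

      I⊑d : I ⊑ X ∪ Y
      I⊑d = set= (I ∷ W ∷ G ∷ X ∷ Y ∷ ⁅ d ⁆ ∷ []) (v0 || v1 <: v2 ∷ v3 || v4 == v2 - v5 ∷
        v5 && (v0 || v1) == ∅ ∷ []) (v0 || (v3 || v4)) (v3 || v4) refl (IW⊑ ∷ XY ∷ d∉ ∷ [])

      W⊑d : W ⊑ (X ∪ Y) ∪ ⊥
      W⊑d = set= (I ∷ W ∷ G ∷ X ∷ Y ∷ ⁅ d ⁆ ∷ []) (v0 || v1 <: v2 ∷ v3 || v4 == v2 - v5 ∷
        v5 && (v0 || v1) == ∅ ∷ []) (v1 || ((v3 || v4) || ∅)) ((v3 || v4) || ∅) refl (IW⊑ ∷ XY ∷ d∉ ∷ [])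

      -- An x outside the closure of Y is neutral, so N survives with x contracted, and contractible
      -- elements lie on the line of `T`.
      outside-spanned : ∀ {x} → ⁅ x ⁆ ⊑ X → ρ Y < ρ (Y ∪ ⁅ x ⁆) → ρ (T ∪ ⁅ x ⁆) ≤ 2
      outside-spanned {x} x∈ new with survives-in {P = ⁅ x ⁆} {S = X} μ I⊑d W⊑d (set= (W ∷ []) [] (∅ || v0) v0 refl []) one exact-d x∈ (set= (X ∷ []) [] (v0 || v0) v0 refl [])
        (prove≤ (X ∷ []) [] [] [] [] (rank (v0 || ∅)) (rank (v0 || ∅)) refl [] []) (prove≤ (X ∷ Y ∷ []) [] [] [] [] (rank ((v0 || v1) || ∅)) (rank ((v0 || v1) || ∅)) refl [] []) (prove≤ (Y ∷ ⁅ x ⁆ ∷ []) [] [] (con 1 ⊕ rank v0 <= rank (v0 || v1) ∷ card v1 <= con 1 ∷ [])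
          (rc v1 ∷ []) (rank (v1 || ∅) ⊕ rank (v0 || ∅)) (rank ((v1 || v0) || ∅) ⊕ rank ∅) refl [] (new ∷
          ∣⁅ x ⁆∣≤1 ∷ []))
      ... | I′ , W′ , μ′ , p , q = contractible-spanned (set= (⁅ x ⁆ ∷ X ∷ Y ∷ G ∷ ⁅ d ⁆ ∷ []) (v0 <: v1 ∷ v1 || v2 == v3 - v4 ∷ []) (v0 || v3) v3 refl
        (x∈ ∷ XY ∷ [])) μ′ (set= (I′ ∷ W′ ∷ X ∷ Y ∷ G ∷ ⁅ d ⁆ ∷ []) (v0 || v1 <: (∅ || v2) || v3 ∷ v2 || v3 == v4 - v5 ∷ [])
        ((v0 || v1) || v4) v4 refl (q ∷ XY ∷ [])) (set= (⁅ x ⁆ ∷ W′ ∷ []) (∅ || v0 <: v1 ∷ []) (v0 || v1) v1 refl (p ∷ []))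

      -- X has rank at least 2 but connectivity only 1 with Y, so some x of X is outside the closure
      -- of Y. It would lie on the line of `T`, which Y spans.
      T-not-with-N : T ⊑ Y → Absurd
      T-not-with-N T⊑Y with two-elements {A = X} X-size
      ... | u , v , u∈ , v∈ , uv with augment Y X (prove≤ (X ∷ Y ∷ G ∷ ⁅ u ⁆ ∷ ⁅ v ⁆ ∷ ⁅ d ⁆ ∷ []) [] (v3 <: v0 ∷ v4 <: v0 ∷ v0 || v1 == v2 - v5 ∷ [])
        (rank v0 ⊕ rank v1 <= rank v2 ⊕ con 1 ∷ con 2 <= rank (v3 || v4) ∷ rank v2 <= rank (v2 - v5) ∷ [])
        (mono (v3 || v4) v0 ∷ []) (con 1 ⊕ rank v1) (rank (v1 || v0)) refl (u∈ ∷ v∈ ∷ XY ∷ []) (s ∷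
        (pair-rank {u} {v} (below u∈) (below v∈) uv) ∷ d-full ∷ []))
        where
        below : ∀ {u} → ⁅ u ⁆ ⊑ X → ⁅ u ⁆ ⊑ G
        below {u} p = set= (⁅ u ⁆ ∷ X ∷ Y ∷ G ∷ ⁅ d ⁆ ∷ []) (v0 <: v1 ∷ v1 || v2 == v3 - v4 ∷ []) (v0 || v3) v3 refl
          (p ∷ XY ∷ [])
      ...   | x , x∈ , new = (refute (Y ∷ ⁅ x ⁆ ∷ T ∷ []) [] (v2 <: v0 ∷ []) (con 1 ⊕ rank v0 <= rank (v0 || v1) ∷
        rank (v2 || v1) <= con 2 ∷ con 2 <= rank (v2 && v2) ∷ []) (sub v0 (v2 || v1) ∷
        mono (v2 && v2) (v0 && (v2 || v1)) ∷ []) refl (T⊑Y ∷ []) (new ∷ outside-spanned x∈ new ∷ T-rank ∷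
        []))
        where
        T-rank : 2 ≤ ρ (T ∩ T)
        T-rank = T-spanned {T} (prove≤ (T ∷ []) [] [] (con 3 <= card v0 ∷ []) [] (con 2) (card (v0 && v0)) refl []
          (≤-reflexive (sym T-size) ∷ []))

      -- An x of X outside `T` is not on the line of `T`, for N would survive its deletion. By
      -- `outside-spanned` it is not outside the closure of Y either. And if Y spans X minus T while
      -- x is off the line, then X has rank at least 3, and shifting X minus T to the other side
      -- leaves `T` with too little connectivity in M.
      separation-is-T : T ⊑ X → X ≡ T
      separation-is-T T⊑X with empty-or-element (X ─ T)
      ... | inj₁ p = set= (X ∷ T ∷ []) (v0 - v1 == ∅ ∷ v1 <: v0 ∷ []) v0 v1 refl (p ∷ T⊑X ∷ [])
      ... | inj₂ (x , x∈) = absurd (first (augment-or-not))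
        where
        T-rank : 2 ≤ ρ (T ∩ T)
        T-rank = T-spanned {T} (prove≤ (T ∷ []) [] [] (con 3 <= card v0 ∷ []) [] (con 2) (card (v0 && v0)) refl []
          (≤-reflexive (sym T-size) ∷ []))
        unspanned : ∀ {x} → ⁅ x ⁆ ⊑ X ─ T → ρ (T ∪ ⁅ x ⁆) ≤ 2 → Absurd
        unspanned {x} x∈ Tx with survives-in {P = ⊥} {S = X ─ ⁅ x ⁆} μ I⊑d W⊑d (set= (W ∷ []) [] (∅ || v0) v0 refl []) one exact-d (set= (X ∷ ⁅ x ⁆ ∷ []) [] (∅ || (v0 - v1)) (v0 - v1) refl []) (set= (X ∷ ⁅ x ⁆ ∷ []) [] ((v0 - v1) || v0) v0 refl [])
          (prove≤ (T ∷ ⁅ x ⁆ ∷ X ∷ []) [] (v0 <: v2 ∷ v1 <: v2 - v0 ∷ []) (rank (v0 || v1) <= con 2 ∷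
            con 2 <= rank (v0 && v0) ∷ []) (sub ((v2 - v1) || ∅) (v0 || v1) ∷ []) (rank (v2 || ∅))
            (rank ((v2 - v1) || ∅)) refl (T⊑X ∷ x∈ ∷ []) (Tx ∷ T-rank ∷ [])) (prove≤ (T ∷ ⁅ x ⁆ ∷ X ∷ Y ∷ []) [] (v0 <: v2 ∷ v1 <: v2 - v0 ∷ []) (rank (v0 || v1) <= con 2 ∷
            con 2 <= rank (v0 && v0) ∷ []) (sub (((v2 - v1) || v3) || ∅) (v0 || v1) ∷
            mono (v0 && v0) ((((v2 - v1) || v3) || ∅) && (v0 || v1)) ∷ []) (rank ((v2 || v3) || ∅))
            (rank (((v2 - v1) || v3) || ∅)) refl (T⊑X ∷ x∈ ∷ []) (Tx ∷ T-rank ∷ [])) (prove≤ (Y ∷ []) [] [] [] [] (rank (∅ || ∅) ⊕ rank (v0 || ∅)) (rank ((∅ || v0) || ∅) ⊕ rank ∅)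
            refl [] [])
        ... | I′ , W′ , μ′ , p , q = spanned-undeletable {x} (set= (⁅ x ⁆ ∷ X ∷ T ∷ Y ∷ G ∷ ⁅ d ⁆ ∷ []) (v0 <: v1 - v2 ∷ v1 || v3 == v4 - v5 ∷ []) (v0 || v4)
          v4 refl (x∈ ∷ XY ∷ [])) (set= (⁅ x ⁆ ∷ X ∷ T ∷ []) (v0 <: v1 - v2 ∷ []) (v0 && v2) ∅ refl (x∈ ∷ [])) Tx μ′ (set= (I′ ∷ W′ ∷ X ∷ ⁅ x ⁆ ∷ Y ∷ G ∷ ⁅ d ⁆ ∷ []) (v0 || v1 <: (∅ || (v2 - v3)) || v4 ∷
          v2 || v4 == v5 - v6 ∷ []) ((v0 || v1) || v5) v5 refl (q ∷ XY ∷ [])) (set= (I′ ∷ W′ ∷ X ∷ ⁅ x ⁆ ∷ Y ∷ T ∷ []) (v0 || v1 <: (∅ || (v2 - v3)) || v4 ∷ v3 <: v2 - v5 ∷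
          v2 && v4 == ∅ ∷ []) (v3 && (v0 || v1)) ∅ refl (q ∷ x∈ ∷ XY0 ∷ []))
        augment-or-not : (∃[ y ] ⁅ y ⁆ ⊑ X ─ T × ρ Y < ρ (Y ∪ ⁅ y ⁆)) ⊎ ρ (Y ∪ (X ─ T)) ≤ ρ Y
        augment-or-not with suc (ρ Y) ≤? ρ (Y ∪ (X ─ T))
        ... | yes p = inj₁ (augment Y (X ─ T) p)
        ... | no p  = inj₂ (≤-pred (≰⇒> p))
        first : (∃[ y ] ⁅ y ⁆ ⊑ X ─ T × ρ Y < ρ (Y ∪ ⁅ y ⁆)) ⊎ ρ (Y ∪ (X ─ T)) ≤ ρ Y → Absurd
        first (inj₁ (y , y∈ , new)) = unspanned y∈ (outside-spanned (set= (⁅ y ⁆ ∷ X ∷ T ∷ []) (v0 <: v1 - v2 ∷ []) (v0 || v1) v1 refl (y∈ ∷ [])) new)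
        first (inj₂ flat) with ρ (T ∪ ⁅ x ⁆) ≤? 2
        ... | yes p = unspanned x∈ p
        ... | no p  = (refute (G ∷ T ∷ Y ∷ X ∷ ⁅ x ⁆ ∷ ⁅ d ⁆ ∷ []) [] (v4 <: v3 - v1 ∷ v1 <: v3 ∷ v3 || v2 == v0 - v5 ∷
          v5 <: v0 ∷ []) (rank v0 ⊕ con 2 <= rank v1 ⊕ rank (v0 - v1) ∷ rank (v2 || (v3 - v1)) <= rank v2 ∷
          rank v3 ⊕ rank v2 <= rank v0 ⊕ con 1 ∷ con 1 ⊕ con 2 <= rank (v1 || v4) ∷ rank v1 <= con 2 ∷
          card v5 <= con 1 ∷ []) (sub (v2 || (v3 - v1)) v5 ∷ mono (v1 || v4) (v3 && (v2 || (v1 || v4))) ∷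
          mono (v3 && (v2 || (v1 || v4))) v3 ∷ mono (v0 - v1) ((v0 - v1) || (v2 || (v3 - v1))) ∷ rc v5 ∷ [])
          refl (x∈ ∷ T⊑X ∷ XY ∷ d∈ ∷ []) (c ∷ flat ∷ s ∷ ≰⇒> p ∷ T-line ∷ ∣⁅ d ⁆∣≤1 ∷ []))
          where
          c = conn₂ {T} {G ─ T} (set= (T ∷ G ∷ []) (v0 <: v1 ∷ []) (v0 || (v1 - v0)) v1 refl (T⊑G ∷ [])) (set= (T ∷ G ∷ []) [] (v0 && (v1 - v0)) ∅ refl []) (prove≤ (T ∷ []) [] [] (con 3 <= card v0 ∷ []) [] (con 2) (card v0) refl []
            (≤-reflexive (sym T-size) ∷ [])) (prove≤ (Y ∷ X ∷ G ∷ ⁅ d ⁆ ∷ T ∷ []) [] (v1 || v0 == v2 - v3 ∷ v1 && v0 == ∅ ∷ v4 <: v1 ∷ [])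
            (con 2 <= card v0 ∷ []) (cmono v0 (v2 - v4) ∷ []) (con 2) (card (v2 - v4)) refl (XY ∷ XY0 ∷
            T⊑X ∷ []) (Y-size ∷ []))

    -- The side with two elements of `T` absorbs all of `T` at no cost in rank. N cannot live mainly
    -- on that side; living on the other, it forces that side to be exactly `T`.
    deletable-by : ∀ {A B} → A ∪ B ≡ G ─ ⁅ d ⁆ → A ∩ B ≡ ⊥ → ρ A + ρ B ≤ ρ G + 1 → 2 ≤ ∣ A ∣ → 2 ≤ ∣ B ∣ →
      2 ≤ ∣ T ∩ A ∣ → ρ (G ─ T ─ ⁅ d ⁆) + 1 ≤ ρ G × ∣ T ∩ I ∣ ≤ 1
    deletable-by {A} {B} AB dis s kA kB TA = cases (one-side {X = A ∪ T} {Y = B ─ T} {C₀ = ⊥} μ (set= (A ∷ B ∷ T ∷ []) (v0 && v1 == ∅ ∷ []) ((v0 || v2) && (v1 - v2)) ∅ refl (dis ∷ []))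
        (set= (I ∷ W ∷ G ∷ A ∷ T ∷ B ∷ ⁅ d ⁆ ∷ []) (v0 || v1 <: v2 ∷ (v3 || v4) || (v5 - v4) == v2 - v6 ∷
          v6 && (v0 || v1) == ∅ ∷ []) (v0 || ((v3 || v4) || (v5 - v4))) ((v3 || v4) || (v5 - v4)) refl
          (IW⊑ ∷ XY ∷ d∉ ∷ [])) (set= (I ∷ W ∷ G ∷ A ∷ T ∷ B ∷ ⁅ d ⁆ ∷ []) (v0 || v1 <: v2 ∷ (v3 || v4) || (v5 - v4) == v2 - v6 ∷
          v6 && (v0 || v1) == ∅ ∷ []) (v1 || (((v3 || v4) || (v5 - v4)) || ∅))
          (((v3 || v4) || (v5 - v4)) || ∅) refl (IW⊑ ∷ XY ∷ d∉ ∷ [])) (set= (W ∷ []) [] (∅ || v0) v0 refl []) (prove≤ (A ∷ T ∷ B ∷ G ∷ ⁅ d ⁆ ∷ []) [] ((v0 || v1) || (v2 - v1) == v3 - v4 ∷ [])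
          (rank (v0 || v1) <= rank v0 ∷ rank v0 ⊕ rank v2 <= rank v3 ⊕ con 1 ∷ rank v3 <= rank (v3 - v4) ∷
          []) (mono ((v2 - v1) || ∅) v2 ∷ []) (rank ((v0 || v1) || ∅) ⊕ rank ((v2 - v1) || ∅))
          ((rank (((v0 || v1) || (v2 - v1)) || ∅) ⊕ rank ∅) ⊕ con 1) refl (XY ∷ []) (XA ∷ s ∷ d-full ∷ [])))
      where
      T-rank : 2 ≤ ρ (T ∩ T)
      T-rank = T-spanned {T} (prove≤ (T ∷ []) [] [] (con 3 <= card v0 ∷ []) [] (con 2) (card (v0 && v0)) refl []
        (≤-reflexive (sym T-size) ∷ []))
      XY : (A ∪ T) ∪ (B ─ T) ≡ G ─ ⁅ d ⁆
      XY = set= (A ∷ B ∷ G ∷ ⁅ d ⁆ ∷ T ∷ []) (v0 || v1 == v2 - v3 ∷ v4 <: v2 ∷ v3 && v4 == ∅ ∷ [])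
        ((v0 || v4) || (v1 - v4)) (v2 - v3) refl (AB ∷ T⊑G ∷ d∉T ∷ [])
      XA : ρ (A ∪ T) ≤ ρ A
      XA = prove≤ (T ∷ A ∷ []) [] [] (con 2 <= rank (v0 && v1) ∷ rank v0 <= con 2 ∷ []) (sub v1 v0 ∷ [])
        (rank (v1 || v0)) (rank v1) refl [] (T-spanned {A} TA ∷ T-line ∷ [])
      -- At most one element of B outside `T` would form with d a set of rank at most 2,
      -- complementary to a set with no more rank than A. As B has rank at least 2, this partition
      -- of M would be too weakly connected.
      B-T : 2 ≤ ∣ B ─ T ∣
      B-T with 2 ≤? ∣ B ─ T ∣
      ... | yes p = p
      ... | no p with two-elements {A = B} kB
      ...   | u , v , u∈ , v∈ , uv = absurd (refute (G ∷ ⁅ d ⁆ ∷ B ∷ T ∷ A ∷ ⁅ u ⁆ ∷ ⁅ v ⁆ ∷ []) [] (v5 <: v2 ∷ v6 <: v2 ∷ [])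
        (rank v0 ⊕ con 2 <= rank (v1 || (v2 - v3)) ⊕ rank (v4 || v3) ∷ rank (v4 || v3) <= rank v4 ∷
        rank v4 ⊕ rank v2 <= rank v0 ⊕ con 1 ∷ con 2 <= rank (v5 || v6) ∷ rank (v1 || (v2 - v3)) <= con 2 ∷
        []) (mono (v5 || v6) v2 ∷ []) refl (u∈ ∷ v∈ ∷ []) (c ∷ XA ∷ s ∷
        (pair-rank {u} {v} (below u∈) (below v∈) uv) ∷ small ∷ []))
        where
        below : ∀ {u} → ⁅ u ⁆ ⊑ B → ⁅ u ⁆ ⊑ G
        below {u} p = set= (⁅ u ⁆ ∷ B ∷ A ∷ G ∷ ⁅ d ⁆ ∷ []) (v0 <: v1 ∷ v2 || v1 == v3 - v4 ∷ []) (v0 || v3) v3 refl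
          (p ∷ AB ∷ [])
        small : ρ (⁅ d ⁆ ∪ (B ─ T)) ≤ 2
        small = prove≤ (B ∷ T ∷ ⁅ d ⁆ ∷ []) [] [] (con 1 ⊕ card (v0 - v1) <= con 2 ∷ card v2 <= con 1 ∷ [])
          (csub (v0 - v1) v2 ∷ rc (v2 || (v0 - v1)) ∷ []) (rank (v2 || (v0 - v1))) (con 2) refl [] (≰⇒> p ∷
          ∣⁅ d ⁆∣≤1 ∷ [])
        c = conn₂ {⁅ d ⁆ ∪ (B ─ T)} {A ∪ T} (set= (A ∷ T ∷ B ∷ G ∷ ⁅ d ⁆ ∷ []) ((v0 || v1) || (v2 - v1) == v3 - v4 ∷ v4 <: v3 ∷ [])
          ((v4 || (v2 - v1)) || (v0 || v1)) v3 refl (XY ∷ d∈ ∷ [])) (set= (A ∷ T ∷ B ∷ G ∷ ⁅ d ⁆ ∷ []) ((v0 || v1) || (v2 - v1) == v3 - v4 ∷ v0 && v2 == ∅ ∷ [])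
          ((v4 || (v2 - v1)) && (v0 || v1)) ∅ refl (XY ∷ dis ∷ [])) (prove≤ (A ∷ B ∷ G ∷ ⁅ d ⁆ ∷ T ∷ []) [] (v0 || v1 == v2 - v3 ∷ v0 && v1 == ∅ ∷ [])
          (con 2 <= card v1 ∷ con 2 <= card (v4 && v0) ∷ card v4 <= con 3 ∷ con 1 <= card v3 ∷ [])
          (cmod (v4 && v0) (v1 && v4) ∷ cmod v3 ((v3 || (v1 - v4)) && v1) ∷
          csub ((v3 || (v1 - v4)) && v1) (v1 && v4) ∷ cmono ((v4 && v0) || (v1 && v4)) v4 ∷ c∅ ∷ []) (con 2)
          (card (v3 || (v1 - v4))) refl (AB ∷ dis ∷ []) (kB ∷ TA ∷ ≤-reflexive T-size ∷ 1≤∣⁅ d ⁆∣ ∷ [])) (prove≤ (T ∷ A ∷ []) [] [] (con 2 <= card (v0 && v1) ∷ []) (cmono (v0 && v1) (v1 || v0) ∷ [])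
          (con 2) (card (v1 || v0)) refl [] (TA ∷ []))
      cases : ∣ (A ∪ T) ∩ I ∣ ≤ 1 ⊎ ∣ (B ─ T) ∩ I ∣ ≤ 1 → ρ (G ─ T ─ ⁅ d ⁆) + 1 ≤ ρ G × ∣ T ∩ I ∣ ≤ 1
      cases (inj₂ one) = absurd (T-not-with-N {X = B ─ T} {Y = A ∪ T} (set= (A ∷ T ∷ B ∷ G ∷ ⁅ d ⁆ ∷ []) ((v0 || v1) || (v2 - v1) == v3 - v4 ∷ [])
        ((v2 - v1) || (v0 || v1)) (v3 - v4) refl (XY ∷ [])) (set= (A ∷ B ∷ T ∷ []) (v0 && v1 == ∅ ∷ []) ((v1 - v2) && (v0 || v2)) ∅ refl (dis ∷ [])) (prove≤ (A ∷ T ∷ B ∷ G ∷ []) [] [] (rank (v0 || v1) <= rank v0 ∷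
        rank v0 ⊕ rank v2 <= rank v3 ⊕ con 1 ∷ []) (mono (v2 - v1) v2 ∷ [])
        (rank (v2 - v1) ⊕ rank (v0 || v1)) (rank v3 ⊕ con 1) refl [] (XA ∷ s ∷ [])) B-T (prove≤ (T ∷ A ∷ []) [] [] (con 2 <= card (v0 && v1) ∷ []) (cmono (v0 && v1) (v1 || v0) ∷ [])
        (con 2) (card (v1 || v0)) refl [] (TA ∷ [])) one (set= (T ∷ A ∷ []) [] (v0 || (v1 || v0)) (v1 || v0) refl []))
      cases (inj₁ one) = (prove≤ (A ∷ T ∷ B ∷ G ∷ ⁅ d ⁆ ∷ []) [] (v0 <: v1 ∷ (v0 || v1) || (v2 - v1) == v3 - v4 ∷ [])
        (rank (v0 || v1) <= rank v0 ∷ rank v0 ⊕ rank v2 <= rank v3 ⊕ con 1 ∷ con 2 <= rank (v1 && v1) ∷ [])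
        (mono ((v3 - v1) - v4) v2 ∷ []) (rank ((v3 - v1) - v4) ⊕ con 1) (rank v3) refl (X≡T ∷ XY ∷ []) (XA ∷
        s ∷ T-rank ∷ [])) , (prove≤ (A ∷ T ∷ I ∷ []) [] [] (card ((v0 || v1) && v2) <= con 1 ∷ [])
        (cmono (v1 && v2) ((v0 || v1) && v2) ∷ []) (card (v1 && v2)) (con 1) refl [] (one ∷ []))
        where
        X≡T : A ∪ T ≡ T
        X≡T = separation-is-T {X = A ∪ T} {Y = B ─ T} XY (set= (A ∷ B ∷ T ∷ []) (v0 && v1 == ∅ ∷ []) ((v0 || v2) && (v1 - v2)) ∅ refl (dis ∷ [])) (prove≤ (A ∷ T ∷ B ∷ G ∷ []) [] [] (rank (v0 || v1) <= rank v0 ∷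
          rank v0 ⊕ rank v2 <= rank v3 ⊕ con 1 ∷ []) (mono (v2 - v1) v2 ∷ [])
          (rank (v0 || v1) ⊕ rank (v2 - v1)) (rank v3 ⊕ con 1) refl [] (XA ∷ s ∷ [])) (prove≤ (T ∷ A ∷ []) [] [] (con 2 <= card (v0 && v1) ∷ []) (cmono (v0 && v1) (v1 || v0) ∷ [])
          (con 2) (card (v1 || v0)) refl [] (TA ∷ [])) B-T one (set= (T ∷ A ∷ []) [] (v0 || (v1 || v0)) (v1 || v0) refl [])

    -- By minimality the deletion of d has a 2-separation, and `T` is then one of its sides. The
    -- first conclusion puts the complement of T ∪ d in a hyperplane, the germ of the cocircuit of
    -- outcome (b).
    deletable : ρ (G ─ T ─ ⁅ d ⁆) + 1 ≤ ρ G × ∣ T ∩ I ∣ ≤ 1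
    deletable with anySubset? (λ A → ((A ∪ (G ─ ⁅ d ⁆)) ≟ˢ (G ─ ⁅ d ⁆)) ×-dec (2 ≤? ∣ A ∣)
        ×-dec (2 ≤? ∣ G ─ ⁅ d ⁆ ─ A ∣) ×-dec (ρ A + ρ (G ─ ⁅ d ⁆ ─ A) ≤? ρ G + 1))
    ... | yes (A , A⊑ , kA , kB , s) with T-sides A (G ─ ⁅ d ⁆ ─ A) (set= (T ∷ G ∷ ⁅ d ⁆ ∷ A ∷ []) (v0 <: v1 ∷ v2 && v0 == ∅ ∷ []) (v0 || (v3 || ((v1 - v2) - v3)))
      (v3 || ((v1 - v2) - v3)) refl (T⊑G ∷ d∉T ∷ []))
    ...   | inj₁ q = deletable-by {A} {G ─ ⁅ d ⁆ ─ A} (set= (A ∷ G ∷ ⁅ d ⁆ ∷ []) (v0 <: v1 - v2 ∷ []) (v0 || ((v1 - v2) - v0)) (v1 - v2) refl (A⊑ ∷ [])) (set= (A ∷ G ∷ ⁅ d ⁆ ∷ []) [] (v0 && ((v1 - v2) - v0)) ∅ refl []) s kA kB q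
    ...   | inj₂ q = deletable-by {G ─ ⁅ d ⁆ ─ A} {A} (set= (A ∷ G ∷ ⁅ d ⁆ ∷ []) (v0 <: v1 - v2 ∷ []) (((v1 - v2) - v0) || v0) (v1 - v2) refl (A⊑ ∷ [])) (set= (G ∷ ⁅ d ⁆ ∷ A ∷ []) [] (((v0 - v1) - v2) && v2) ∅ refl []) (prove≤ (A ∷ G ∷ ⁅ d ⁆ ∷ []) [] [] (rank v0 ⊕ rank ((v1 - v2) - v0) <= rank v1 ⊕ con 1 ∷ []) []
      (rank ((v1 - v2) - v0) ⊕ rank v0) (rank v1 ⊕ con 1) refl [] (s ∷ [])) kB kA q
    deletable | no none = absurd (delete-minimal d∈ d∉T connected-d μ IW⊑ d∉)
      where
      connected-d : Connected₃ R (G ─ ⁅ d ⁆) ⊥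
      connected-d 1 _ _ A B AB dis kA kB with 2 ≤? ∣ A ∣
      ... | yes p = prove≤ (G ∷ A ∷ B ∷ ⁅ d ⁆ ∷ []) [] [] (rank v0 ⊕ con 2 <= rank v1 ⊕ rank (v2 || v3) ∷
        card v3 <= con 1 ∷ []) (sub (v2 || ∅) v3 ∷
        mono ((v0 - v3) || ∅) (((v0 - v3) || ∅) || ((v1 || ∅) && v0)) ∷
        mono (((v0 - v3) || ∅) || ((v1 || ∅) && v0)) v0 ∷ c∅ ∷ rc v3 ∷ rc ∅ ∷ [])
        ((rank ((v0 - v3) || ∅) ⊕ rank ∅) ⊕ con 1) (rank (v1 || ∅) ⊕ rank (v2 || ∅)) refl [] (c ∷
        ∣⁅ d ⁆∣≤1 ∷ [])
        where
        c = conn₂ {A} {B ∪ ⁅ d ⁆} (set= (A ∷ B ∷ G ∷ ⁅ d ⁆ ∷ []) (v0 || v1 == v2 - v3 ∷ v3 <: v2 ∷ []) (v0 || (v1 || v3)) v2 refl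
          (AB ∷ d∈ ∷ [])) (set= (A ∷ B ∷ G ∷ ⁅ d ⁆ ∷ []) (v0 || v1 == v2 - v3 ∷ v0 && v1 == ∅ ∷ []) (v0 && (v1 || v3)) ∅
          refl (AB ∷ dis ∷ [])) p (prove≤ (B ∷ A ∷ G ∷ ⁅ d ⁆ ∷ []) [] (v1 || v0 == v2 - v3 ∷ []) (con 1 <= card v0 ∷
          con 1 <= card v3 ∷ []) (cmod v0 v3 ∷ c∅ ∷ []) (con 2) (card (v0 || v3)) refl (AB ∷ []) (kB ∷
          1≤∣⁅ d ⁆∣ ∷ []))
      ... | no p = prove≤ (G ∷ A ∷ ⁅ d ⁆ ∷ B ∷ []) [] [] (rank v0 ⊕ con 2 <= rank (v1 || v2) ⊕ rank v3 ∷
        card v2 <= con 1 ∷ []) (sub (v1 || ∅) v2 ∷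
        mono ((v0 - v2) || ∅) (((v0 - v2) || ∅) || ((v1 || ∅) && v0)) ∷
        mono (((v0 - v2) || ∅) || ((v1 || ∅) && v0)) v0 ∷ c∅ ∷ rc v2 ∷ rc ∅ ∷ [])
        ((rank ((v0 - v2) || ∅) ⊕ rank ∅) ⊕ con 1) (rank (v1 || ∅) ⊕ rank (v3 || ∅)) refl [] (c ∷
        ∣⁅ d ⁆∣≤1 ∷ [])
        where
        c = conn₂ {A ∪ ⁅ d ⁆} {B} (set= (A ∷ B ∷ G ∷ ⁅ d ⁆ ∷ []) (v0 || v1 == v2 - v3 ∷ v3 <: v2 ∷ []) ((v0 || v3) || v1) v2 refl
          (AB ∷ d∈ ∷ [])) (set= (A ∷ B ∷ G ∷ ⁅ d ⁆ ∷ []) (v0 || v1 == v2 - v3 ∷ v0 && v1 == ∅ ∷ []) ((v0 || v3) && v1) ∅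
          refl (AB ∷ dis ∷ [])) (prove≤ (A ∷ B ∷ G ∷ ⁅ d ⁆ ∷ []) [] (v0 || v1 == v2 - v3 ∷ []) (con 1 <= card v0 ∷
          con 1 <= card v3 ∷ []) (cmod v0 v3 ∷ c∅ ∷ []) (con 2) (card (v0 || v3)) refl (AB ∷ []) (kA ∷
          1≤∣⁅ d ⁆∣ ∷ [])) (prove≤ (A ∷ B ∷ G ∷ ⁅ d ⁆ ∷ []) [] (v0 || v1 == v2 - v3 ∷ v3 <: v2 ∷ []) (con 4 <= card v2 ∷
          con 1 ⊕ card v0 <= con 2 ∷ card v3 <= con 1 ∷ []) (csub v1 (v0 || v3) ∷ csub v0 v3 ∷ []) (con 2)
          (card v1) refl (AB ∷ d∈ ∷ []) (G-size ∷ ≰⇒> p ∷ ∣⁅ d ⁆∣≤1 ∷ []))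
      connected-d 2 _ _ A B AB dis kA kB with ρ A + ρ B ≤? ρ G + 1
      ... | yes p = absurd (none (A , (set= (A ∷ B ∷ G ∷ ⁅ d ⁆ ∷ []) (v0 || v1 == v2 - v3 ∷ []) (v0 || (v2 - v3)) (v2 - v3) refl (AB ∷
        [])) , kA , (prove≤ (B ∷ A ∷ G ∷ ⁅ d ⁆ ∷ []) [] (v1 || v0 == v2 - v3 ∷ v1 && v0 == ∅ ∷ []) (con 2 <= card v0 ∷
        []) [] (con 2) (card ((v2 - v3) - v1)) refl (AB ∷ dis ∷ []) (kB ∷ [])) , (prove≤ (A ∷ B ∷ G ∷ ⁅ d ⁆ ∷ []) [] (v0 || v1 == v2 - v3 ∷ v0 && v1 == ∅ ∷ [])
        (rank v0 ⊕ rank v1 <= rank v2 ⊕ con 1 ∷ []) [] (rank v0 ⊕ rank ((v2 - v3) - v0)) (rank v2 ⊕ con 1)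
        refl (AB ∷ dis ∷ []) (p ∷ []))))
      ... | no p  = prove≤ (G ∷ A ∷ B ∷ ⁅ d ⁆ ∷ []) [] [] (con 1 ⊕ rank v0 ⊕ con 1 <= rank v1 ⊕ rank v2 ∷ [])
        (mono ((v0 - v3) || ∅) v0 ∷ c∅ ∷ rc ∅ ∷ []) ((rank ((v0 - v3) || ∅) ⊕ rank ∅) ⊕ con 2)
        (rank (v1 || ∅) ⊕ rank (v2 || ∅)) refl [] (≰⇒> p ∷ [])
      connected-d (suc (suc (suc k))) _ (s≤s (s≤s ()))

  T-rank : 2 ≤ ρ T
  T-rank = prove≤ (T ∷ []) [] [] (con 2 <= rank (v0 && v0) ∷ []) [] (con 2) (rank v0) refl []
    (T-spanned {T} full ∷ [])
    where
    full : 2 ≤ ∣ T ∩ T ∣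
    full = prove≤ (T ∷ []) [] [] (con 3 <= card v0 ∷ []) [] (con 2) (card (v0 && v0)) refl []
      (≤-reflexive (sym T-size) ∷ [])

  -- N has at least three elements outside `T`, so the complement of `T` is large enough for
  -- 3-connectivity to apply; as `T` has rank 2, that complement must span.
  T-coindependent : ∀ {I W} → Model I W → I ∪ W ⊑ G → ∣ T ∩ I ∣ ≤ 1 → ρ G ≤ ρ (G ─ T)
  T-coindependent {I} {W} μ IW⊑ one = prove≤ (G ∷ T ∷ []) [] [] (rank v0 ⊕ con 2 <= rank v1 ⊕ rank (v0 - v1) ∷ rank v1 <= con 2 ∷ []) []
    (rank v0) (rank (v0 - v1)) refl [] (c ∷ T-line ∷ [])
    where
    c = conn₂ {T} {G ─ T} (set= (T ∷ G ∷ []) (v0 <: v1 ∷ []) (v0 || (v1 - v0)) v1 refl (T⊑G ∷ [])) (set= (T ∷ G ∷ []) [] (v0 && (v1 - v0)) ∅ refl []) (prove≤ (T ∷ []) [] [] (con 3 <= card v0 ∷ []) [] (con 2) (card v0) refl []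
      (≤-reflexive (sym T-size) ∷ [])) (prove≤ (I ∷ W ∷ G ∷ T ∷ []) [] (v0 || v1 <: v2 ∷ []) (con 4 <= card v0 ∷ card (v3 && v0) <= con 1 ∷
      []) (csub (v2 - v3) (v3 && v0) ∷ cmono v0 ((v2 - v3) || v0) ∷ []) (con 2) (card (v2 - v3)) refl (IW⊑ ∷
      []) (model-size μ ∷ one ∷ []))

  model-nonloop : ∀ {I W y} → Model I W → ⁅ y ⁆ ⊑ I → ρ W + 1 ≤ ρ (⁅ y ⁆ ∪ W)
  model-nonloop {I} {W} {y} μ y∈ = prove≤ (I ∷ W ∷ ⁅ y ⁆ ∷ []) [] []
    ((rank (v0 || v1) ⊕ rank v1) ⊕ con 1 <= rank (v2 || v1) ⊕ rank ((v0 - v2) || v1) ∷ [])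
    (mono ((v0 - v2) || v1) (v0 || v1) ∷ []) (rank v1 ⊕ con 1) (rank (v2 || v1)) refl [] (c ∷ [])
    where
    c = connected μ {⁅ y ⁆} {I ─ ⁅ y ⁆} (set= (⁅ y ⁆ ∷ I ∷ []) (v0 <: v1 ∷ []) (v0 || (v1 - v0)) v1 refl (y∈ ∷ [])) (set= (⁅ y ⁆ ∷ I ∷ []) [] (v0 && (v1 - v0)) ∅ refl []) 1 ≤-refl (s≤s z≤n) (prove≤ (⁅ y ⁆ ∷ []) [] [] (con 1 <= card v0 ∷ []) [] (con 1) (card v0) refl [] (1≤∣⁅ y ⁆∣ ∷ [])) (prove≤ (I ∷ ⁅ y ⁆ ∷ []) [] (v1 <: v0 ∷ []) (con 4 <= card v0 ∷ card v1 <= con 1 ∷ [])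
      (csub (v0 - v1) v1 ∷ []) (con 1) (card (v0 - v1)) refl (y∈ ∷ []) (model-size μ ∷ ∣⁅ y ⁆∣≤1 ∷ []))

  -- The complements of T ∪ a and of T ∪ b are not spanning, so the complement of T ∪ a ∪ b has
  -- corank two. As I ∪ W spans, `T` is skew to that complement; N, being connected, avoids `T`, and
  -- contracting W ∩ T amounts to deleting it. The element b is skew to that complement too, so it
  -- can be contracted instead, which puts it on the line of `T`. There it is not deletable.
  two-undeletable : ∀ {I W a b} → ⁅ a ⁆ ⊑ G → ⁅ b ⁆ ⊑ G → ⁅ a ⁆ ∩ ⁅ b ⁆ ≡ ⊥ → ⁅ a ⁆ ∩ T ≡ ⊥ → ⁅ b ⁆ ∩ T ≡ ⊥ →
    Model I W → I ∪ W ⊑ G → ρ G ≤ ρ (I ∪ W) → ⁅ a ⁆ ∩ (I ∪ W) ≡ ⊥ → ⁅ b ⁆ ∩ (I ∪ W) ≡ ⊥ → Absurd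
  two-undeletable {I} {W} {a} {b} a∈ b∈ ab a∉T b∉T μ IW⊑ spanning a∉ b∉
    with deletable a∈ a∉T μ IW⊑ a∉ | deletable b∈ b∉T μ IW⊑ b∉
  ... | da , one | db , _ = spanned-undeletable b∈ b∉T
      (contractible-spanned b∈ (recontract ((W ─ T) ∪ ⁅ b ⁆) μ (set= (I ∷ W ∷ ⁅ b ⁆ ∷ T ∷ []) (v0 && v1 == ∅ ∷ v2 && (v0 || v1) == ∅ ∷ [])
        (v0 && ((v1 - v3) || v2)) ∅ refl (dis ∷ b∉ ∷ [])) moved) (set= (I ∷ W ∷ G ∷ ⁅ b ⁆ ∷ T ∷ []) (v0 || v1 <: v2 ∷ v3 <: v2 ∷ [])
        ((v0 || ((v1 - v4) || v3)) || v2) v2 refl (IW⊑ ∷ b∈ ∷ [])) (set= (⁅ b ⁆ ∷ W ∷ T ∷ []) [] (v0 || ((v1 - v2) || v0)) ((v1 - v2) || v0) refl []))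
      μ IW⊑ b∉
    where
    dis : I ∩ W ≡ ⊥
    dis = disjoint μ
    full : ρ G ≤ ρ (G ─ T)
    full = T-coindependent μ IW⊑ one
    Y-rank : ρ (G ─ T ─ ⁅ a ⁆ ─ ⁅ b ⁆) + 2 ≤ ρ G
    Y-rank = prove≤ (G ∷ T ∷ ⁅ a ⁆ ∷ ⁅ b ⁆ ∷ []) [] (v2 && v3 == ∅ ∷ [])
      (rank ((v0 - v1) - v2) ⊕ con 1 <= rank v0 ∷ rank ((v0 - v1) - v3) ⊕ con 1 <= rank v0 ∷
      rank v0 <= rank (v0 - v1) ∷ []) (sub ((v0 - v1) - v2) ((v0 - v1) - v3) ∷ [])
      (rank (((v0 - v1) - v2) - v3) ⊕ con 2) (rank v0) refl (ab ∷ []) (da ∷ db ∷ full ∷ [])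
    Yb-rank : ρ G ≤ ρ ((G ─ T ─ ⁅ a ⁆ ─ ⁅ b ⁆) ∪ ⁅ b ⁆) + 1
    Yb-rank = prove≤ (G ∷ T ∷ ⁅ a ⁆ ∷ ⁅ b ⁆ ∷ []) [] [] (rank v0 <= rank (v0 - v1) ∷ card v2 <= con 1 ∷ [])
      (sub ((((v0 - v1) - v2) - v3) || v3) v2 ∷ mono (v0 - v1) (((((v0 - v1) - v2) - v3) || v3) || v2) ∷
      rc v2 ∷ []) (rank v0) (rank ((((v0 - v1) - v2) - v3) || v3) ⊕ con 1) refl [] (full ∷ ∣⁅ a ⁆∣≤1 ∷ [])
    skew : ∀ {A B} → A ⊑ G ─ T ─ ⁅ a ⁆ ─ ⁅ b ⁆ → B ⊑ T → ρ A + ρ B ≤ ρ (A ∪ B)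
    skew {A} {B} A⊑ B⊑ = prove≤ (G ∷ T ∷ ⁅ a ⁆ ∷ ⁅ b ⁆ ∷ A ∷ B ∷ []) [] (v4 <: ((v0 - v1) - v2) - v3 ∷ v5 <: v1 ∷ [])
      (rank (((v0 - v1) - v2) - v3) ⊕ rank v1 <= rank ((((v0 - v1) - v2) - v3) || v1) ∷ [])
      (sub (v4 || v5) v1 ∷ sub (((v0 - v1) - v2) - v3) ((v4 || v5) || v1) ∷ []) (rank v4 ⊕ rank v5)
      (rank (v4 || v5)) refl (A⊑ ∷ B⊑ ∷ []) (YT ∷ [])
      where
      YT : ρ (G ─ T ─ ⁅ a ⁆ ─ ⁅ b ⁆) + ρ T ≤ ρ ((G ─ T ─ ⁅ a ⁆ ─ ⁅ b ⁆) ∪ T)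
      YT = prove≤ (G ∷ T ∷ ⁅ a ⁆ ∷ ⁅ b ⁆ ∷ I ∷ W ∷ []) [] (v4 || v5 <: v0 ∷ v2 && (v4 || v5) == ∅ ∷
        v3 && (v4 || v5) == ∅ ∷ []) (rank (((v0 - v1) - v2) - v3) ⊕ con 2 <= rank v0 ∷ rank v1 <= con 2 ∷
        rank v0 <= rank (v4 || v5) ∷ []) (mono (v4 || v5) ((((v0 - v1) - v2) - v3) || v1) ∷ [])
        (rank (((v0 - v1) - v2) - v3) ⊕ rank v1) (rank ((((v0 - v1) - v2) - v3) || v1)) refl (IW⊑ ∷ a∉ ∷
        b∉ ∷ []) (Y-rank ∷ T-line ∷ spanning ∷ [])
    I-T : T ∩ I ≡ ⊥
    I-T with 1 ≤? ∣ T ∩ I ∣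
    ... | no p  = ∣∣≤0⇒≡⊥ (prove≤ (T ∷ I ∷ []) [] [] (con 1 ⊕ card (v0 && v1) <= con 1 ∷ []) [] (card (v0 && v1)) (con 0) refl
      [] (≰⇒> p ∷ []))
    ... | yes p = absurd (refute (I ∷ W ∷ T ∷ []) [] []
      ((rank (v0 || v1) ⊕ rank v1) ⊕ con 1 <= rank ((v2 && v0) || v1) ⊕ rank ((v0 - v2) || v1) ∷
      rank ((v0 || v1) - v2) ⊕ rank ((v0 || v1) && v2) <= rank (v0 || v1) ∷ []) (sub v1 ((v0 || v1) && v2) ∷
      sub ((v0 || v1) - v2) (v1 && ((v0 || v1) && v2)) ∷ []) refl [] (c ∷ k₁ ∷ []))
      where
      c = connected μ {T ∩ I} {I ─ T} (set= (T ∷ I ∷ []) [] ((v0 && v1) || (v1 - v0)) v1 refl []) (set= (T ∷ I ∷ []) [] ((v0 && v1) && (v1 - v0)) ∅ refl []) 1 ≤-refl (s≤s z≤n) p (prove≤ (I ∷ T ∷ []) [] [] (con 4 <= card v0 ∷ card (v1 && v0) <= con 1 ∷ [])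
        (csub (v0 - v1) (v1 && v0) ∷ []) (con 1) (card (v0 - v1)) refl [] (model-size μ ∷ one ∷ []))
      k₁ : ρ ((I ∪ W) ─ T) + ρ ((I ∪ W) ∩ T) ≤ ρ (I ∪ W)
      k₁ = prove≤ (I ∷ W ∷ T ∷ []) [] []
        (rank ((v0 || v1) - v2) ⊕ rank ((v0 || v1) && v2) <= rank (((v0 || v1) - v2) || ((v0 || v1) && v2)) ∷
        []) [] (rank ((v0 || v1) - v2) ⊕ rank ((v0 || v1) && v2)) (rank (v0 || v1)) refl []
        ((skew {A = (I ∪ W) ─ T} {B = (I ∪ W) ∩ T} low inT) ∷ [])
        where
        inT : (I ∪ W) ∩ T ⊑ T
        inT = set= (I ∷ W ∷ T ∷ []) [] (((v0 || v1) && v2) || v2) v2 refl []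
        low : (I ∪ W) ─ T ⊑ G ─ T ─ ⁅ a ⁆ ─ ⁅ b ⁆
        low = set= (I ∷ W ∷ G ∷ ⁅ a ⁆ ∷ ⁅ b ⁆ ∷ T ∷ []) (v0 || v1 <: v2 ∷ v3 && (v0 || v1) == ∅ ∷
          v4 && (v0 || v1) == ∅ ∷ []) (((v0 || v1) - v5) || (((v2 - v5) - v3) - v4)) (((v2 - v5) - v3) - v4)
          refl (IW⊑ ∷ a∉ ∷ b∉ ∷ [])
    moved : ∀ A → A ⊑ I → ρ (A ∪ (W ─ T) ∪ ⁅ b ⁆) + ρ W ≡ ρ (A ∪ W) + ρ ((W ─ T) ∪ ⁅ b ⁆)
    moved A A⊑ = ≤-antisym (prove≤ (A ∷ W ∷ T ∷ ⁅ b ⁆ ∷ []) [] []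
      (rank (v0 || ((v1 - v2) || v3)) ⊕ rank (v1 && v2) <= rank (v0 || v1) ⊕ con 1 ∷
      rank (∅ || v1) ⊕ con 1 <= rank (∅ || ((v1 - v2) || v3)) ⊕ rank (v1 && v2) ∷ []) []
      (rank (v0 || ((v1 - v2) || v3)) ⊕ rank v1) (rank (v0 || v1) ⊕ rank ((v1 - v2) || v3)) refl []
      (≤-reflexive (close A A⊑) ∷ ≤-reflexive (sym (close ⊥ bot)) ∷ []))
      (prove≤ (A ∷ W ∷ T ∷ ⁅ b ⁆ ∷ []) [] []
      (rank (v0 || v1) ⊕ con 1 <= rank (v0 || ((v1 - v2) || v3)) ⊕ rank (v1 && v2) ∷
      rank (∅ || ((v1 - v2) || v3)) ⊕ rank (v1 && v2) <= rank (∅ || v1) ⊕ con 1 ∷ []) []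
      (rank (v0 || v1) ⊕ rank ((v1 - v2) || v3)) (rank (v0 || ((v1 - v2) || v3)) ⊕ rank v1) refl []
      (≤-reflexive (sym (close A A⊑)) ∷ ≤-reflexive (close ⊥ bot) ∷ []))
      where
      bot : ⊥ ⊑ I
      bot = set= (I ∷ []) [] (∅ || v0) v0 refl []
      -- Both W ∩ T and b are skew to A ∪ (W minus T), so trading one for the other shifts every
      -- rank by the same amount, whatever A is.
      close : ∀ A → A ⊑ I → ρ (A ∪ (W ─ T) ∪ ⁅ b ⁆) + ρ (W ∩ T) ≡ ρ (A ∪ W) + 1
      close A A⊑ = ≤-antisym (prove≤ (A ∷ W ∷ T ∷ ⁅ b ⁆ ∷ []) [] []
        (rank (v0 || (v1 - v2)) ⊕ rank (v1 && v2) <= rank ((v0 || (v1 - v2)) || (v1 && v2)) ∷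
        card v3 <= con 1 ∷ []) (sub (v0 || (v1 - v2)) v3 ∷ rc v3 ∷ [])
        (rank (v0 || ((v1 - v2) || v3)) ⊕ rank (v1 && v2)) (rank (v0 || v1) ⊕ con 1) refl [] (k ∷
        ∣⁅ b ⁆∣≤1 ∷ []))
        (prove≤ (A ∷ W ∷ T ∷ ⁅ b ⁆ ∷ []) [] []
        (rank (v0 || (v1 - v2)) ⊕ con 1 <= rank ((v0 || (v1 - v2)) || v3) ∷ [])
        (sub (v1 && v2) (v0 || (v1 - v2)) ∷ []) (rank (v0 || v1) ⊕ con 1)
        (rank (v0 || ((v1 - v2) || v3)) ⊕ rank (v1 && v2)) refl [] (b-new ∷ []))
        where
        low : A ∪ (W ─ T) ⊑ G ─ T ─ ⁅ a ⁆ ─ ⁅ b ⁆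
        low = set= (I ∷ W ∷ G ∷ ⁅ a ⁆ ∷ ⁅ b ⁆ ∷ A ∷ T ∷ []) (v0 || v1 <: v2 ∷ v3 && (v0 || v1) == ∅ ∷
          v4 && (v0 || v1) == ∅ ∷ v5 <: v0 ∷ v6 && v0 == ∅ ∷ [])
          ((v5 || (v1 - v6)) || (((v2 - v6) - v3) - v4)) (((v2 - v6) - v3) - v4) refl (IW⊑ ∷ a∉ ∷ b∉ ∷ A⊑ ∷
          I-T ∷ [])
        k = skew {A = A ∪ (W ─ T)} {B = W ∩ T} low (set= (W ∷ T ∷ []) [] ((v0 && v1) || v1) v1 refl [])
        b-new : ρ (A ∪ (W ─ T)) + 1 ≤ ρ ((A ∪ (W ─ T)) ∪ ⁅ b ⁆)
        b-new = prove≤ (G ∷ T ∷ ⁅ a ⁆ ∷ ⁅ b ⁆ ∷ A ∷ W ∷ []) [] (v4 || (v5 - v1) <: ((v0 - v1) - v2) - v3 ∷ [])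
          (rank v0 <= rank ((((v0 - v1) - v2) - v3) || v3) ⊕ con 1 ∷
          rank (((v0 - v1) - v2) - v3) ⊕ con 2 <= rank v0 ∷ [])
          (sub ((v4 || (v5 - v1)) || v3) (((v0 - v1) - v2) - v3) ∷ []) (rank (v4 || (v5 - v1)) ⊕ con 1)
          (rank ((v4 || (v5 - v1)) || v3)) refl (low ∷ []) (Yb-rank ∷ Y-rank ∷ [])

  -- Normalised `N`-minors.

  -- After a basis B of W is contracted the rest of W consists of loops and can be deleted. Elements
  -- D independent over I ∪ B can be contracted instead of deleted with the same effect on I, and
  -- they make the pair spanning.
  normalise : ∀ {I W} → Model I W → I ∪ W ⊑ G →
    ∃[ W′ ] Model I W′ × I ∪ W′ ⊑ G × ρ G ≤ ρ (I ∪ W′) × ρ W′ ≡ ∣ W′ ∣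
  normalise {I} {W} μ IW⊑ with basis ⊥ W
  ... | B , B⊑ , b₁ , b₂ with basis (I ∪ B) (G ─ (I ∪ B))
  ...   | D , D⊑ , d₁ , d₂ = B ∪ D , recontract (B ∪ D) μ (set= (I ∷ W ∷ B ∷ D ∷ G ∷ []) (v0 && v1 == ∅ ∷ v2 <: v1 ∷ v3 <: v4 - (v0 || v2) ∷ [])
    (v0 && (v2 || v3)) ∅ refl (dis ∷ B⊑ ∷ D⊑ ∷ [])) moved , (set= (I ∷ W ∷ G ∷ B ∷ D ∷ []) (v0 || v1 <: v2 ∷ v3 <: v1 ∷ v4 <: v2 - (v0 || v3) ∷ [])
    ((v0 || (v3 || v4)) || v2) v2 refl (IW⊑ ∷ B⊑ ∷ D⊑ ∷ [])) ,
      (prove≤ (I ∷ B ∷ D ∷ G ∷ W ∷ []) [] (v0 || v4 <: v3 ∷ v1 <: v4 ∷ [])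
        (rank ((v0 || v1) || (v3 - (v0 || v1))) <= rank ((v0 || v1) || v2) ∷ []) [] (rank v3)
        (rank (v0 || (v1 || v2))) refl (IW⊑ ∷ B⊑ ∷ []) (≤-reflexive (sym d₁) ∷ [])) , (≤-antisym (prove≤ (B ∷ D ∷ []) [] [] [] (rc (v0 || v1) ∷ []) (rank (v0 || v1)) (card (v0 || v1)) refl [] [])
        (prove≤ (B ∷ I ∷ D ∷ G ∷ []) [] (v2 <: v3 - (v1 || v0) ∷ []) (rank ∅ ⊕ card v0 <= rank (∅ || v0) ∷
        rank (v1 || v0) ⊕ card v2 <= rank ((v1 || v0) || v2) ∷ []) (sub (v0 || v2) (v1 || v0) ∷ csub v0 v2 ∷
        []) (card (v0 || v2)) (rank (v0 || v2)) refl (D⊑ ∷ []) (≤-reflexive (sym b₂) ∷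
        ≤-reflexive (sym d₂) ∷ [])))
    where
    dis : I ∩ W ≡ ⊥
    dis = disjoint μ
    moved : ∀ A → A ⊑ I → ρ (A ∪ B ∪ D) + ρ W ≡ ρ (A ∪ W) + ρ (B ∪ D)
    moved A A⊑ = ≤-antisym (prove≤ (A ∷ B ∷ D ∷ W ∷ []) [] [] (rank (v0 || (v1 || v2)) <= rank (v0 || v1) ⊕ card v2 ∷
      rank (∅ || v1) ⊕ card v2 <= rank (∅ || (v1 || v2)) ∷ rank (v0 || v1) <= rank (v0 || v3) ∷
      rank (∅ || v3) <= rank (∅ || v1) ∷ []) [] (rank (v0 || (v1 || v2)) ⊕ rank v3)
      (rank (v0 || v3) ⊕ rank (v1 || v2)) refl [] (≤-reflexive (close A A⊑) ∷
      ≤-reflexive (sym (close ⊥ bot)) ∷ ≤-reflexive AB ∷ ≤-reflexive (sym b₁) ∷ []))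
      (prove≤ (A ∷ B ∷ D ∷ W ∷ []) [] [] (rank (v0 || v1) ⊕ card v2 <= rank (v0 || (v1 || v2)) ∷
      rank (∅ || (v1 || v2)) <= rank (∅ || v1) ⊕ card v2 ∷ rank (v0 || v3) <= rank (v0 || v1) ∷
      rank (∅ || v1) <= rank (∅ || v3) ∷ []) [] (rank (v0 || v3) ⊕ rank (v1 || v2))
      (rank (v0 || (v1 || v2)) ⊕ rank v3) refl [] (≤-reflexive (sym (close A A⊑)) ∷
      ≤-reflexive (close ⊥ bot) ∷ ≤-reflexive (sym AB) ∷ ≤-reflexive b₁ ∷ []))
      where
      bot : ⊥ ⊑ I
      bot = set= (I ∷ []) [] (∅ || v0) v0 refl []
      AB : ρ (A ∪ B) ≡ ρ (A ∪ W)
      AB = ≤-antisym (prove≤ (B ∷ W ∷ A ∷ []) [] (v0 <: v1 ∷ []) [] (mono (v2 || v0) (v2 || v1) ∷ []) (rank (v2 || v0))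
        (rank (v2 || v1)) refl (B⊑ ∷ []) [])
        (prove≤ (B ∷ W ∷ A ∷ []) [] (v0 <: v1 ∷ []) (rank (∅ || v1) <= rank (∅ || v0) ∷ [])
        (sub (v2 || v0) (∅ || v1) ∷ mono (∅ || v0) ((v2 || v0) && (∅ || v1)) ∷ []) (rank (v2 || v1))
        (rank (v2 || v0)) refl (B⊑ ∷ []) (≤-reflexive (sym b₁) ∷ []))
      close : ∀ A → A ⊑ I → ρ (A ∪ B ∪ D) ≡ ρ (A ∪ B) + ∣ D ∣
      close A A⊑ = ≤-antisym (prove≤ (B ∷ D ∷ A ∷ []) [] [] [] (sub (v2 || v0) v1 ∷ rc v1 ∷ []) (rank (v2 || (v0 || v1)))
        (rank (v2 || v0) ⊕ card v1) refl [] [])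
        (prove≤ (I ∷ B ∷ D ∷ A ∷ []) [] (v3 <: v0 ∷ [])
        (rank (v0 || v1) ⊕ card v2 <= rank ((v0 || v1) || v2) ∷ []) (sub (v3 || (v1 || v2)) (v0 || v1) ∷
        mono (v3 || v1) ((v3 || (v1 || v2)) && (v0 || v1)) ∷ []) (rank (v3 || v1) ⊕ card v2)
        (rank (v3 || (v1 || v2))) refl (A⊑ ∷ []) (≤-reflexive (sym d₂) ∷ []))

  contracted-in-span : ∀ {I W} → Model I W → I ∪ W ⊑ G → ρ (T ∪ W) ≤ 2
  contracted-in-span {I} {W} μ IW⊑ with 3 ≤? ρ (T ∪ W)
  ... | no p  = prove≤ (T ∷ W ∷ []) [] [] (con 1 ⊕ rank (v0 || v1) <= con 3 ∷ []) [] (rank (v0 || v1)) (con 2) refl []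
    (≰⇒> p ∷ [])
  ... | yes p with augment T W (prove≤ (T ∷ W ∷ []) [] [] (con 3 <= rank (v0 || v1) ∷ rank v0 <= con 2 ∷ []) [] (con 1 ⊕ rank v0)
    (rank (v0 || v1)) refl [] (p ∷ T-line ∷ []))
  ...   | w , w∈ , q = absurd (refute (T ∷ ⁅ w ⁆ ∷ []) [] [] (con 1 ⊕ rank v0 <= rank (v0 || v1) ∷ con 2 <= rank v0 ∷
    rank (v0 || v1) <= con 2 ∷ []) [] refl [] (q ∷ T-rank ∷ contractible-spanned {w} below μ IW⊑ w∈ ∷ []))
    where
    below : ⁅ w ⁆ ⊑ G
    below = set= (⁅ w ⁆ ∷ W ∷ I ∷ G ∷ []) (v0 <: v1 ∷ v2 || v1 <: v3 ∷ []) (v0 || v3) v3 refl (w∈ ∷ IW⊑ ∷ [])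

  other-T : ∀ x → ∃[ t ] ∃[ t′ ] ⁅ t ⁆ ⊑ T × ⁅ t′ ⁆ ⊑ T × ⁅ t ⁆ ∩ ⁅ t′ ⁆ ≡ ⊥ × ⁅ t ⁆ ∩ ⁅ x ⁆ ≡ ⊥ × ⁅ t′ ⁆ ∩ ⁅ x ⁆ ≡ ⊥
  other-T x with two-elements {A = T ─ ⁅ x ⁆} (prove≤ (T ∷ ⁅ x ⁆ ∷ []) [] [] (con 3 <= card v0 ∷ card v1 <= con 1 ∷ []) (csub (v0 - v1) v1 ∷
    cmono v0 ((v0 - v1) || v1) ∷ []) (con 2) (card (v0 - v1)) refl [] (≤-reflexive (sym T-size) ∷
    ∣⁅ x ⁆∣≤1 ∷ []))
  ... | t , t′ , p , q , d = t , t′ , (set= (⁅ t ⁆ ∷ T ∷ ⁅ x ⁆ ∷ []) (v0 <: v1 - v2 ∷ []) (v0 || v1) v1 refl (p ∷ [])) , (set= (⁅ t′ ⁆ ∷ T ∷ ⁅ x ⁆ ∷ []) (v0 <: v1 - v2 ∷ []) (v0 || v1) v1 refl (q ∷ [])) , d , (set= (⁅ t ⁆ ∷ T ∷ ⁅ x ⁆ ∷ []) (v0 <: v1 - v2 ∷ []) (v0 && v2) ∅ refl (p ∷ [])) , (set= (⁅ t′ ⁆ ∷ T ∷ ⁅ x ⁆ ∷ []) (v0 <: v1 - v2 ∷ []) (v0 && v2) ∅ refl (q ∷ []))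

  in-G : ∀ {t} → ⁅ t ⁆ ⊑ T → ⁅ t ⁆ ⊑ G
  in-G {t} p = set= (⁅ t ⁆ ∷ T ∷ G ∷ []) (v0 <: v1 ∷ v1 <: v2 ∷ []) (v0 || v2) v2 refl (p ∷ T⊑G ∷ [])

  -- A point x of cl T outside `T`, and outcome (a).

  module Point {x} (x∈ : ⁅ x ⁆ ⊑ G) (x∉T : ⁅ x ⁆ ∩ T ≡ ⊥) (Tx : ρ (T ∪ ⁅ x ⁆) ≤ 2) where

    -- If M / z has an N-minor for some z ≠ x, then x is parallel to an element of T in
    -- M / z, so it can be deleted.
    only-contractible : ∀ {I W z} → Model I W → I ∪ W ⊑ G → ⁅ z ⁆ ⊑ W → ⁅ z ⁆ ∩ ⁅ x ⁆ ≡ ⊥ → Absurd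
    -- Two elements of `T` other than z are used: t is parallel to x over z and takes its place, and
    -- t′ stays on the other side to span t there.
    only-contractible {I} {W} {z} μ IW⊑ z∈ zx with other-T z
    ... | t , t′ , t∈ , t′∈ , tt′ , tz , t′z = finish
        (survives {C = ⊥} {f = t} μ I⊑ W⊑ z∈ one (set= (⁅ x ⁆ ∷ ⁅ t ⁆ ∷ []) [] (∅ || (v0 || v1)) (v0 || v1) refl []) (set= (⁅ t ⁆ ∷ ⁅ x ⁆ ∷ []) [] (v0 || (v1 || v0)) (v1 || v0) refl []) (prove≤ (⁅ z ⁆ ∷ G ∷ ⁅ x ⁆ ∷ ⁅ t ⁆ ∷ []) [] [] [] []
          (rank (∅ || v0) ⊕ rank (((v1 - v0) - (v2 || v3)) || v0))
          (rank ((∅ || ((v1 - v0) - (v2 || v3))) || v0) ⊕ rank v0) refl [] []) (prove≤ (⁅ t ⁆ ∷ ⁅ z ⁆ ∷ []) [] [] (con 2 <= rank (v0 || v1) ∷ card v1 <= con 1 ∷ []) (rc v1 ∷ [])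
          (rank (∅ || v1) ⊕ con 1) (rank ((v0 || ∅) || v1)) refl [] (tz-rank ∷ ∣⁅ z ⁆∣≤1 ∷ [])) spanned)
      where
      dis : I ∩ W ≡ ⊥
      dis = disjoint μ
      z∈G : ⁅ z ⁆ ⊑ G
      z∈G = set= (⁅ z ⁆ ∷ W ∷ I ∷ G ∷ []) (v0 <: v1 ∷ v2 || v1 <: v3 ∷ []) (v0 || v3) v3 refl (z∈ ∷ IW⊑ ∷ [])
      Tz : ρ (T ∪ ⁅ z ⁆) ≤ 2
      Tz = contractible-spanned z∈G μ IW⊑ z∈
      z-rank : 1 ≤ ρ ⁅ z ⁆
      z-rank = nonloop z∈G
      tz-rank : 2 ≤ ρ (⁅ t ⁆ ∪ ⁅ z ⁆)
      tz-rank = pair-rank {t} {z} (in-G t∈) z∈G tz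
      t′z-rank : 2 ≤ ρ (⁅ t′ ⁆ ∪ ⁅ z ⁆)
      t′z-rank = pair-rank {t′} {z} (in-G t′∈) z∈G t′z
      XY0 : (⁅ x ⁆ ∪ ⁅ t ⁆) ∩ (G ─ ⁅ z ⁆ ─ (⁅ x ⁆ ∪ ⁅ t ⁆)) ≡ ⊥
      XY0 = set= (⁅ x ⁆ ∷ ⁅ t ⁆ ∷ G ∷ ⁅ z ⁆ ∷ []) [] ((v0 || v1) && ((v2 - v3) - (v0 || v1))) ∅ refl []
      Txz : ρ ((⁅ x ⁆ ∪ ⁅ t ⁆) ∪ ⁅ z ⁆) ≤ 2
      Txz = prove≤ (T ∷ ⁅ x ⁆ ∷ ⁅ z ⁆ ∷ ⁅ t ⁆ ∷ []) [] (v3 <: v0 ∷ []) (rank (v0 || v1) <= con 2 ∷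
        rank (v0 || v2) <= con 2 ∷ con 2 <= rank v0 ∷ []) (sub (v0 || v1) (v0 || v2) ∷
        mono v0 ((v0 || v1) && (v0 || v2)) ∷ mono ((v1 || v3) || v2) (((v1 || v3) || v2) || (v0 || v1)) ∷
        []) (rank ((v1 || v3) || v2)) (con 2) refl (t∈ ∷ []) (Tx ∷ Tz ∷ T-rank ∷ [])
      sep : ρ ((⁅ x ⁆ ∪ ⁅ t ⁆) ∪ ⁅ z ⁆) + ρ ((G ─ ⁅ z ⁆ ─ (⁅ x ⁆ ∪ ⁅ t ⁆)) ∪ ⁅ z ⁆)
        ≤ ρ (((⁅ x ⁆ ∪ ⁅ t ⁆) ∪ (G ─ ⁅ z ⁆ ─ (⁅ x ⁆ ∪ ⁅ t ⁆))) ∪ ⁅ z ⁆) + ρ ⁅ z ⁆ + 1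
      sep = prove≤ (⁅ x ⁆ ∷ ⁅ t ⁆ ∷ ⁅ z ⁆ ∷ G ∷ []) [] [] (rank ((v0 || v1) || v2) <= con 2 ∷
        con 1 <= rank v2 ∷ [])
        (mono (((v3 - v2) - (v0 || v1)) || v2) (((v0 || v1) || ((v3 - v2) - (v0 || v1))) || v2) ∷ [])
        (rank ((v0 || v1) || v2) ⊕ rank (((v3 - v2) - (v0 || v1)) || v2))
        ((rank (((v0 || v1) || ((v3 - v2) - (v0 || v1))) || v2) ⊕ rank v2) ⊕ con 1) refl [] (Txz ∷ z-rank ∷
        [])
      open TwoSeparation {X = ⁅ x ⁆ ∪ ⁅ t ⁆} {Y = G ─ ⁅ z ⁆ ─ (⁅ x ⁆ ∪ ⁅ t ⁆)} {C₀ = ⁅ z ⁆} XY0 sep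
      I⊑ : I ⊑ (⁅ x ⁆ ∪ ⁅ t ⁆) ∪ (G ─ ⁅ z ⁆ ─ (⁅ x ⁆ ∪ ⁅ t ⁆))
      I⊑ = set= (I ∷ W ∷ G ∷ ⁅ z ⁆ ∷ ⁅ x ⁆ ∷ ⁅ t ⁆ ∷ []) (v0 || v1 <: v2 ∷ v0 && v1 == ∅ ∷ v3 <: v1 ∷ [])
        (v0 || ((v4 || v5) || ((v2 - v3) - (v4 || v5)))) ((v4 || v5) || ((v2 - v3) - (v4 || v5))) refl
        (IW⊑ ∷ dis ∷ z∈ ∷ [])
      W⊑ : W ⊑ ((⁅ x ⁆ ∪ ⁅ t ⁆) ∪ (G ─ ⁅ z ⁆ ─ (⁅ x ⁆ ∪ ⁅ t ⁆))) ∪ ⁅ z ⁆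
      W⊑ = set= (I ∷ W ∷ G ∷ ⁅ x ⁆ ∷ ⁅ t ⁆ ∷ ⁅ z ⁆ ∷ []) (v0 || v1 <: v2 ∷ [])
        (v1 || (((v3 || v4) || ((v2 - v5) - (v3 || v4))) || v5))
        (((v3 || v4) || ((v2 - v5) - (v3 || v4))) || v5) refl (IW⊑ ∷ [])
      one : ∣ (⁅ x ⁆ ∪ ⁅ t ⁆) ∩ I ∣ ≤ 1
      one with one-side μ XY0 I⊑ W⊑ z∈ sep
      ... | inj₁ p = p
      ... | inj₂ p = absurd (refute (G ∷ ⁅ z ⁆ ∷ ⁅ x ⁆ ∷ ⁅ t ⁆ ∷ I ∷ []) [] (v4 <: (v2 || v3) || ((v0 - v1) - (v2 || v3)) ∷ [])
        (card (((v0 - v1) - (v2 || v3)) && v4) <= con 1 ∷ con 4 <= card v4 ∷ card v2 <= con 1 ∷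
        card v3 <= con 1 ∷ []) (csub ((v2 || v3) && v4) (((v0 - v1) - (v2 || v3)) && v4) ∷ csub v2 v3 ∷
        cmono ((v2 || v3) && v4) (v2 || v3) ∷ []) refl (I⊑ ∷ []) (p ∷ model-size μ ∷ ∣⁅ x ⁆∣≤1 ∷ ∣⁅ t ⁆∣≤1 ∷
        []))
      spanned : ρ (((⁅ t ⁆ ∪ ⊥) ∪ (G ─ ⁅ z ⁆ ─ (⁅ x ⁆ ∪ ⁅ t ⁆))) ∪ ⁅ z ⁆) ≤ ρ ((⊥ ∪ (G ─ ⁅ z ⁆ ─ (⁅ x ⁆ ∪ ⁅ t ⁆))) ∪ ⁅ z ⁆)
      spanned = prove≤ (⁅ t ⁆ ∷ ⁅ t′ ⁆ ∷ ⁅ z ⁆ ∷ T ∷ G ∷ ⁅ x ⁆ ∷ []) [] (v1 <: v3 ∷ v1 <: v4 ∷ v5 && v3 == ∅ ∷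
        v0 && v1 == ∅ ∷ []) (rank ((v0 || v1) || v2) <= rank (v1 || v2) ∷ [])
        (sub ((∅ || ((v4 - v2) - (v5 || v0))) || v2) ((v0 || v1) || v2) ∷ [])
        (rank (((v0 || ∅) || ((v4 - v2) - (v5 || v0))) || v2))
        (rank ((∅ || ((v4 - v2) - (v5 || v0))) || v2)) refl (t′∈ ∷ in-G t′∈ ∷ x∉T ∷ tt′ ∷ [])
        (tail t′z-rank Tz ∷ [])
        where
        tail : 2 ≤ ρ (⁅ t′ ⁆ ∪ ⁅ z ⁆) → ρ (T ∪ ⁅ z ⁆) ≤ 2 → ρ ((⁅ t ⁆ ∪ ⁅ t′ ⁆) ∪ ⁅ z ⁆) ≤ ρ (⁅ t′ ⁆ ∪ ⁅ z ⁆)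
        tail a b = prove≤ (⁅ t′ ⁆ ∷ ⁅ z ⁆ ∷ T ∷ ⁅ t ⁆ ∷ []) [] (v3 <: v2 ∷ v0 <: v2 ∷ [])
          (con 2 <= rank (v0 || v1) ∷ rank (v2 || v1) <= con 2 ∷ []) (mono ((v3 || v0) || v1) (v2 || v1) ∷
          []) (rank ((v3 || v0) || v1)) (rank (v0 || v1)) refl (t∈ ∷ t′∈ ∷ []) (a ∷ b ∷ [])
      finish : (∃[ I′ ] ∃[ W′ ] Model I′ W′ × ⁅ z ⁆ ∪ ⊥ ⊑ W′
        × I′ ∪ W′ ⊑ ((⁅ z ⁆ ∪ ⊥) ∪ ⁅ t ⁆) ∪ (G ─ ⁅ z ⁆ ─ (⁅ x ⁆ ∪ ⁅ t ⁆))) → Absurd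
      finish (I′ , W′ , μ′ , _ , q) = spanned-undeletable x∈ x∉T Tx μ′ (set= (I′ ∷ W′ ∷ ⁅ z ⁆ ∷ ⁅ t ⁆ ∷ G ∷ ⁅ x ⁆ ∷ [])
        (v0 || v1 <: ((v2 || ∅) || v3) || ((v4 - v2) - (v5 || v3)) ∷ v2 <: v4 ∷ v3 <: v4 ∷ [])
        ((v0 || v1) || v4) v4 refl (q ∷ z∈G ∷ (in-G t∈) ∷ [])) (set= (I′ ∷ W′ ∷ ⁅ z ⁆ ∷ ⁅ t ⁆ ∷ G ∷ ⁅ x ⁆ ∷ T ∷ [])
        (v0 || v1 <: ((v2 || ∅) || v3) || ((v4 - v2) - (v5 || v3)) ∷ v2 && v5 == ∅ ∷ v3 <: v6 ∷
        v5 && v6 == ∅ ∷ []) (v5 && (v0 || v1)) ∅ refl (q ∷ zx ∷ t∈ ∷ x∉T ∷ []))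

    -- T ∪ W has rank at most 2 and x in W is not a loop, so two elements of `T` in N would be
    -- parallel there.
    T-meets-model : ∀ {I W} → Model I W → I ∪ W ⊑ G → ⁅ x ⁆ ⊑ W → ∣ T ∩ I ∣ ≤ 1
    T-meets-model {I} {W} μ IW⊑ x∈W with 2 ≤? ∣ T ∩ I ∣
    ... | no p  = prove≤ (T ∷ I ∷ []) [] [] (con 1 ⊕ card (v0 && v1) <= con 2 ∷ []) [] (card (v0 && v1)) (con 1) refl
      [] (≰⇒> p ∷ [])
    ... | yes p with two-elements {A = T ∩ I} p
    ...   | u , v , u∈ , v∈ , uv = absurd (refute (I ∷ W ∷ ⁅ u ⁆ ∷ ⁅ v ⁆ ∷ T ∷ ⁅ x ⁆ ∷ []) [] (v5 <: v1 ∷ v2 <: v4 && v0 ∷ v3 <: v4 && v0 ∷ [])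
      ((rank (v0 || v1) ⊕ rank v1) ⊕ con 2 <= rank ((v2 || v3) || v1) ⊕ rank ((v0 - (v2 || v3)) || v1) ∷
      rank (v4 || v1) <= con 2 ∷ con 1 <= rank v5 ∷ []) (mono v5 v1 ∷
      mono ((v0 - (v2 || v3)) || v1) (v0 || v1) ∷ mono ((v2 || v3) || v1) (v4 || v1) ∷ []) refl (x∈W ∷ u∈ ∷
      v∈ ∷ []) (c ∷ contracted-in-span μ IW⊑ ∷ nonloop x∈ ∷ []))
      where
      c = connected μ {⁅ u ⁆ ∪ ⁅ v ⁆} {I ─ (⁅ u ⁆ ∪ ⁅ v ⁆)} (set= (⁅ u ⁆ ∷ T ∷ I ∷ ⁅ v ⁆ ∷ []) (v0 <: v1 && v2 ∷ v3 <: v1 && v2 ∷ [])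
        ((v0 || v3) || (v2 - (v0 || v3))) v2 refl (u∈ ∷ v∈ ∷ [])) (set= (⁅ u ⁆ ∷ ⁅ v ⁆ ∷ I ∷ []) [] ((v0 || v1) && (v2 - (v0 || v1))) ∅ refl []) 2 (s≤s z≤n) ≤-refl
        (prove≤ (⁅ u ⁆ ∷ ⁅ v ⁆ ∷ []) [] (v0 && v1 == ∅ ∷ []) (con 1 <= card v0 ∷ con 1 <= card v1 ∷ [])
          (cmod v0 v1 ∷ c∅ ∷ []) (con 2) (card (v0 || v1)) refl (uv ∷ []) (1≤∣⁅ u ⁆∣ ∷ 1≤∣⁅ v ⁆∣ ∷ [])) (prove≤ (I ∷ ⁅ u ⁆ ∷ T ∷ ⁅ v ⁆ ∷ []) [] (v1 <: v2 && v0 ∷ v3 <: v2 && v0 ∷ []) (con 4 <= card v0 ∷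
          card v1 <= con 1 ∷ card v3 <= con 1 ∷ []) (csub (v0 - (v1 || v3)) v1 ∷
          csub v3 ((v0 - (v1 || v3)) || v1) ∷ []) (con 2) (card (v0 - (v1 || v3))) refl (u∈ ∷ v∈ ∷ [])
          (model-size μ ∷ ∣⁅ u ⁆∣≤1 ∷ ∣⁅ v ⁆∣≤1 ∷ []))

    -- With d deleted, `T` is a side of a 2-separation, and so is T ∪ x because x lies on the line
    -- of `T`. But a side that contains `T` and at most one element of N equals `T`.
    not-both : ∀ {I W d} → Model I W → I ∪ W ⊑ G → ⁅ x ⁆ ⊑ W → ⁅ d ⁆ ⊑ G → ⁅ d ⁆ ∩ T ≡ ⊥ → ⁅ d ⁆ ∩ (I ∪ W) ≡ ⊥ → Absurd
    not-both {I} {W} {d} μ IW⊑ x∈W d∈ d∉T d∉ with deletable d∈ d∉T μ IW⊑ d∉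
    ... | dl , one = ⊥≡⁅⁆⇒absurd {x = x} (set= (T ∷ ⁅ x ⁆ ∷ []) (v0 || v1 == v0 ∷ v1 && v0 == ∅ ∷ []) ∅ v1 refl (X≡T ∷ x∉T ∷ []))
      where
      dis : I ∩ W ≡ ⊥
      dis = disjoint μ
      dx : ⁅ d ⁆ ∩ ⁅ x ⁆ ≡ ⊥
      dx = set= (⁅ d ⁆ ∷ I ∷ W ∷ ⁅ x ⁆ ∷ []) (v0 && (v1 || v2) == ∅ ∷ v3 <: v2 ∷ []) (v0 && v3) ∅ refl (d∉ ∷
        x∈W ∷ [])
      X≡T : T ∪ ⁅ x ⁆ ≡ T
      X≡T = separation-is-T d∈ d∉T μ IW⊑ d∉ {X = T ∪ ⁅ x ⁆} {Y = G ─ T ─ ⁅ d ⁆ ─ ⁅ x ⁆}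
        (set= (T ∷ G ∷ ⁅ x ⁆ ∷ ⁅ d ⁆ ∷ []) (v0 <: v1 ∷ v2 <: v1 ∷ v3 && v0 == ∅ ∷ v3 && v2 == ∅ ∷ [])
          ((v0 || v2) || (((v1 - v0) - v3) - v2)) (v1 - v3) refl (T⊑G ∷ x∈ ∷ d∉T ∷ dx ∷ [])) (set= (T ∷ ⁅ x ⁆ ∷ G ∷ ⁅ d ⁆ ∷ []) [] ((v0 || v1) && (((v2 - v0) - v3) - v1)) ∅ refl []) (prove≤ (T ∷ ⁅ x ⁆ ∷ G ∷ ⁅ d ⁆ ∷ []) [] [] (rank (v0 || v1) <= con 2 ∷
          rank ((v2 - v0) - v3) ⊕ con 1 <= rank v2 ∷ []) (mono (((v2 - v0) - v3) - v1) ((v2 - v0) - v3) ∷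
          []) (rank (v0 || v1) ⊕ rank (((v2 - v0) - v3) - v1)) (rank v2 ⊕ con 1) refl [] (Tx ∷ dl ∷ [])) (prove≤ (T ∷ ⁅ x ⁆ ∷ []) [] [] (con 3 <= card v0 ∷ []) (cmono v0 (v0 || v1) ∷ []) (con 2)
          (card (v0 || v1)) refl [] (≤-reflexive (sym T-size) ∷ []))
        (prove≤ (I ∷ T ∷ W ∷ G ∷ ⁅ d ⁆ ∷ ⁅ x ⁆ ∷ []) [] (v0 || v2 <: v3 ∷ v4 && (v0 || v2) == ∅ ∷
          v0 && v2 == ∅ ∷ v5 <: v2 ∷ []) (con 4 <= card v0 ∷ card (v1 && v0) <= con 1 ∷ [])
          (csub (((v3 - v1) - v4) - v5) (v1 && v0) ∷ cmono v0 ((((v3 - v1) - v4) - v5) || v0) ∷ []) (con 2)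
          (card (((v3 - v1) - v4) - v5)) refl (IW⊑ ∷ d∉ ∷ dis ∷ x∈W ∷ []) (model-size μ ∷ one ∷ [])) (prove≤ (T ∷ I ∷ W ∷ ⁅ x ⁆ ∷ []) [] (v1 && v2 == ∅ ∷ v3 <: v2 ∷ []) (card (v0 && v1) <= con 1 ∷
          []) [] (card ((v0 || v3) && v1)) (con 1) refl (dis ∷ x∈W ∷ []) (one ∷ [])) (set= (T ∷ ⁅ x ⁆ ∷ []) [] (v0 || (v0 || v1)) (v0 || v1) refl [])

    contracts-only-x : ∀ {I W} → Model I W → I ∪ W ⊑ G → ⁅ x ⁆ ⊑ W → W ≡ ⁅ x ⁆
    contracts-only-x {I} {W} μ IW⊑ x∈W with empty-or-element (W ─ ⁅ x ⁆)
    ... | inj₁ p = set= (W ∷ ⁅ x ⁆ ∷ []) (v0 - v1 == ∅ ∷ v1 <: v0 ∷ []) v0 v1 refl (p ∷ x∈W ∷ [])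
    ... | inj₂ (w , w∈) = absurd (only-contractible {z = w} μ IW⊑ (set= (⁅ w ⁆ ∷ W ∷ ⁅ x ⁆ ∷ []) (v0 <: v1 - v2 ∷ []) (v0 || v1) v1 refl (w∈ ∷ [])) (set= (⁅ w ⁆ ∷ W ∷ ⁅ x ⁆ ∷ []) (v0 <: v1 - v2 ∷ []) (v0 && v2) ∅ refl (w∈ ∷ [])))

    -- All elements other than x and those of N lie in `T`, whose elements are parallel to one
    -- another in M/x. If N meets this class, it is itself the simplification. Otherwise one t of
    -- `T` is kept; it is spanned by N and parallel to none of its elements, so adding it preserves
    -- 3-connectivity.
    simplification : ∀ {I} → Model I ⁅ x ⁆ → I ∪ ⁅ x ⁆ ⊑ G → G ─ ⁅ x ⁆ ─ I ⊑ T → ρ G ≤ ρ (I ∪ ⁅ x ⁆) →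
      ∃[ S ] I ⊑ S × S ⊑ G ─ ⁅ x ⁆ × Connected₃ R S ⁅ x ⁆ ×
        (∀ d → ⁅ d ⁆ ⊑ G ─ ⁅ x ⁆ ─ S → ∃[ s ] ⁅ s ⁆ ⊑ S × ⁅ d ⁆ ∩ ⁅ s ⁆ ≡ ⊥ × ρ ((⁅ d ⁆ ∪ ⁅ s ⁆) ∪ ⁅ x ⁆) ≤ 2)
    simplification {I} μ Ix⊑ D⊑T spanning with empty-or-element (T ∩ I) | other-T x
    ... | inj₂ (i , i∈) | _ = I , (set= (I ∷ []) [] (v0 || v0) v0 refl []) , (set= (I ∷ ⁅ x ⁆ ∷ G ∷ []) (v0 || v1 <: v2 ∷ v0 && v1 == ∅ ∷ []) (v0 || (v2 - v1)) (v2 - v1) refl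
      (Ix⊑ ∷ dis ∷ [])) ,
        (λ k p q A B AB d kA kB → connected μ AB d k p q kA kB) ,
        λ d d∈ → i , (set= (⁅ i ⁆ ∷ T ∷ I ∷ []) (v0 <: v1 && v2 ∷ []) (v0 || v2) v2 refl (i∈ ∷ [])) , (set= (⁅ d ⁆ ∷ G ∷ ⁅ x ⁆ ∷ I ∷ ⁅ i ⁆ ∷ T ∷ []) (v0 <: (v1 - v2) - v3 ∷ v4 <: v5 && v3 ∷ [])
          (v0 && v4) ∅ refl (d∈ ∷ i∈ ∷ [])) , (prove≤ (T ∷ ⁅ x ⁆ ∷ ⁅ d ⁆ ∷ G ∷ I ∷ ⁅ i ⁆ ∷ []) [] (v2 <: (v3 - v1) - v4 ∷ v5 <: v0 && v4 ∷
          (v3 - v1) - v4 <: v0 ∷ []) (rank (v0 || v1) <= con 2 ∷ []) (mono ((v2 || v5) || v1) (v0 || v1) ∷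
          []) (rank ((v2 || v5) || v1)) (con 2) refl (d∈ ∷ i∈ ∷ D⊑T ∷ []) (Tx ∷ []))
      where
      dis : I ∩ ⁅ x ⁆ ≡ ⊥
      dis = disjoint μ
    ... | inj₁ T∩I | t , _ , t∈ , _ , _ , tx , _ with any? (λ i → ((⁅ i ⁆ ∪ I) ≟ˢ I) ×-dec (ρ ((⁅ t ⁆ ∪ ⁅ i ⁆) ∪ ⁅ x ⁆) ≤? 2))
    ...   | yes (i , i∈ , p) = I , (set= (I ∷ []) [] (v0 || v0) v0 refl []) , (set= (I ∷ ⁅ x ⁆ ∷ G ∷ []) (v0 || v1 <: v2 ∷ v0 && v1 == ∅ ∷ []) (v0 || (v2 - v1)) (v2 - v1) refl
      (Ix⊑ ∷ dis ∷ [])) ,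
        (λ k p q A B AB d kA kB → connected μ AB d k p q kA kB) ,
        λ d d∈ → i , i∈ , (set= (⁅ d ⁆ ∷ G ∷ ⁅ x ⁆ ∷ I ∷ ⁅ i ⁆ ∷ []) (v0 <: (v1 - v2) - v3 ∷ v4 <: v3 ∷ []) (v0 && v4) ∅
          refl (d∈ ∷ i∈ ∷ [])) , (prove≤ (T ∷ ⁅ i ⁆ ∷ ⁅ x ⁆ ∷ ⁅ d ⁆ ∷ G ∷ I ∷ []) [] (v3 <: (v4 - v2) - v5 ∷ (v4 - v2) - v5 <: v0 ∷
          []) (rank ((v0 || v1) || v2) <= con 2 ∷ []) (mono ((v3 || v1) || v2) ((v0 || v1) || v2) ∷ [])
          (rank ((v3 || v1) || v2)) (con 2) refl (d∈ ∷ D⊑T ∷ []) (Tix p ∷ []))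
      where
      dis : I ∩ ⁅ x ⁆ ≡ ⊥
      dis = disjoint μ
      tx-rank : 2 ≤ ρ (⁅ t ⁆ ∪ ⁅ x ⁆)
      tx-rank = pair-rank {t} {x} (in-G t∈) x∈ tx
      Tix : ρ ((⁅ t ⁆ ∪ ⁅ i ⁆) ∪ ⁅ x ⁆) ≤ 2 → ρ ((T ∪ ⁅ i ⁆) ∪ ⁅ x ⁆) ≤ 2
      Tix p = prove≤ (⁅ t ⁆ ∷ ⁅ i ⁆ ∷ ⁅ x ⁆ ∷ T ∷ []) [] (v0 <: v3 ∷ []) (rank ((v0 || v1) || v2) <= con 2 ∷
        rank (v3 || v2) <= con 2 ∷ con 2 <= rank (v0 || v2) ∷ []) (sub ((v0 || v1) || v2) (v3 || v2) ∷
        mono (v0 || v2) (((v0 || v1) || v2) && (v3 || v2)) ∷ []) (rank ((v3 || v1) || v2)) (con 2) refl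
        (t∈ ∷ []) (p ∷ Tx ∷ tx-rank ∷ [])
    ...   | no none = I ∪ ⁅ t ⁆ , (set= (I ∷ ⁅ t ⁆ ∷ []) [] (v0 || (v0 || v1)) (v0 || v1) refl []) , (set= (I ∷ ⁅ x ⁆ ∷ G ∷ ⁅ t ⁆ ∷ []) (v0 || v1 <: v2 ∷ v0 && v1 == ∅ ∷ v3 <: v2 ∷ v3 && v1 == ∅ ∷ [])
      ((v0 || v3) || (v2 - v1)) (v2 - v1) refl (Ix⊑ ∷ dis ∷ (in-G t∈) ∷ tx ∷ [])) , conn-t ,
        λ d d∈ → t , (set= (⁅ t ⁆ ∷ I ∷ []) [] (v0 || (v1 || v0)) (v1 || v0) refl []) , (set= (⁅ d ⁆ ∷ G ∷ ⁅ x ⁆ ∷ I ∷ ⁅ t ⁆ ∷ []) (v0 <: (v1 - v2) - (v3 || v4) ∷ []) (v0 && v4) ∅ refl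
          (d∈ ∷ [])) , (prove≤ (T ∷ ⁅ x ⁆ ∷ ⁅ d ⁆ ∷ G ∷ I ∷ ⁅ t ⁆ ∷ []) [] (v2 <: (v3 - v1) - (v4 || v5) ∷ v5 <: v0 ∷
          (v3 - v1) - v4 <: v0 ∷ []) (rank (v0 || v1) <= con 2 ∷ []) (mono ((v2 || v5) || v1) (v0 || v1) ∷
          []) (rank ((v2 || v5) || v1)) (con 2) refl (d∈ ∷ t∈ ∷ D⊑T ∷ []) (Tx ∷ []))
      where
      dis : I ∩ ⁅ x ⁆ ≡ ⊥
      dis = disjoint μ
      t∉I : ⁅ t ⁆ ∩ I ≡ ⊥
      t∉I = set= (T ∷ I ∷ ⁅ t ⁆ ∷ []) (v0 && v1 == ∅ ∷ v2 <: v0 ∷ []) (v2 && v1) ∅ refl (T∩I ∷ t∈ ∷ [])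
      tx-rank : 2 ≤ ρ (⁅ t ⁆ ∪ ⁅ x ⁆)
      tx-rank = pair-rank {t} {x} (in-G t∈) x∈ tx
      same : ρ ((I ∪ ⁅ t ⁆) ∪ ⁅ x ⁆) ≤ ρ (I ∪ ⁅ x ⁆)
      same = prove≤ (G ∷ I ∷ ⁅ x ⁆ ∷ ⁅ t ⁆ ∷ []) [] (v1 || v2 <: v0 ∷ v3 <: v0 ∷ [])
        (rank v0 <= rank (v1 || v2) ∷ []) (mono ((v1 || v3) || v2) v0 ∷ []) (rank ((v1 || v3) || v2))
        (rank (v1 || v2)) refl (Ix⊑ ∷ in-G t∈ ∷ []) (spanning ∷ [])
      with-t : ∀ k → 1 ≤ k → k ≤ 2 → ∀ A B → A ∪ B ≡ I ∪ ⁅ t ⁆ → A ∩ B ≡ ⊥ → ⁅ t ⁆ ⊑ A → k ≤ ∣ A ∣ → k ≤ ∣ B ∣ →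
        ρ ((I ∪ ⁅ t ⁆) ∪ ⁅ x ⁆) + ρ ⁅ x ⁆ + k ≤ ρ (A ∪ ⁅ x ⁆) + ρ (B ∪ ⁅ x ⁆)
      with-t k 1≤k k≤2 A B AB d t∈A kA kB with k ≤? ∣ A ─ ⁅ t ⁆ ∣
      ... | yes p = prove≤ (I ∷ ⁅ x ⁆ ∷ A ∷ ⁅ t ⁆ ∷ B ∷ []) (k ∷ []) []
        ((rank (v0 || v1) ⊕ rank v1) ⊕ nv 0 <= rank ((v2 - v3) || v1) ⊕ rank (v4 || v1) ∷
        rank ((v0 || v3) || v1) <= rank (v0 || v1) ∷ []) (mono ((v2 - v3) || v1) (v2 || v1) ∷ [])
        ((rank ((v0 || v3) || v1) ⊕ rank v1) ⊕ nv 0) (rank (v2 || v1) ⊕ rank (v4 || v1)) refl [] (c ∷ same ∷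
        [])
        where
        c = connected μ {A ─ ⁅ t ⁆} {B} (set= (A ∷ B ∷ I ∷ ⁅ t ⁆ ∷ []) (v0 || v1 == v2 || v3 ∷ v0 && v1 == ∅ ∷ v3 <: v0 ∷ v3 && v2 == ∅ ∷
          []) ((v0 - v3) || v1) v2 refl (AB ∷ d ∷ t∈A ∷ t∉I ∷ [])) (set= (A ∷ B ∷ ⁅ t ⁆ ∷ []) (v0 && v1 == ∅ ∷ []) ((v0 - v2) && v1) ∅ refl (d ∷ [])) k 1≤k k≤2 p kB
      ... | no p with empty-or-element (A ─ ⁅ t ⁆)
      ...   | inj₁ q = prove≤ (A ∷ ⁅ t ⁆ ∷ B ∷ I ∷ ⁅ x ⁆ ∷ []) (k ∷ []) (v0 - v1 == ∅ ∷ v0 || v2 == v3 || v1 ∷ v1 <: v0 ∷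
        v1 && v3 == ∅ ∷ []) (nv 0 <= card v0 ∷ con 2 <= rank (v1 || v4) ∷
        rank ((v3 || v1) || v4) <= rank (v3 || v4) ∷ card v1 <= con 1 ∷ card v4 <= con 1 ∷ [])
        (mono (v3 || v4) (v2 || v4) ∷ rc v4 ∷ []) ((rank ((v3 || v1) || v4) ⊕ rank v4) ⊕ nv 0)
        (rank (v0 || v4) ⊕ rank (v2 || v4)) refl (q ∷ AB ∷ t∈A ∷ t∉I ∷ []) (kA ∷ tx-rank ∷ same ∷
        ∣⁅ t ⁆∣≤1 ∷ ∣⁅ x ⁆∣≤1 ∷ [])
      -- Here k = 2 and A is {t , a}. Its rank over x is 2, one more than that of a alone, which
      -- makes up for N giving only connectivity 1 to the single element a.
      ...   | inj₂ (a , a∈) = prove≤ (I ∷ ⁅ x ⁆ ∷ ⁅ a ⁆ ∷ B ∷ ⁅ t ⁆ ∷ A ∷ []) (k ∷ []) (v2 <: v5 - v4 ∷ v4 <: v5 ∷ [])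
        ((rank (v0 || v1) ⊕ rank v1) ⊕ con 1 <= rank (v2 || v1) ⊕ rank (v3 || v1) ∷
        rank ((v0 || v4) || v1) <= rank (v0 || v1) ∷ con 1 ⊕ con 2 <= rank ((v4 || v2) || v1) ∷
        nv 0 <= con 2 ∷ card v1 <= con 1 ∷ card v2 <= con 1 ∷ []) (csub v1 v2 ∷
        mono ((v4 || v2) || v1) (v5 || v1) ∷ rc (v1 || v2) ∷ [])
        ((rank ((v0 || v4) || v1) ⊕ rank v1) ⊕ nv 0) (rank (v5 || v1) ⊕ rank (v3 || v1)) refl (a∈ ∷ t∈A ∷
        []) (c ∷ same ∷ ≰⇒> not-parallel ∷ k≤2 ∷ ∣⁅ x ⁆∣≤1 ∷ ∣⁅ a ⁆∣≤1 ∷ [])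
        where
        a∈I : ⁅ a ⁆ ⊑ I
        a∈I = set= (⁅ a ⁆ ∷ A ∷ ⁅ t ⁆ ∷ B ∷ I ∷ []) (v0 <: v1 - v2 ∷ v1 || v3 == v4 || v2 ∷ []) (v0 || v4) v4
          refl (a∈ ∷ AB ∷ [])
        not-parallel : ¬ ρ ((⁅ t ⁆ ∪ ⁅ a ⁆) ∪ ⁅ x ⁆) ≤ 2
        not-parallel q = none (a , a∈I , q)
        A≡ : A ─ ⁅ t ⁆ ─ ⁅ a ⁆ ≡ ⊥
        A≡ = ∣∣≤0⇒≡⊥ (prove≤ (A ∷ ⁅ t ⁆ ∷ ⁅ a ⁆ ∷ []) (k ∷ []) (v2 <: v0 - v1 ∷ []) (con 1 ⊕ card (v0 - v1) <= nv 0 ∷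
          nv 0 <= con 2 ∷ con 1 <= card v2 ∷ []) (cmod ((v0 - v1) - v2) v2 ∷ c∅ ∷ [])
          (card ((v0 - v1) - v2)) (con 0) refl (a∈ ∷ []) (≰⇒> p ∷ k≤2 ∷ 1≤∣⁅ a ⁆∣ ∷ []))
        c = connected μ {⁅ a ⁆} {B} (set= (A ∷ B ∷ I ∷ ⁅ t ⁆ ∷ ⁅ a ⁆ ∷ []) (v0 || v1 == v2 || v3 ∷ v0 && v1 == ∅ ∷
          (v0 - v3) - v4 == ∅ ∷ v4 <: v0 - v3 ∷ v3 <: v0 ∷ v3 && v2 == ∅ ∷ []) (v4 || v1) v2 refl (AB ∷ d ∷
          A≡ ∷ a∈ ∷ t∈A ∷ t∉I ∷ [])) (set= (A ∷ B ∷ ⁅ a ⁆ ∷ ⁅ t ⁆ ∷ []) (v0 && v1 == ∅ ∷ v2 <: v0 - v3 ∷ []) (v2 && v1) ∅ refl (d ∷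
          a∈ ∷ [])) 1 ≤-refl (s≤s z≤n) (prove≤ (⁅ a ⁆ ∷ []) [] [] (con 1 <= card v0 ∷ []) [] (con 1) (card v0) refl [] (1≤∣⁅ a ⁆∣ ∷ [])) (prove≤ (B ∷ []) (k ∷ []) [] (nv 0 <= card v0 ∷ con 1 <= nv 0 ∷ []) [] (con 1) (card v0) refl []
          (kB ∷ 1≤k ∷ []))
      conn-t : Connected₃ R (I ∪ ⁅ t ⁆) ⁅ x ⁆
      conn-t k 1≤k k≤2 A B AB d kA kB with inside? t A
      ... | inj₁ p = with-t k 1≤k k≤2 A B AB d p kA kB
      ... | inj₂ p = prove≤ (I ∷ ⁅ t ⁆ ∷ ⁅ x ⁆ ∷ B ∷ A ∷ []) (k ∷ []) []
        ((rank ((v0 || v1) || v2) ⊕ rank v2) ⊕ nv 0 <= rank (v3 || v2) ⊕ rank (v4 || v2) ∷ []) []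
        ((rank ((v0 || v1) || v2) ⊕ rank v2) ⊕ nv 0) (rank (v4 || v2) ⊕ rank (v3 || v2)) refl []
        (with-t k 1≤k k≤2 B A BA d′ t∈B kB kA ∷ [])
        where
        BA : B ∪ A ≡ I ∪ ⁅ t ⁆
        BA = set= (A ∷ B ∷ I ∷ ⁅ t ⁆ ∷ []) (v0 || v1 == v2 || v3 ∷ []) (v1 || v0) (v2 || v3) refl (AB ∷ [])
        d′ : B ∩ A ≡ ⊥
        d′ = set= (A ∷ B ∷ []) (v0 && v1 == ∅ ∷ []) (v1 && v0) ∅ refl (d ∷ [])
        t∈B : ⁅ t ⁆ ⊑ B
        t∈B = set= (A ∷ B ∷ I ∷ ⁅ t ⁆ ∷ []) (v0 || v1 == v2 || v3 ∷ v3 && v0 == ∅ ∷ []) (v3 || v1) v1 refl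
          (AB ∷ p ∷ [])

  -- A deletable element y outside `T`, and outcome (b).

  module CocircuitPoint {y I W} (y∈ : ⁅ y ⁆ ⊑ G) (y∉T : ⁅ y ⁆ ∩ T ≡ ⊥) (μ : Model I W) (IW⊑ : I ∪ W ⊑ G)
      (y∉ : ⁅ y ⁆ ∩ (I ∪ W) ≡ ⊥) where

    y-outside : 3 ≤ ρ (T ∪ ⁅ y ⁆)
    y-outside with 3 ≤? ρ (T ∪ ⁅ y ⁆)
    ... | yes p = p
    ... | no p  = absurd (spanned-undeletable y∈ y∉T (≤-pred (≰⇒> p)) μ IW⊑ y∉)

    not-contractible : ∀ {I′ W′} → Model I′ W′ → I′ ∪ W′ ⊑ G → ⁅ y ⁆ ⊑ W′ → Absurd
    not-contractible μ′ p q = (refute (T ∷ ⁅ y ⁆ ∷ []) [] [] (con 3 <= rank (v0 || v1) ∷ rank (v0 || v1) <= con 2 ∷ []) [] refl []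
      (y-outside ∷ contractible-spanned y∈ μ′ p q ∷ []))

    T-hyperplane : ρ (G ─ T ─ ⁅ y ⁆) + 1 ≤ ρ G
    T-hyperplane = proj₁ (deletable y∈ y∉T μ IW⊑ y∉)

    T-one : ∣ T ∩ I ∣ ≤ 1
    T-one = proj₂ (deletable y∈ y∉T μ IW⊑ y∉)

    G-T-full : ρ G ≤ ρ (G ─ T)
    G-T-full = T-coindependent μ IW⊑ T-one

    -- Otherwise t is in the closure of H, the complement of T ∪ y. As (T , H) is a 2-separation
    -- once y is deleted, a second element u of `T` can be contracted with t kept. Now H ∪ t is one
    -- short of full rank and spans neither u nor y, so contracting y has the same effect as
    -- contracting u; but y is not contractible.
    T-outside : ∀ {t} → ⁅ t ⁆ ⊑ T → ρ G ≤ ρ ((G ─ T ─ ⁅ y ⁆) ∪ ⁅ t ⁆)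
    T-outside {t} t∈ with ρ G ≤? ρ ((G ─ T ─ ⁅ y ⁆) ∪ ⁅ t ⁆) | other-T t
    ... | yes p | _ = p
    ... | no p  | u , _ , u∈ , _ , _ , ut , _ = absurd (finish
        (survives {C = ⁅ u ⁆} {f = t} μ (set= (I ∷ W ∷ G ∷ ⁅ y ⁆ ∷ T ∷ []) (v0 || v1 <: v2 ∷ v3 && (v0 || v1) == ∅ ∷ [])
          (v0 || (v4 || ((v2 - v4) - v3))) (v4 || ((v2 - v4) - v3)) refl (IW⊑ ∷ y∉ ∷ [])) (set= (I ∷ W ∷ G ∷ ⁅ y ⁆ ∷ T ∷ []) (v0 || v1 <: v2 ∷ v3 && (v0 || v1) == ∅ ∷ [])
          (v1 || ((v4 || ((v2 - v4) - v3)) || ∅)) ((v4 || ((v2 - v4) - v3)) || ∅) refl (IW⊑ ∷ y∉ ∷ [])) (set= (W ∷ []) [] (∅ || v0) v0 refl []) T-one u∈ t∈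
          (prove≤ (G ∷ T ∷ ⁅ y ⁆ ∷ ⁅ u ⁆ ∷ []) [] []
            (rank ((v0 - v1) - v2) ⊕ con 1 <= rank (v3 || ((v0 - v1) - v2)) ∷ card v3 <= con 1 ∷ [])
            (rc v3 ∷ []) (rank (v3 || ∅) ⊕ rank (((v0 - v1) - v2) || ∅))
            (rank ((v3 || ((v0 - v1) - v2)) || ∅) ⊕ rank ∅) refl [] (u-new ∷ ∣⁅ u ⁆∣≤1 ∷ [])) (prove≤ (⁅ u ⁆ ∷ ⁅ t ⁆ ∷ []) [] [] (con 2 <= rank (v0 || v1) ∷ card v0 <= con 1 ∷ []) (rc v0 ∷
            []) (rank (v0 || ∅) ⊕ con 1) (rank ((v1 || v0) || ∅)) refl [] (ut-rank ∷ ∣⁅ u ⁆∣≤1 ∷ [])) (prove≤ (G ∷ T ∷ ⁅ y ⁆ ∷ ⁅ t ⁆ ∷ ⁅ u ⁆ ∷ []) [] (v3 <: v1 ∷ v4 <: v1 ∷ v1 <: v0 ∷ [])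
            (rank ((v0 - v1) - v2) ⊕ con 1 <= rank (v4 || ((v0 - v1) - v2)) ∷
            rank v0 <= rank ((v0 - v1) - v2) ⊕ con 1 ∷ [])
            (mono (((v3 || v4) || ((v0 - v1) - v2)) || ∅) v0 ∷ [])
            (rank (((v3 || v4) || ((v0 - v1) - v2)) || ∅)) (rank ((v4 || ((v0 - v1) - v2)) || ∅)) refl (t∈ ∷
            u∈ ∷ T⊑G ∷ []) (u-new ∷ Y≥ ∷ []))))
      where
      ut-rank : 2 ≤ ρ (⁅ u ⁆ ∪ ⁅ t ⁆)
      ut-rank = T-pair u t u∈ t∈ ut
      y-full : ρ G ≤ ρ (G ─ ⁅ y ⁆)
      y-full = spans {⁅ y ⁆} y∈ (prove≤ (⁅ y ⁆ ∷ []) [] [] (card v0 <= con 1 ∷ []) [] (card v0) (con 1) refl [] (∣⁅ y ⁆∣≤1 ∷ []))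
      tu-full : ρ G ≤ ρ (((G ─ T ─ ⁅ y ⁆) ∪ ⁅ t ⁆) ∪ ⁅ u ⁆)
      tu-full = prove≤ (G ∷ ⁅ y ⁆ ∷ ⁅ u ⁆ ∷ ⁅ t ⁆ ∷ T ∷ []) [] (v3 <: v4 ∷ v2 <: v4 ∷ [])
        (rank v0 <= rank (v0 - v1) ∷ con 2 <= rank (v2 || v3) ∷ rank v4 <= con 2 ∷ [])
        (sub ((((v0 - v4) - v1) || v3) || v2) v4 ∷ mono (v0 - v1) (((((v0 - v4) - v1) || v3) || v2) || v4) ∷
        []) (rank v0) (rank ((((v0 - v4) - v1) || v3) || v2)) refl (t∈ ∷ u∈ ∷ []) (y-full ∷ ut-rank ∷
        T-line ∷ [])
      Y≥ : ρ G ≤ ρ (G ─ T ─ ⁅ y ⁆) + 1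
      Y≥ = prove≤ (G ∷ T ∷ ⁅ y ⁆ ∷ []) [] [] (rank v0 <= rank (v0 - v1) ∷ card v2 <= con 1 ∷ [])
        (sub ((v0 - v1) - v2) v2 ∷ mono (v0 - v1) (((v0 - v1) - v2) || v2) ∷ rc v2 ∷ []) (rank v0)
        (rank ((v0 - v1) - v2) ⊕ con 1) refl [] (G-T-full ∷ ∣⁅ y ⁆∣≤1 ∷ [])
      t-low : ρ ((G ─ T ─ ⁅ y ⁆) ∪ ⁅ t ⁆) + 1 ≤ ρ G
      t-low = prove≤ (G ∷ T ∷ ⁅ y ⁆ ∷ ⁅ t ⁆ ∷ []) [] [] (con 1 ⊕ rank (((v0 - v1) - v2) || v3) <= rank v0 ∷ [])
        [] (rank (((v0 - v1) - v2) || v3) ⊕ con 1) (rank v0) refl [] (≰⇒> p ∷ [])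
      u-new : ρ (G ─ T ─ ⁅ y ⁆) + 1 ≤ ρ (⁅ u ⁆ ∪ (G ─ T ─ ⁅ y ⁆))
      u-new = prove≤ (G ∷ T ∷ ⁅ y ⁆ ∷ ⁅ t ⁆ ∷ ⁅ u ⁆ ∷ []) [] []
        (rank v0 <= rank ((((v0 - v1) - v2) || v3) || v4) ∷
        rank (((v0 - v1) - v2) || v3) ⊕ con 1 <= rank v0 ∷ [])
        (sub (v4 || ((v0 - v1) - v2)) (((v0 - v1) - v2) || v3) ∷
        mono ((v0 - v1) - v2) ((v4 || ((v0 - v1) - v2)) && (((v0 - v1) - v2) || v3)) ∷ [])
        (rank ((v0 - v1) - v2) ⊕ con 1) (rank (v4 || ((v0 - v1) - v2))) refl [] (tu-full ∷ t-low ∷ [])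
      open TwoSeparation {X = T} {Y = G ─ T ─ ⁅ y ⁆} {C₀ = ⊥} (set= (T ∷ G ∷ ⁅ y ⁆ ∷ []) [] (v0 && ((v1 - v0) - v2)) ∅ refl []) (prove≤ (T ∷ G ∷ ⁅ y ⁆ ∷ []) [] (v0 <: v1 ∷ v2 && v0 == ∅ ∷ []) (rank v0 <= con 2 ∷
        rank ((v1 - v0) - v2) ⊕ con 1 <= rank v1 ∷ rank v1 <= rank (v1 - v2) ∷ []) []
        (rank (v0 || ∅) ⊕ rank (((v1 - v0) - v2) || ∅))
        ((rank ((v0 || ((v1 - v0) - v2)) || ∅) ⊕ rank ∅) ⊕ con 1) refl (T⊑G ∷ y∉T ∷ []) (T-line ∷
        T-hyperplane ∷ y-full ∷ []))
      finish : (∃[ I′ ] ∃[ W′ ] Model I′ W′ × ⊥ ∪ ⁅ u ⁆ ⊑ W′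
        × I′ ∪ W′ ⊑ ((⊥ ∪ ⁅ u ⁆) ∪ ⁅ t ⁆) ∪ (G ─ T ─ ⁅ y ⁆)) → Absurd
      finish (I′ , W′ , μ′ , q , h) = not-contractible
          (recontract ((W′ ─ ⁅ u ⁆) ∪ ⁅ y ⁆) μ′ (set= (I′ ∷ W′ ∷ ⁅ u ⁆ ∷ ⁅ t ⁆ ∷ G ∷ T ∷ ⁅ y ⁆ ∷ []) (v0 && v1 == ∅ ∷
            v0 || v1 <: ((∅ || v2) || v3) || ((v4 - v5) - v6) ∷ v6 && v5 == ∅ ∷ v3 <: v5 ∷ v2 <: v5 ∷ [])
            (v0 && ((v1 - v2) || v6)) ∅ refl (dis ∷ h ∷ y∉T ∷ t∈ ∷ u∈ ∷ [])) moved) (set= (I′ ∷ W′ ∷ ⁅ u ⁆ ∷ ⁅ t ⁆ ∷ G ∷ T ∷ ⁅ y ⁆ ∷ [])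
            (v0 || v1 <: ((∅ || v2) || v3) || ((v4 - v5) - v6) ∷ v6 <: v4 ∷ v3 <: v4 ∷ v2 <: v4 ∷ [])
            ((v0 || ((v1 - v2) || v6)) || v4) v4 refl (h ∷ y∈ ∷ (in-G t∈) ∷ (in-G u∈) ∷ [])) (set= (⁅ y ⁆ ∷ W′ ∷ ⁅ u ⁆ ∷ []) [] (v0 || ((v1 - v2) || v0)) ((v1 - v2) || v0) refl [])
        where
        dis : I′ ∩ W′ ≡ ⊥
        dis = disjoint μ′
        y-new : ρ ((G ─ T ─ ⁅ y ⁆) ∪ ⁅ t ⁆) + 1 ≤ ρ (((G ─ T ─ ⁅ y ⁆) ∪ ⁅ t ⁆) ∪ ⁅ y ⁆)
        y-new = prove≤ (G ∷ T ∷ ⁅ y ⁆ ∷ ⁅ t ⁆ ∷ []) [] [] (rank v0 <= rank (v0 - v1) ∷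
          rank (((v0 - v1) - v2) || v3) ⊕ con 1 <= rank v0 ∷ [])
          (mono (v0 - v1) ((((v0 - v1) - v2) || v3) || v2) ∷ []) (rank (((v0 - v1) - v2) || v3) ⊕ con 1)
          (rank ((((v0 - v1) - v2) || v3) || v2)) refl [] (G-T-full ∷ t-low ∷ [])
        u-new′ : ρ ((G ─ T ─ ⁅ y ⁆) ∪ ⁅ t ⁆) + 1 ≤ ρ (((G ─ T ─ ⁅ y ⁆) ∪ ⁅ t ⁆) ∪ ⁅ u ⁆)
        u-new′ = prove≤ (G ∷ T ∷ ⁅ y ⁆ ∷ ⁅ t ⁆ ∷ ⁅ u ⁆ ∷ []) [] []
          (rank v0 <= rank ((((v0 - v1) - v2) || v3) || v4) ∷
          rank (((v0 - v1) - v2) || v3) ⊕ con 1 <= rank v0 ∷ []) [] (rank (((v0 - v1) - v2) || v3) ⊕ con 1)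
          (rank ((((v0 - v1) - v2) || v3) || v4)) refl [] (tu-full ∷ t-low ∷ [])
        moved : ∀ A → A ⊑ I′ → ρ (A ∪ (W′ ─ ⁅ u ⁆) ∪ ⁅ y ⁆) + ρ W′ ≡ ρ (A ∪ W′) + ρ ((W′ ─ ⁅ u ⁆) ∪ ⁅ y ⁆)
        moved A A⊑ = ≤-antisym (prove≤ (A ∷ W′ ∷ ⁅ u ⁆ ∷ ⁅ y ⁆ ∷ []) [] [] (rank (v0 || ((v1 - v2) || v3)) <= rank (v0 || v1) ∷
          rank (∅ || v1) <= rank (∅ || ((v1 - v2) || v3)) ∷ []) []
          (rank (v0 || ((v1 - v2) || v3)) ⊕ rank v1) (rank (v0 || v1) ⊕ rank ((v1 - v2) || v3)) refl []
          (≤-reflexive (close A A⊑) ∷ ≤-reflexive (sym (close ⊥ bot)) ∷ []))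
          (prove≤ (A ∷ W′ ∷ ⁅ u ⁆ ∷ ⁅ y ⁆ ∷ []) [] [] (rank (v0 || v1) <= rank (v0 || ((v1 - v2) || v3)) ∷
          rank (∅ || ((v1 - v2) || v3)) <= rank (∅ || v1) ∷ []) []
          (rank (v0 || v1) ⊕ rank ((v1 - v2) || v3)) (rank (v0 || ((v1 - v2) || v3)) ⊕ rank v1) refl []
          (≤-reflexive (sym (close A A⊑)) ∷ ≤-reflexive (close ⊥ bot) ∷ []))
          where
          bot : ⊥ ⊑ I′
          bot = set= (I′ ∷ []) [] (∅ || v0) v0 refl []
          close : ∀ A → A ⊑ I′ → ρ (A ∪ (W′ ─ ⁅ u ⁆) ∪ ⁅ y ⁆) ≡ ρ (A ∪ W′)
          close A A⊑ = close′ low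
            where
            low : A ∪ (W′ ─ ⁅ u ⁆) ⊑ (G ─ T ─ ⁅ y ⁆) ∪ ⁅ t ⁆
            low = set= (I′ ∷ W′ ∷ ⁅ u ⁆ ∷ ⁅ t ⁆ ∷ G ∷ T ∷ ⁅ y ⁆ ∷ A ∷ [])
              (v0 || v1 <: ((∅ || v2) || v3) || ((v4 - v5) - v6) ∷ ∅ || v2 <: v1 ∷ v0 && v1 == ∅ ∷
              v7 <: v0 ∷ []) ((v7 || (v1 - v2)) || (((v4 - v5) - v6) || v3)) (((v4 - v5) - v6) || v3) refl
              (h ∷ q ∷ dis ∷ A⊑ ∷ [])
            close′ : A ∪ (W′ ─ ⁅ u ⁆) ⊑ (G ─ T ─ ⁅ y ⁆) ∪ ⁅ t ⁆ → ρ (A ∪ (W′ ─ ⁅ u ⁆) ∪ ⁅ y ⁆) ≡ ρ (A ∪ W′)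
            close′ low = ≤-antisym (prove≤ (G ∷ T ∷ ⁅ y ⁆ ∷ ⁅ t ⁆ ∷ ⁅ u ⁆ ∷ A ∷ W′ ∷ []) []
              (v5 || (v6 - v4) <: ((v0 - v1) - v2) || v3 ∷ ∅ || v4 <: v6 ∷ [])
              (rank (((v0 - v1) - v2) || v3) ⊕ con 1 <= rank ((((v0 - v1) - v2) || v3) || v4) ∷
              card v2 <= con 1 ∷ []) (sub (v5 || v6) (((v0 - v1) - v2) || v3) ∷
              sub v2 ((v5 || v6) && (((v0 - v1) - v2) || v3)) ∷
              mono (v5 || ((v6 - v4) || v2)) ((v5 || ((v6 - v4) || v2)) || ((v5 || v6) && v3)) ∷
              mono ((v5 || ((v6 - v4) || v2)) || ((v5 || v6) && v3)) ((v5 || ((v6 - v4) || v2)) || ((v5 || v6) && (((v0 - v1) - v2) || v3))) ∷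
              rc v2 ∷ []) (rank (v5 || ((v6 - v4) || v2))) (rank (v5 || v6)) refl (low ∷ q ∷ []) (u-new′ ∷
              ∣⁅ y ⁆∣≤1 ∷ []))
              (prove≤ (G ∷ T ∷ ⁅ y ⁆ ∷ ⁅ t ⁆ ∷ ⁅ u ⁆ ∷ A ∷ W′ ∷ []) []
              (v5 || (v6 - v4) <: ((v0 - v1) - v2) || v3 ∷ ∅ || v4 <: v6 ∷ [])
              (rank (((v0 - v1) - v2) || v3) ⊕ con 1 <= rank ((((v0 - v1) - v2) || v3) || v2) ∷
              card v4 <= con 1 ∷ []) (sub (v5 || ((v6 - v4) || v2)) (((v0 - v1) - v2) || v3) ∷
              sub v4 ((v5 || ((v6 - v4) || v2)) && (((v0 - v1) - v2) || v3)) ∷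
              mono (v5 || v6) ((v5 || v6) || ((v5 || ((v6 - v4) || v2)) && (((v0 - v1) - v2) || v3))) ∷
              rc v4 ∷ []) (rank (v5 || v6)) (rank (v5 || ((v6 - v4) || v2))) refl (low ∷ q ∷ []) (y-new ∷
              ∣⁅ u ⁆∣≤1 ∷ []))

    -- Once t and u are deleted, the cocircuit T ∪ y leaves y in series with the last element s of
    -- `T`, so y could be contracted with N kept.
    not-two-deletable : ∀ {I′ W′ t u} → ⁅ t ⁆ ⊑ T → ⁅ u ⁆ ⊑ T → ⁅ t ⁆ ∩ ⁅ u ⁆ ≡ ⊥ → Model I′ W′ → I′ ∪ W′ ⊑ G →
      (⁅ t ⁆ ∪ ⁅ u ⁆) ∩ (I′ ∪ W′) ≡ ⊥ → Absurd
    not-two-deletable {I′} {W′} {t} {u} t∈ u∈ tu μ′ IW′ tu∉ with element {A = T ─ ⁅ t ⁆ ─ ⁅ u ⁆} (prove≤ (T ∷ ⁅ t ⁆ ∷ ⁅ u ⁆ ∷ []) [] [] (con 3 <= card v0 ∷ card v1 <= con 1 ∷ card v2 <= con 1 ∷ [])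
      (csub ((v0 - v1) - v2) v1 ∷ cmod v0 (v1 || v2) ∷ csub v2 (((v0 - v1) - v2) || v1) ∷
      cmono (v0 && (v1 || v2)) (v1 || (v0 && v2)) ∷ cmono (v1 || (v0 && v2)) (v1 || v2) ∷ []) (con 1)
      (card ((v0 - v1) - v2)) refl [] (≤-reflexive (sym T-size) ∷ ∣⁅ t ⁆∣≤1 ∷ ∣⁅ u ⁆∣≤1 ∷ []))
    ... | s , s∈ = finish (survives {C = ⁅ y ⁆} {f = s} μ′ I⊑ W⊑ (set= (W′ ∷ []) [] (∅ || v0) v0 refl []) one (set= (⁅ y ⁆ ∷ ⁅ s ⁆ ∷ []) [] (v0 || (v0 || v1)) (v0 || v1) refl []) (set= (⁅ s ⁆ ∷ ⁅ y ⁆ ∷ []) [] (v0 || (v1 || v0)) (v1 || v0) refl [])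
          (prove≤ (G ∷ T ∷ ⁅ y ⁆ ∷ []) [] [] (rank v0 <= rank (v0 - v1) ∷
            rank ((v0 - v1) - v2) ⊕ con 1 <= rank v0 ∷ card v2 <= con 1 ∷ [])
            (mono (v0 - v1) ((v2 || ((v0 - v1) - v2)) || ∅) ∷ rc v2 ∷ [])
            (rank (v2 || ∅) ⊕ rank (((v0 - v1) - v2) || ∅)) (rank ((v2 || ((v0 - v1) - v2)) || ∅) ⊕ rank ∅)
            refl [] (G-T-full ∷ T-hyperplane ∷ ∣⁅ y ⁆∣≤1 ∷ [])) (prove≤ (⁅ s ⁆ ∷ ⁅ y ⁆ ∷ []) [] [] (con 2 <= rank (v0 || v1) ∷ card v1 <= con 1 ∷ []) (rc v1 ∷
            []) (rank (v1 || ∅) ⊕ con 1) (rank ((v0 || v1) || ∅)) refl [] (sy-rank ∷ ∣⁅ y ⁆∣≤1 ∷ [])) (prove≤ (G ∷ T ∷ ⁅ y ⁆ ∷ ⁅ s ⁆ ∷ ⁅ t ⁆ ∷ ⁅ u ⁆ ∷ []) [] (v2 <: v0 ∷ v3 <: (v1 - v4) - v5 ∷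
            v1 <: v0 ∷ []) (rank v0 <= rank (v0 - v1) ∷ [])
            (mono (v0 - v1) ((v2 || ((v0 - v1) - v2)) || ∅) ∷
            mono (((v3 || v2) || ((v0 - v1) - v2)) || ∅) v0 ∷ [])
            (rank (((v3 || v2) || ((v0 - v1) - v2)) || ∅)) (rank ((v2 || ((v0 - v1) - v2)) || ∅)) refl (y∈ ∷
            s∈ ∷ T⊑G ∷ []) (G-T-full ∷ [])))
      where
      T≡ : T ≡ ⁅ t ⁆ ∪ ⁅ u ⁆ ∪ ⁅ s ⁆
      T≡ = set= (T ∷ ⁅ t ⁆ ∷ ⁅ u ⁆ ∷ ⁅ s ⁆ ∷ []) (v0 - (v1 || (v2 || v3)) == ∅ ∷ v1 <: v0 ∷ v2 <: v0 ∷
        v3 <: (v0 - v1) - v2 ∷ []) v0 (v1 || (v2 || v3)) refl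
        ((∣∣≤0⇒≡⊥ {A = T ─ (⁅ t ⁆ ∪ ⁅ u ⁆ ∪ ⁅ s ⁆)} rest) ∷ t∈ ∷ u∈ ∷ s∈ ∷ [])
        where
        rest : ∣ T ─ (⁅ t ⁆ ∪ ⁅ u ⁆ ∪ ⁅ s ⁆) ∣ ≤ 0
        rest = prove≤ (T ∷ ⁅ t ⁆ ∷ ⁅ u ⁆ ∷ ⁅ s ⁆ ∷ []) [] (v1 <: v0 ∷ v2 <: v0 ∷ v1 && v2 == ∅ ∷
          v3 <: (v0 - v1) - v2 ∷ []) (card v0 <= con 3 ∷ con 1 <= card v1 ∷ con 1 <= card v2 ∷
          con 1 <= card v3 ∷ []) (cmod (v0 - (v1 || (v2 || v3))) v3 ∷ cmod v1 v2 ∷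
          cmod ((v0 - (v1 || (v2 || v3))) || v3) (v1 || v2) ∷ c∅ ∷ c∅ ∷ c∅ ∷ [])
          (card (v0 - (v1 || (v2 || v3)))) (con 0) refl (t∈ ∷ u∈ ∷ tu ∷ s∈ ∷ []) (≤-reflexive T-size ∷
          1≤∣⁅ t ⁆∣ ∷ 1≤∣⁅ u ⁆∣ ∷ 1≤∣⁅ s ⁆∣ ∷ [])
      s∈T : ⁅ s ⁆ ⊑ T
      s∈T = set= (⁅ s ⁆ ∷ T ∷ ⁅ t ⁆ ∷ ⁅ u ⁆ ∷ []) (v0 <: (v1 - v2) - v3 ∷ []) (v0 || v1) v1 refl (s∈ ∷ [])
      sy-rank : 2 ≤ ρ (⁅ s ⁆ ∪ ⁅ y ⁆)
      sy-rank = pair-rank {s} {y} (in-G s∈T) y∈ (set= (⁅ s ⁆ ∷ T ∷ ⁅ y ⁆ ∷ []) (v0 <: v1 ∷ v2 && v1 == ∅ ∷ []) (v0 && v2) ∅ refl (s∈T ∷ y∉T ∷ []))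
      full : ρ G ≤ ρ ((G ─ T ─ ⁅ y ⁆) ∪ ⁅ s ⁆)
      full = T-outside s∈T
      XY0 : (⁅ y ⁆ ∪ ⁅ s ⁆) ∩ (G ─ T ─ ⁅ y ⁆) ≡ ⊥
      XY0 = set= (⁅ s ⁆ ∷ T ∷ ⁅ y ⁆ ∷ G ∷ []) (v0 <: v1 ∷ []) ((v2 || v0) && ((v3 - v1) - v2)) ∅ refl (s∈T ∷
        [])
      sep : ρ ((⁅ y ⁆ ∪ ⁅ s ⁆) ∪ ⊥) + ρ ((G ─ T ─ ⁅ y ⁆) ∪ ⊥) ≤ ρ (((⁅ y ⁆ ∪ ⁅ s ⁆) ∪ (G ─ T ─ ⁅ y ⁆)) ∪ ⊥) + ρ ⊥ + 1
      sep = prove≤ (G ∷ T ∷ ⁅ y ⁆ ∷ ⁅ s ⁆ ∷ []) [] [] (rank v0 <= rank (((v0 - v1) - v2) || v3) ∷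
        rank ((v0 - v1) - v2) ⊕ con 1 <= rank v0 ∷ card v2 <= con 1 ∷ card v3 <= con 1 ∷ []) (csub v2 v3 ∷
        mono (((v0 - v1) - v2) || v3) (((v2 || v3) || ((v0 - v1) - v2)) || ∅) ∷ rc (v2 || v3) ∷ [])
        (rank ((v2 || v3) || ∅) ⊕ rank (((v0 - v1) - v2) || ∅))
        ((rank (((v2 || v3) || ((v0 - v1) - v2)) || ∅) ⊕ rank ∅) ⊕ con 1) refl [] (full ∷ T-hyperplane ∷
        ∣⁅ y ⁆∣≤1 ∷ ∣⁅ s ⁆∣≤1 ∷ [])
      open TwoSeparation {X = ⁅ y ⁆ ∪ ⁅ s ⁆} {Y = G ─ T ─ ⁅ y ⁆} {C₀ = ⊥} XY0 sep
      I⊑ : I′ ⊑ (⁅ y ⁆ ∪ ⁅ s ⁆) ∪ (G ─ T ─ ⁅ y ⁆)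
      I⊑ = set= (I′ ∷ W′ ∷ G ∷ ⁅ t ⁆ ∷ ⁅ u ⁆ ∷ T ∷ ⁅ s ⁆ ∷ ⁅ y ⁆ ∷ []) (v0 || v1 <: v2 ∷
        (v3 || v4) && (v0 || v1) == ∅ ∷ v5 == v3 || (v4 || v6) ∷ [])
        (v0 || ((v7 || v6) || ((v2 - v5) - v7))) ((v7 || v6) || ((v2 - v5) - v7)) refl (IW′ ∷ tu∉ ∷ T≡ ∷
        [])
      W⊑ : W′ ⊑ ((⁅ y ⁆ ∪ ⁅ s ⁆) ∪ (G ─ T ─ ⁅ y ⁆)) ∪ ⊥
      W⊑ = set= (I′ ∷ W′ ∷ G ∷ ⁅ t ⁆ ∷ ⁅ u ⁆ ∷ T ∷ ⁅ s ⁆ ∷ ⁅ y ⁆ ∷ []) (v0 || v1 <: v2 ∷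
        (v3 || v4) && (v0 || v1) == ∅ ∷ v5 == v3 || (v4 || v6) ∷ [])
        (v1 || (((v7 || v6) || ((v2 - v5) - v7)) || ∅)) (((v7 || v6) || ((v2 - v5) - v7)) || ∅) refl (IW′ ∷
        tu∉ ∷ T≡ ∷ [])
      one : ∣ (⁅ y ⁆ ∪ ⁅ s ⁆) ∩ I′ ∣ ≤ 1
      one with one-side μ′ XY0 I⊑ W⊑ (set= (W′ ∷ []) [] (∅ || v0) v0 refl []) sep
      ... | inj₁ p = p
      ... | inj₂ p = absurd (refute (G ∷ T ∷ ⁅ y ⁆ ∷ I′ ∷ ⁅ s ⁆ ∷ []) [] (v3 <: (v2 || v4) || ((v0 - v1) - v2) ∷ [])
        (card (((v0 - v1) - v2) && v3) <= con 1 ∷ con 4 <= card v3 ∷ card v2 <= con 1 ∷ card v4 <= con 1 ∷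
        []) (csub ((v2 || v4) && v3) (((v0 - v1) - v2) && v3) ∷ csub v2 v4 ∷
        cmono ((v2 || v4) && v3) (v2 || v4) ∷ []) refl (I⊑ ∷ []) (p ∷ model-size μ′ ∷ ∣⁅ y ⁆∣≤1 ∷
        ∣⁅ s ⁆∣≤1 ∷ []))
      finish : (∃[ I″ ] ∃[ W″ ] Model I″ W″ × ⊥ ∪ ⁅ y ⁆ ⊑ W″
        × I″ ∪ W″ ⊑ ((⊥ ∪ ⁅ y ⁆) ∪ ⁅ s ⁆) ∪ (G ─ T ─ ⁅ y ⁆)) → Absurd
      finish (I″ , W″ , μ″ , q , h) = not-contractible μ″ (set= (I″ ∷ W″ ∷ ⁅ y ⁆ ∷ ⁅ s ⁆ ∷ G ∷ T ∷ []) (v0 || v1 <: ((∅ || v2) || v3) || ((v4 - v5) - v2) ∷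
        v2 <: v4 ∷ v3 <: v4 ∷ []) ((v0 || v1) || v4) v4 refl (h ∷ y∈ ∷ (in-G s∈T) ∷ [])) (set= (⁅ y ⁆ ∷ W″ ∷ []) (∅ || v0 <: v1 ∷ []) (v0 || v1) v1 refl (q ∷ []))

    -- `T` consists of W, at most one element of N and at most one deleted element. Some element of
    -- `T` is deleted, for otherwise W would be two points spanning the line and the third point of
    -- `T` a loop of N. Together with y this makes two deletions.
    counts : W ⊑ T → ρ W ≡ ∣ W ∣ → G ─ I ─ W ⊑ T ∪ ⁅ y ⁆ →
      ∣ G ─ I ─ W ∣ ≡ 2 × (∣ W ∣ ≡ 1 ⊎ ∣ W ∣ ≡ 2)
    counts W⊑ indep D⊑ = (≤-antisym (prove≤ (G ∷ I ∷ W ∷ T ∷ []) [] [] (card (((v0 - v1) - v2) && v3) <= con 1 ∷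
      card ((v0 - v1) - v2) <= card (((v0 - v1) - v2) && v3) ⊕ con 1 ∷ []) [] (card ((v0 - v1) - v2))
      (con 2) refl [] (≤-reflexive D-size ∷ ≤-reflexive y-size ∷ []))
      (prove≤ (G ∷ I ∷ W ∷ T ∷ []) [] [] (con 1 <= card (((v0 - v1) - v2) && v3) ∷
      card (((v0 - v1) - v2) && v3) ⊕ con 1 <= card ((v0 - v1) - v2) ∷ []) [] (con 2)
      (card ((v0 - v1) - v2)) refl [] (≤-reflexive (sym D-size) ∷ ≤-reflexive (sym y-size) ∷ []))) , (case-W)
      where
      dis : I ∩ W ≡ ⊥
      dis = disjoint μ
      W-small : ∣ W ∣ ≤ 2
      W-small = prove≤ (W ∷ T ∷ []) [] (v0 <: v1 ∷ []) (rank v1 <= con 2 ∷ card v0 <= rank v0 ∷ []) (mono v0 v1 ∷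
        []) (card v0) (con 2) refl (W⊑ ∷ []) (T-line ∷ ≤-reflexive (sym indep) ∷ [])
      D-small : ∣ (G ─ I ─ W) ∩ T ∣ ≤ 1
      D-small with 2 ≤? ∣ (G ─ I ─ W) ∩ T ∣
      ... | no p = prove≤ (G ∷ I ∷ W ∷ T ∷ []) [] [] (con 1 ⊕ card (((v0 - v1) - v2) && v3) <= con 2 ∷ []) []
        (card (((v0 - v1) - v2) && v3)) (con 1) refl [] (≰⇒> p ∷ [])
      ... | yes p with two-elements {A = (G ─ I ─ W) ∩ T} p
      ...   | t , u , t∈ , u∈ , tu = absurd (not-two-deletable {t = t} {u = u} (set= (⁅ t ⁆ ∷ G ∷ I ∷ W ∷ T ∷ []) (v0 <: ((v1 - v2) - v3) && v4 ∷ []) (v0 || v4) v4 refl (t∈ ∷ [])) (set= (⁅ u ⁆ ∷ G ∷ I ∷ W ∷ T ∷ []) (v0 <: ((v1 - v2) - v3) && v4 ∷ []) (v0 || v4) v4 refl (u∈ ∷ [])) tu μ IW⊑ (set= (⁅ t ⁆ ∷ G ∷ I ∷ W ∷ T ∷ ⁅ u ⁆ ∷ []) (v0 <: ((v1 - v2) - v3) && v4 ∷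
        v5 <: ((v1 - v2) - v3) && v4 ∷ []) ((v0 || v5) && (v2 || v3)) ∅ refl (t∈ ∷ u∈ ∷ [])))
      T-count : ∣ T ∩ I ∣ + ∣ W ∣ + ∣ (G ─ I ─ W) ∩ T ∣ ≡ 3
      T-count = ≤-antisym (prove≤ (W ∷ T ∷ G ∷ I ∷ []) [] (v0 <: v1 ∷ v1 <: v2 ∷ v3 && v0 == ∅ ∷ []) (card v1 <= con 3 ∷ [])
        (cmod (v1 && v3) (v0 || (((v2 - v3) - v0) && v1)) ∷ cmod v0 (((v2 - v3) - v0) && v1) ∷ c∅ ∷ c∅ ∷ [])
        ((card (v1 && v3) ⊕ card v0) ⊕ card (((v2 - v3) - v0) && v1)) (con 3) refl (W⊑ ∷ T⊑G ∷ dis ∷ [])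
        (≤-reflexive T-size ∷ []))
        (prove≤ (W ∷ T ∷ G ∷ I ∷ []) [] (v0 <: v1 ∷ v1 <: v2 ∷ []) (con 3 <= card v1 ∷ [])
        (csub (v1 && v3) (v0 || (((v2 - v3) - v0) && v1)) ∷ csub v0 (((v2 - v3) - v0) && v1) ∷ []) (con 3)
        ((card (v1 && v3) ⊕ card v0) ⊕ card (((v2 - v3) - v0) && v1)) refl (W⊑ ∷ T⊑G ∷ [])
        (≤-reflexive (sym T-size) ∷ []))
      D-nonempty : 1 ≤ ∣ (G ─ I ─ W) ∩ T ∣
      D-nonempty with 1 ≤? ∣ (G ─ I ─ W) ∩ T ∣
      ... | yes p = p
      ... | no p with element {A = T ∩ I} (prove≤ (T ∷ I ∷ W ∷ G ∷ []) [] []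
        (con 3 <= (card (v0 && v1) ⊕ card v2) ⊕ card (((v3 - v1) - v2) && v0) ∷
        con 1 ⊕ card (((v3 - v1) - v2) && v0) <= con 1 ∷ card v2 <= con 2 ∷ []) [] (con 1) (card (v0 && v1))
        refl [] (≤-reflexive (sym T-count) ∷ ≰⇒> p ∷ W-small ∷ []))
      ...   | t , t∈ = prove≤ (W ∷ ⁅ t ⁆ ∷ T ∷ I ∷ G ∷ []) [] (v1 <: v2 && v3 ∷ v0 <: v2 ∷ [])
        (rank v0 ⊕ con 1 <= rank (v1 || v0) ∷ rank v2 <= con 2 ∷ card v0 <= rank v0 ∷
        con 3 <= (card (v2 && v3) ⊕ card v0) ⊕ card (((v4 - v3) - v0) && v2) ∷ card (v2 && v3) <= con 1 ∷
        []) (mono (v1 || v0) v2 ∷ []) (con 1) (card (((v4 - v3) - v0) && v2)) refl (t∈ ∷ W⊑ ∷ [])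
        (model-nonloop {y = t} μ t∈I ∷ T-line ∷ ≤-reflexive (sym indep) ∷ ≤-reflexive (sym T-count) ∷
        T-one ∷ [])
        where
        t∈I : ⁅ t ⁆ ⊑ I
        t∈I = set= (⁅ t ⁆ ∷ T ∷ I ∷ []) (v0 <: v1 && v2 ∷ []) (v0 || v2) v2 refl (t∈ ∷ [])
      D-size : ∣ (G ─ I ─ W) ∩ T ∣ ≡ 1
      D-size = ≤-antisym D-small D-nonempty
      y-size : ∣ G ─ I ─ W ∣ ≡ ∣ (G ─ I ─ W) ∩ T ∣ + 1
      y-size = ≤-antisym (prove≤ (G ∷ I ∷ W ∷ T ∷ ⁅ y ⁆ ∷ []) [] ((v0 - v1) - v2 <: v3 || v4 ∷ v4 <: v0 ∷
        v4 && (v1 || v2) == ∅ ∷ []) (card v4 <= con 1 ∷ []) (csub (((v0 - v1) - v2) && v3) v4 ∷ [])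
        (card ((v0 - v1) - v2)) (card (((v0 - v1) - v2) && v3) ⊕ con 1) refl (D⊑ ∷ y∈ ∷ y∉ ∷ [])
        (∣⁅ y ⁆∣≤1 ∷ []))
        (prove≤ (G ∷ I ∷ W ∷ T ∷ ⁅ y ⁆ ∷ []) [] ((v0 - v1) - v2 <: v3 || v4 ∷ v4 <: v0 ∷
        v4 && (v1 || v2) == ∅ ∷ v4 && v3 == ∅ ∷ []) (con 1 <= card v4 ∷ [])
        (cmod (((v0 - v1) - v2) && v3) v4 ∷ c∅ ∷ []) (card (((v0 - v1) - v2) && v3) ⊕ con 1)
        (card ((v0 - v1) - v2)) refl (D⊑ ∷ y∈ ∷ y∉ ∷ y∉T ∷ []) (1≤∣⁅ y ⁆∣ ∷ []))
      case-W : ∣ W ∣ ≡ 1 ⊎ ∣ W ∣ ≡ 2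
      case-W with 2 ≤? ∣ W ∣
      ... | yes p = inj₂ (≤-antisym W-small p)
      ... | no p  = inj₁ (≤-antisym (prove≤ (W ∷ []) [] [] (con 1 ⊕ card v0 <= con 2 ∷ []) [] (card v0) (con 1) refl [] (≰⇒> p ∷ []))
        (prove≤ (W ∷ T ∷ I ∷ G ∷ []) [] []
        (con 3 <= (card (v1 && v2) ⊕ card v0) ⊕ card (((v3 - v2) - v0) && v1) ∷
        card (((v3 - v2) - v0) && v1) <= con 1 ∷ card (v1 && v2) <= con 1 ∷ []) [] (con 1) (card v0) refl []
        (≤-reflexive (sym T-count) ∷ ≤-reflexive D-size ∷ T-one ∷ [])))

-- Elements outside the ground set become loops, so that the axioms hold for all subsets.
abstract
  rankFn : ∀ {n} → Matroid n → RankFn n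
  rankFn M = record
    { ρ = λ X → r M (X ∩ E M)
    ; ρ-card = λ X → ≤-trans (r-card M (X ∩ E M) (⊑⇒⊆ below)) (p⊆q⇒∣p∣≤∣q∣ (⊑⇒⊆ {A = X ∩ E M} {B = X} below′))
    ; ρ-mono = λ X Y h → r-mono M (X ∩ E M) (Y ∩ E M) (⊑⇒⊆ below) (⊑⇒⊆ (meet h))
    ; ρ-sub = λ X Y → subst₂ (λ A B → r M A + r M B ≤ r M (X ∩ E M) + r M (Y ∩ E M)) (union X Y) (inter X Y)
        (r-sub M (X ∩ E M) (Y ∩ E M) (⊑⇒⊆ below) (⊑⇒⊆ below)) }
    where
    open import Data.Fin.Subset.Properties using (p⊆q⇒∣p∣≤∣q∣)
    below : ∀ {X} → X ∩ E M ⊑ E M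
    below {X} = set= (X ∷ E M ∷ []) [] ((v0 && v1) || v1) v1 refl []
    below′ : ∀ {X} → X ∩ E M ⊑ X
    below′ {X} = set= (X ∷ E M ∷ []) [] ((v0 && v1) || v0) v0 refl []
    meet : ∀ {X Y} → X ⊑ Y → X ∩ E M ⊑ Y ∩ E M
    meet {X} {Y} h = set= (X ∷ Y ∷ E M ∷ []) (v0 <: v1 ∷ []) ((v0 && v2) || (v1 && v2)) (v1 && v2) refl (h ∷ [])
    union : ∀ X Y → (X ∩ E M) ∪ (Y ∩ E M) ≡ (X ∪ Y) ∩ E M
    union X Y = set= (X ∷ E M ∷ Y ∷ []) [] ((v0 && v1) || (v2 && v1)) ((v0 || v2) && v1) refl []
    inter : ∀ X Y → (X ∩ E M) ∩ (Y ∩ E M) ≡ (X ∩ Y) ∩ E M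
    inter X Y = set= (X ∷ E M ∷ Y ∷ []) [] ((v0 && v1) && (v2 && v1)) ((v0 && v2) && v1) refl []

  ρ-ground : ∀ {n} (M : Matroid n) {X} → X ⊑ E M → RankFn.ρ (rankFn M) X ≡ r M X
  ρ-ground M {X} h = cong (r M) inside
    where
    inside : X ∩ E M ≡ X
    inside = set= (X ∷ E M ∷ []) (v0 <: v1 ∷ []) (v0 && v1) v0 refl (h ∷ [])

-- Passage between minors as matroids and minors as pairs of sets.

rank-⊥ : ∀ {n} (M : Matroid n) → r M ⊥ ≡ 0
rank-⊥ {n} M = n≤0⇒n≡0 (≤-trans (r-card M ⊥ (λ x∈ → absurd (∉⊥ x∈))) (≤-reflexive (∣⊥∣≡0 n)))

self-minor : ∀ {n} (M : Matroid n) → IsMinorVia M ⊥ ⊥ M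
self-minor M = (λ x∈ → absurd (∉⊥ x∈)) , (λ x∈ → absurd (∉⊥ x∈)) , (set= [] [] (∅ && ∅) ∅ refl []) , (set= (E M ∷ []) [] v0 (v0 - (∅ || ∅)) refl []) ,
  λ X _ → sym (trans (cong₂ _∸_ (cong (r M) (unit X)) (rank-⊥ M)) refl)
  where
  unit : ∀ X → X ∪ ⊥ ≡ X
  unit X = set= (X ∷ []) [] (v0 || ∅) v0 refl []

minor-trans : ∀ {n} (M M₁ M₂ : Matroid n) {C D C′ D′} → IsMinorVia M C D M₁ → IsMinorVia M₁ C′ D′ M₂ →
  IsMinorVia M (C ∪ C′) (D ∪ D′) M₂
minor-trans M M₁ M₂ {C} {D} {C′} {D′} (C⊆ , D⊆ , CD , E₁ , r₁) (C′⊆ , D′⊆ , CD′ , E₂ , r₂) =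
  ⊑⇒⊆ C∪⊑ , ⊑⇒⊆ D∪⊑ , (set= (C ∷ D ∷ C′ ∷ D′ ∷ E M₁ ∷ E M ∷ []) (v0 && v1 == ∅ ∷ v2 && v3 == ∅ ∷ v2 <: v4 ∷ v3 <: v4 ∷
    v4 == v5 - (v0 || v1) ∷ []) ((v0 || v2) && (v1 || v3)) ∅ refl (CD ∷ CD′ ∷ C′⊑ ∷ D′⊑ ∷ E₁ ∷ [])) , (set= (E M₁ ∷ E M ∷ C ∷ D ∷ E M₂ ∷ C′ ∷ D′ ∷ []) (v0 == v1 - (v2 || v3) ∷ v4 == v0 - (v5 || v6) ∷ []) v4
    (v1 - ((v2 || v5) || (v3 || v6))) refl (E₁ ∷ E₂ ∷ [])) ,
  λ X X⊆ → ranks X (⊆⇒⊑ X⊆) (r₂ X X⊆)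
    (r₁ (X ∪ C′) (⊑⇒⊆ (XC′ X (⊆⇒⊑ X⊆)))) (r₁ C′ C′⊆)
  where
  C⊑ : C ⊑ E M
  C⊑ = ⊆⇒⊑ C⊆
  D⊑ : D ⊑ E M
  D⊑ = ⊆⇒⊑ D⊆
  C′⊑ : C′ ⊑ E M₁
  C′⊑ = ⊆⇒⊑ C′⊆
  D′⊑ : D′ ⊑ E M₁
  D′⊑ = ⊆⇒⊑ D′⊆
  C∪⊑ : C ∪ C′ ⊑ E M
  C∪⊑ = set= (C ∷ E M ∷ C′ ∷ E M₁ ∷ D ∷ []) (v0 <: v1 ∷ v2 <: v3 ∷ v3 == v1 - (v0 || v4) ∷ [])
    ((v0 || v2) || v1) v1 refl (C⊑ ∷ C′⊑ ∷ E₁ ∷ [])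
  D∪⊑ : D ∪ D′ ⊑ E M
  D∪⊑ = set= (D ∷ E M ∷ D′ ∷ E M₁ ∷ C ∷ []) (v0 <: v1 ∷ v2 <: v3 ∷ v3 == v1 - (v4 || v0) ∷ [])
    ((v0 || v2) || v1) v1 refl (D⊑ ∷ D′⊑ ∷ E₁ ∷ [])
  XC′ : ∀ X → X ⊑ E M₂ → X ∪ C′ ⊑ E M₁
  XC′ X h = set= (X ∷ E M₂ ∷ E M₁ ∷ C′ ∷ D′ ∷ []) (v0 <: v1 ∷ v1 == v2 - (v3 || v4) ∷ v3 <: v2 ∷ [])
    ((v0 || v3) || v2) v2 refl (h ∷ E₂ ∷ C′⊑ ∷ [])
  arith : ∀ a b c p q s → c ≤ b → b ≤ a → p ≡ a ∸ c → q ≡ b ∸ c → s ≡ p ∸ q → s ≡ a ∸ b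
  arith a b c p q s c≤b b≤a refl refl refl =
    trans (∸-+-assoc a c (b ∸ c)) (cong (a ∸_) (trans (+-comm c (b ∸ c)) (m∸n+n≡m c≤b)))
  ranks : ∀ X → X ⊑ E M₂ → r M₂ X ≡ r M₁ (X ∪ C′) ∸ r M₁ C′ →
    r M₁ (X ∪ C′) ≡ r M ((X ∪ C′) ∪ C) ∸ r M C → r M₁ C′ ≡ r M (C′ ∪ C) ∸ r M C →
    r M₂ X ≡ r M (X ∪ (C ∪ C′)) ∸ r M (C ∪ C′)
  ranks X h p q s = trans (arith (r M ((X ∪ C′) ∪ C)) (r M (C′ ∪ C)) (r M C) _ _ _
      (r-mono M C (C′ ∪ C) (⊑⇒⊆ below₁) (⊑⇒⊆ sub₁)) (r-mono M (C′ ∪ C) ((X ∪ C′) ∪ C) (⊑⇒⊆ below₂) (⊑⇒⊆ sub₂)) q s p)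
    (cong₂ (λ A B → r M A ∸ r M B) eq₁ eq₂)
    where
    below₁ : C′ ∪ C ⊑ E M
    below₁ = set= (C ∷ C′ ∷ E M ∷ []) (v0 || v1 <: v2 ∷ []) ((v1 || v0) || v2) v2 refl (C∪⊑ ∷ [])
    below₂ : (X ∪ C′) ∪ C ⊑ E M
    below₂ = set= (C ∷ C′ ∷ E M ∷ X ∷ E M₂ ∷ E M₁ ∷ D ∷ D′ ∷ []) (v0 || v1 <: v2 ∷ v3 <: v4 ∷
      v5 == v2 - (v0 || v6) ∷ v4 == v5 - (v1 || v7) ∷ []) (((v3 || v1) || v0) || v2) v2 refl (C∪⊑ ∷ h ∷ E₁ ∷
      E₂ ∷ [])
    sub₁ : C ⊑ C′ ∪ C
    sub₁ = set= (C ∷ C′ ∷ []) [] (v0 || (v1 || v0)) (v1 || v0) refl []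
    sub₂ : C′ ∪ C ⊑ (X ∪ C′) ∪ C
    sub₂ = set= (C′ ∷ C ∷ X ∷ []) [] ((v0 || v1) || ((v2 || v0) || v1)) ((v2 || v0) || v1) refl []
    eq₁ : (X ∪ C′) ∪ C ≡ X ∪ (C ∪ C′)
    eq₁ = set= (X ∷ C′ ∷ C ∷ []) [] ((v0 || v1) || v2) (v0 || (v2 || v1)) refl []
    eq₂ : C′ ∪ C ≡ C ∪ C′
    eq₂ = set= (C′ ∷ C ∷ []) [] (v0 || v1) (v1 || v0) refl []

module Bridge {n m : ℕ} (M : Matroid n) (N : Matroid m) (N-size : 4 ≤ ∣ E N ∣) where
  open RankFn (rankFn M)
  open RankSolver (rankFn M)
  open Models (rankFn M) N
  open HasN (rankFn M) N

  minor : Subset n → Subset n → Matroid n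
  minor S C = record
    { E = S
    ; r = λ X → ρ (X ∪ C) ∸ ρ C
    ; r-card = λ X _ → m≤n+o⇒m∸n≤o (ρ (X ∪ C)) (ρ C) (small X)
    ; r-mono = λ X Y _ h → ∸-monoˡ-≤ (ρ C) (larger X Y (⊆⇒⊑ h))
    ; r-sub = λ X Y _ _ → submodular X Y }
    where
    small : ∀ X → ρ (X ∪ C) ≤ ρ C + ∣ X ∣
    small X = prove≤ (X ∷ C ∷ []) [] [] [] (sub v1 v0 ∷ rc v0 ∷ []) (rank (v0 || v1)) (rank v1 ⊕ card v0) refl []
      []
    larger : ∀ X Y → X ⊑ Y → ρ (X ∪ C) ≤ ρ (Y ∪ C)
    larger X Y h = prove≤ (X ∷ Y ∷ C ∷ []) [] (v0 <: v1 ∷ []) [] (mono (v0 || v2) (v1 || v2) ∷ []) (rank (v0 || v2))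
      (rank (v1 || v2)) refl (h ∷ []) []
    restore : ∀ X → ρ (X ∪ C) ∸ ρ C + ρ C ≡ ρ (X ∪ C)
    restore X = m∸n+n≡m below
      where
      below : ρ C ≤ ρ (X ∪ C)
      below = prove≤ (C ∷ X ∷ []) [] [] [] (mono v0 (v1 || v0) ∷ []) (rank v0) (rank (v1 || v0)) refl [] []
    submodular : ∀ X Y → (ρ ((X ∪ Y) ∪ C) ∸ ρ C) + (ρ ((X ∩ Y) ∪ C) ∸ ρ C) ≤ (ρ (X ∪ C) ∸ ρ C) + (ρ (Y ∪ C) ∸ ρ C)
    submodular X Y = prove≤ (C ∷ X ∷ Y ∷ []) ((ρ ((X ∪ Y) ∪ C)) ∸ (ρ C) ∷ (ρ ((X ∩ Y) ∪ C)) ∸ (ρ C) ∷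
      (ρ (X ∪ C)) ∸ (ρ C) ∷ (ρ (Y ∪ C)) ∸ (ρ C) ∷ []) [] (nv 0 ⊕ rank v0 <= rank ((v1 || v2) || v0) ∷
      nv 1 ⊕ rank v0 <= rank ((v1 && v2) || v0) ∷ rank (v1 || v0) <= nv 2 ⊕ rank v0 ∷
      rank (v2 || v0) <= nv 3 ⊕ rank v0 ∷ []) (sub (v1 || v0) (v2 || v0) ∷ []) (nv 0 ⊕ nv 1) (nv 2 ⊕ nv 3)
      refl [] (≤-reflexive (restore (X ∪ Y)) ∷ ≤-reflexive (restore (X ∩ Y)) ∷
      ≤-reflexive (sym (restore X)) ∷ ≤-reflexive (sym (restore Y)) ∷ [])

  minor-restore : ∀ S C X → r (minor S C) X + ρ C ≡ ρ (X ∪ C)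
  minor-restore S C X = m∸n+n≡m below
    where
    below : ρ C ≤ ρ (X ∪ C)
    below = prove≤ (C ∷ X ∷ []) [] [] [] (mono v0 (v1 || v0) ∷ []) (rank v0) (rank (v1 || v0)) refl [] []

  minor-via : ∀ {S C D} → C ⊑ E M → D ⊑ E M → C ∩ D ≡ ⊥ → S ≡ E M ─ (C ∪ D) → IsMinorVia M C D (minor S C)
  minor-via {S} {C} {D} C⊑ D⊑ CD S≡ = ⊑⇒⊆ C⊑ , ⊑⇒⊆ D⊑ , CD , S≡ ,
    λ X X⊆ → cong₂ _∸_ (ρ-ground M (XC X (⊆⇒⊑ X⊆))) (ρ-ground M C⊑)
    where
    XC : ∀ X → X ⊑ S → X ∪ C ⊑ E M
    XC X h = set= (X ∷ S ∷ E M ∷ C ∷ D ∷ []) (v0 <: v1 ∷ v1 == v2 - (v3 || v4) ∷ v3 <: v2 ∷ []) ((v0 || v3) || v2)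
      v2 refl (h ∷ S≡ ∷ C⊑ ∷ [])

  minor-minor : ∀ {S C I W} → S ∩ C ≡ ⊥ → I ∩ W ≡ ⊥ → C ⊑ W → I ⊑ S → W ⊑ S ∪ C →
    IsMinorVia (minor S C) (W ─ C) (S ─ (I ∪ W)) (minor I W)
  minor-minor {S} {C} {I} {W} SC IW C⊑ I⊑ W⊑ = ⊑⇒⊆ sub₁ , ⊑⇒⊆ sub₂ , (set= (W ∷ C ∷ S ∷ I ∷ []) [] ((v0 - v1) && (v2 - (v3 || v0))) ∅ refl []) , ground ,
    λ X _ → trans (cong (λ A → ρ A ∸ ρ W) (eq X)) (sym (arith (ρ ((X ∪ (W ─ C)) ∪ C)) (ρ W) (ρ C) (ρ ((W ─ C) ∪ C))
      C≤W (cong ρ W≡)))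
    where
    ground : I ≡ S ─ ((W ─ C) ∪ (S ─ (I ∪ W)))
    ground = set= (S ∷ C ∷ I ∷ W ∷ []) (v0 && v1 == ∅ ∷ v2 && v3 == ∅ ∷ v2 <: v0 ∷ []) v2
      (v0 - ((v3 - v1) || (v0 - (v2 || v3)))) refl (SC ∷ IW ∷ I⊑ ∷ [])
    sub₁ : W ─ C ⊑ S
    sub₁ = set= (W ∷ S ∷ C ∷ []) (v0 <: v1 || v2 ∷ []) ((v0 - v2) || v1) v1 refl (W⊑ ∷ [])
    sub₂ : S ─ (I ∪ W) ⊑ S
    sub₂ = set= (S ∷ I ∷ W ∷ []) [] ((v0 - (v1 || v2)) || v0) v0 refl []
    eq : ∀ X → X ∪ W ≡ (X ∪ (W ─ C)) ∪ C
    eq X = set= (C ∷ W ∷ X ∷ []) (v0 <: v1 ∷ []) (v2 || v1) ((v2 || (v1 - v0)) || v0) refl (C⊑ ∷ [])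
    W≡ : (W ─ C) ∪ C ≡ W
    W≡ = set= (C ∷ W ∷ []) (v0 <: v1 ∷ []) ((v1 - v0) || v0) v1 refl (C⊑ ∷ [])
    C≤W : ρ C ≤ ρ W
    C≤W = prove≤ (C ∷ W ∷ []) [] (v0 <: v1 ∷ []) [] (mono v0 v1 ∷ []) (rank v0) (rank v1) refl (C⊑ ∷ []) []
    arith : ∀ a b c b′ → c ≤ b → b′ ≡ b → (a ∸ c) ∸ (b′ ∸ c) ≡ a ∸ b
    arith a b c .b c≤b refl =
      trans (∸-+-assoc a c (b ∸ c)) (cong (a ∸_) (trans (+-comm c (b ∸ c)) (m∸n+n≡m c≤b)))

  minor-connected : ∀ {S C} → Connected₃ (rankFn M) S C → ThreeConnected (minor S C)
  minor-connected {S} {C} conn k 1≤k k≤2 X X⊆ kX kX′ =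
    shifted
    where
    shifted : r (minor S C) S + k ≤ r (minor S C) X + r (minor S C) (S ─ X)
    X⊑ : X ⊑ S
    X⊑ = ⊆⇒⊑ X⊆
    split : X ∪ (S ─ X) ≡ S
    split = set= (X ∷ S ∷ []) (v0 <: v1 ∷ []) (v0 || (v1 - v0)) v1 refl (X⊑ ∷ [])
    split′ : X ∩ (S ─ X) ≡ ⊥
    split′ = set= (X ∷ S ∷ []) [] (v0 && (v1 - v0)) ∅ refl []
    shifted = prove≤ (S ∷ C ∷ X ∷ []) (k ∷ r (minor S C) S ∷ r (minor S C) X ∷ r (minor S C) (S ─ X) ∷ []) []
      ((rank (v0 || v1) ⊕ rank v1) ⊕ nv 0 <= rank (v2 || v1) ⊕ rank ((v0 - v2) || v1) ∷
      nv 1 ⊕ rank v1 <= rank (v0 || v1) ∷ rank (v2 || v1) <= nv 2 ⊕ rank v1 ∷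
      rank ((v0 - v2) || v1) <= nv 3 ⊕ rank v1 ∷ []) [] (nv 1 ⊕ nv 0) (nv 2 ⊕ nv 3) refl []
      ((conn k 1≤k k≤2 X (S ─ X) split split′ kX kX′) ∷ ≤-reflexive (minor-restore S C S) ∷
      ≤-reflexive (sym (minor-restore S C X)) ∷ ≤-reflexive (sym (minor-restore S C (S ─ X))) ∷ [])

  some-element : Fin m
  some-element = proj₁ (element {A = E N} (≤-trans (s≤s z≤n) N-size))

  -- The model maps N into M, whereas `Isomorphic` asks for a map to N on all of `Fin n`. It inverts
  -- the model on I and takes the default value `some-element` elsewhere.
  model-isomorphic : ∀ {I W} → Model I W → Isomorphic (minor I W) N
  model-isomorphic {I} {W} μ = f , (λ i∈ → proj₁ (f-spec i∈)) ,
    (λ i∈ j∈ p → trans (sym (proj₂ (f-spec i∈))) (trans (cong (φ μ) p) (proj₂ (f-spec j∈)))) ,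
    (λ {j} j∈ → φ μ j , φ∈ j∈ , injective μ (proj₁ (f-spec (φ∈ j∈))) j∈ (proj₂ (f-spec (φ∈ j∈)))) ,
    λ X X⊆ → combine X (trans (cong (λ Z → r N Z + ρ W) (image-f X X⊆)) (rank-preimage μ (⊆⇒⊑ X⊆))) (minor-restore I W X)
    where
    φ∈ : ∀ {j} → j ∈ E N → φ μ j ∈ I
    φ∈ j∈ = subst (_ ∈_) (onto μ) (∈-image⁺ (φ μ) j∈)
    f : Fin n → Fin m
    f i with any? (λ j → (j ∈? E N) ×-dec (φ μ j ≟ i))
    ... | yes (j , _) = j
    ... | no _        = some-element
    f-spec : ∀ {i} → i ∈ I → f i ∈ E N × φ μ (f i) ≡ i
    f-spec {i} i∈ with any? (λ j → (j ∈? E N) ×-dec (φ μ j ≟ i))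
    ... | yes (_ , p) = p
    ... | no none     = absurd (none (∈-image⁻ (φ μ) (subst (i ∈_) (sym (onto μ)) i∈)))
    image-f : ∀ X → X ⊆ I → image f X ≡ preimage (φ μ) (E N) X
    image-f X X⊆ = ⊆-antisym to from
      where
      to : image f X ⊆ preimage (φ μ) (E N) X
      to j∈ with ∈-image⁻ f j∈
      ... | i , i∈ , refl = preimage⁺ (φ μ) (proj₁ (f-spec (X⊆ i∈))) (subst (_∈ X) (sym (proj₂ (f-spec (X⊆ i∈)))) i∈)
      from : preimage (φ μ) (E N) X ⊆ image f X
      from {j} j∈ = let (p , q) = preimage⁻ (φ μ) j∈ in
        subst (_∈ image f X) (injective μ (proj₁ (f-spec (X⊆ q))) p (proj₂ (f-spec (X⊆ q)))) (∈-image⁺ f q)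
    combine : ∀ X → r N (image f X) + ρ W ≡ ρ (X ∪ W) → r (minor I W) X + ρ W ≡ ρ (X ∪ W) → r N (image f X) ≡ r (minor I W) X
    combine X p q = +-cancelʳ-≡ (ρ W) _ _ (trans p (sym q))

  Has⇒minor : ∀ {S C} → S ∩ C ≡ ⊥ → Has S C → HasMinor (minor S C) N
  Has⇒minor SC (I , W , μ , C⊑ , I⊑ , W⊑) =
    minor I W , (_ , _ , minor-minor SC (disjoint μ) C⊑ I⊑ W⊑) , model-isomorphic μ

  -- The two minors are composed and the isomorphism is inverted on E(N). The conclusion records
  -- that C is contracted and that D is avoided, the forms in which contractible and deletable
  -- elements appear above.
  minor⇒model : ∀ M₁ {C D} → IsMinorVia M C D M₁ → HasMinor M₁ N →
    ∃[ I ] ∃[ W ] Model I W × C ⊑ W × I ∪ W ⊑ E M × D ∩ (I ∪ W) ≡ ⊥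
  minor⇒model M₁ {C} {D} via (M₀ , (C′ , D′ , via′) , f , f∈ , f-inj , f-onto , f-rank) =
    build (minor-trans M M₁ M₀ via via′)
    where
    i₀ : ∃[ i ] i ∈ E M₀ × f i ≡ some-element
    i₀ = f-onto (⊑⇒∈ (proj₂ (element {A = E N} (≤-trans (s≤s z≤n) N-size))))
    ψ : Fin m → Fin n
    ψ j with any? (λ i → (i ∈? E M₀) ×-dec (f i ≟ j))
    ... | yes (i , _) = i
    ... | no _        = proj₁ i₀
    ψ-spec : ∀ {j} → j ∈ E N → ψ j ∈ E M₀ × f (ψ j) ≡ j
    ψ-spec {j} j∈ with any? (λ i → (i ∈? E M₀) ×-dec (f i ≟ j))
    ... | yes (_ , p) = p
    ... | no none     = absurd (none (f-onto j∈))
    ψ-onto : image ψ (E N) ≡ E M₀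
    ψ-onto = ⊆-antisym to from
      where
      to : image ψ (E N) ⊆ E M₀
      to j∈ with ∈-image⁻ ψ j∈
      ... | i , i∈ , refl = proj₁ (ψ-spec i∈)
      from : E M₀ ⊆ image ψ (E N)
      from {i} i∈ = subst (_∈ image ψ (E N)) (f-inj (proj₁ (ψ-spec (f∈ i∈))) i∈ (proj₂ (ψ-spec (f∈ i∈)))) (∈-image⁺ ψ (f∈ i∈))
    f-image-ψ : ∀ Z → Z ⊆ E N → image f (image ψ Z) ≡ Z
    f-image-ψ Z Z⊆ = ⊆-antisym to from
      where
      to : image f (image ψ Z) ⊆ Z
      to j∈ with ∈-image⁻ f j∈
      ... | i , i∈ , refl with ∈-image⁻ ψ i∈
      ...   | k , k∈ , refl = subst (_∈ Z) (sym (proj₂ (ψ-spec (Z⊆ k∈)))) k∈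
      from : Z ⊆ image f (image ψ Z)
      from {j} j∈ = subst (_∈ image f (image ψ Z)) (proj₂ (ψ-spec (Z⊆ j∈))) (∈-image⁺ f (∈-image⁺ ψ j∈))
    build : IsMinorVia M (C ∪ C′) (D ∪ D′) M₀ →
      ∃[ I ] ∃[ W ] Model I W × C ⊑ W × I ∪ W ⊑ E M × D ∩ (I ∪ W) ≡ ⊥
    build (C⊆ , D⊆ , CD , E₀ , r₀) = E M₀ , C ∪ C′ , μ , (set= (C ∷ C′ ∷ []) [] (v0 || (v0 || v1)) (v0 || v1) refl []) , (set= (E M₀ ∷ E M ∷ C ∷ C′ ∷ D ∷ D′ ∷ []) (v0 == v1 - ((v2 || v3) || (v4 || v5)) ∷ v2 || v3 <: v1 ∷
      []) ((v0 || (v2 || v3)) || v1) v1 refl (E₀ ∷ C⊑ ∷ [])) , (set= (E M₀ ∷ E M ∷ C ∷ C′ ∷ D ∷ D′ ∷ []) (v0 == v1 - ((v2 || v3) || (v4 || v5)) ∷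
      (v2 || v3) && (v4 || v5) == ∅ ∷ []) (v4 && (v0 || (v2 || v3))) ∅ refl (E₀ ∷ CD ∷ []))
      where
      C⊑ : C ∪ C′ ⊑ E M
      C⊑ = ⊆⇒⊑ C⊆
      ranks : ∀ X → X ⊑ E M₀ → r M₀ X ≡ r M (X ∪ (C ∪ C′)) ∸ r M (C ∪ C′) → r M₀ X + ρ (C ∪ C′) ≡ ρ (X ∪ (C ∪ C′))
      ranks X h p = trans (cong₂ _+_ p (ρ-ground M C⊑)) (trans (m∸n+n≡m
          (r-mono M (C ∪ C′) (X ∪ (C ∪ C′)) (⊑⇒⊆ below) (⊑⇒⊆ sub′)))
          (sym (ρ-ground M below)))
        where
        below : X ∪ (C ∪ C′) ⊑ E M
        below = set= (X ∷ E M₀ ∷ E M ∷ C ∷ C′ ∷ D ∷ D′ ∷ []) (v0 <: v1 ∷ v1 == v2 - ((v3 || v4) || (v5 || v6)) ∷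
          v3 || v4 <: v2 ∷ []) ((v0 || (v3 || v4)) || v2) v2 refl (h ∷ E₀ ∷ C⊑ ∷ [])
        sub′ : C ∪ C′ ⊑ X ∪ (C ∪ C′)
        sub′ = set= (C ∷ C′ ∷ X ∷ []) [] ((v0 || v1) || (v2 || (v0 || v1))) (v2 || (v0 || v1)) refl []
      image⊆ : ∀ Z → Z ⊆ E N → image ψ Z ⊆ E M₀
      image⊆ Z Z⊆ j∈ with ∈-image⁻ ψ j∈
      ... | i , i∈ , refl = proj₁ (ψ-spec (Z⊆ i∈))
      μ : Model (E M₀) (C ∪ C′)
      μ = record
        { φ = ψ
        ; injective = λ i∈ j∈ p → trans (sym (proj₂ (ψ-spec i∈))) (trans (cong f p) (proj₂ (ψ-spec j∈)))
        ; onto = ψ-onto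
        ; disjoint = set= (E M₀ ∷ E M ∷ C ∷ C′ ∷ D ∷ D′ ∷ []) (v0 == v1 - ((v2 || v3) || (v4 || v5)) ∷ [])
          (v0 && (v2 || v3)) ∅ refl (E₀ ∷ [])
        ; rank-φ = λ Z Z⊆ → trans (cong (_+ ρ (C ∪ C′))
            (trans (cong (r N) (sym (f-image-ψ Z Z⊆))) (f-rank (image ψ Z) (image⊆ Z Z⊆))))
            (ranks (image ψ Z) (⊆⇒⊑ (image⊆ Z Z⊆)) (r₀ (image ψ Z) (image⊆ Z Z⊆))) }

-- Here g and e are the sizes of the ground sets of M and N, a and b their ranks, w the number of
-- contracted and d that of deleted elements. Ranks are at most sizes, so truncated subtraction is
-- exact.
corank-difference : ∀ {g a e b s w d} → a ≤ g → b ≤ e → a ≡ b + w → g ≡ e + w + d → s ≡ d → g ∸ a ≡ (e ∸ b) + s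
corank-difference {g} {a} {e} {b} {s} {w} {d} a≤ b≤ p q t = +-cancelʳ-≡ (b + w) _ _
  (trans (cong (g ∸ a +_) (sym p)) (trans (m∸n+n≡m a≤) (trans q (sym (trans (cong (λ z → (e ∸ b) + z + (b + w)) t)
    (rearrange (e ∸ b) b w d (m∸n+n≡m b≤)))))))
  where
  rearrange : ∀ c b w d → c + b ≡ e → c + d + (b + w) ≡ e + w + d
  rearrange c b w d h = trans (trans (+-assoc c d (b + w)) (cong (c +_) (trans (+-comm d (b + w)) (+-assoc b w d))))
    (trans (sym (+-assoc c b (w + d))) (trans (cong (_+ (w + d)) h) (sym (+-assoc e w d))))

-- The two outcomes for M.

module Proof {n m : ℕ} (M : Matroid n) (N : Matroid m) (T : Subset n)
    (N-conn : ThreeConnected N) (N-size : 4 ≤ ∣ E N ∣) (triangle : IsTriangle M T)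
    (M-conn : ThreeConnected M) (M-has : HasMinor M N)
    (M-minimal : ∀ (M₀ : Matroid n) → IsProperMinor M M₀ → T ⊆ E M₀ → ¬ (ThreeConnected M₀ × HasMinor M₀ N)) where
  open RankFn (rankFn M)
  open RankSolver (rankFn M)
  open Rank (rankFn M)
  open Models (rankFn M) N
  open Survival (rankFn M) N N-conn N-size
  open HasN (rankFn M) N
  open Bridge M N N-size

  T⊑G : T ⊑ E M
  T⊑G = ⊆⇒⊑ (proj₁ (proj₁ triangle))

  T-size : ∣ T ∣ ≡ 3
  T-size = proj₂ triangle

  T-line : ρ T ≤ 2
  T-line = ≤-pred (subst₂ _<_ (sym (ρ-ground M T⊑G)) T-size (proj₁ (proj₂ (proj₁ triangle))))

  T-pair : ∀ u v → ⁅ u ⁆ ⊑ T → ⁅ v ⁆ ⊑ T → ⁅ u ⁆ ∩ ⁅ v ⁆ ≡ ⊥ → 2 ≤ ρ (⁅ u ⁆ ∪ ⁅ v ⁆)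
  T-pair u v u∈ v∈ uv = prove≤ (⁅ u ⁆ ∷ ⁅ v ⁆ ∷ []) [] (v0 && v1 == ∅ ∷ []) (card (v0 || v1) <= rank (v0 || v1) ∷
    con 1 <= card v0 ∷ con 1 <= card v1 ∷ []) (cmod v0 v1 ∷ c∅ ∷ []) (con 2) (rank (v0 || v1)) refl (uv ∷
    [])
    (≤-reflexive (sym (trans (ρ-ground M below) (proj₂ (proj₂ (proj₁ triangle)) (⁅ u ⁆ ∪ ⁅ v ⁆) (⊑⇒⊆ in-T) proper))) ∷
    1≤∣⁅ u ⁆∣ ∷ 1≤∣⁅ v ⁆∣ ∷ [])
    where
    in-T : ⁅ u ⁆ ∪ ⁅ v ⁆ ⊑ T
    in-T = set= (⁅ u ⁆ ∷ T ∷ ⁅ v ⁆ ∷ []) (v0 <: v1 ∷ v2 <: v1 ∷ []) ((v0 || v2) || v1) v1 refl (u∈ ∷ v∈ ∷ [])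
    below : ⁅ u ⁆ ∪ ⁅ v ⁆ ⊑ E M
    below = set= (⁅ u ⁆ ∷ ⁅ v ⁆ ∷ T ∷ E M ∷ []) (v0 || v1 <: v2 ∷ v2 <: v3 ∷ []) ((v0 || v1) || v3) v3 refl
      (in-T ∷ T⊑G ∷ [])
    proper : ⁅ u ⁆ ∪ ⁅ v ⁆ ≢ T
    proper p = (refute (⁅ u ⁆ ∷ ⁅ v ⁆ ∷ T ∷ []) [] (v0 || v1 == v2 ∷ []) (con 3 <= card v2 ∷ card v0 <= con 1 ∷
      card v1 <= con 1 ∷ []) (csub v0 v1 ∷ []) refl (p ∷ []) (≤-reflexive (sym T-size) ∷ ∣⁅ u ⁆∣≤1 ∷
      ∣⁅ v ⁆∣≤1 ∷ []))

  conn : ∀ k → 1 ≤ k → k ≤ 2 → ∀ A B → A ∪ B ≡ E M → A ∩ B ≡ ⊥ → k ≤ ∣ A ∣ → k ≤ ∣ B ∣ → ρ (E M) + k ≤ ρ A + ρ B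
  conn k 1≤k k≤2 A B AB d kA kB = subst₂ _≤_ (cong (_+ k) (sym (ρ-ground M G⊑)))
      (cong₂ _+_ (sym (ρ-ground M A⊑)) (trans (cong (r M) (sym B≡)) (sym (ρ-ground M B⊑))))
      (M-conn k 1≤k k≤2 A (⊑⇒⊆ A⊑) kA (subst (λ Z → k ≤ ∣ Z ∣) B≡ kB))
    where
    G⊑ : E M ⊑ E M
    G⊑ = set= (E M ∷ []) [] (v0 || v0) v0 refl []
    A⊑ : A ⊑ E M
    A⊑ = set= (A ∷ B ∷ E M ∷ []) (v0 || v1 == v2 ∷ []) (v0 || v2) v2 refl (AB ∷ [])
    B⊑ : B ⊑ E M
    B⊑ = set= (A ∷ B ∷ E M ∷ []) (v0 || v1 == v2 ∷ []) (v1 || v2) v2 refl (AB ∷ [])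
    B≡ : B ≡ E M ─ A
    B≡ = set= (A ∷ B ∷ E M ∷ []) (v0 || v1 == v2 ∷ v0 && v1 == ∅ ∷ []) v1 (v2 - v0) refl (AB ∷ d ∷ [])

  minimal : ∀ S C → S ∩ C ≡ ⊥ → S ∪ C ⊑ E M → T ⊑ S → S ≢ E M → Connected₃ (rankFn M) S C → Has S C → Absurd
  minimal S C SC SC⊑ T⊑ S≢ c has = M-minimal (minor S C)
    ((C , E M ─ (S ∪ C) , minor-via (set= (S ∷ C ∷ E M ∷ []) (v0 || v1 <: v2 ∷ []) (v1 || v2) v2 refl (SC⊑ ∷ [])) (set= (E M ∷ S ∷ C ∷ []) [] ((v0 - (v1 || v2)) || v0) v0 refl []) (set= (C ∷ E M ∷ S ∷ []) [] (v0 && (v1 - (v2 || v0))) ∅ refl []) (set= (S ∷ C ∷ E M ∷ []) (v0 && v1 == ∅ ∷ v0 || v1 <: v2 ∷ []) v0 (v2 - (v1 || (v2 - (v0 || v1))))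
      refl (SC ∷ SC⊑ ∷ []))) , S≢) (⊑⇒⊆ T⊑)
    (minor-connected c , Has⇒minor SC has)

  model₀ : ∃[ I ] ∃[ W ] Model I W × ⊥ ⊑ W × I ∪ W ⊑ E M × ⊥ ∩ (I ∪ W) ≡ ⊥
  model₀ = minor⇒model M (self-minor M) M-has

  G-size : 4 ≤ ∣ E M ∣
  G-size = larger (model-size (proj₁ (proj₂ (proj₂ model₀)))) (proj₁ (proj₂ (proj₂ (proj₂ (proj₂ model₀)))))
    where
    larger : ∀ {I W G : Subset n} → 4 ≤ ∣ I ∣ → I ∪ W ⊑ G → 4 ≤ ∣ G ∣
    larger {I} {W} {G} h p = prove≤ (I ∷ W ∷ G ∷ []) [] (v0 || v1 <: v2 ∷ []) (con 4 <= card v0 ∷ []) (cmono v0 v2 ∷ []) (con 4)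
      (card v2) refl (p ∷ []) (h ∷ [])

  open Triangle (rankFn M) N N-conn N-size (E M) T T⊑G T-size T-line T-pair G-size conn minimal

  ρG : ρ (E M) ≡ rk M
  ρG = ρ-ground M (set= (E M ∷ []) [] (v0 || v0) v0 refl [])

  CaseA CaseB : Subset n → Set
  CaseA I =
    rk M ≡ rk N + 1 × (corank M ≡ corank N + 2 ⊎ corank M ≡ corank N + 3) ×
    ∃ λ (x : Fin n) → x ∈ E M × E M ─ I ⊆ T ∪ ⁅ x ⁆ × IsFourPointLine M (T ∪ ⁅ x ⁆) ×
      (∀ (M₁ : Matroid n) → IsDeletion M ⁅ x ⁆ M₁ → ¬ HasMinor M₁ N) ×
      SiContract3ConnNMinor M x N ×
      (∀ (z : Fin n) → z ∈ E M → SiContract3ConnNMinor M z N → z ≡ x)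
  CaseB I =
    corank M ≡ corank N + 2 × (rk M ≡ rk N + 1 ⊎ rk M ≡ rk N + 2) ×
    ∃ λ (y : Fin n) → y ∈ E M × E M ─ I ⊆ T ∪ ⁅ y ⁆ × IsCocircuit M (T ∪ ⁅ y ⁆) × ∣ T ∪ ⁅ y ⁆ ∣ ≡ 4 ×
      (∀ (M₁ : Matroid n) → IsContraction M ⁅ y ⁆ M₁ → ¬ HasMinor M₁ N) ×
      (∀ (A : Subset n) → A ⊆ T → 2 ≤ ∣ A ∣ → ∀ (M₁ : Matroid n) → IsDeletion M A M₁ → ¬ HasMinor M₁ N)

  module Normal {I W} (μ : Model I W) (IW⊑ : I ∪ W ⊑ E M) (spanning : ρ (E M) ≤ ρ (I ∪ W)) (indep : ρ W ≡ ∣ W ∣) where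

    I∩W≡⊥ : I ∩ W ≡ ⊥
    I∩W≡⊥ = disjoint μ

    rank-difference : rk M ≡ rk N + ∣ W ∣
    rank-difference = trans (sym ρG) (trans (≤-antisym spanning below) (trans (sym (rank-model μ)) (cong (rk N +_) indep)))
      where
      below : ρ (I ∪ W) ≤ ρ (E M)
      below = prove≤ (I ∷ W ∷ E M ∷ []) [] (v0 || v1 <: v2 ∷ []) [] (mono (v0 || v1) v2 ∷ []) (rank (v0 || v1))
        (rank v2) refl (IW⊑ ∷ []) []

    corank-by : ∀ {s} → ∣ E M ─ I ─ W ∣ ≡ s → corank M ≡ corank N + s
    corank-by refl = corank-difference (r-card M (E M) (λ x∈ → x∈)) (r-card N (E N) (λ x∈ → x∈)) rank-difference
      (trans partition (cong (λ z → z + ∣ W ∣ + ∣ E M ─ I ─ W ∣) (∣model∣ μ))) refl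
      where
      partition : ∣ E M ∣ ≡ ∣ I ∣ + ∣ W ∣ + ∣ E M ─ I ─ W ∣
      partition = ≤-antisym (prove≤ (I ∷ W ∷ E M ∷ []) [] (v0 || v1 <: v2 ∷ []) [] (csub v0 v1 ∷
        csub ((v2 - v0) - v1) (v0 || v1) ∷ []) (card v2) ((card v0 ⊕ card v1) ⊕ card ((v2 - v0) - v1)) refl
        (IW⊑ ∷ []) [])
        (prove≤ (I ∷ W ∷ E M ∷ []) [] (v0 && v1 == ∅ ∷ v0 || v1 <: v2 ∷ []) []
        (cmod v0 (v1 || ((v2 - v0) - v1)) ∷ cmod v1 ((v2 - v0) - v1) ∷ c∅ ∷ c∅ ∷ [])
        ((card v0 ⊕ card v1) ⊕ card ((v2 - v0) - v1)) (card v2) refl (I∩W≡⊥ ∷ IW⊑ ∷ []) [])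

    -- A contracted x outside `T` lies on the line of `T`. Then x is all that is contracted and only
    -- elements of `T` are deleted: the rank difference is 1, and the corank difference is 2 or 3
    -- according to whether N keeps an element of `T`.
    case-a : ∀ {x} → ⁅ x ⁆ ⊑ W ─ T → CaseA I × ∣ E M ─ (I ∪ T) ∣ ≤ 1
    case-a {x} x∈ = (trans rank-difference (cong (rk N +_) W-size) , coranks , x , ⊑⇒∈ x∈G , ⊑⇒⊆ inside ,
        (⊑⇒⊆ four-in , four-size , trans (sym (ρ-ground M four-in)) four-rank) , no-deletion , si , unique) ,
        (prove≤ (W ∷ ⁅ x ⁆ ∷ E M ∷ I ∷ T ∷ []) [] (v0 == v1 ∷ (v2 - v3) - v0 <: v4 ∷ [])
          (card v1 <= con 1 ∷ []) (cmono (v2 - (v3 || v4)) v1 ∷ []) (card (v2 - (v3 || v4))) (con 1) refl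
          (W≡ ∷ D⊑T ∷ []) (∣⁅ x ⁆∣≤1 ∷ []))
      where
      x∈G : ⁅ x ⁆ ⊑ E M
      x∈G = set= (⁅ x ⁆ ∷ W ∷ T ∷ I ∷ E M ∷ []) (v0 <: v1 - v2 ∷ v3 || v1 <: v4 ∷ []) (v0 || v4) v4 refl (x∈ ∷
        IW⊑ ∷ [])
      x∉T : ⁅ x ⁆ ∩ T ≡ ⊥
      x∉T = set= (⁅ x ⁆ ∷ W ∷ T ∷ []) (v0 <: v1 - v2 ∷ []) (v0 && v2) ∅ refl (x∈ ∷ [])
      x∈W : ⁅ x ⁆ ⊑ W
      x∈W = set= (⁅ x ⁆ ∷ W ∷ T ∷ []) (v0 <: v1 - v2 ∷ []) (v0 || v1) v1 refl (x∈ ∷ [])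
      Tx : ρ (T ∪ ⁅ x ⁆) ≤ 2
      Tx = contractible-spanned x∈G μ IW⊑ x∈W
      open Point x∈G x∉T Tx
      W≡ : W ≡ ⁅ x ⁆
      W≡ = contracts-only-x μ IW⊑ x∈W
      W-size : ∣ W ∣ ≡ 1
      W-size = ≤-antisym (prove≤ (W ∷ ⁅ x ⁆ ∷ []) [] (v0 == v1 ∷ []) (card v1 <= con 1 ∷ []) [] (card v0) (con 1) refl (W≡ ∷
        []) (∣⁅ x ⁆∣≤1 ∷ []))
        (prove≤ (W ∷ ⁅ x ⁆ ∷ []) [] (v0 == v1 ∷ []) (con 1 <= card v1 ∷ []) [] (con 1) (card v0) refl (W≡ ∷
        []) (1≤∣⁅ x ⁆∣ ∷ []))
      D⊑T : E M ─ I ─ W ⊑ T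
      D⊑T with empty-or-element (E M ─ I ─ W ─ T)
      ... | inj₁ p = set= (E M ∷ I ∷ W ∷ T ∷ []) (((v0 - v1) - v2) - v3 == ∅ ∷ []) (((v0 - v1) - v2) || v3) v3 refl (p ∷
        [])
      ... | inj₂ (d , d∈) = absurd (not-both {d = d} μ IW⊑ x∈W (set= (⁅ d ⁆ ∷ E M ∷ I ∷ W ∷ T ∷ []) (v0 <: ((v1 - v2) - v3) - v4 ∷ []) (v0 || v1) v1 refl (d∈ ∷
        [])) (set= (⁅ d ⁆ ∷ E M ∷ I ∷ W ∷ T ∷ []) (v0 <: ((v1 - v2) - v3) - v4 ∷ []) (v0 && v4) ∅ refl (d∈ ∷ [])) (set= (⁅ d ⁆ ∷ E M ∷ I ∷ W ∷ T ∷ []) (v0 <: ((v1 - v2) - v3) - v4 ∷ []) (v0 && (v2 || v3)) ∅ refl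
        (d∈ ∷ [])))
      D-size : ∣ E M ─ I ─ W ∣ + ∣ T ∩ I ∣ ≡ 3
      D-size = ≤-antisym (prove≤ (E M ∷ I ∷ W ∷ T ∷ ⁅ x ⁆ ∷ []) [] ((v0 - v1) - v2 <: v3 ∷ v2 == v4 ∷ v4 && v3 == ∅ ∷
        v3 <: v0 ∷ []) (card v3 <= con 3 ∷ []) (cmod ((v0 - v1) - v2) (v3 && v1) ∷ c∅ ∷ [])
        (card ((v0 - v1) - v2) ⊕ card (v3 && v1)) (con 3) refl (D⊑T ∷ W≡ ∷ x∉T ∷ T⊑G ∷ [])
        (≤-reflexive T-size ∷ []))
        (prove≤ (E M ∷ I ∷ W ∷ T ∷ ⁅ x ⁆ ∷ []) [] ((v0 - v1) - v2 <: v3 ∷ v2 == v4 ∷ v4 && v3 == ∅ ∷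
        v3 <: v0 ∷ []) (con 3 <= card v3 ∷ []) (csub ((v0 - v1) - v2) (v3 && v1) ∷ []) (con 3)
        (card ((v0 - v1) - v2) ⊕ card (v3 && v1)) refl (D⊑T ∷ W≡ ∷ x∉T ∷ T⊑G ∷ [])
        (≤-reflexive (sym T-size) ∷ []))
      coranks : corank M ≡ corank N + 2 ⊎ corank M ≡ corank N + 3
      coranks with 1 ≤? ∣ T ∩ I ∣
      ... | yes p = inj₁ (corank-by (≤-antisym (prove≤ (E M ∷ I ∷ W ∷ T ∷ []) [] [] (card ((v0 - v1) - v2) ⊕ card (v3 && v1) <= con 3 ∷
        con 1 <= card (v3 && v1) ∷ []) [] (card ((v0 - v1) - v2)) (con 2) refl [] (≤-reflexive D-size ∷ p ∷
        []))
        (prove≤ (E M ∷ I ∷ W ∷ T ∷ []) [] [] (con 3 <= card ((v0 - v1) - v2) ⊕ card (v3 && v1) ∷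
        card (v3 && v1) <= con 1 ∷ []) [] (con 2) (card ((v0 - v1) - v2)) refl []
        (≤-reflexive (sym D-size) ∷ T-meets-model μ IW⊑ x∈W ∷ []))))
      ... | no p  = inj₂ (corank-by (≤-antisym (prove≤ (E M ∷ I ∷ W ∷ T ∷ []) [] [] (card ((v0 - v1) - v2) ⊕ card (v3 && v1) <= con 3 ∷ []) []
        (card ((v0 - v1) - v2)) (con 3) refl [] (≤-reflexive D-size ∷ []))
        (prove≤ (E M ∷ I ∷ W ∷ T ∷ []) [] [] (con 3 <= card ((v0 - v1) - v2) ⊕ card (v3 && v1) ∷
        con 1 ⊕ card (v3 && v1) <= con 1 ∷ []) [] (con 3) (card ((v0 - v1) - v2)) refl []
        (≤-reflexive (sym D-size) ∷ ≰⇒> p ∷ []))))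
      inside : E M ─ I ⊑ T ∪ ⁅ x ⁆
      inside = set= (E M ∷ I ∷ W ∷ T ∷ ⁅ x ⁆ ∷ []) ((v0 - v1) - v2 <: v3 ∷ v2 == v4 ∷ [])
        ((v0 - v1) || (v3 || v4)) (v3 || v4) refl (D⊑T ∷ W≡ ∷ [])
      four-in : T ∪ ⁅ x ⁆ ⊑ E M
      four-in = set= (T ∷ E M ∷ ⁅ x ⁆ ∷ []) (v0 <: v1 ∷ v2 <: v1 ∷ []) ((v0 || v2) || v1) v1 refl (T⊑G ∷ x∈G ∷ [])
      four-size : ∣ T ∪ ⁅ x ⁆ ∣ ≡ 4
      four-size = ≤-antisym (prove≤ (T ∷ ⁅ x ⁆ ∷ []) [] [] (card v0 <= con 3 ∷ card v1 <= con 1 ∷ []) (csub v0 v1 ∷ [])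
        (card (v0 || v1)) (con 4) refl [] (≤-reflexive T-size ∷ ∣⁅ x ⁆∣≤1 ∷ []))
        (prove≤ (T ∷ ⁅ x ⁆ ∷ []) [] (v1 && v0 == ∅ ∷ []) (con 3 <= card v0 ∷ con 1 <= card v1 ∷ [])
        (cmod v0 v1 ∷ c∅ ∷ []) (con 4) (card (v0 || v1)) refl (x∉T ∷ []) (≤-reflexive (sym T-size) ∷
        1≤∣⁅ x ⁆∣ ∷ []))
      four-rank : ρ (T ∪ ⁅ x ⁆) ≡ 2
      four-rank = ≤-antisym (prove≤ (T ∷ ⁅ x ⁆ ∷ []) [] [] (rank (v0 || v1) <= con 2 ∷ []) [] (rank (v0 || v1)) (con 2) refl []
        (Tx ∷ []))
        (prove≤ (T ∷ ⁅ x ⁆ ∷ []) [] [] (con 2 <= rank v0 ∷ []) (mono v0 (v0 || v1) ∷ []) (con 2)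
        (rank (v0 || v1)) refl [] (T-rank ∷ []))
      no-deletion : ∀ (M₁ : Matroid n) → IsDeletion M ⁅ x ⁆ M₁ → ¬ HasMinor M₁ N
      no-deletion M₁ del has with minor⇒model M₁ del has
      ... | _ , _ , μ₁ , _ , p , q = spanned-undeletable x∈G x∉T Tx μ₁ p q
      μx : Model I ⁅ x ⁆
      μx = subst (Model I) W≡ μ
      si : SiContract3ConnNMinor M x N
      si with simplification μx (set= (I ∷ W ∷ E M ∷ ⁅ x ⁆ ∷ []) (v0 || v1 <: v2 ∷ v1 == v3 ∷ []) ((v0 || v3) || v2) v2 refl (IW⊑ ∷
        W≡ ∷ [])) (set= (E M ∷ I ∷ W ∷ T ∷ ⁅ x ⁆ ∷ []) ((v0 - v1) - v2 <: v3 ∷ v2 == v4 ∷ []) (((v0 - v4) - v1) || v3)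
        v3 refl (D⊑T ∷ W≡ ∷ [])) (prove≤ (E M ∷ I ∷ W ∷ ⁅ x ⁆ ∷ []) [] (v2 == v3 ∷ []) (rank v0 <= rank (v1 || v2) ∷ []) [] (rank v0)
        (rank (v1 || v3)) refl (W≡ ∷ []) (spanning ∷ []))
      ... | S , I⊑S , S⊑ , S-conn , parallel = minor (E M ─ ⁅ x ⁆) ⁅ x ⁆ , minor S ⁅ x ⁆ ,
          minor-via x∈G (set= (E M ∷ []) [] (∅ || v0) v0 refl []) (set= (⁅ x ⁆ ∷ []) [] (v0 && ∅) ∅ refl []) (set= (E M ∷ ⁅ x ⁆ ∷ []) [] (v0 - v1) (v0 - (v1 || ∅)) refl []) ,
          (E M ─ ⁅ x ⁆ ─ S , deletion , simple , λ {d} d∈ → inj₂ (circuit d (parallel d (∈⇒⊑ d∈)) (∈⇒⊑ d∈))) ,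
          minor-connected S-conn , Has⇒minor (set= (S ∷ E M ∷ ⁅ x ⁆ ∷ []) (v0 <: v1 - v2 ∷ []) (v0 && v2) ∅ refl (S⊑ ∷ [])) (I , ⁅ x ⁆ , μx , (set= (⁅ x ⁆ ∷ []) [] (v0 || v0) v0 refl []) , I⊑S , (set= (⁅ x ⁆ ∷ S ∷ []) [] (v0 || (v1 || v0)) (v1 || v0) refl []))
        where
        deletion : IsMinorVia (minor (E M ─ ⁅ x ⁆) ⁅ x ⁆) ⊥ (E M ─ ⁅ x ⁆ ─ S) (minor S ⁅ x ⁆)
        deletion = (λ q → absurd (∉⊥ q)) , ⊑⇒⊆ {A = E M ─ ⁅ x ⁆ ─ S} {B = E M ─ ⁅ x ⁆} (set= (E M ∷ ⁅ x ⁆ ∷ S ∷ []) [] (((v0 - v1) - v2) || (v0 - v1)) (v0 - v1) refl []) , (set= (E M ∷ ⁅ x ⁆ ∷ S ∷ []) [] (∅ && ((v0 - v1) - v2)) ∅ refl []) , S≡ ,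
          λ X _ → ranks X (trans (cong (λ A → ρ A ∸ ρ ⁅ x ⁆) (unit ⁅ x ⁆)) (n∸n≡0 (ρ ⁅ x ⁆)))
          where
          S≡ : S ≡ (E M ─ ⁅ x ⁆) ─ (⊥ ∪ (E M ─ ⁅ x ⁆ ─ S))
          S≡ = set= (S ∷ E M ∷ ⁅ x ⁆ ∷ []) (v0 <: v1 - v2 ∷ []) v0 ((v1 - v2) - (∅ || ((v1 - v2) - v0))) refl
            (S⊑ ∷ [])
          unit : ∀ A → ⊥ ∪ A ≡ A
          unit A = set= (A ∷ []) [] (∅ || v0) v0 refl []
          unit′ : ∀ X → X ≡ X ∪ ⊥
          unit′ X = set= (X ∷ []) [] v0 (v0 || ∅) refl []
          ranks : ∀ X → ρ (⊥ ∪ ⁅ x ⁆) ∸ ρ ⁅ x ⁆ ≡ 0 →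
            ρ (X ∪ ⁅ x ⁆) ∸ ρ ⁅ x ⁆ ≡ (ρ ((X ∪ ⊥) ∪ ⁅ x ⁆) ∸ ρ ⁅ x ⁆) ∸ (ρ (⊥ ∪ ⁅ x ⁆) ∸ ρ ⁅ x ⁆)
          ranks X z = trans (cong (λ A → ρ (A ∪ ⁅ x ⁆) ∸ ρ ⁅ x ⁆) (unit′ X))
            (cong (ρ ((X ∪ ⊥) ∪ ⁅ x ⁆) ∸ ρ ⁅ x ⁆ ∸_) (sym z))
        S-size : 4 ≤ ∣ S ∣
        S-size = prove≤ (I ∷ S ∷ []) [] (v0 <: v1 ∷ []) (con 4 <= card v0 ∷ []) (cmono v0 v1 ∷ []) (con 4)
          (card v1) refl (I⊑S ∷ []) (model-size μ ∷ [])
        -- A circuit with one or two elements would be a side of a separation, since at least four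
        -- elements leave the complement large enough.
        simple : Simple (minor S ⁅ x ⁆)
        simple X (X⊆ , X< , _) with 3 ≤? ∣ X ∣
        ... | yes p = p
        ... | no p  = absurd (independent ∣ X ∣ refl)
          where
          X⊑ : X ⊑ S
          X⊑ = ⊆⇒⊑ X⊆
          split : X ∪ (S ─ X) ≡ S
          split = set= (X ∷ S ∷ []) (v0 <: v1 ∷ []) (v0 || (v1 - v0)) v1 refl (X⊑ ∷ [])
          split′ : X ∩ (S ─ X) ≡ ⊥
          split′ = set= (X ∷ S ∷ []) [] (v0 && (v1 - v0)) ∅ refl []
          X<′ : r (minor S ⁅ x ⁆) X < ∣ X ∣
          X<′ = X<
          independent : ∀ k → k ≡ ∣ X ∣ → Absurd
          independent zero k≡ = n≮0 (subst (r (minor S ⁅ x ⁆) X <_) (sym k≡) X<′)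
          independent (suc k) k≡ = (refute (S ∷ ⁅ x ⁆ ∷ X ∷ []) (k ∷ r (minor S ⁅ x ⁆) X ∷ []) []
            ((rank (v0 || v1) ⊕ rank v1) ⊕ con 1 ⊕ nv 0 <= rank (v2 || v1) ⊕ rank ((v0 - v2) || v1) ∷
            card v2 <= con 1 ⊕ nv 0 ∷ con 1 ⊕ nv 1 <= card v2 ∷ rank (v2 || v1) <= nv 1 ⊕ rank v1 ∷ [])
            (mono ((v0 - v2) || v1) (v0 || v1) ∷ []) refl []
            ((S-conn (suc k) (s≤s z≤n) k≤ X (S ─ X) split split′ (≤-reflexive k≡) other) ∷
            ≤-reflexive (sym k≡) ∷ X<′ ∷ ≤-reflexive (sym (minor-restore S ⁅ x ⁆ X)) ∷ []))
            where
            k≤ : suc k ≤ 2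
            k≤ = prove≤ (X ∷ []) (k ∷ []) [] (con 1 ⊕ nv 0 <= card v0 ∷ con 1 ⊕ card v0 <= con 3 ∷ []) []
              (con 1 ⊕ nv 0) (con 2) refl [] (≤-reflexive k≡ ∷ ≰⇒> p ∷ [])
            other : suc k ≤ ∣ S ─ X ∣
            other = prove≤ (X ∷ S ∷ []) (k ∷ []) (v0 <: v1 ∷ []) (con 1 ⊕ nv 0 <= con 2 ∷
              card v0 <= con 1 ⊕ nv 0 ∷ con 4 <= card v1 ∷ []) (hyp 1 ∷ csub (v1 - v0) v0 ∷ [])
              (con 1 ⊕ nv 0) (card (v1 - v0)) refl (X⊑ ∷ []) (k≤ ∷ ≤-reflexive (sym k≡) ∷ S-size ∷ [])
        circuit : ∀ d → (∃[ s ] ⁅ s ⁆ ⊑ S × ⁅ d ⁆ ∩ ⁅ s ⁆ ≡ ⊥ × ρ ((⁅ d ⁆ ∪ ⁅ s ⁆) ∪ ⁅ x ⁆) ≤ 2) →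
          ⁅ d ⁆ ⊑ E M ─ ⁅ x ⁆ ─ S →
          ∃ λ s → s ∈ S × IsCircuit (minor (E M ─ ⁅ x ⁆) ⁅ x ⁆) (⁅ d ⁆ ∪ ⁅ s ⁆)
        circuit d (s , s∈ , ds , par) d∈ = s , ⊑⇒∈ s∈ , ⊑⇒⊆ {A = ⁅ d ⁆ ∪ ⁅ s ⁆} {B = E M ─ ⁅ x ⁆} (set= (⁅ d ⁆ ∷ E M ∷ ⁅ x ⁆ ∷ S ∷ ⁅ s ⁆ ∷ []) (v0 <: (v1 - v2) - v3 ∷ v4 <: v3 ∷ v3 <: v1 - v2 ∷
          []) ((v0 || v4) || (v1 - v2)) (v1 - v2) refl (d∈ ∷ s∈ ∷ S⊑ ∷ [])) , dependent ,
            λ Y Y⊆ Y≢ → proper Y (⊆⇒⊑ Y⊆) Y≢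
          where
          restore : ∀ Y → r (minor (E M ─ ⁅ x ⁆) ⁅ x ⁆) Y + ρ ⁅ x ⁆ ≡ ρ (Y ∪ ⁅ x ⁆)
          restore Y = minor-restore (E M ─ ⁅ x ⁆) ⁅ x ⁆ Y
          x-rank : 1 ≤ ρ ⁅ x ⁆
          x-rank = nonloop x∈G
          dependent : r (minor (E M ─ ⁅ x ⁆) ⁅ x ⁆) (⁅ d ⁆ ∪ ⁅ s ⁆) < ∣ ⁅ d ⁆ ∪ ⁅ s ⁆ ∣
          dependent = prove≤ (⁅ x ⁆ ∷ ⁅ d ⁆ ∷ ⁅ s ⁆ ∷ []) (r (minor ((E M) ─ ⁅ x ⁆) ⁅ x ⁆) (⁅ d ⁆ ∪ ⁅ s ⁆) ∷ [])
            (v1 && v2 == ∅ ∷ []) (nv 0 ⊕ rank v0 <= rank ((v1 || v2) || v0) ∷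
            rank ((v1 || v2) || v0) <= con 2 ∷ con 1 <= rank v0 ∷ con 1 <= card v1 ∷ con 1 <= card v2 ∷ [])
            (cmod v1 v2 ∷ c∅ ∷ []) (con 1 ⊕ nv 0) (card (v1 || v2)) refl (ds ∷ [])
            (≤-reflexive (restore (⁅ d ⁆ ∪ ⁅ s ⁆)) ∷ par ∷ x-rank ∷ 1≤∣⁅ d ⁆∣ ∷ 1≤∣⁅ s ⁆∣ ∷ [])
          proper : ∀ Y → Y ⊑ ⁅ d ⁆ ∪ ⁅ s ⁆ → Y ≢ ⁅ d ⁆ ∪ ⁅ s ⁆ → r (minor (E M ─ ⁅ x ⁆) ⁅ x ⁆) Y ≡ ∣ Y ∣
          proper Y Y⊑ Y≢ with 2 ≤? ∣ Y ∣
          ... | yes q = absurd (Y≢ (set= (⁅ d ⁆ ∷ ⁅ s ⁆ ∷ Y ∷ []) ((v0 || v1) - v2 == ∅ ∷ v2 <: v0 || v1 ∷ []) v2 (v0 || v1) refl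
            ((∣∣≤0⇒≡⊥ {A = (⁅ d ⁆ ∪ ⁅ s ⁆) ─ Y} rest) ∷ Y⊑ ∷ [])))
            where
            rest : ∣ (⁅ d ⁆ ∪ ⁅ s ⁆) ─ Y ∣ ≤ 0
            rest = prove≤ (Y ∷ ⁅ d ⁆ ∷ ⁅ s ⁆ ∷ []) [] (v0 <: v1 || v2 ∷ []) (con 2 <= card v0 ∷
              card v1 <= con 1 ∷ card v2 <= con 1 ∷ []) (cmod ((v1 || v2) - v0) v0 ∷ csub v1 v2 ∷
              cmono ∅ (v1 && v2) ∷ []) (card ((v1 || v2) - v0)) (con 0) refl (Y⊑ ∷ []) (q ∷ ∣⁅ d ⁆∣≤1 ∷
              ∣⁅ s ⁆∣≤1 ∷ [])
          ... | no q with ≤1⇒≡⊥⊎≡⁅⁆ {A = Y} (≤-pred (≰⇒> q))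
          ...   | inj₁ e = small (restore Y) e
            where
            small : r (minor (E M ─ ⁅ x ⁆) ⁅ x ⁆) Y + ρ ⁅ x ⁆ ≡ ρ (Y ∪ ⁅ x ⁆) → Y ≡ ⊥ → r (minor (E M ─ ⁅ x ⁆) ⁅ x ⁆) Y ≡ ∣ Y ∣
            small a e = ≤-antisym (prove≤ (⁅ x ⁆ ∷ Y ∷ []) (r (minor ((E M) ─ ⁅ x ⁆) ⁅ x ⁆) Y ∷ []) (v1 == ∅ ∷ [])
              (nv 0 ⊕ rank v0 <= rank (v1 || v0) ∷ []) [] (nv 0) (card v1) refl (e ∷ []) (≤-reflexive a ∷
              []))
              (prove≤ (Y ∷ []) (r (minor ((E M) ─ ⁅ x ⁆) ⁅ x ⁆) Y ∷ []) (v0 == ∅ ∷ []) [] (c∅ ∷ [])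
              (card v0) (nv 0) refl (e ∷ []) [])
          ...   | inj₂ (y , e) = small (restore Y) e (pair-rank {y} {x} (set= (Y ∷ ⁅ y ⁆ ∷ ⁅ d ⁆ ∷ ⁅ s ⁆ ∷ E M ∷ ⁅ x ⁆ ∷ S ∷ []) (v0 == v1 ∷ v0 <: v2 || v3 ∷
            v2 <: (v4 - v5) - v6 ∷ v3 <: v6 ∷ v6 <: v4 - v5 ∷ []) (v1 || v4) v4 refl (e ∷ Y⊑ ∷ d∈ ∷ s∈ ∷
            S⊑ ∷ [])) x∈G (set= (Y ∷ ⁅ y ⁆ ∷ ⁅ d ⁆ ∷ ⁅ s ⁆ ∷ E M ∷ ⁅ x ⁆ ∷ S ∷ []) (v0 == v1 ∷ v0 <: v2 || v3 ∷
            v2 <: (v4 - v5) - v6 ∷ v3 <: v6 ∷ v6 <: v4 - v5 ∷ []) (v1 && v5) ∅ refl (e ∷ Y⊑ ∷ d∈ ∷ s∈ ∷ S⊑ ∷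
            [])))
            where
            small : r (minor (E M ─ ⁅ x ⁆) ⁅ x ⁆) Y + ρ ⁅ x ⁆ ≡ ρ (Y ∪ ⁅ x ⁆) → Y ≡ ⁅ y ⁆ → 2 ≤ ρ (⁅ y ⁆ ∪ ⁅ x ⁆) →
              r (minor (E M ─ ⁅ x ⁆) ⁅ x ⁆) Y ≡ ∣ Y ∣
            small a e b = ≤-antisym (prove≤ (⁅ x ⁆ ∷ Y ∷ []) (r (minor ((E M) ─ ⁅ x ⁆) ⁅ x ⁆) Y ∷ []) []
              (nv 0 ⊕ rank v0 <= rank (v1 || v0) ∷ con 1 <= rank v0 ∷ card v0 <= con 1 ∷ []) (csub v1 v0 ∷
              rc (v1 || v0) ∷ []) (nv 0) (card v1) refl [] (≤-reflexive a ∷ x-rank ∷ ∣⁅ x ⁆∣≤1 ∷ []))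
              (prove≤ (⁅ x ⁆ ∷ Y ∷ ⁅ y ⁆ ∷ []) (r (minor ((E M) ─ ⁅ x ⁆) ⁅ x ⁆) Y ∷ []) (v1 == v2 ∷ [])
              (rank (v1 || v0) <= nv 0 ⊕ rank v0 ∷ con 2 <= rank (v2 || v0) ∷ card v0 <= con 1 ∷
              card v2 <= con 1 ∷ []) (rc v0 ∷ []) (card v1) (nv 0) refl (e ∷ []) (≤-reflexive (sym a) ∷ b ∷
              ∣⁅ x ⁆∣≤1 ∷ ∣⁅ y ⁆∣≤1 ∷ []))
      unique : ∀ (z : Fin n) → z ∈ E M → SiContract3ConnNMinor M z N → z ≡ x
      -- Contraction and simplification compose to a minor of M in which z is contracted, so z is
      -- contractible, and only x is.
      unique z z∈ (M₁ , S , contraction , (D , deletion , _) , _ , has)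
        with minor⇒model S (minor-trans M M₁ S contraction deletion) has
      ... | _ , W₁ , μ₁ , p , q , _ with z ≟ x
      ...   | yes z≡x = z≡x
      ...   | no z≢x  = absurd (only-contractible {z = z} μ₁ q (below p) (≢⇒disjoint z≢x))
        where
        below : ⁅ z ⁆ ∪ ⊥ ⊑ W₁ → ⁅ z ⁆ ⊑ W₁
        below p = set= (⁅ z ⁆ ∷ W₁ ∷ []) (v0 || ∅ <: v1 ∷ []) (v0 || v1) v1 refl (p ∷ [])

    -- All contracted elements are in `T` and y is deleted outside it. A second such deleted element
    -- is excluded by `two-undeletable`, as I ∪ W spans; counting within T ∪ y then yields both
    -- differences.
    case-b : ∀ {y} → W ⊑ T → ⁅ y ⁆ ⊑ E M ─ I ─ W ─ T → CaseB I × ∣ E M ─ (I ∪ T) ∣ ≤ 1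
    case-b {y} W⊑T y∈ = (corank-by (proj₁ sizes) , ranks (proj₂ sizes) , y , ⊑⇒∈ y∈G , ⊑⇒⊆ inside , cocircuit , four-size ,
        no-contraction , no-deletion) , (prove≤ (E M ∷ I ∷ W ∷ T ∷ ⁅ y ⁆ ∷ []) [] ((v0 - v1) - v2 <: v3 || v4 ∷ v2 <: v3 ∷ [])
          (card v4 <= con 1 ∷ []) (cmono (v0 - (v1 || v3)) v4 ∷ []) (card (v0 - (v1 || v3))) (con 1) refl
          (D⊑ ∷ W⊑T ∷ []) (∣⁅ y ⁆∣≤1 ∷ []))
      where
      y∈G : ⁅ y ⁆ ⊑ E M
      y∈G = set= (⁅ y ⁆ ∷ E M ∷ I ∷ W ∷ T ∷ []) (v0 <: ((v1 - v2) - v3) - v4 ∷ []) (v0 || v1) v1 refl (y∈ ∷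
        [])
      y∉T : ⁅ y ⁆ ∩ T ≡ ⊥
      y∉T = set= (⁅ y ⁆ ∷ E M ∷ I ∷ W ∷ T ∷ []) (v0 <: ((v1 - v2) - v3) - v4 ∷ []) (v0 && v4) ∅ refl (y∈ ∷ [])
      y∉IW : ⁅ y ⁆ ∩ (I ∪ W) ≡ ⊥
      y∉IW = set= (⁅ y ⁆ ∷ E M ∷ I ∷ W ∷ T ∷ []) (v0 <: ((v1 - v2) - v3) - v4 ∷ []) (v0 && (v2 || v3)) ∅ refl
        (y∈ ∷ [])
      open CocircuitPoint y∈G y∉T μ IW⊑ y∉IW
      D⊑ : E M ─ I ─ W ⊑ T ∪ ⁅ y ⁆
      D⊑ with empty-or-element (E M ─ I ─ W ─ (T ∪ ⁅ y ⁆))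
      ... | inj₁ p = set= (E M ∷ I ∷ W ∷ T ∷ ⁅ y ⁆ ∷ []) (((v0 - v1) - v2) - (v3 || v4) == ∅ ∷ [])
        (((v0 - v1) - v2) || (v3 || v4)) (v3 || v4) refl (p ∷ [])
      ... | inj₂ (d , d∈) = absurd (two-undeletable {a = y} {b = d} y∈G (set= (⁅ d ⁆ ∷ E M ∷ I ∷ W ∷ T ∷ ⁅ y ⁆ ∷ []) (v0 <: ((v1 - v2) - v3) - (v4 || v5) ∷ []) (v0 || v1)
        v1 refl (d∈ ∷ [])) (set= (⁅ d ⁆ ∷ E M ∷ I ∷ W ∷ T ∷ ⁅ y ⁆ ∷ []) (v0 <: ((v1 - v2) - v3) - (v4 || v5) ∷ []) (v5 && v0) ∅
        refl (d∈ ∷ [])) y∉T (set= (⁅ d ⁆ ∷ E M ∷ I ∷ W ∷ T ∷ ⁅ y ⁆ ∷ []) (v0 <: ((v1 - v2) - v3) - (v4 || v5) ∷ []) (v0 && v4) ∅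
        refl (d∈ ∷ [])) μ IW⊑ spanning y∉IW (set= (⁅ d ⁆ ∷ E M ∷ I ∷ W ∷ T ∷ ⁅ y ⁆ ∷ []) (v0 <: ((v1 - v2) - v3) - (v4 || v5) ∷ [])
        (v0 && (v2 || v3)) ∅ refl (d∈ ∷ [])))
      sizes : ∣ E M ─ I ─ W ∣ ≡ 2 × (∣ W ∣ ≡ 1 ⊎ ∣ W ∣ ≡ 2)
      sizes = counts W⊑T indep D⊑
      ranks : ∣ W ∣ ≡ 1 ⊎ ∣ W ∣ ≡ 2 → rk M ≡ rk N + 1 ⊎ rk M ≡ rk N + 2
      ranks (inj₁ p) = inj₁ (trans rank-difference (cong (rk N +_) p))
      ranks (inj₂ p) = inj₂ (trans rank-difference (cong (rk N +_) p))
      inside : E M ─ I ⊑ T ∪ ⁅ y ⁆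
      inside = set= (E M ∷ I ∷ W ∷ T ∷ ⁅ y ⁆ ∷ []) ((v0 - v1) - v2 <: v3 || v4 ∷ v2 <: v3 ∷ [])
        ((v0 - v1) || (v3 || v4)) (v3 || v4) refl (D⊑ ∷ W⊑T ∷ [])
      four-size : ∣ T ∪ ⁅ y ⁆ ∣ ≡ 4
      four-size = ≤-antisym (prove≤ (T ∷ ⁅ y ⁆ ∷ []) [] [] (card v0 <= con 3 ∷ card v1 <= con 1 ∷ []) (csub v0 v1 ∷ [])
        (card (v0 || v1)) (con 4) refl [] (≤-reflexive T-size ∷ ∣⁅ y ⁆∣≤1 ∷ []))
        (prove≤ (T ∷ ⁅ y ⁆ ∷ []) [] (v1 && v0 == ∅ ∷ []) (con 3 <= card v0 ∷ con 1 <= card v1 ∷ [])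
        (cmod v0 v1 ∷ c∅ ∷ []) (con 4) (card (v0 || v1)) refl (y∉T ∷ []) (≤-reflexive (sym T-size) ∷
        1≤∣⁅ y ⁆∣ ∷ []))
      -- The dual rank formula without truncated subtraction, which is exact because deleting Y
      -- lowers the rank by at most |Y|.
      co-restore : ∀ Y → Y ⊑ E M → r* M Y + ρ (E M) ≡ ∣ Y ∣ + ρ (E M ─ Y)
      co-restore Y Y⊑ = trans (cong₂ _+_ (cong₂ (λ a b → (∣ Y ∣ + a) ∸ b) (sym (ρ-ground M (set= (E M ∷ Y ∷ []) [] ((v0 - v1) || v0) v0 refl []))) (sym ρG)) refl) (m∸n+n≡m below)
        where
        below : ρ (E M) ≤ ∣ Y ∣ + ρ (E M ─ Y)
        below = prove≤ (Y ∷ E M ∷ []) [] (v0 <: v1 ∷ []) [] (sub (v1 - v0) v0 ∷ rc v0 ∷ []) (rank v1)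
          (card v0 ⊕ rank (v1 - v0)) refl (Y⊑ ∷ []) []
      cocircuit : IsCocircuit M (T ∪ ⁅ y ⁆)
      cocircuit = ⊑⇒⊆ in-G′ , dependent , λ Y Y⊆ Y≢ → proper Y (⊆⇒⊑ Y⊆) Y≢
        where
        in-G′ : T ∪ ⁅ y ⁆ ⊑ E M
        in-G′ = set= (T ∷ E M ∷ ⁅ y ⁆ ∷ []) (v0 <: v1 ∷ v2 <: v1 ∷ []) ((v0 || v2) || v1) v1 refl (T⊑G ∷ y∈G ∷
          [])
        dependent : r* M (T ∪ ⁅ y ⁆) < ∣ T ∪ ⁅ y ⁆ ∣
        dependent = prove≤ (E M ∷ T ∷ ⁅ y ⁆ ∷ []) (r* M (T ∪ ⁅ y ⁆) ∷ []) []
          (nv 0 ⊕ rank v0 <= card (v1 || v2) ⊕ rank (v0 - (v1 || v2)) ∷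
          rank ((v0 - v1) - v2) ⊕ con 1 <= rank v0 ∷ []) [] (con 1 ⊕ nv 0) (card (v1 || v2)) refl []
          (≤-reflexive (co-restore (T ∪ ⁅ y ⁆) in-G′) ∷ T-hyperplane ∷ [])
        proper : ∀ Y → Y ⊑ T ∪ ⁅ y ⁆ → Y ≢ T ∪ ⁅ y ⁆ → r* M Y ≡ ∣ Y ∣
        proper Y Y⊑ Y≢ = ≤-antisym (prove≤ (E M ∷ Y ∷ []) (r* M Y ∷ []) [] (nv 0 ⊕ rank v0 <= card v1 ⊕ rank (v0 - v1) ∷ [])
          (mono (v0 - v1) v0 ∷ []) (nv 0) (card v1) refl [] (≤-reflexive (co-restore Y below) ∷ []))
          (prove≤ (E M ∷ Y ∷ []) (r* M Y ∷ []) [] (card v1 ⊕ rank (v0 - v1) <= nv 0 ⊕ rank v0 ∷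
          rank v0 <= rank (v0 - v1) ∷ []) [] (card v1) (nv 0) refl []
          (≤-reflexive (sym (co-restore Y below)) ∷ spans-Y ∷ []))
          where
          below : Y ⊑ E M
          below = set= (Y ∷ T ∷ ⁅ y ⁆ ∷ E M ∷ []) (v0 <: v1 || v2 ∷ v1 || v2 <: v3 ∷ []) (v0 || v3) v3 refl (Y⊑ ∷
            in-G′ ∷ [])
          -- A proper subset Y of T ∪ y misses y or some t of `T`. Its complement then contains the
          -- complement of `T`, or that of T ∪ y together with t, and both of these span.
          spans-Y : ρ (E M) ≤ ρ (E M ─ Y)
          spans-Y with inside? y Y
          ... | inj₂ q = prove≤ (E M ∷ T ∷ ⁅ y ⁆ ∷ Y ∷ []) [] (v2 && v3 == ∅ ∷ v3 <: v1 || v2 ∷ [])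
            (rank v0 <= rank (v0 - v1) ∷ []) (mono (v0 - v1) (v0 - v3) ∷ []) (rank v0) (rank (v0 - v3)) refl
            (q ∷ Y⊑ ∷ []) (G-T-full ∷ [])
          ... | inj₁ q with empty-or-element (T ─ Y)
          ...   | inj₁ e = absurd (Y≢ (set= (T ∷ Y ∷ ⁅ y ⁆ ∷ []) (v0 - v1 == ∅ ∷ v2 <: v1 ∷ v1 <: v0 || v2 ∷ []) v1 (v0 || v2) refl
            (e ∷ q ∷ Y⊑ ∷ [])))
          ...   | inj₂ (t , t∈) = prove≤ (E M ∷ T ∷ ⁅ y ⁆ ∷ ⁅ t ⁆ ∷ Y ∷ []) [] (v3 <: v1 - v4 ∷ v4 <: v1 || v2 ∷ v1 <: v0 ∷ [])
            (rank v0 <= rank (((v0 - v1) - v2) || v3) ∷ []) (mono (((v0 - v1) - v2) || v3) (v0 - v4) ∷ [])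
            (rank v0) (rank (v0 - v4)) refl (t∈ ∷ Y⊑ ∷ T⊑G ∷ []) (T-outside {t} t∈T ∷ [])
            where
            t∈T : ⁅ t ⁆ ⊑ T
            t∈T = set= (⁅ t ⁆ ∷ T ∷ Y ∷ []) (v0 <: v1 - v2 ∷ []) (v0 || v1) v1 refl (t∈ ∷ [])
      no-contraction : ∀ (M₁ : Matroid n) → IsContraction M ⁅ y ⁆ M₁ → ¬ HasMinor M₁ N
      no-contraction M₁ contraction has with minor⇒model M₁ contraction has
      ... | _ , _ , μ₁ , p , q , _ = not-contractible μ₁ q p
      no-deletion : ∀ (A : Subset n) → A ⊆ T → 2 ≤ ∣ A ∣ → ∀ (M₁ : Matroid n) → IsDeletion M A M₁ → ¬ HasMinor M₁ N
      no-deletion A A⊆ kA M₁ del has with minor⇒model M₁ del has | two-elements {A = A} kA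
      ... | I₁ , W₁ , μ₁ , _ , p , q | t , u , t∈ , u∈ , tu = not-two-deletable {t = t} {u = u} (set= (⁅ t ⁆ ∷ A ∷ T ∷ []) (v0 <: v1 ∷ v1 <: v2 ∷ []) (v0 || v2) v2 refl (t∈ ∷ A⊑ ∷ [])) (set= (⁅ u ⁆ ∷ A ∷ T ∷ []) (v0 <: v1 ∷ v1 <: v2 ∷ []) (v0 || v2) v2 refl (u∈ ∷ A⊑ ∷ [])) tu μ₁ p (set= (A ∷ I₁ ∷ W₁ ∷ ⁅ t ⁆ ∷ ⁅ u ⁆ ∷ []) (v0 && (v1 || v2) == ∅ ∷ v3 <: v0 ∷ v4 <: v0 ∷ [])
        ((v3 || v4) && (v1 || v2)) ∅ refl (q ∷ t∈ ∷ u∈ ∷ []))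
        where
        A⊑ : A ⊑ T
        A⊑ = ⊆⇒⊑ A⊆

    -- A contracted element outside `T` gives (a). If there is none, a deleted one outside `T` gives
    -- (b). With neither, all of E(M) outside N lies in `T`.
    conclusion : ∣ E M ─ (I ∪ T) ∣ ≤ 1 × (¬ (E M ─ I ⊆ T) → CaseA I ⊎ CaseB I)
    conclusion with empty-or-element (W ─ T)
    ... | inj₂ (x , x∈) = let (a , s) = case-a x∈ in s , λ _ → inj₁ a
    ... | inj₁ W-T with empty-or-element (E M ─ I ─ W ─ T)
    ...   | inj₂ (y , y∈) = let (b , s) = case-b (set= (W ∷ T ∷ []) (v0 - v1 == ∅ ∷ []) (v0 || v1) v1 refl (W-T ∷ [])) y∈ in s , λ _ → inj₂ b
    ...   | inj₁ D-T = (prove≤ (W ∷ T ∷ E M ∷ I ∷ []) [] (v0 - v1 == ∅ ∷ ((v2 - v3) - v0) - v1 == ∅ ∷ []) [] (c∅ ∷ [])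
      (card (v2 - (v3 || v1))) (con 1) refl (W-T ∷ D-T ∷ []) []) , λ outside → absurd (outside (⊑⇒⊆ inside))
      where
      inside : E M ─ I ⊑ T
      inside = set= (W ∷ T ∷ E M ∷ I ∷ []) (v0 - v1 == ∅ ∷ ((v2 - v3) - v0) - v1 == ∅ ∷ []) ((v2 - v3) || v1) v1
        refl (W-T ∷ D-T ∷ [])

  result : rk M ≤ rk N + 2 × Σ (Matroid n) λ N′ → IsMinor M N′ × Isomorphic N′ N ×
    ∣ E M ─ (E N′ ∪ T) ∣ ≤ 1 × (¬ (E M ─ E N′ ⊆ T) → CaseA (E N′) ⊎ CaseB (E N′))
  result with model₀
  -- Any `N`-minor can serve as the one sought: normalising changes what is contracted but keeps the
  -- ground set I.
  ... | I , W₀ , μ₀ , _ , IW₀ , _ with normalise μ₀ IW₀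
  ...   | W , μ , IW⊑ , spanning , indep =
      ≤-trans (≤-reflexive (rank-difference)) (+-monoʳ-≤ (rk N) W-small) ,
      minor I W , (W , E M ─ (I ∪ W) , minor-via (set= (I ∷ W ∷ E M ∷ []) (v0 || v1 <: v2 ∷ []) (v1 || v2) v2 refl (IW⊑ ∷ [])) (set= (E M ∷ I ∷ W ∷ []) [] ((v0 - (v1 || v2)) || v0) v0 refl []) (set= (W ∷ E M ∷ I ∷ []) [] (v0 && (v1 - (v2 || v0))) ∅ refl []) (set= (I ∷ W ∷ E M ∷ []) (v0 || v1 <: v2 ∷ v0 && v1 == ∅ ∷ []) v0 (v2 - (v1 || (v2 - (v0 || v1))))
        refl (IW⊑ ∷ (disjoint μ) ∷ []))) ,
      model-isomorphic μ , conclusion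
    where
    open Normal μ IW⊑ spanning indep
    -- W is independent and contained in the line cl T.
    W-small : ∣ W ∣ ≤ 2
    W-small = prove≤ (W ∷ T ∷ []) [] [] (card v0 <= rank v0 ∷ rank (v1 || v0) <= con 2 ∷ []) (mono v0 (v1 || v0) ∷
      []) (card v0) (con 2) refl [] (≤-reflexive (sym indep) ∷ contracted-in-span μ IW⊑ ∷ [])

theorem1p3 : ∀ {n m} (M : Matroid n) (N : Matroid m) (T : Subset n) →
    ThreeConnected N → 4 ≤ ∣ E N ∣ →
    IsTriangle M T →
    ThreeConnected M → HasMinor M N →
    (∀ (M₀ : Matroid n) → IsProperMinor M M₀ → T ⊆ E M₀ →
    ¬ (ThreeConnected M₀ × HasMinor M₀ N)) →
    rk M ≤ rk N + 2 ×
    Σ (Matroid n) λ N' → IsMinor M N' × Isomorphic N' N ×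
    ∣ E M ─ (E N' ∪ T) ∣ ≤ 1 ×
    (¬ (E M ─ E N' ⊆ T) →
    (rk M ≡ rk N + 1 ×
    (corank M ≡ corank N + 2 ⊎ corank M ≡ corank N + 3) ×
    ∃ λ (x : Fin n) → x ∈ E M ×
    E M ─ E N' ⊆ T ∪ ⁅ x ⁆ ×
    IsFourPointLine M (T ∪ ⁅ x ⁆) ×
    (∀ (M₁ : Matroid n) → IsDeletion M ⁅ x ⁆ M₁ → ¬ HasMinor M₁ N) ×
    SiContract3ConnNMinor M x N ×
    (∀ (z : Fin n) → z ∈ E M → SiContract3ConnNMinor M z N → z ≡ x))
    ⊎
    (corank M ≡ corank N + 2 ×
    (rk M ≡ rk N + 1 ⊎ rk M ≡ rk N + 2) ×
    ∃ λ (y : Fin n) → y ∈ E M ×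
    E M ─ E N' ⊆ T ∪ ⁅ y ⁆ ×
    IsCocircuit M (T ∪ ⁅ y ⁆) × ∣ T ∪ ⁅ y ⁆ ∣ ≡ 4 ×
    (∀ (M₁ : Matroid n) → IsContraction M ⁅ y ⁆ M₁ → ¬ HasMinor M₁ N) ×
    (∀ (A : Subset n) → A ⊆ T → 2 ≤ ∣ A ∣ →
    ∀ (M₁ : Matroid n) → IsDeletion M A M₁ → ¬ HasMinor M₁ N)))
theorem1p3 M N T N-conn N-size triangle M-conn has M-minimal =
  Proof.result M N T N-conn N-size triangle M-conn has M-minimal
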